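{- Let $k$ be a global field. (1) Let $L=K\times K'$ be a finite étale $k$-algebra, where $K$ is a Galois field extension of $k$ whose Galois group $G$ is of the form $G=H\rtimes G_p$, with $p$ a prime number, $G_p$ a Sylow $p$-subgroup of $G$ and $H\subset G$ a normal subgroup of prime-to-$p$ order, and $K'$ is a finite étale $k$-algebra. Then the $p$-primary component $\text{Ш}(L/k)(p)$ of $\text{Ш}(L/k)$ is isomorphic to $\text{Ш}((K(p)\times K')/k)$, where $K(p)\subset K$ is the subfield fixed by $H$. (2) Let $L=\prod_{i=0}^m K_i$, where every $K_i$ is a nilpotent field extension of $k$. Then $$\text{Ш}(L/k)\simeq\bigoplus_{p\mid d}\text{Ш}(L(p)/k),$$ where $p$ runs over the prime divisors of $d=\gcd([K_0:k],\dots,[K_m:k])$ and $L(p)$ is the maximal $k$-subalgebra of $L$ of $p$-power degree, i.e. $L(p)=\prod_{i=0}^m K_i(p)$ with $K_i(p)$ the maximal subextension of $K_i/k$ of $p$-power degree.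
   Context: For a finite étale $k$-algebra $L=\prod_i K_i$ (product of finite separable field extensions), $N_{L/k}((x_i))=\prod_i N_{K_i/k}(x_i)$, $\mathbb A_L=\prod_i\mathbb A_{K_i}$ is the adèle ring of $L$, and $$\text{Ш}(L/k):=\frac{k^\times\cap N_{L/k}(\mathbb A_L^\times)}{N_{L/k}(L^\times)}.$$ A nilpotent extension is a finite Galois extension with nilpotent Galois group. -}

module Defs where

open import Level using (Level; 0ℓ; _⊔_) renaming (suc to lsuc)
open import Data.Empty using (⊥-elim)
open import Data.Fin.Base using (Fin; zero; suc; punchIn)
open import Data.List.Base using (List; []; _∷_; map; filter; upTo; _++_)
open import Data.List.Relation.Unary.All using (All)
open import Data.List.Relation.Unary.Any using (Any)
open import Data.List.Relation.Unary.Any.Properties using (++⁺ˡ; ++⁺ʳ)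
open import Data.Nat.Base as ℕ using (ℕ; zero; suc)
import Data.Nat.Properties as ℕ
open import Data.Nat.Divisibility using (_∣_; _∤_; _∣?_)
open import Data.Nat.GCD using (gcd)
open import Data.Nat.Primality using (Prime; prime?)
open import Data.Product.Base using (Σ; Σ-syntax; ∃; ∃-syntax; _×_; _,_; proj₁; proj₂)
open import Data.Rational.Base as ℚ using (ℚ; 0ℚ; 1ℚ; ½)
import Data.Rational.Properties as ℚ
open import Data.Sum.Base using (_⊎_; inj₁; inj₂; [_,_])
open import Data.Unit.Polymorphic.Base using (⊤)
import Data.Vec.Functional as Vector
open import Function.Base using (_∘_; id)
open import Function.Bundles using (Inverse)
import Relation.Binary.PropositionalEquality as ≡
open ≡ using (_≡_)
open import Relation.Nullary using (¬_; yes; no)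
open import Relation.Nullary.Decidable.Core using (_×-dec_)
open import Algebra.Bundles
open import Algebra.Morphism.Bundles using (RingHomomorphism)
open import Algebra.Morphism.Structures
  using (IsRingHomomorphism; IsRingMonomorphism; IsGroupMonomorphism; IsGroupIsomorphism)
import Algebra.Morphism.Construct.Composition as Composition
import Algebra.Morphism.Construct.Identity as Identity
import Algebra.Morphism.RingMonomorphism as RingMonomorphism
import Algebra.Morphism.GroupMonomorphism as GroupMonomorphism
import Algebra.Definitions.RawMonoid as RawMonoidDefs
import Algebra.Properties.AbelianGroup as AbelianGroupProperties
import Algebra.Properties.CommutativeMonoid.Mult as CommMult
import Algebra.Properties.Group as GroupProperties
import Algebra.Properties.Monoid.Mult as Mult
import Algebra.Properties.Ring as RingProperties
import Relation.Binary.Reasoning.Setoid as SetoidReasoning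

record Subgroup {c ℓ} (G : Group c ℓ) (p : Level) : Set (c ⊔ ℓ ⊔ lsuc p) where
  open Group G
  field
    _∈S  : Carrier → Set p
    resp : ∀ {x y} → x ≈ y → x ∈S → y ∈S
    ε∈   : ε ∈S
    ∙∈   : ∀ {x y} → x ∈S → y ∈S → (x ∙ y) ∈S
    ⁻¹∈  : ∀ {x} → x ∈S → (x ⁻¹) ∈S

infix 4 _∈_
_∈_ : ∀ {c ℓ p} {G : Group c ℓ} → Group.Carrier G → Subgroup G p → Set p
x ∈ S = Subgroup._∈S S x

module _ {c ℓ} (G : Group c ℓ) where
  open Group G

  data Generated {p} (P : Carrier → Set p) : Carrier → Set (c ⊔ ℓ ⊔ p) where
    gen    : ∀ {x} → P x → Generated P x
    gen-≈  : ∀ {x y} → x ≈ y → Generated P x → Generated P y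
    gen-ε  : Generated P ε
    gen-∙  : ∀ {x y} → Generated P x → Generated P y → Generated P (x ∙ y)
    gen-⁻¹ : ∀ {x} → Generated P x → Generated P (x ⁻¹)

  ⟨_⟩ : ∀ {p} → (Carrier → Set p) → Subgroup G (c ⊔ ℓ ⊔ p)
  ⟨ P ⟩ = record { _∈S = Generated P ; resp = gen-≈ ; ε∈ = gen-ε ; ∙∈ = gen-∙ ; ⁻¹∈ = gen-⁻¹ }

  HasOrder : ℕ → Set (c ⊔ ℓ)
  HasOrder n = Inverse (≡.setoid (Fin n)) setoid

  [_,_]ᵍ : Carrier → Carrier → Carrier
  [ x , y ]ᵍ = x ∙ y ∙ x ⁻¹ ∙ y ⁻¹

  LowerCentral : ℕ → Carrier → Set (c ⊔ ℓ)
  LowerCentral zero    _ = ⊤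
  LowerCentral (suc n)   = Generated λ z →
    Σ[ g ∈ Carrier ] Σ[ x ∈ Carrier ] LowerCentral n x × z ≈ [ g , x ]ᵍ

  IsNilpotent : Set (c ⊔ ℓ)
  IsNilpotent = ∃[ n ] (∀ x → LowerCentral n x → x ≈ ε)

module _ {c ℓ p} {G : Group c ℓ} (S : Subgroup G p) where
  open Group G
  open Subgroup S

  subgroup : Group (c ⊔ p) ℓ
  subgroup = record
    { Carrier = Σ Carrier _∈S
    ; _≈_     = λ x y → proj₁ x ≈ proj₁ y
    ; _∙_     = λ x y → proj₁ x ∙ proj₁ y , ∙∈ (proj₂ x) (proj₂ y)
    ; ε       = ε , ε∈
    ; _⁻¹     = λ x → proj₁ x ⁻¹ , ⁻¹∈ (proj₂ x)
    ; isGroup = GroupMonomorphism.isGroup mono isGroup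
    }
    where
    mono : IsGroupMonomorphism _ rawGroup proj₁
    mono = record
      { isGroupHomomorphism = record
        { isMonoidHomomorphism = record
          { isMagmaHomomorphism = record
            { isRelHomomorphism = record { cong = id }
            ; homo = λ _ _ → refl
            }
          ; ε-homo = refl
          }
        ; ⁻¹-homo = λ _ → refl
        }
      ; injective = id
      }

  IsNormal : Set (c ⊔ p)
  IsNormal = ∀ g {h} → h ∈S → (g ∙ h ∙ g ⁻¹) ∈S

  IsSylow : ℕ → Set (c ⊔ ℓ ⊔ p)
  IsSylow q = ∃[ a ] ∃[ m ]
    HasOrder subgroup (q ℕ.^ a) × HasOrder G (q ℕ.^ a ℕ.* m) × q ∤ m

-- G = H ⋊ P as an internal semidirect product.
IsSemidirect : ∀ {c ℓ p q} {G : Group c ℓ} → Subgroup G p → Subgroup G q → Set _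
IsSemidirect {G = G} H P =
    IsNormal H
  × (∀ {x} → x ∈ H → x ∈ P → x ≈ ε)
  × (∀ g → Σ[ h ∈ Carrier ] Σ[ x ∈ Carrier ] h ∈ H × x ∈ P × g ≈ h ∙ x)
  where open Group G

infix 4 _≅_
_≅_ : ∀ {c₁ ℓ₁ c₂ ℓ₂} → AbelianGroup c₁ ℓ₁ → AbelianGroup c₂ ℓ₂ → Set _
A ≅ B = Σ (AbelianGroup.Carrier A → AbelianGroup.Carrier B)
          (IsGroupIsomorphism (AbelianGroup.rawGroup A) (AbelianGroup.rawGroup B))

module _ {c ℓ} (A : AbelianGroup c ℓ) where
  open AbelianGroup A
  open AbelianGroupProperties A using (⁻¹-∙-comm)
  open GroupProperties group using (ε⁻¹≈ε; ⁻¹-involutive)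
  open CommMult commutativeMonoid using (×-distrib-+)
  open Mult monoid using (×-congʳ; ×-assocˡ; ×-congˡ) renaming (_×_ to _·_)
  open SetoidReasoning setoid

  -- The quotient S / (S ∩ T).
  Subquotient : ∀ {p q} → Subgroup group p → Subgroup group q → AbelianGroup (c ⊔ p) q
  Subquotient S T = record
    { Carrier = Σ Carrier S._∈S
    ; _≈_     = λ x y → (proj₁ x ∙ proj₁ y ⁻¹) ∈ T
    ; _∙_     = λ x y → proj₁ x ∙ proj₁ y , S.∙∈ (proj₂ x) (proj₂ y)
    ; ε       = ε , S.ε∈
    ; _⁻¹     = λ x → proj₁ x ⁻¹ , S.⁻¹∈ (proj₂ x)
    ; isAbelianGroup = record
      { isGroup = record
        { isMonoid = record
          { isSemigroup = record
            { isMagma = record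
              { isEquivalence = record
                { refl  = λ {x} → T.resp (sym (inverseʳ (proj₁ x))) T.ε∈
                ; sym   = λ x~y → T.resp (flip _ _) (T.⁻¹∈ x~y)
                ; trans = λ x~y y~z → T.resp (telescope _ _ _) (T.∙∈ x~y y~z)
                }
              ; ∙-cong = λ x~y u~v → T.resp (interchange _ _ _ _) (T.∙∈ x~y u~v)
              }
            ; assoc = λ x y z → lift (assoc (proj₁ x) (proj₁ y) (proj₁ z))
            }
          ; identity = (λ x → lift (identityˡ (proj₁ x))) , (λ x → lift (identityʳ (proj₁ x)))
          }
        ; inverse = (λ x → lift (inverseˡ (proj₁ x))) , (λ x → lift (inverseʳ (proj₁ x)))
        ; ⁻¹-cong = λ x~y → T.resp (sym (⁻¹-∙-comm _ _)) (T.⁻¹∈ x~y)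
        }
      ; comm = λ x y → lift (comm (proj₁ x) (proj₁ y))
      }
    }
    where
    module S = Subgroup S
    module T = Subgroup T

    lift : ∀ {x y} → x ≈ y → (x ∙ y ⁻¹) ∈ T
    lift x≈y = T.resp (sym (trans (∙-congʳ x≈y) (inverseʳ _))) T.ε∈

    flip : ∀ x y → (x ∙ y ⁻¹) ⁻¹ ≈ y ∙ x ⁻¹
    flip x y = begin
      (x ∙ y ⁻¹) ⁻¹     ≈⟨ ⁻¹-∙-comm x (y ⁻¹) ⟨
      x ⁻¹ ∙ y ⁻¹ ⁻¹    ≈⟨ comm _ _ ⟩
      y ⁻¹ ⁻¹ ∙ x ⁻¹    ≈⟨ ∙-congʳ (⁻¹-involutive y) ⟩
      y ∙ x ⁻¹          ∎

    telescope : ∀ x y z → (x ∙ y ⁻¹) ∙ (y ∙ z ⁻¹) ≈ x ∙ z ⁻¹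
    telescope x y z = begin
      (x ∙ y ⁻¹) ∙ (y ∙ z ⁻¹)  ≈⟨ assoc _ _ _ ⟩
      x ∙ (y ⁻¹ ∙ (y ∙ z ⁻¹))  ≈⟨ ∙-congˡ (assoc _ _ _) ⟨
      x ∙ (y ⁻¹ ∙ y ∙ z ⁻¹)    ≈⟨ ∙-congˡ (∙-congʳ (inverseˡ y)) ⟩
      x ∙ (ε ∙ z ⁻¹)           ≈⟨ ∙-congˡ (identityˡ _) ⟩
      x ∙ z ⁻¹                 ∎

    interchange : ∀ x y u v → (x ∙ y ⁻¹) ∙ (u ∙ v ⁻¹) ≈ (x ∙ u) ∙ (y ∙ v) ⁻¹
    interchange x y u v = begin
      (x ∙ y ⁻¹) ∙ (u ∙ v ⁻¹)  ≈⟨ assoc _ _ _ ⟩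
      x ∙ (y ⁻¹ ∙ (u ∙ v ⁻¹))  ≈⟨ ∙-congˡ (assoc _ _ _) ⟨
      x ∙ (y ⁻¹ ∙ u ∙ v ⁻¹)    ≈⟨ ∙-congˡ (∙-congʳ (comm _ _)) ⟩
      x ∙ (u ∙ y ⁻¹ ∙ v ⁻¹)    ≈⟨ ∙-congˡ (assoc _ _ _) ⟩
      x ∙ (u ∙ (y ⁻¹ ∙ v ⁻¹))  ≈⟨ assoc _ _ _ ⟨
      (x ∙ u) ∙ (y ⁻¹ ∙ v ⁻¹)  ≈⟨ ∙-congˡ (⁻¹-∙-comm _ _) ⟩
      (x ∙ u) ∙ (y ∙ v) ⁻¹     ∎

  primaryComponent : ℕ → AbelianGroup (c ⊔ ℓ) ℓ
  primaryComponent p = record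
    { isAbelianGroup = record
      { isGroup = Group.isGroup (subgroup torsion)
      ; comm    = λ x y → comm (proj₁ x) (proj₁ y)
      }
    }
    where
    ·-ε : ∀ n → n · ε ≈ ε
    ·-ε zero    = refl
    ·-ε (suc n) = trans (identityˡ _) (·-ε n)

    ·-⁻¹ : ∀ n x → n · (x ⁻¹) ≈ (n · x) ⁻¹
    ·-⁻¹ zero    x = sym ε⁻¹≈ε
    ·-⁻¹ (suc n) x = trans (∙-congˡ (·-⁻¹ n x)) (⁻¹-∙-comm _ _)

    raise : ∀ m n x → n · x ≈ ε → (m ℕ.* n) · x ≈ ε
    raise m n x e = trans (sym (×-assocˡ x m n)) (trans (×-congʳ m e) (·-ε m))

    torsion : Subgroup group ℓ
    torsion = record
      { _∈S  = λ x → ∃[ n ] (p ℕ.^ n) · x ≈ ε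
      ; resp = λ { x≈y (n , e) → n , trans (×-congʳ (p ℕ.^ n) (sym x≈y)) e }
      ; ε∈   = 0 , ·-ε 1
      ; ∙∈   = λ { {x} {y} (m , e) (n , f) → m ℕ.+ n ,
                 trans (×-distrib-+ x y (p ℕ.^ (m ℕ.+ n)))
                 (trans (∙-cong
                   (trans (×-congˡ (≡.trans (ℕ.^-distribˡ-+-* p m n) (ℕ.*-comm (p ℕ.^ m) _)))
                          (raise (p ℕ.^ n) (p ℕ.^ m) x e))
                   (trans (×-congˡ (ℕ.^-distribˡ-+-* p m n))
                          (raise (p ℕ.^ m) (p ℕ.^ n) y f)))
                 (identityˡ ε)) }
      ; ⁻¹∈  = λ { {x} (n , e) → n ,
                 trans (·-⁻¹ (p ℕ.^ n) x) (trans (⁻¹-cong e) ε⁻¹≈ε) }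
      }

⨁ : ∀ {c ℓ n} → (Fin n → AbelianGroup c ℓ) → AbelianGroup c ℓ
⨁ {n = n} A = record
  { Carrier = ∀ i → AbelianGroup.Carrier (A i)
  ; _≈_     = λ x y → ∀ i → AbelianGroup._≈_ (A i) (x i) (y i)
  ; _∙_     = λ x y i → AbelianGroup._∙_ (A i) (x i) (y i)
  ; ε       = λ i → AbelianGroup.ε (A i)
  ; _⁻¹     = λ x i → AbelianGroup._⁻¹ (A i) (x i)
  ; isAbelianGroup = record
    { isGroup = record
      { isMonoid = record
        { isSemigroup = record
          { isMagma = record
            { isEquivalence = record
              { refl  = λ i → AbelianGroup.refl (A i)
              ; sym   = λ e i → AbelianGroup.sym (A i) (e i)
              ; trans = λ e f i → AbelianGroup.trans (A i) (e i) (f i)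
              }
            ; ∙-cong = λ e f i → AbelianGroup.∙-cong (A i) (e i) (f i)
            }
          ; assoc = λ x y z i → AbelianGroup.assoc (A i) (x i) (y i) (z i)
          }
        ; identity = (λ x i → AbelianGroup.identityˡ (A i) (x i))
                   , (λ x i → AbelianGroup.identityʳ (A i) (x i))
        }
      ; inverse = (λ x i → AbelianGroup.inverseˡ (A i) (x i))
                , (λ x i → AbelianGroup.inverseʳ (A i) (x i))
      ; ⁻¹-cong = λ e i → AbelianGroup.⁻¹-cong (A i) (e i)
      }
    ; comm = λ x y i → AbelianGroup.comm (A i) (x i) (y i)
    }
  }

module _ {c ℓ} (R : CommutativeRing c ℓ) where
  open CommutativeRing R hiding (zero)
  open Mult +-monoid using () renaming (_×_ to _·_)
  open SetoidReasoning setoid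

  Units : AbelianGroup (c ⊔ ℓ) ℓ
  Units = record
    { Carrier = Σ[ x ∈ Carrier ] Σ[ y ∈ Carrier ] x * y ≈ 1#
    ; _≈_     = λ x y → proj₁ x ≈ proj₁ y
    ; _∙_     = λ { (x , x⁻¹ , e) (y , y⁻¹ , f) → x * y , x⁻¹ * y⁻¹ , product x x⁻¹ y y⁻¹ e f }
    ; ε       = 1# , 1# , *-identityˡ 1#
    ; _⁻¹     = λ { (x , x⁻¹ , e) → x⁻¹ , x , trans (*-comm x⁻¹ x) e }
    ; isAbelianGroup = record
      { isGroup = record
        { isMonoid = record
          { isSemigroup = record
            { isMagma = record
              { isEquivalence = record { refl = refl ; sym = sym ; trans = trans }
              ; ∙-cong = *-cong
              }
            ; assoc = λ _ _ _ → *-assoc _ _ _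
            }
          ; identity = (λ _ → *-identityˡ _) , (λ _ → *-identityʳ _)
          }
        ; inverse = (λ { (x , x⁻¹ , e) → trans (*-comm x⁻¹ x) e }) , (λ { (x , x⁻¹ , e) → e })
        ; ⁻¹-cong = λ { {x , x⁻¹ , e} {y , y⁻¹ , f} x≈y → begin
            x⁻¹              ≈⟨ *-identityʳ x⁻¹ ⟨
            x⁻¹ * 1#         ≈⟨ *-congˡ f ⟨
            x⁻¹ * (y * y⁻¹)  ≈⟨ *-assoc _ _ _ ⟨
            x⁻¹ * y * y⁻¹    ≈⟨ *-congʳ (*-congˡ x≈y) ⟨
            x⁻¹ * x * y⁻¹    ≈⟨ *-congʳ (trans (*-comm x⁻¹ x) e) ⟩
            1# * y⁻¹         ≈⟨ *-identityˡ y⁻¹ ⟩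
            y⁻¹              ∎ }
        }
      ; comm = λ _ _ → *-comm _ _
      }
    }
    where
    product : ∀ x x⁻¹ y y⁻¹ → x * x⁻¹ ≈ 1# → y * y⁻¹ ≈ 1# → (x * y) * (x⁻¹ * y⁻¹) ≈ 1#
    product x x⁻¹ y y⁻¹ e f = begin
      (x * y) * (x⁻¹ * y⁻¹)  ≈⟨ *-assoc _ _ _ ⟩
      x * (y * (x⁻¹ * y⁻¹))  ≈⟨ *-congˡ (*-assoc _ _ _) ⟨
      x * (y * x⁻¹ * y⁻¹)    ≈⟨ *-congˡ (*-congʳ (*-comm _ _)) ⟩
      x * (x⁻¹ * y * y⁻¹)    ≈⟨ *-congˡ (*-assoc _ _ _) ⟩
      x * (x⁻¹ * (y * y⁻¹))  ≈⟨ *-assoc _ _ _ ⟨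
      (x * x⁻¹) * (y * y⁻¹)  ≈⟨ *-cong e f ⟩
      1# * 1#                ≈⟨ *-identityˡ 1# ⟩
      1#                     ∎

  ∑ : ∀ {n} → (Fin n → Carrier) → Carrier
  ∑ = RawMonoidDefs.sum +-rawMonoid

  ∏ : ∀ {n} → (Fin n → Carrier) → Carrier
  ∏ = RawMonoidDefs.sum *-rawMonoid

  Matrix : ℕ → Set c
  Matrix n = Fin n → Fin n → Carrier

  alternatingSum : ∀ {n} → (Fin n → Carrier) → Carrier
  alternatingSum {zero}  f = 0#
  alternatingSum {suc n} f = f zero - alternatingSum (f ∘ suc)

  det : ∀ {n} → Matrix n → Carrier
  det {zero}  M = 1#
  det {suc n} M = alternatingSum λ j → M zero j * det (λ i l → M (suc i) (punchIn j l))

  -- Polynomials are coefficient lists with the constant coefficient first.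

  coefficient : List Carrier → ℕ → Carrier
  coefficient []      _       = 0#
  coefficient (a ∷ f) zero    = a
  coefficient (a ∷ f) (suc n) = coefficient f n

  infixl 6 _+ₚ_
  _+ₚ_ : List Carrier → List Carrier → List Carrier
  []      +ₚ g       = g
  f       +ₚ []      = f
  (a ∷ f) +ₚ (b ∷ g) = a + b ∷ f +ₚ g

  infixl 7 _*ₚ_
  _*ₚ_ : List Carrier → List Carrier → List Carrier
  []      *ₚ g = []
  (a ∷ f) *ₚ g = map (a *_) g +ₚ (0# ∷ f *ₚ g)

  derivative : List Carrier → List Carrier
  derivative []      = []
  derivative (a ∷ f) = f +ₚ (0# ∷ derivative f)

  evaluate : List Carrier → Carrier → Carrier
  evaluate []      x = 0#
  evaluate (a ∷ f) x = a + x * evaluate f x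

  -- Coprimality of f with its derivative, as a Bézout identity.
  IsSeparablePolynomial : List Carrier → Set (c ⊔ ℓ)
  IsSeparablePolynomial f = Σ[ u ∈ List Carrier ] Σ[ w ∈ List Carrier ]
    (∀ n → coefficient (u *ₚ f +ₚ w *ₚ derivative f) n ≈ coefficient (1# ∷ []) n)

  -- The value at t of the polynomial over the prime ring with the given
  -- natural numbers as coefficients.
  evaluateℕ : List ℕ → Carrier → Carrier
  evaluateℕ f = evaluate (map (_· 1#) f)

record Field : Set₁ where
  field
    commutativeRing : CommutativeRing 0ℓ 0ℓ
  open CommutativeRing commutativeRing public
  field
    0≉1        : ¬ 0# ≈ 1#
    invertible : ∀ x → ¬ x ≈ 0# → ∃[ y ] x * y ≈ 1#

record Extension (k : Field) : Set₁ where
  field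
    top   : Field
    embed : RingHomomorphism (Field.rawRing k) (Field.rawRing top)
  open Field top public
  open RingHomomorphism embed public using () renaming (⟦_⟧ to ι)
  module ι = RingHomomorphism embed

module _ {k : Field} (E : Extension k) where
  private
    module k = Field k
  open Extension E

  record Basis (n : ℕ) : Set where
    field
      basis       : Fin n → Carrier
      coordinates : ∀ x → Σ[ a ∈ (Fin n → k.Carrier) ] x ≈ ∑ commutativeRing (λ i → ι (a i) * basis i)
      independent : ∀ (a : Fin n → k.Carrier) →
                    ∑ commutativeRing (λ i → ι (a i) * basis i) ≈ 0# → ∀ i → a i k.≈ k.0#

  IsFinite : Set
  IsFinite = ∃ Basis

  degree : IsFinite → ℕ
  degree = proj₁

  IsSeparable : Set
  IsSeparable = ∀ x → Σ[ f ∈ List k.Carrier ]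
    evaluate commutativeRing (map ι f) x ≈ 0# × IsSeparablePolynomial k.commutativeRing f

  record Automorphism : Set where
    field
      to      : RingHomomorphism rawRing rawRing
      from    : RingHomomorphism rawRing rawRing
    open RingHomomorphism to   public using (⟦_⟧; ⟦⟧-cong)
    open RingHomomorphism from public using () renaming (⟦_⟧ to ⟦_⟧⁻¹; ⟦⟧-cong to ⟦⟧⁻¹-cong)
    field
      from∘to : ∀ x → ⟦ ⟦ x ⟧ ⟧⁻¹ ≈ x
      to∘from : ∀ x → ⟦ ⟦ x ⟧⁻¹ ⟧ ≈ x
      fixes   : ∀ a → ⟦ ι a ⟧ ≈ ι a

  open Automorphism

  private
    idHom : RingHomomorphism rawRing rawRing
    idHom = record { ⟦_⟧ = id ; isRingHomomorphism = Identity.isRingHomomorphism rawRing refl }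

    _∘ʰ_ : (f g : RingHomomorphism rawRing rawRing) → RingHomomorphism rawRing rawRing
    f ∘ʰ g = record
      { ⟦_⟧ = RingHomomorphism.⟦_⟧ f ∘ RingHomomorphism.⟦_⟧ g
      ; isRingHomomorphism = Composition.isRingHomomorphism trans
          (RingHomomorphism.isRingHomomorphism g) (RingHomomorphism.isRingHomomorphism f)
      }

  Gal : Group 0ℓ 0ℓ
  Gal = record
    { Carrier = Automorphism
    ; _≈_     = λ σ τ → ∀ x → ⟦ σ ⟧ x ≈ ⟦ τ ⟧ x
    ; _∙_     = λ σ τ → record
      { to      = to σ ∘ʰ to τ
      ; from    = from τ ∘ʰ from σ
      ; from∘to = λ x → trans (⟦⟧⁻¹-cong τ (from∘to σ _)) (from∘to τ x)
      ; to∘from = λ x → trans (⟦⟧-cong σ (to∘from τ _)) (to∘from σ x)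
      ; fixes   = λ a → trans (⟦⟧-cong σ (fixes τ a)) (fixes σ a)
      }
    ; ε       = record
      { to = idHom ; from = idHom
      ; from∘to = λ _ → refl ; to∘from = λ _ → refl ; fixes = λ _ → refl }
    ; _⁻¹     = λ σ → record
      { to = from σ ; from = to σ ; from∘to = to∘from σ ; to∘from = from∘to σ
      ; fixes = λ a → trans (⟦⟧⁻¹-cong σ (sym (fixes σ a))) (from∘to σ (ι a)) }
    ; isGroup = record
      { isMonoid = record
        { isSemigroup = record
          { isMagma = record
            { isEquivalence = record
              { refl  = λ _ → refl
              ; sym   = λ e x → sym (e x)
              ; trans = λ e f x → trans (e x) (f x)
              }
            ; ∙-cong = λ {_} {σ} e f x → trans (e _) (⟦⟧-cong σ (f x))
            }
          ; assoc = λ _ _ _ _ → refl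
          }
        ; identity = (λ _ _ → refl) , (λ _ _ → refl)
        }
      ; inverse = from∘to , to∘from
      ; ⁻¹-cong = λ {σ} {τ} e x → trans
          (⟦⟧⁻¹-cong σ (trans (sym (to∘from τ x)) (sym (e _))))
          (from∘to σ _)
      }
    }

  record IsGalois : Set where
    field
      finite : IsFinite
      fixed  : ∀ x → (∀ σ → ⟦ σ ⟧ x ≈ x) → ∃[ a ] ι a ≈ x

  record IsNilpotentExtension : Set where
    field
      isGalois  : IsGalois
      nilpotent : IsNilpotent Gal
    open IsGalois isGalois public

  record Subextension : Set₁ where
    field
      _∈F  : Carrier → Set
      resp : ∀ {x y} → x ≈ y → x ∈F → y ∈F
      ι∈   : ∀ a → ι a ∈F
      +∈   : ∀ {x y} → x ∈F → y ∈F → (x + y) ∈F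
      *∈   : ∀ {x y} → x ∈F → y ∈F → (x * y) ∈F
      -∈   : ∀ {x} → x ∈F → (- x) ∈F
      ⁻¹∈  : ∀ {x y} → x ∈F → x * y ≈ 1# → y ∈F

  fixedField : ∀ (H : Subgroup Gal 0ℓ) → Subextension
  fixedField H = record
    { _∈F  = λ x → ∀ σ → σ ∈ H → ⟦ σ ⟧ x ≈ x
    ; resp = λ x≈y p σ h → trans (⟦⟧-cong σ (sym x≈y)) (trans (p σ h) x≈y)
    ; ι∈   = λ a σ _ → fixes σ a
    ; +∈   = λ p q σ h → trans (+-homo (to σ) _ _) (+-cong (p σ h) (q σ h))
    ; *∈   = λ p q σ h → trans (*-homo (to σ) _ _) (*-cong (p σ h) (q σ h))
    ; -∈   = λ p σ h → trans (-‿homo (to σ) _) (-‿cong (p σ h))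
    ; ⁻¹∈  = λ {x} {y} p xy≈1 σ h → begin
        ⟦ σ ⟧ y                  ≈⟨ *-identityʳ _ ⟨
        ⟦ σ ⟧ y * 1#             ≈⟨ *-congˡ xy≈1 ⟨
        ⟦ σ ⟧ y * (x * y)        ≈⟨ *-assoc _ _ _ ⟨
        ⟦ σ ⟧ y * x * y          ≈⟨ *-congʳ (*-comm _ _) ⟩
        x * ⟦ σ ⟧ y * y          ≈⟨ *-congʳ (*-congʳ (p σ h)) ⟨
        ⟦ σ ⟧ x * ⟦ σ ⟧ y * y    ≈⟨ *-congʳ (*-homo (to σ) _ _) ⟨
        ⟦ σ ⟧ (x * y) * y        ≈⟨ *-congʳ (⟦⟧-cong σ xy≈1) ⟩
        ⟦ σ ⟧ 1# * y             ≈⟨ *-congʳ (1#-homo (to σ)) ⟩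
        1# * y                   ≈⟨ *-identityˡ y ⟩
        y                        ∎
    }
    where
    open RingHomomorphism using (+-homo; *-homo; -‿homo; 1#-homo)
    open SetoidReasoning setoid

  module _ (F : Subextension) where
    open Subextension F

    private
      0∈ : 0# ∈F
      0∈ = resp ι.0#-homo (ι∈ k.0#)

      1∈ : 1# ∈F
      1∈ = resp ι.1#-homo (ι∈ k.1#)

    subfield : Field
    subfield = record
      { commutativeRing = record
        { Carrier = Σ Carrier _∈F
        ; _≈_     = λ x y → proj₁ x ≈ proj₁ y
        ; _+_     = λ x y → proj₁ x + proj₁ y , +∈ (proj₂ x) (proj₂ y)
        ; _*_     = λ x y → proj₁ x * proj₁ y , *∈ (proj₂ x) (proj₂ y)
        ; -_      = λ x → - proj₁ x , -∈ (proj₂ x)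
        ; 0#      = 0# , 0∈
        ; 1#      = 1# , 1∈
        ; isCommutativeRing = RingMonomorphism.isCommutativeRing mono isCommutativeRing
        }
      ; 0≉1        = 0≉1
      ; invertible = λ { (x , x∈F) x≉0 → let y , e = invertible x x≉0 in (y , ⁻¹∈ x∈F e) , e }
      }
      where
      mono : IsRingMonomorphism _ rawRing proj₁
      mono = record
        { isRingHomomorphism = record
          { isSemiringHomomorphism = record
            { isNearSemiringHomomorphism = record
              { +-isMonoidHomomorphism = record
                { isMagmaHomomorphism = record
                  { isRelHomomorphism = record { cong = id } ; homo = λ _ _ → refl }
                ; ε-homo = refl
                }
              ; *-homo = λ _ _ → refl
              }
            ; 1#-homo = refl
            }
          ; -‿homo = λ _ → refl
          }
        ; injective = id
        }

    asExtension : Extension k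
    asExtension = record
      { top   = subfield
      ; embed = record
        { ⟦_⟧ = λ a → ι a , ι∈ a
        ; isRingHomomorphism = record
          { isSemiringHomomorphism = record
            { isNearSemiringHomomorphism = record
              { +-isMonoidHomomorphism = record
                { isMagmaHomomorphism = record
                  { isRelHomomorphism = record { cong = ι.⟦⟧-cong } ; homo = ι.+-homo }
                ; ε-homo = ι.0#-homo
                }
              ; *-homo = ι.*-homo
              }
            ; 1#-homo = ι.1#-homo
            }
          ; -‿homo = ι.-‿homo
          }
        }
      }

gcds : ∀ {m} → (Fin m → ℕ) → ℕ
gcds = Vector.foldr gcd 0

primeDivisors : ℕ → List ℕ
primeDivisors d = filter (λ p → prime? p ×-dec (p ∣? d)) (upTo (suc d))

HasPPowerDegree : ∀ {k} → ℕ → Extension k → Set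
HasPPowerDegree p E = ∃[ a ] Basis E (p ℕ.^ a)

IsMaximalOfPPowerDegree : ∀ {k} {E : Extension k} → ℕ → Subextension E → Set₁
IsMaximalOfPPowerDegree {E = E} p F =
    HasPPowerDegree p (asExtension E F)
  × (∀ F′ → HasPPowerDegree p (asExtension E F′) → ∀ {x} → x ∈F F′ → x ∈F F)
  where
  _∈F_ : Extension.Carrier E → Subextension E → Set
  x ∈F F = Subextension._∈F F x

-- A finite étale algebra is recorded by its field factors; its elements,
-- norm and adèles are given factorwise.
record EtaleAlgebra (k : Field) : Set₁ where
  field
    {size}    : ℕ
    factor    : Fin size → Extension k
    finite    : ∀ i → IsFinite (factor i)
    separable : ∀ i → IsSeparable (factor i)

ℚ-field : Field
ℚ-field = record
  { commutativeRing = ℚ.+-*-commutativeRing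
  ; 0≉1             = λ ()
  ; invertible      = λ x x≢0 → let instance _ = ℚ.≢-nonZero x≢0 in ℚ.1/ x , ℚ.*-inverseʳ x
  }

-- F is the field 𝔽ₚ(t) of rational functions in one variable.
record IsRationalFunctionField (p : ℕ) (F : Field) : Set where
  open Field F
  open Mult +-monoid using () renaming (_×_ to _·_)
  field
    characteristic : p · 1# ≈ 0#
    t              : Carrier
    transcendental : ∀ f → evaluateℕ commutativeRing f t ≈ 0# → All (p ∣_) f
    generated      : ∀ x → ∃[ f ] ∃[ g ] ¬ evaluateℕ commutativeRing g t ≈ 0#
                       × x * evaluateℕ commutativeRing g t ≈ evaluateℕ commutativeRing f t

IsFiniteOver : Field → Field → Set
IsFiniteOver F k =
  Σ[ ι ∈ RingHomomorphism (Field.rawRing F) (Field.rawRing k) ] IsFinite {k = F} (record { top = k ; embed = ι })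

data IsGlobal (k : Field) : Set₁ where
  numberField   : IsFiniteOver ℚ-field k → IsGlobal k
  functionField : ∀ p → Prime p → ∀ F → IsRationalFunctionField p F → IsFiniteOver F k → IsGlobal k

-- A nonnegative Dedekind real, given by its upper cut: r ≺ q means r < q.
record ℝ≥0 : Set₁ where
  field
    Above     : ℚ → Set
    positive  : ∀ {q} → Above q → 0ℚ ℚ.< q
    inhabited : ∃ Above
    upward    : ∀ {p q} → p ℚ.≤ q → Above p → Above q
    rounded   : ∀ {q} → Above q → ∃[ p ] p ℚ.< q × Above p
    located   : ∀ {p q} → p ℚ.< q → ¬ Above p ⊎ Above q

infix 4 _≺_
_≺_ : ℝ≥0 → ℚ → Set
r ≺ q = ℝ≥0.Above r q

module _ (K : Field) where
  open Field K

  -- Nontriviality is part of the definition; |x| ≠ 1 for some x ≠ 0 amounts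
  -- to |x| < 1 for some x ≠ 0, by passing to the inverse.
  record AbsoluteValue : Set₁ where
    field
      ∣_∣         : Carrier → ℝ≥0
      cong        : ∀ {x y q} → x ≈ y → ∣ x ∣ ≺ q → ∣ y ∣ ≺ q
      ∣0∣≤0       : ∀ {q} → 0ℚ ℚ.< q → ∣ 0# ∣ ≺ q
      ∣x∣≤0⇒x≈0   : ∀ {x} → (∀ q → 0ℚ ℚ.< q → ∣ x ∣ ≺ q) → x ≈ 0#
      ∣1∣≤1       : ∀ {q} → 1ℚ ℚ.< q → ∣ 1# ∣ ≺ q
      ∣xy∣≤∣x∣∣y∣ : ∀ {x y p q} → ∣ x ∣ ≺ p → ∣ y ∣ ≺ q → ∣ x * y ∣ ≺ p ℚ.* q
      ∣x∣∣y∣≤∣xy∣ : ∀ {x y r} → ∣ x * y ∣ ≺ r → ∃[ p ] ∃[ q ] ∣ x ∣ ≺ p × ∣ y ∣ ≺ q × p ℚ.* q ℚ.≤ r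
      triangle    : ∀ {x y p q} → ∣ x ∣ ≺ p → ∣ y ∣ ≺ q → ∣ x + y ∣ ≺ p ℚ.+ q
      nontrivial  : ∃[ x ] ¬ x ≈ 0# × ∣ x ∣ ≺ 1ℚ

module _ {K : Field} where
  open Field K
  open RingProperties ring
  open SetoidReasoning setoid

  private
    split : ∀ ε → 0ℚ ℚ.< ε → ∃[ δ ] 0ℚ ℚ.< δ × δ ℚ.+ δ ≡ ε
    split ε 0<ε = ½ ℚ.* ε
      , ≡.subst (ℚ._< ½ ℚ.* ε) (ℚ.*-zeroʳ ½) (ℚ.*-monoʳ-<-pos ½ 0<ε)
      , ≡.trans (≡.sym (ℚ.*-distribʳ-+ ε ½ ½)) (ℚ.*-identityˡ ε)

    -- q / p is the unique s with p s = q.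
    quotient : ∀ p q → 0ℚ ℚ.< p → ∀ {r} → r ℚ.* p ℚ.< q → ∃[ s ] r ℚ.< s × p ℚ.* s ≡ q
    quotient p q 0<p {r} rp<q = s , r<s , ps≡q
      where
      instance
        _ = ℚ.>-nonZero 0<p
        _ = ℚ.positive 0<p
        _ = ℚ.pos⇒nonNeg p
      s = ℚ.1/ p ℚ.* q
      ps≡q : p ℚ.* s ≡ q
      ps≡q = ≡.trans (≡.sym (ℚ.*-assoc p _ q))
             (≡.trans (≡.cong (ℚ._* q) (ℚ.*-inverseʳ p)) (ℚ.*-identityˡ q))
      r<s : r ℚ.< s
      r<s = ℚ.*-cancelʳ-<-nonNeg p (≡.subst (r ℚ.* p ℚ.<_) (≡.trans (≡.sym ps≡q) (ℚ.*-comm p s)) rp<q)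

    shrink : ∀ B ε → 0ℚ ℚ.< B → 0ℚ ℚ.< ε → ∃[ δ ] 0ℚ ℚ.< δ × B ℚ.* δ ≡ ε
    shrink B ε 0<B 0<ε = quotient B ε 0<B (≡.subst (ℚ._< ε) (≡.sym (ℚ.*-zeroˡ B)) 0<ε)

    telescope : ∀ x y z → (x - y) + (y - z) ≈ x - z
    telescope x y z = begin
      (x - y) + (y - z)    ≈⟨ +-assoc _ _ _ ⟩
      x + (- y + (y - z))  ≈⟨ +-congˡ (+-assoc _ _ _) ⟨
      x + (- y + y - z)    ≈⟨ +-congˡ (+-congʳ (-‿inverseˡ y)) ⟩
      x + (0# - z)         ≈⟨ +-congˡ (+-identityˡ _) ⟩
      x - z                ∎

    sum-difference : ∀ x y x′ y′ → (x - x′) + (y - y′) ≈ (x + y) - (x′ + y′)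
    sum-difference x y x′ y′ = begin
      (x - x′) + (y - y′)      ≈⟨ +-assoc _ _ _ ⟩
      x + (- x′ + (y - y′))    ≈⟨ +-congˡ (+-assoc _ _ _) ⟨
      x + (- x′ + y - y′)      ≈⟨ +-congˡ (+-congʳ (+-comm _ _)) ⟩
      x + (y - x′ - y′)        ≈⟨ +-congˡ (+-assoc _ _ _) ⟩
      x + (y + (- x′ - y′))    ≈⟨ +-assoc _ _ _ ⟨
      (x + y) + (- x′ - y′)    ≈⟨ +-congˡ (-‿+-comm x′ y′) ⟩
      (x + y) - (x′ + y′)      ∎

    neg-difference : ∀ x y → y - x ≈ - x - - y
    neg-difference x y = trans (+-comm y (- x)) (+-congˡ (sym (-‿involutive y)))

    product-difference : ∀ x y x′ y′ → x * (y - y′) + (x - x′) * y′ ≈ x * y - x′ * y′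
    product-difference x y x′ y′ = begin
      x * (y - y′) + (x - x′) * y′
        ≈⟨ +-cong (x[y-z]≈xy-xz x y y′) ([y-z]x≈yx-zx y′ x x′) ⟩
      (x * y - x * y′) + (x * y′ - x′ * y′)
        ≈⟨ telescope _ _ _ ⟩
      x * y - x′ * y′ ∎

  module _ (v : AbsoluteValue K) where
    open AbsoluteValue v

    NonArchimedean : Set
    NonArchimedean = ∀ {x y q} → ∣ x ∣ ≺ q → ∣ y ∣ ≺ q → ∣ x + y ∣ ≺ q

    Eventually : (ℕ → Set) → Set
    Eventually P = ∃[ N ] (∀ n → N ℕ.≤ n → P n)

    Null : (ℕ → Carrier) → Set
    Null s = ∀ ε → 0ℚ ℚ.< ε → Eventually λ n → ∣ s n ∣ ≺ ε

    record CauchySequence : Set where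
      field
        seq    : ℕ → Carrier
        cauchy : ∀ ε → 0ℚ ℚ.< ε → ∃[ N ] (∀ m n → N ℕ.≤ m → N ℕ.≤ n → ∣ seq m - seq n ∣ ≺ ε)

    open CauchySequence

    private
      both : ∀ {P Q R : ℕ → Set} → (∀ n → P n → Q n → R n) → Eventually P → Eventually Q → Eventually R
      both f (M , p) (N , q) = M ℕ.⊔ N , λ n h →
        f n (p n (ℕ.≤-trans (ℕ.m≤m⊔n M N) h)) (q n (ℕ.≤-trans (ℕ.m≤n⊔m M N) h))

      Bounded : (ℕ → Carrier) → Set
      Bounded s = ∃[ B ] 0ℚ ℚ.< B × Eventually λ n → ∣ s n ∣ ≺ B

      ∣-∣ : ∀ {x q} → ∣ x ∣ ≺ q → ∣ - x ∣ ≺ q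
      ∣-∣ {x} {q} h with ∣x∣∣y∣≤∣xy∣ (cong (sym square) (∣xy∣≤∣x∣∣y∣ h h))
        where
        square : - x * - x ≈ x * x
        square = trans (sym (-‿distribˡ-* x (- x)))
                 (trans (-‿cong (sym (-‿distribʳ-* x x))) (-‿involutive (x * x)))
      ... | a , b , a> , b> , ab≤qq with a ℚ.≤? q | b ℚ.≤? q
      ... | yes a≤q | _       = ℝ≥0.upward ∣ - x ∣ a≤q a>
      ... | no _    | yes b≤q = ℝ≥0.upward ∣ - x ∣ b≤q b>
      ... | no a≰q  | no b≰q  = ⊥-elim (ℚ.<-irrefl ≡.refl (ℚ.<-≤-trans qq<ab ab≤qq))
        where
        instance
          _ = ℚ.positive (ℝ≥0.positive ∣ x ∣ h)
          _ = ℚ.positive (ℝ≥0.positive ∣ - x ∣ a>)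
        qq<ab : q ℚ.* q ℚ.< a ℚ.* b
        qq<ab = ℚ.<-trans (ℚ.*-monoʳ-<-pos q (ℚ.≰⇒> b≰q)) (ℚ.*-monoˡ-<-pos b (ℚ.≰⇒> a≰q))
          where instance _ = ℚ.positive (ℝ≥0.positive ∣ - x ∣ b>)

      null-≈ : ∀ {s t : ℕ → Carrier} → (∀ n → s n ≈ t n) → Null s → Null t
      null-≈ s≈t null ε 0<ε = let N , h = null ε 0<ε in N , λ n N≤n → cong (s≈t n) (h n N≤n)

      null-+ : ∀ {s t} → Null s → Null t → Null (λ n → s n + t n)
      null-+ {s} {t} p q ε 0<ε with split ε 0<ε
      ... | δ , 0<δ , ≡.refl = both (λ n → triangle) (p δ 0<δ) (q δ 0<δ)

      null-neg : ∀ {s} → Null s → Null (λ n → - s n)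
      null-neg p ε 0<ε = let N , h = p ε 0<ε in N , λ n N≤n → ∣-∣ (h n N≤n)

      null-* : ∀ {s t} → Bounded s → Null t → Null (λ n → s n * t n)
      null-* (B , 0<B , b) q ε 0<ε with shrink B ε 0<B 0<ε
      ... | δ , 0<δ , ≡.refl = both (λ n → ∣xy∣≤∣x∣∣y∣) b (q δ 0<δ)

      lift : ∀ {s t : ℕ → Carrier} → (∀ n → s n ≈ t n) → Null (λ n → s n - t n)
      lift {s} {t} s≈t ε 0<ε = 0 , λ n _ →
        cong (sym (trans (+-congʳ (s≈t n)) (-‿inverseʳ (t n)))) (∣0∣≤0 0<ε)

      0<1 : 0ℚ ℚ.< 1ℚ
      0<1 = ℚ.positive⁻¹ 1ℚ

      bounded : ∀ x → Bounded (seq x)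
      bounded x with cauchy x 1ℚ 0<1
      ... | N , h with ℝ≥0.inhabited ∣ seq x N ∣
      ... | b , b> = 1ℚ ℚ.+ b , ℝ≥0.positive ∣ seq x N ∣ (bound N ℕ.≤-refl) , N , bound
        where
        bound : ∀ n → N ℕ.≤ n → ∣ seq x n ∣ ≺ 1ℚ ℚ.+ b
        bound n N≤n = cong
          (trans (+-assoc _ _ _) (trans (+-congˡ (-‿inverseˡ _)) (+-identityʳ _)))
          (triangle (h n N N≤n ℕ.≤-refl) b>)

    constant : Carrier → CauchySequence
    constant a = record
      { seq    = λ _ → a
      ; cauchy = λ ε 0<ε → 0 , λ _ _ _ _ → cong (sym (-‿inverseʳ a)) (∣0∣≤0 0<ε)
      }

    private
      addition : CauchySequence → CauchySequence → CauchySequence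
      addition x y = record
        { seq    = λ n → seq x n + seq y n
        ; cauchy = cauchy-+
        }
        where
        cauchy-+ : ∀ ε → 0ℚ ℚ.< ε → ∃[ N ] (∀ m n → N ℕ.≤ m → N ℕ.≤ n →
                   ∣ (seq x m + seq y m) - (seq x n + seq y n) ∣ ≺ ε)
        cauchy-+ ε 0<ε with split ε 0<ε
        ... | δ , 0<δ , ≡.refl with cauchy x δ 0<δ | cauchy y δ 0<δ
        ... | M , p | N , q = M ℕ.⊔ N , λ m n hm hn → cong (sum-difference _ _ _ _)
          (triangle (p m n (ℕ.m⊔n≤o⇒m≤o M N hm) (ℕ.m⊔n≤o⇒m≤o M N hn))
                    (q m n (ℕ.m⊔n≤o⇒n≤o M N hm) (ℕ.m⊔n≤o⇒n≤o M N hn)))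

      multiplication : CauchySequence → CauchySequence → CauchySequence
      multiplication x y = record
        { seq    = λ n → seq x n * seq y n
        ; cauchy = cauchy-*
        }
        where
        cauchy-* : ∀ ε → 0ℚ ℚ.< ε → ∃[ N ] (∀ m n → N ℕ.≤ m → N ℕ.≤ n →
                   ∣ (seq x m * seq y m) - (seq x n * seq y n) ∣ ≺ ε)
        cauchy-* ε 0<ε with split ε 0<ε
        ... | δ , 0<δ , ≡.refl with bounded x | bounded y
        ... | A , 0<A , a₀ , a | B , 0<B , b₀ , b with shrink A δ 0<A 0<δ | shrink B δ 0<B 0<δ
        ... | α , 0<α , Aα≡δ | β , 0<β , Bβ≡δ with cauchy y α 0<α | cauchy x β 0<β
        ... | M , p | N , q = (a₀ ℕ.⊔ b₀) ℕ.⊔ (M ℕ.⊔ N) , λ m n hm hn →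
          let am = ℕ.m⊔n≤o⇒m≤o a₀ b₀ (ℕ.m⊔n≤o⇒m≤o (a₀ ℕ.⊔ b₀) _ hm)
              bn = ℕ.m⊔n≤o⇒n≤o a₀ b₀ (ℕ.m⊔n≤o⇒m≤o (a₀ ℕ.⊔ b₀) _ hn)
              m′ = ℕ.m⊔n≤o⇒n≤o (a₀ ℕ.⊔ b₀) _ hm
              n′ = ℕ.m⊔n≤o⇒n≤o (a₀ ℕ.⊔ b₀) _ hn
          in cong (product-difference _ _ _ _) (triangle
               (≡.subst (∣ _ ∣ ≺_) Aα≡δ
                 (∣xy∣≤∣x∣∣y∣ (a m am) (p m n (ℕ.m⊔n≤o⇒m≤o M N m′) (ℕ.m⊔n≤o⇒m≤o M N n′))))
               (≡.subst (∣ _ ∣ ≺_) (≡.trans (ℚ.*-comm β B) Bβ≡δ)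
                 (∣xy∣≤∣x∣∣y∣ (q m n (ℕ.m⊔n≤o⇒n≤o M N m′) (ℕ.m⊔n≤o⇒n≤o M N n′)) (b n bn))))

      negation : CauchySequence → CauchySequence
      negation x = record
        { seq    = λ n → - seq x n
        ; cauchy = λ ε 0<ε → let N , h = cauchy x ε 0<ε in
            N , λ m n hm hn → cong (neg-difference _ _) (h n m hn hm)
        }

    Completion : CommutativeRing 0ℓ 0ℓ
    Completion = record
      { Carrier = CauchySequence
      ; _≈_     = λ x y → Null (λ n → seq x n - seq y n)
      ; _+_     = addition
      ; _*_     = multiplication
      ; -_      = negation
      ; 0#      = constant 0#
      ; 1#      = constant 1#
      ; isCommutativeRing = record
        { isRing = record
          { +-isAbelianGroup = record
            { isGroup = record
              { isMonoid = record
                { isSemigroup = record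
                  { isMagma = record
                    { isEquivalence = record
                      { refl  = lift (λ _ → refl)
                      ; sym   = λ p → null-≈ (λ _ → ⁻¹-anti-homo‿- _ _) (null-neg p)
                      ; trans = λ p q → null-≈ (λ _ → telescope _ _ _) (null-+ p q)
                      }
                    ; ∙-cong = λ p q → null-≈ (λ _ → sum-difference _ _ _ _) (null-+ p q)
                    }
                  ; assoc = λ _ _ _ → lift (λ _ → +-assoc _ _ _)
                  }
                ; identity = (λ _ → lift (λ _ → +-identityˡ _)) , (λ _ → lift (λ _ → +-identityʳ _))
                }
              ; inverse = (λ _ → lift (λ _ → -‿inverseˡ _)) , (λ _ → lift (λ _ → -‿inverseʳ _))
              ; ⁻¹-cong = λ p → null-≈ (λ _ → sym (-‿+-comm _ _)) (null-neg p)
              }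
            ; comm = λ _ _ → lift (λ _ → +-comm _ _)
            }
          ; *-cong = λ {x} {y} {u} {w} p q → null-≈
              (λ _ → product-difference _ _ _ _)
              (null-+ (null-* (bounded x) q)
                      (null-≈ (λ _ → *-comm _ _) (null-* (bounded w) p)))
          ; *-assoc = λ _ _ _ → lift (λ _ → *-assoc _ _ _)
          ; *-identity = (λ _ → lift (λ _ → *-identityˡ _)) , (λ _ → lift (λ _ → *-identityʳ _))
          ; distrib = (λ _ _ _ → lift (λ _ → distribˡ _ _ _)) , (λ _ _ _ → lift (λ _ → distribʳ _ _ _))
          }
        ; *-comm = λ _ _ → lift (λ _ → *-comm _ _)
        }
      }

    -- For nonarchimedean v this holds exactly when the limit has absolute
    -- value at most 1, independently of the Cauchy sequence representing it.
    Integral : CauchySequence → Set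
    Integral x = Eventually λ n → ∀ q → 1ℚ ℚ.< q → ∣ seq x n ∣ ≺ q

    integral-+ : NonArchimedean → ∀ x y → Integral x → Integral y → Integral (addition x y)
    integral-+ na x y = both (λ n p q r 1<r → na (p r 1<r) (q r 1<r))

    integral-* : ∀ x y → Integral x → Integral y → Integral (multiplication x y)
    integral-* x y = both λ n p q → product p q
      where
      product : ∀ {a b} → (∀ q → 1ℚ ℚ.< q → ∣ a ∣ ≺ q) → (∀ q → 1ℚ ℚ.< q → ∣ b ∣ ≺ q) →
                ∀ q → 1ℚ ℚ.< q → ∣ a * b ∣ ≺ q
      product f g q 1<q with ℚ.<-dense 1<q
      ... | p , 1<p , p<q with quotient p q (ℚ.<-trans 0<1 1<p) (≡.subst (ℚ._< q) (≡.sym (ℚ.*-identityˡ p)) p<q)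
      ... | s , 1<s , ≡.refl = ∣xy∣≤∣x∣∣y∣ (f p 1<p) (g s 1<s)

    integral-neg : ∀ x → Integral x → Integral (negation x)
    integral-neg x (N , h) = N , λ n N≤n q 1<q → ∣-∣ (h n N≤n q 1<q)

    integral-0 : Integral (constant 0#)
    integral-0 = 0 , λ _ _ q 1<q → ∣0∣≤0 (ℚ.<-trans 0<1 1<q)

    integral-1 : Integral (constant 1#)
    integral-1 = 0 , λ _ _ q 1<q → ∣1∣≤1 1<q

    constant-cong : ∀ {a b} → a ≈ b → CommutativeRing._≈_ Completion (constant a) (constant b)
    constant-cong a≈b = lift (λ _ → a≈b)

  -- The topology of v is finer than that of w. Absolute values are equivalent
  -- when they define the same topology, and places are equivalence classes.
  infix 4 _≼_ _∼_
  _≼_ : AbsoluteValue K → AbsoluteValue K → Set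
  v ≼ w = ∀ ε → 0ℚ ℚ.< ε → ∃[ δ ] 0ℚ ℚ.< δ × (∀ x → AbsoluteValue.∣ v ∣ x ≺ δ → AbsoluteValue.∣ w ∣ x ≺ ε)

  _∼_ : AbsoluteValue K → AbsoluteValue K → Set
  v ∼ w = v ≼ w × w ≼ v

  transport : ∀ {v w} → v ≼ w → CauchySequence v → CauchySequence w
  transport v≼w x = record
    { seq    = CauchySequence.seq x
    ; cauchy = λ ε 0<ε → let δ , 0<δ , f = v≼w ε 0<ε
                             N , h = CauchySequence.cauchy x δ 0<δ
                         in N , λ m n hm hn → f _ (h m n hm hn)
    }

module _ (K : Field) where
  private
    module Kᵥ (v : AbsoluteValue K) = CommutativeRing (Completion v)

  -- The restricted product of the completions over the equivalence classes
  -- of absolute values: a family indexed by all nontrivial absolute values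
  -- that agrees on equivalent ones. Archimedean places are finite in number,
  -- so integrality almost everywhere only concerns the nonarchimedean ones.
  record Adèle : Set₁ where
    field
      at       : ∀ v → CauchySequence v
      coherent : ∀ v w (v∼w : v ∼ w) → Kᵥ._≈_ w (transport (proj₁ v∼w) (at v)) (at w)
      integral : Σ[ S ∈ List (AbsoluteValue K) ]
                 (∀ v → NonArchimedean v → Any (_∼ v) S ⊎ Integral v (at v))

  open Adèle

  adèleRing : CommutativeRing (lsuc 0ℓ) (lsuc 0ℓ)
  adèleRing = record
    { Carrier = Adèle
    ; _≈_     = λ x y → ∀ v → Kᵥ._≈_ v (at x v) (at y v)
    ; _+_     = λ x y → record
      { at       = λ v → Kᵥ._+_ v (at x v) (at y v)
      ; coherent = λ v w v∼w → Kᵥ.+-cong w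
          {transport (proj₁ v∼w) (at x v)} {at x w} {transport (proj₁ v∼w) (at y v)} {at y w}
          (coherent x v w v∼w) (coherent y v w v∼w)
      ; integral = both x y λ v na → integral-+ v na (at x v) (at y v)
      }
    ; _*_     = λ x y → record
      { at       = λ v → Kᵥ._*_ v (at x v) (at y v)
      ; coherent = λ v w v∼w → Kᵥ.*-cong w
          {transport (proj₁ v∼w) (at x v)} {at x w} {transport (proj₁ v∼w) (at y v)} {at y w}
          (coherent x v w v∼w) (coherent y v w v∼w)
      ; integral = both x y λ v _ → integral-* v (at x v) (at y v)
      }
    ; -_      = λ x → record
      { at       = λ v → Kᵥ.-_ v (at x v)
      ; coherent = λ v w v∼w → Kᵥ.-‿cong w
          {transport (proj₁ v∼w) (at x v)} {at x w} (coherent x v w v∼w)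
      ; integral = let S , h = integral x in
          S , λ v na → [ inj₁ , inj₂ ∘ integral-neg v (at x v) ] (h v na)
      }
    ; 0#      = record
      { at       = λ v → Kᵥ.0# v
      ; coherent = λ v w _ → Kᵥ.refl w {Kᵥ.0# w}
      ; integral = [] , λ v _ → inj₂ (integral-0 v)
      }
    ; 1#      = record
      { at       = λ v → Kᵥ.1# v
      ; coherent = λ v w _ → Kᵥ.refl w {Kᵥ.1# w}
      ; integral = [] , λ v _ → inj₂ (integral-1 v)
      }
    ; isCommutativeRing = record
      { isRing = record
        { +-isAbelianGroup = record
          { isGroup = record
            { isMonoid = record
              { isSemigroup = record
                { isMagma = record
                  { isEquivalence = record
                    { refl  = λ {x} v → Kᵥ.refl v {at x v}
                    ; sym   = λ {x} {y} p v → Kᵥ.sym v {at x v} {at y v} (p v)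
                    ; trans = λ {x} {y} {z} p q v → Kᵥ.trans v {at x v} {at y v} {at z v} (p v) (q v)
                    }
                  ; ∙-cong = λ {x} {y} {z} {w} p q v →
                      Kᵥ.+-cong v {at x v} {at y v} {at z v} {at w v} (p v) (q v)
                  }
                ; assoc = λ x y z v → Kᵥ.+-assoc v (at x v) (at y v) (at z v)
                }
              ; identity = (λ x v → Kᵥ.+-identityˡ v (at x v)) , (λ x v → Kᵥ.+-identityʳ v (at x v))
              }
            ; inverse = (λ x v → Kᵥ.-‿inverseˡ v (at x v)) , (λ x v → Kᵥ.-‿inverseʳ v (at x v))
            ; ⁻¹-cong = λ {x} {y} p v → Kᵥ.-‿cong v {at x v} {at y v} (p v)
            }
          ; comm = λ x y v → Kᵥ.+-comm v (at x v) (at y v)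
          }
        ; *-cong = λ {x} {y} {z} {w} p q v →
            Kᵥ.*-cong v {at x v} {at y v} {at z v} {at w v} (p v) (q v)
        ; *-assoc = λ x y z v → Kᵥ.*-assoc v (at x v) (at y v) (at z v)
        ; *-identity = (λ x v → Kᵥ.*-identityˡ v (at x v)) , (λ x v → Kᵥ.*-identityʳ v (at x v))
        ; distrib = (λ x y z v → Kᵥ.distribˡ v (at x v) (at y v) (at z v))
                  , (λ x y z v → Kᵥ.distribʳ v (at x v) (at y v) (at z v))
        }
      ; *-comm = λ x y v → Kᵥ.*-comm v (at x v) (at y v)
      }
    }
    where
    both : ∀ x y {R : AbsoluteValue K → Set} →
           (∀ v → NonArchimedean v → Integral v (at x v) → Integral v (at y v) → R v) →
           Σ[ S ∈ List (AbsoluteValue K) ] (∀ v → NonArchimedean v → Any (_∼ v) S ⊎ R v)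
    both x y f = let S , g = integral x ; T , h = integral y in S ++ T , λ v na →
      [ inj₁ ∘ ++⁺ˡ , (λ p → [ inj₁ ∘ ++⁺ʳ S , inj₂ ∘ f v na p ] (h v na)) ] (g v na)

  Idèles : AbelianGroup (lsuc 0ℓ) (lsuc 0ℓ)
  Idèles = Units adèleRing

  -- α is the image of x under the diagonal embedding of K.
  IsPrincipal : Field.Carrier K → Adèle → Set₁
  IsPrincipal x α = ∀ v → Kᵥ._≈_ v (at α v) (constant v x)

module _ {k : Field} (E : Extension k) where
  open Extension E
  private
    module k = Field k

  -- y is the determinant of multiplication by x on the k-vector space E.
  record IsNorm (x : Carrier) (y : k.Carrier) : Set where
    field
      {n}    : ℕ
      e      : Basis E n
    open Basis e
    field
      matrix : Matrix k.commutativeRing n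
      action : ∀ j → x * basis j ≈ ∑ commutativeRing (λ i → ι (matrix i j) * basis i)
      value  : y k.≈ det k.commutativeRing matrix

  infix 4 _∣ᵖ_
  _∣ᵖ_ : AbsoluteValue top → AbsoluteValue k → Set
  w ∣ᵖ v = (∀ a {q} → AbsoluteValue.∣ v ∣ a ≺ q → AbsoluteValue.∣ w ∣ (ι a) ≺ q)
         × (∀ a {q} → AbsoluteValue.∣ w ∣ (ι a) ≺ q → AbsoluteValue.∣ v ∣ a ≺ q)

  extend : ∀ {v w} → w ∣ᵖ v → CauchySequence v → CauchySequence w
  extend {w = w} w∣v x = record
    { seq    = ι ∘ CauchySequence.seq x
    ; cauchy = λ ε 0<ε → let N , h = CauchySequence.cauchy x ε 0<ε in
        N , λ m n hm hn → AbsoluteValue.cong w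
          (trans (ι.+-homo _ _) (+-congˡ (ι.-‿homo _)))
          (proj₁ w∣v _ (h m n hm hn))
    }

  -- The norm from 𝔸_E to 𝔸_k. As 𝔸_k-module, 𝔸_E = 𝔸_k ⊗_k E is free on
  -- any k-basis (eᵢ) of E. If α = ∑ᵢ cᵢ eᵢ with cᵢ ∈ 𝔸_k, then
  -- α eⱼ = ∑ₗ (∑ᵢ cᵢ mᵢₗⱼ) eₗ, where mᵢ is the matrix of multiplication by eᵢ,
  -- so the norm of α, being the determinant of multiplication by α, is
  -- det (∑ᵢ cᵢ mᵢ).
  record IsAdèlicNorm (α : Adèle top) (β : Adèle k) : Set₁ where
    field
      {n}       : ℕ
      e         : Basis E n
    open Basis e
    field
      structure : Fin n → Matrix k.commutativeRing n
      action    : ∀ i j → basis i * basis j ≈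
                  ∑ commutativeRing (λ l → ι (structure i l j) * basis l)
      c         : Fin n → Adèle k
      expansion : ∀ v w (w∣v : w ∣ᵖ v) →
                  let open CommutativeRing (Completion w) using () renaming (_≈_ to _≈ʷ_; _*_ to _*ʷ_) in
                  Adèle.at α w ≈ʷ
                  ∑ (Completion w) (λ i → extend w∣v (Adèle.at (c i) v) *ʷ constant w (basis i))
      value     : ∀ v →
                  let open CommutativeRing (Completion v) using () renaming (_≈_ to _≈ᵛ_; _*_ to _*ᵛ_) in
                  Adèle.at β v ≈ᵛ
                  det (Completion v) (λ l j →
                    ∑ (Completion v) (λ i → Adèle.at (c i) v *ᵛ constant v (structure i l j)))

module _ (k : Field) {m : ℕ} (K : Fin m → Extension k) where
  private
    module k = Field k
    module K (i : Fin m) = Extension (K i)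

  open AbelianGroup (Units k.commutativeRing) using () renaming (Carrier to k×; group to k×-group)
  open AbelianGroup (Idèles k) using () renaming (Carrier to Iₖ; group to Iₖ-group)

  IsNormFrom : k× → Set
  IsNormFrom y =
    Σ[ x ∈ (∀ i → AbelianGroup.Carrier (Units (K.commutativeRing i))) ]
    Σ[ z ∈ (Fin m → k.Carrier) ]
      (∀ i → IsNorm (K i) (proj₁ (x i)) (z i)) × proj₁ y k.≈ ∏ k.commutativeRing z

  IsIdèlicNormFrom : Iₖ → Set₁
  IsIdèlicNormFrom β =
    Σ[ α ∈ (∀ i → AbelianGroup.Carrier (Idèles (K.top i))) ]
    Σ[ z ∈ (Fin m → Adèle k) ]
      (∀ i → IsAdèlicNorm (K i) (proj₁ (α i)) (z i)) × proj₁ β 𝔸.≈ ∏ (adèleRing k) z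
    where module 𝔸 = CommutativeRing (adèleRing k)

  -- The norms of units form subgroups, the norm being multiplicative; passing
  -- to the subgroup they generate changes nothing and makes this evident.

  normGroup : Subgroup k×-group 0ℓ
  normGroup = ⟨ k×-group ⟩ IsNormFrom

  idèlicNormGroup : Subgroup Iₖ-group (lsuc 0ℓ)
  idèlicNormGroup = ⟨ Iₖ-group ⟩ IsIdèlicNormFrom

  -- k^× ∩ N(𝔸_L^×)
  localNorms : Subgroup k×-group (lsuc 0ℓ)
  localNorms = record
    { _∈S  = λ x → Σ[ β ∈ Iₖ ] β ∈ idèlicNormGroup × IsPrincipal k (proj₁ x) (proj₁ β)
    ; resp = λ { {x , _} {y , _} x≈y (β@(b , _) , β∈ , p) → β , β∈ , λ v →
        Kᵥ.trans v {Adèle.at b v} {constant v x} {constant v y} (p v) (constant-cong v x≈y) }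
    ; ε∈   = ε , ε∈ , λ v → Kᵥ.refl v {constant v k.1#}
    ; ∙∈   = λ { {x , _} {y , _} (β@(b , _) , β∈ , p) (γ@(c , _) , γ∈ , q) → (β ∙ γ) , ∙∈ β∈ γ∈ , λ v →
        Kᵥ.*-cong v {Adèle.at b v} {constant v x} {Adèle.at c v} {constant v y} (p v) (q v) }
    ; ⁻¹∈  = λ { {x , x⁻¹ , e} (β@(b , b⁻¹ , f) , β∈ , p) → β ⁻¹ , ⁻¹∈ β∈ , λ v →
        inverse v (Adèle.at b v) (Adèle.at b⁻¹ v) x x⁻¹ (p v) (f v) e }
    }
    where
    open AbelianGroup (Idèles k) using (ε; _∙_; _⁻¹)
    open Subgroup idèlicNormGroup using (ε∈; ∙∈; ⁻¹∈)
    module Kᵥ (v : AbsoluteValue k) = CommutativeRing (Completion v)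

    inverse : ∀ v b b⁻¹ x x⁻¹ → let open Kᵥ v in
              b ≈ constant v x → b * b⁻¹ ≈ 1# → x k.* x⁻¹ k.≈ k.1# → b⁻¹ ≈ constant v x⁻¹
    inverse v b b⁻¹ x x⁻¹ p f e = begin
      b⁻¹                  ≈⟨ *-identityʳ b⁻¹ ⟨
      b⁻¹ * 1#             ≈⟨ *-congˡ {b⁻¹} {cx * cx⁻¹} {1#} (constant-cong v e) ⟨
      b⁻¹ * (cx * cx⁻¹)    ≈⟨ *-assoc b⁻¹ cx cx⁻¹ ⟨
      b⁻¹ * cx * cx⁻¹      ≈⟨ *-congʳ {cx⁻¹} {b⁻¹ * b} {b⁻¹ * cx} (*-congˡ {b⁻¹} {b} {cx} p) ⟨
      b⁻¹ * b * cx⁻¹       ≈⟨ *-congʳ {cx⁻¹} {b⁻¹ * b} {b * b⁻¹} (*-comm b⁻¹ b) ⟩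
      b * b⁻¹ * cx⁻¹       ≈⟨ *-congʳ {cx⁻¹} {b * b⁻¹} {1#} f ⟩
      1# * cx⁻¹            ≈⟨ *-identityˡ cx⁻¹ ⟩
      cx⁻¹                 ∎
      where
      open CommutativeRing (Completion v)
      open SetoidReasoning setoid
      cx   = constant v x
      cx⁻¹ = constant v x⁻¹

  Ш : AbelianGroup (lsuc 0ℓ) 0ℓ
  Ш = Subquotient (Units k.commutativeRing) localNorms normGroup

{-# OPTIONS --safe #-}

-- Let K / k be Galois, H a subgroup of its Galois group of order h, and F the
-- fixed field of H. An element of F has norm N_{K/k}(x) = N_{F/k}(x)ʰ, and the
-- h-th power of a norm from K is the h-th power of a norm from F; both hold
-- after any base change R of k, in particular for R = 𝔸ₖ. Hence replacing K by
-- F in L changes neither the norm group nor the group of local norms up to h-th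
-- powers. If h is prime to p and [F : k] is a power of p, then Ш of the new
-- algebra is killed by [F : k], so the h-th power map identifies it with the
-- p-primary component of Ш(L/k). A nilpotent group has such a subgroup H for
-- every p, and since Ш(L/k) is killed by d the p-primary components for the
-- primes p ∣ d assemble to Ш(L/k) by the Chinese remainder theorem.
--
-- Elements of k are adèles because they have finitely many poles, which for a
-- global field is inherited from ℚ or from a rational function field.
module Submission where

open import Defs
open import Algebra.Bundles
open import Algebra.Bundles.Raw using (RawRing)
open import Algebra.Morphism.Bundles using (RingHomomorphism)
open import Algebra.Morphism.Structures using (IsRingHomomorphism)
open import Algebra.Solver.Ring.AlmostCommutativeRing using (_-Raw-AlmostCommutative⟶_; fromCommutativeRing)
open import Axiom.ExcludedMiddle using (ExcludedMiddle)
open import Data.Empty using (⊥; ⊥-elim)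
open import Data.Fin.Base using (Fin; punchIn; suc; toℕ; zero)
open import Data.Fin.Permutation using (Permutation′; _⟨$⟩ʳ_; _⟨$⟩ˡ_; permutation)
open import Data.List.Base using (List; length; lookup; upTo)
open import Data.List.Membership.Propositional using () renaming (_∈_ to _∈ˡ_)
open import Data.List.Membership.Propositional.Properties using (∈-filter⁺; ∈-filter⁻; ∈-lookup; ∈-upTo⁺)
open import Data.List.Relation.Unary.All using (All)
open import Data.List.Relation.Unary.AllPairs using (AllPairs)
open import Data.List.Relation.Unary.Any using (Any; here; there)
open import Data.List.Relation.Unary.Unique.Propositional using (Unique)
open import Data.Maybe.Base using (Maybe; just; nothing)
open import Data.Nat.Base using (suc; zero; ℕ)
open import Data.Nat.Coprimality using (Coprime; coprime-Bézout)
open import Data.Nat.DivMod using (_%_; _/_; m%n<n; m≡m%n+[m/n]*n)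
open import Data.Nat.Divisibility using (_∣?_; _∣_; _∤_; divides)
open import Data.Nat.GCD using (gcd; gcd-GCD; gcd[m,n]∣m; gcd[m,n]∣n; module Bézout)
open import Data.Nat.Induction using (<-wellFounded)
open import Data.Nat.Primality using (Prime; euclidsLemma; prime?; prime⇒irreducible; prime⇒nonTrivial; prime⇒nonZero; ¬prime[1])
open import Data.Nat.Primality.Factorisation using (PrimeFactorisation; factorise)
open import Data.Product.Base using (_,_; _×_; proj₁; proj₂; Σ; Σ-syntax; ∃; ∃-syntax)
open import Data.Rational.Base using (0ℚ; 1ℚ; ℚ)
open import Data.Sum.Base using (_⊎_; inj₁; inj₂)
open import Data.Vec.Functional using (_∷_; insertAt; removeAt; updateAt)
open import Function.Base using (_$_; _∘_; const; id)
open import Function.Bundles using (Inverse)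
open import Induction.WellFounded using (Acc; acc)
open import Level using (0ℓ; Lift; _⊔_; lift) renaming (suc to lsuc)
open import Relation.Binary.Definitions using (Tri; tri<; tri>; tri≈)
open import Relation.Binary.PropositionalEquality using (_≡_; _≢_)
open import Relation.Nullary using (Dec; no; yes; ¬_)
open import Relation.Nullary.Decidable.Core using (_×-dec_)
import Algebra.Morphism.Construct.Composition as Composition
import Algebra.Morphism.Construct.Identity as Identity
import Algebra.Properties.AbelianGroup as AbelianGroupProperties
import Algebra.Properties.CommutativeMonoid.Mult as CommutativeMonoidMult
import Algebra.Properties.CommutativeMonoid.Sum as MonoidSum
import Algebra.Properties.Group as GroupProperties
import Algebra.Properties.Monoid.Mult as MonoidMult
import Algebra.Properties.Ring as RingProperties
import Algebra.Properties.Semiring.Exp as Exp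
import Algebra.Properties.Semiring.Mult as Mult
import Algebra.Properties.Semiring.Sum as SemiringSum
import Algebra.Solver.Ring as Solver
import Algebra.Solver.Ring.NaturalCoefficients.Default as NaturalSolver
import Data.Fin.Base as Fin
import Data.Fin.Permutation as Fin
import Data.Fin.Properties as Fin
import Data.Integer.Base as ℤ
import Data.Integer.Properties as ℤ
import Data.List.Base as List
import Data.List.Membership.Propositional.Properties as Membership
import Data.List.Relation.Unary.All as All
import Data.List.Relation.Unary.AllPairs as AllPairs
import Data.List.Relation.Unary.Any as Any
import Data.List.Relation.Unary.Any.Properties as Any
import Data.List.Relation.Unary.Unique.Propositional.Properties as Unique
import Data.Nat.Base as ℕ
import Data.Nat.Coprimality as Coprimality
import Data.Nat.Divisibility as ℕ
import Data.Nat.ListAction as ListAction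
import Data.Nat.Properties as ℕ
import Data.Nat.Solver
import Data.Rational.Base as ℚ
import Data.Rational.Properties as ℚ
import Data.Rational.Unnormalised.Base as ℚᵘ
import Data.Rational.Unnormalised.Properties as ℚᵘ
import Data.Unit.Polymorphic.Base as Unit
import Data.Vec.Functional.Properties as Vector
import Relation.Binary.PropositionalEquality as ≡
import Relation.Binary.Reasoning.Setoid as SetoidReasoning

-- The tensor product R ⊗ E is never formed. Its elements are handled through the matrices of
-- multiplication by elements of E with coefficients in R, and norms are determinants, so that one
-- argument serves for R = k and for R = 𝔸ₖ. Descent from K to F takes the product of the conjugates
-- under H, which an element of trace 1 rewrites with entries in F. Transitivity of norms is
-- replaced by an equality of h-th powers, which suffices because all comparisons are up to
-- multiples prime to p.
--
-- The obstacle is on the side of the idèles: a determinant over 𝔸ₖ must come from an actual idèle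
-- of E. Its component at w is read off at the restriction of w to k, so this restriction has to be
-- nontrivial, only finitely many places may lie above a given one, and elements of E must have
-- finitely many poles. This accounts for the approximation theorem and for the study of the places
-- of ℚ and 𝔽ₚ(t).
--
-- Maximality of the fixed field of H among subfields of p-power degree rests on chains of subgroups
-- of prime index, down which a subgroup of exponent prime to p is followed.

private module NS = Data.Nat.Solver.+-*-Solver

-- A commutative ring solver with integer coefficients

reduce : ℕ → ℕ → ℕ × ℕ
reduce (suc a) (suc b) = reduce a b
reduce a       b       = a , b

-- The pair (a , b) stands for the integer a − b.
differences : RawRing 0ℓ 0ℓ
differences = record
  { Carrier = ℕ × ℕ
  ; _≈_     = _≡_
  -- Pairs are kept with a zero component, so that the coefficients 0 and 1 appear as `(0 , 0)` and
  -- `(1 , 0)`, the two shapes that evaluate to `0#` and `1#` by definition.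
  ; _+_     = λ { (a , b) (c , d) → reduce (a ℕ.+ c) (b ℕ.+ d) }
  ; _*_     = λ { (a , b) (c , d) → reduce (a ℕ.* c ℕ.+ b ℕ.* d) (a ℕ.* d ℕ.+ b ℕ.* c) }
  ; -_      = λ { (a , b) → b , a }
  ; 0#      = 0 , 0
  ; 1#      = 1 , 0
  }

module RingSolver {c ℓ} (R : CommutativeRing c ℓ) where
  open CommutativeRing R hiding (zero)
  open RingProperties ring
  open Mult semiring renaming (_×_ to _·_)
  open SetoidReasoning setoid
  module N = NaturalSolver commutativeSemiring
  open N using () renaming (_:+_ to _⊹_; _:=_ to _≐_)

  private
    -- Agrees with ⟦_⟧′; the extra clauses make the constants 0 and 1 compute.
    ⟦_⟧′ ⟦_⟧ : ℕ × ℕ → Carrier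
    ⟦ a , b ⟧′ = a · 1# - b · 1#
    ⟦ 0 , 0 ⟧ = 0#
    ⟦ 1 , 0 ⟧ = 1#
    ⟦ a , b ⟧ = ⟦ a , b ⟧′

    ⟦⟧≈⟦⟧′ : ∀ x → ⟦ x ⟧ ≈ ⟦ x ⟧′
    ⟦⟧≈⟦⟧′ (0 , 0)           = sym (-‿inverseʳ 0#)
    ⟦⟧≈⟦⟧′ (1 , 0)           = sym (trans (+-cong (+-identityʳ 1#) -0#≈0#) (+-identityʳ 1#))
    ⟦⟧≈⟦⟧′ (0 , suc b)       = refl
    ⟦⟧≈⟦⟧′ (1 , suc b)       = refl
    ⟦⟧≈⟦⟧′ (suc (suc a) , b) = refl

    difference : ∀ {a b c d} → a + d ≈ c + b → a - b ≈ c - d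
    difference {a} {b} {c} {d} e = begin
      a - b                ≈⟨ +-identityʳ _ ⟨
      a - b + 0#           ≈⟨ +-congˡ (-‿inverseʳ d) ⟨
      a - b + (d - d)      ≈⟨ N.solve 4 (λ a b d d′ → (a ⊹ b) ⊹ (d ⊹ d′) ≐ (a ⊹ d) ⊹ (b ⊹ d′)) refl _ _ _ _ ⟩
      a + d + (- b - d)    ≈⟨ +-congʳ e ⟩
      c + b + (- b - d)    ≈⟨ N.solve 4 (λ c b b′ d′ → (c ⊹ b) ⊹ (b′ ⊹ d′) ≐ (c ⊹ d′) ⊹ (b ⊹ b′)) refl _ _ _ _ ⟩
      c - d + (b - b)      ≈⟨ +-congˡ (-‿inverseʳ b) ⟩
      c - d + 0#           ≈⟨ +-identityʳ _ ⟩
      c - d                ∎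

    product : ∀ a b c d → (a - b) * (c - d) ≈ (a * c + b * d) - (a * d + b * c)
    product a b c d = begin
      (a - b) * (c - d)
        ≈⟨ [y-z]x≈yx-zx (c - d) a b ⟩
      a * (c - d) - b * (c - d)
        ≈⟨ +-cong (x[y-z]≈xy-xz a c d) (-‿cong (x[y-z]≈xy-xz b c d)) ⟩
      (a * c - a * d) - (b * c - b * d)
        ≈⟨ +-congˡ (⁻¹-anti-homo‿- (b * c) (b * d)) ⟩
      (a * c - a * d) + (b * d - b * c)
        ≈⟨ N.solve 4 (λ p q r s → (p ⊹ q) ⊹ (r ⊹ s) ≐ (p ⊹ r) ⊹ (q ⊹ s)) refl _ _ _ _ ⟩
      (a * c + b * d) + (- (a * d) - b * c)
        ≈⟨ +-congˡ (-‿+-comm (a * d) (b * c)) ⟩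
      (a * c + b * d) - (a * d + b * c) ∎

    morphism : differences -Raw-AlmostCommutative⟶ fromCommutativeRing R
    morphism = record
      { ⟦_⟧    = ⟦_⟧
      ; +-homo = λ { (a , b) (c , d) → via′ (a ℕ.+ c) (b ℕ.+ d)
          (+-cong (⟦⟧≈⟦⟧′ (a , b)) (⟦⟧≈⟦⟧′ (c , d))) $ trans
          (+-cong (×-homo-+ 1# a c) (trans (-‿cong (×-homo-+ 1# b d)) (sym (-‿+-comm _ _))))
          (N.solve 4 (λ p q r s → (p ⊹ q) ⊹ (r ⊹ s) ≐ (p ⊹ r) ⊹ (q ⊹ s)) refl _ _ _ _) }
      ; *-homo = λ { (a , b) (c , d) → via′ (a ℕ.* c ℕ.+ b ℕ.* d) (a ℕ.* d ℕ.+ b ℕ.* c)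
          (*-cong (⟦⟧≈⟦⟧′ (a , b)) (⟦⟧≈⟦⟧′ (c , d))) $ trans
          (+-cong (trans (×-homo-+ 1# (a ℕ.* c) _) (+-cong (×1-homo-* a c) (×1-homo-* b d)))
                  (-‿cong (trans (×-homo-+ 1# (a ℕ.* d) _) (+-cong (×1-homo-* a d) (×1-homo-* b c)))))
          (sym (product _ _ _ _)) }
      ; -‿homo = λ { (a , b) → via (b , a) (-‿cong (⟦⟧≈⟦⟧′ (a , b))) (sym (⁻¹-anti-homo‿- _ _)) }
      ; 0-homo = refl
      ; 1-homo = refl
      }
      where
      via : ∀ x {y z} → y ≈ z → ⟦ x ⟧′ ≈ z → ⟦ x ⟧ ≈ y
      via x e f = trans (⟦⟧≈⟦⟧′ x) (trans f (sym e))
      reduce≈ : ∀ a b → ⟦ reduce a b ⟧′ ≈ ⟦ a , b ⟧′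
      reduce≈ zero    b       = refl
      reduce≈ (suc a) zero    = refl
      reduce≈ (suc a) (suc b) = trans (reduce≈ a b) (difference
        (N.solve 3 (λ o x y → x ⊹ (o ⊹ y) ≐ (o ⊹ x) ⊹ y) refl 1# (a · 1#) (b · 1#)))
      via′ : ∀ a b {y z} → y ≈ z → ⟦ a , b ⟧′ ≈ z → ⟦ reduce a b ⟧ ≈ y
      via′ a b e f = via (reduce a b) e (trans (reduce≈ a b) f)

    decide : (x y : ℕ × ℕ) → Maybe (⟦ x ⟧ ≈ ⟦ y ⟧)
    decide (a , b) (c , d) with a ℕ.+ d ℕ.≟ c ℕ.+ b
    ... | yes e = just (trans (⟦⟧≈⟦⟧′ (a , b)) (trans (difference (trans (sym (×-homo-+ 1# a d))
                       (trans (×-congˡ e) (×-homo-+ 1# c b)))) (sym (⟦⟧≈⟦⟧′ (c , d)))))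
    ... | no _  = nothing

  open Solver differences (fromCommutativeRing R) morphism decide public
    using (solve; con; _:+_; _:*_; :-_; _:-_; _:=_; Polynomial)

-- Determinants and linear algebra

module Sums {c ℓ} (R : CommutativeRing c ℓ) where
  open CommutativeRing R hiding (zero)
  private module Sum = SemiringSum semiring

  ∑-cong : ∀ {n} {f g : Fin n → Carrier} → (∀ i → f i ≈ g i) → ∑ R f ≈ ∑ R g
  ∑-cong = Sum.sum-cong-≋

  ∑-+ : ∀ {n} (f g : Fin n → Carrier) → ∑ R (λ i → f i + g i) ≈ ∑ R f + ∑ R g
  ∑-+ = Sum.∑-distrib-+

  ∑-comm : ∀ {m n} (f : Fin m → Fin n → Carrier) →
           ∑ R (λ i → ∑ R (f i)) ≈ ∑ R (λ j → ∑ R (λ i → f i j))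
  ∑-comm = Sum.∑-comm

  *-∑ : ∀ {n} x (f : Fin n → Carrier) → x * ∑ R f ≈ ∑ R (λ i → x * f i)
  *-∑ = Sum.*-distribˡ-sum

  ∑-* : ∀ {n} x (f : Fin n → Carrier) → ∑ R f * x ≈ ∑ R (λ i → f i * x)
  ∑-* = Sum.*-distribʳ-sum

  ∑-0 : ∀ {n} {f : Fin n → Carrier} → (∀ i → f i ≈ 0#) → ∑ R f ≈ 0#
  ∑-0 {zero}  e = refl
  ∑-0 {suc n} e = trans (+-cong (e zero) (∑-0 (e ∘ suc))) (+-identityˡ 0#)

module Determinant {c ℓ} (R : CommutativeRing c ℓ) where
  open CommutativeRing R hiding (zero)
  open RingProperties ring using (-0#≈0#)
  open RingSolver R
  open Sums R
  open SetoidReasoning setoid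

  private
    Row : ℕ → Set c
    Row n = Fin n → Carrier

    asum : ∀ {n} → Row n → Carrier
    asum = alternatingSum R

  asum-cong : ∀ {n} {f g : Row n} → (∀ i → f i ≈ g i) → asum f ≈ asum g
  asum-cong {zero}  e = refl
  asum-cong {suc n} e = +-cong (e zero) (-‿cong (asum-cong (e ∘ suc)))

  asum-linear : ∀ {n} a b (f g : Row n) → asum (λ i → a * f i + b * g i) ≈ a * asum f + b * asum g
  asum-linear {zero}  a b f g = solve 2 (λ a b → con (0 , 0) := a :* con (0 , 0) :+ b :* con (0 , 0)) refl a b
  asum-linear {suc n} a b f g = trans (+-congˡ (-‿cong (asum-linear a b (f ∘ suc) (g ∘ suc))))
    (solve 6 (λ a b p q r s → a :* p :+ b :* q :- (a :* r :+ b :* s) := a :* (p :- r) :+ b :* (q :- s)) refl _ _ _ _ _ _)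

  asum-scale : ∀ {n} a (f : Row n) → asum (λ i → a * f i) ≈ a * asum f
  asum-scale a f = begin
    asum (λ i → a * f i)              ≈⟨ asum-cong (λ i → solve 2 (λ a x → a :* x := a :* x :+ con (0 , 0) :* x) refl a (f i)) ⟩
    asum (λ i → a * f i + _ * f i)    ≈⟨ asum-linear a _ f f ⟩
    a * asum f + _ * asum f           ≈⟨ solve 2 (λ a x → a :* x :+ con (0 , 0) :* x := a :* x) refl a _ ⟩
    a * asum f                        ∎

  asum-difference : ∀ {n} (f g : Row n) → asum (λ i → f i - g i) ≈ asum f - asum g
  asum-difference {zero}  f g = sym (-‿inverseʳ 0#)
  asum-difference {suc n} f g = trans (+-congˡ (-‿cong (asum-difference (f ∘ suc) (g ∘ suc))))
    (solve 4 (λ p q r s → p :- q :- (r :- s) := (p :- r) :- (q :- s)) refl _ _ _ _)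

  asum-zero : ∀ {n} {f : Row n} → (∀ i → f i ≈ 0#) → asum f ≈ 0#
  asum-zero {zero}  e = refl
  asum-zero {suc n} e = trans (+-cong (e zero) (-‿cong (asum-zero (e ∘ suc)))) (-‿inverseʳ 0#)

  sign : ∀ {n} → Fin n → Carrier
  sign zero    = 1#
  sign (suc i) = - sign i

  sign² : ∀ {n} (i : Fin n) → sign i * sign i ≈ 1#
  sign² zero    = *-identityˡ 1#
  sign² (suc i) = trans (solve 1 (λ s → (:- s) :* (:- s) := s :* s) refl _) (sign² i)

  asum≈∑ : ∀ {n} (f : Row n) → asum f ≈ ∑ R (λ i → f i * sign i)
  asum≈∑ {zero}  f = refl
  asum≈∑ {suc n} f = +-cong (sym (*-identityʳ _)) (begin
    - asum (f ∘ suc)                              ≈⟨ -‿cong (asum≈∑ (f ∘ suc)) ⟩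
    - ∑ R (λ i → f (suc i) * sign i)              ≈⟨ solve 1 (λ x → :- x := (:- con (1 , 0)) :* x) refl (∑ R (λ i → f (suc i) * sign i)) ⟩
    - 1# * ∑ R (λ i → f (suc i) * sign i)         ≈⟨ *-∑ (- 1#) (λ i → f (suc i) * sign i) ⟩
    ∑ R (λ i → - 1# * (f (suc i) * sign i))       ≈⟨ ∑-cong (λ i → solve 2 (λ x s → (:- con (1 , 0)) :* (x :* s) := x :* (:- s)) refl (f (suc i)) (sign i)) ⟩
    ∑ R (λ i → f (suc i) * (- sign i))            ∎)

  -- The number of rows and their length are independent, because fixing the first row of such a
  -- form leaves a form in fewer rows of the same length. Linearity compares three families that
  -- agree off row `i`, which avoids rewriting under updates.
  record IsAlternating {m n} (f : (Fin n → Row m) → Carrier) : Set (c ⊔ ℓ) where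
    field
      cong        : ∀ {X Y} → (∀ i l → X i l ≈ Y i l) → f X ≈ f Y
      linear      : ∀ i a b {X Y Z} → (∀ i′ → i′ ≢ i → ∀ l → X i′ l ≈ Y i′ l) →
                    (∀ i′ → i′ ≢ i → ∀ l → X i′ l ≈ Z i′ l) →
                    (∀ l → X i l ≈ a * Y i l + b * Z i l) → f X ≈ a * f Y + b * f Z
      alternating : ∀ i j → i ≢ j → ∀ {X} → (∀ l → X i l ≈ X j l) → f X ≈ 0#

  open IsAlternating

  module _ {m n} {f : (Fin n → Row m) → Carrier} (F : IsAlternating f) where

    linear-+ : ∀ i {X Y Z} → (∀ i′ → i′ ≢ i → ∀ l → X i′ l ≈ Y i′ l) →
               (∀ i′ → i′ ≢ i → ∀ l → X i′ l ≈ Z i′ l) →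
               (∀ l → X i l ≈ Y i l + Z i l) → f X ≈ f Y + f Z
    linear-+ i p q e = trans
      (linear F i 1# 1# p q (λ l → trans (e l) (sym (+-cong (*-identityˡ _) (*-identityˡ _)))))
      (+-cong (*-identityˡ _) (*-identityˡ _))

    private
      kept : ∀ {X : Fin n → Row m} {i r s} i′ → i′ ≢ i → ∀ l →
             updateAt X i (const r) i′ l ≈ updateAt X i (const s) i′ l
      kept {X} {i} i′ ne l = reflexive (≡.cong (_$ l)
        (≡.trans (Vector.updateAt-minimal i′ i X ne) (≡.sym (Vector.updateAt-minimal i′ i X ne))))

      new : ∀ {X : Fin n → Row m} i {r} l → updateAt X i (const r) i l ≡ r l
      new {X} i l = ≡.cong (_$ l) (Vector.updateAt-updates i X)

    linear-0 : ∀ i {X} → (∀ l → X i l ≈ 0#) → f X ≈ 0#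
    linear-0 i {X} e = trans
      (linear F i 0# 0# (λ _ _ _ → refl) (λ _ _ _ → refl)
        (λ l → trans (e l) (sym (trans (+-cong (zeroˡ _) (zeroˡ _)) (+-identityˡ 0#)))))
      (trans (+-cong (zeroˡ (f X)) (zeroˡ (f X))) (+-identityˡ 0#))

    linear-∑ : ∀ {k} i X (a : Fin k → Carrier) (r : Fin k → Row m) →
               f (updateAt X i (const (λ l → ∑ R (λ j → a j * r j l))))
                 ≈ ∑ R (λ j → a j * f (updateAt X i (const (r j))))
    linear-∑ {zero}  i X a r = linear-0 i (λ l → reflexive (new {X} i l))
    linear-∑ {suc k} i X a r = begin
      f (updateAt X i (const (λ l → ∑ R (λ j → a j * r j l))))
        ≈⟨ linear F i (a zero) 1# (kept {X}) (kept {X}) (λ l → trans (reflexive (new {X} i l))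
             (sym (+-cong (*-congˡ (reflexive (new {X} i l))) (trans (*-identityˡ _) (reflexive (new {X} i l)))))) ⟩
      a zero * _ + 1# * f (updateAt X i (const (λ l → ∑ R (λ j → a (suc j) * r (suc j) l))))
        ≈⟨ +-congˡ (trans (*-identityˡ _) (linear-∑ i X (a ∘ suc) (r ∘ suc))) ⟩
      ∑ R (λ j → a j * f (updateAt X i (const (r j)))) ∎

    update-same : ∀ X i {r} → (∀ l → X i l ≈ r l) → f X ≈ f (updateAt X i (const r))
    update-same X i e = cong F λ i′ l → go i′ l (i′ Fin.≟ i)
      where
      go : ∀ i′ l → Dec (i′ ≡ i) → X i′ l ≈ updateAt X i (const _) i′ l
      go i′ l (yes ≡.refl) = trans (e l) (reflexive (≡.sym (new {X} i l)))
      go i′ l (no ne)      = reflexive (≡.sym (≡.cong (_$ l) (Vector.updateAt-minimal i′ i X ne)))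

  private
    cons-cong : ∀ {m n} {x y : Row m} {X Y : Fin n → Row m} → (∀ l → x l ≈ y l) →
                (∀ i l → X i l ≈ Y i l) → ∀ i l → (x ∷ X) i l ≈ (y ∷ Y) i l
    cons-cong p q zero    l = p l
    cons-cong p q (suc i) l = q i l

    suc-≢ : ∀ {n} {i j : Fin n} → i ≢ j → Fin.suc i ≢ suc j
    suc-≢ ne ≡.refl = ne ≡.refl

    off-suc : ∀ {m n} {x : Row m} {X Y : Fin n → Row m} {i} → (∀ i′ → i′ ≢ i → ∀ l → X i′ l ≈ Y i′ l) →
              ∀ i′ → i′ ≢ suc i → ∀ l → (x ∷ X) i′ l ≈ (x ∷ Y) i′ l
    off-suc p zero     ne l = refl
    off-suc p (suc i′) ne l = p i′ (λ { ≡.refl → ne ≡.refl }) l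

    off-zero : ∀ {m n} {x y : Row m} {X : Fin n → Row m} → ∀ i′ → i′ ≢ zero → ∀ l → (x ∷ X) i′ l ≈ (y ∷ X) i′ l
    off-zero zero     ne l = ⊥-elim (ne ≡.refl)
    off-zero (suc i′) ne l = refl

  tail-alternating : ∀ {m n} {f : (Fin (suc n) → Row m) → Carrier} → IsAlternating f →
                     ∀ x → IsAlternating (λ X → f (x ∷ X))
  tail-alternating F x = record
    { cong        = λ e → cong F (cons-cong (λ _ → refl) e)
    ; linear      = λ i a b p q e → linear F (suc i) a b (off-suc p) (off-suc q) e
    ; alternating = λ i j ne e → alternating F (suc i) (suc j) (suc-≢ ne) e
    }

  -- Polarisation: the form vanishes when both of the first two rows are the sum `s`, and expanding
  -- this leaves only the two mixed terms.
  swap : ∀ {m n} {f : (Fin (suc (suc n)) → Row m) → Carrier} → IsAlternating f →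
         ∀ x y X → f (x ∷ y ∷ X) ≈ - f (y ∷ x ∷ X)
  swap {f = f} F x y X = begin
    f (x ∷ y ∷ X)
      ≈⟨ solve 2 (λ p q → p := (con (0 , 0) :+ p :+ (q :+ con (0 , 0))) :- q) refl (B x y) (B y x) ⟩
    0# + B x y + (B y x + 0#) - B y x
      ≈⟨ +-congʳ (+-cong (+-congʳ (same x)) (+-congˡ (same y))) ⟨
    B x x + B x y + (B y x + B y y) - B y x
      ≈⟨ +-congʳ (+-cong (split₁ x x y) (split₁ y x y)) ⟨
    B x s + B y s - B y x
      ≈⟨ +-congʳ split₀ ⟨
    B s s - B y x
      ≈⟨ trans (+-congʳ (alternating F zero (suc zero) (λ ()) (λ _ → refl))) (+-identityˡ _) ⟩
    - B y x ∎
    where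
    B : _ → _ → Carrier
    B u v = f (u ∷ v ∷ X)
    s = λ l → x l + y l
    same : ∀ u → B u u ≈ 0#
    same u = alternating F zero (suc zero) (λ ()) (λ _ → refl)
    split₀ : B s s ≈ B x s + B y s
    split₀ = linear-+ F zero off-zero off-zero (λ _ → refl)
    split₁ : ∀ u v w → B u (λ l → v l + w l) ≈ B u v + B u w
    split₁ u v w = linear-+ (tail-alternating F u) zero off-zero off-zero (λ _ → refl)

  -- Row `j` passes the rows before it one at a time, and each exchange contributes a sign.
  move-to-front : ∀ {m n} {f : (Fin (suc n) → Row m) → Carrier} → IsAlternating f →
                  ∀ X j → f (X j ∷ removeAt X j) ≈ sign j * f X
  move-to-front F X zero = trans (cong F λ { zero l → refl ; (suc i) l → refl }) (sym (*-identityˡ _))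
  move-to-front {n = suc n} {f} F X (suc j) = begin
    f (X (suc j) ∷ removeAt X (suc j))
      ≈⟨ cong F (λ { zero l → refl ; (suc zero) l → refl ; (suc (suc i)) l → refl }) ⟩
    f (X (suc j) ∷ X zero ∷ removeAt (X ∘ suc) j)
      ≈⟨ swap F _ _ _ ⟩
    - f (X zero ∷ X (suc j) ∷ removeAt (X ∘ suc) j)
      ≈⟨ -‿cong (move-to-front (tail-alternating F (X zero)) (X ∘ suc) j) ⟩
    - (sign j * f (X zero ∷ X ∘ suc))
      ≈⟨ solve 2 (λ s y → :- (s :* y) := (:- s) :* y) refl _ _ ⟩
    - sign j * f (X zero ∷ X ∘ suc)
      ≈⟨ *-congˡ (cong F λ { zero l → refl ; (suc i) l → refl }) ⟩
    - sign j * f X ∎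

  minor : ∀ {n} → (Fin n → Row (suc n)) → Fin (suc n) → Matrix R n
  minor X j i l = X i (punchIn j l)

  det-cong : ∀ {n} {X Y : Matrix R n} → (∀ i l → X i l ≈ Y i l) → det R X ≈ det R Y
  det-cong {zero}  e = refl
  det-cong {suc n} e = asum-cong λ j → *-cong (e zero j) (det-cong λ i l → e (suc i) (punchIn j l))

  det-linear : ∀ {n} i a b {X Y Z : Matrix R n} → (∀ i′ → i′ ≢ i → ∀ l → X i′ l ≈ Y i′ l) →
               (∀ i′ → i′ ≢ i → ∀ l → X i′ l ≈ Z i′ l) →
               (∀ l → X i l ≈ a * Y i l + b * Z i l) → det R X ≈ a * det R Y + b * det R Z
  det-linear {suc n} zero a b {X} {Y} {Z} p q e = trans (asum-cong term)
    (asum-linear a b (λ j → Y zero j * det R (minor (Y ∘ suc) j)) (λ j → Z zero j * det R (minor (Z ∘ suc) j)))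
    where
    term : ∀ j → X zero j * det R (minor (X ∘ suc) j) ≈
           a * (Y zero j * det R (minor (Y ∘ suc) j)) + b * (Z zero j * det R (minor (Z ∘ suc) j))
    term j = begin
      X zero j * det R (minor (X ∘ suc) j)
        ≈⟨ *-congʳ (e j) ⟩
      (a * Y zero j + b * Z zero j) * det R (minor (X ∘ suc) j)
        ≈⟨ solve 5 (λ a b y z d → (a :* y :+ b :* z) :* d := a :* (y :* d) :+ b :* (z :* d)) refl a b _ _ _ ⟩
      a * (Y zero j * det R (minor (X ∘ suc) j)) + b * (Z zero j * det R (minor (X ∘ suc) j))
        ≈⟨ +-cong (*-congˡ (*-congˡ (det-cong λ i l → p (suc i) (λ ()) (punchIn j l))))
                  (*-congˡ (*-congˡ (det-cong λ i l → q (suc i) (λ ()) (punchIn j l)))) ⟩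
      a * (Y zero j * det R (minor (Y ∘ suc) j)) + b * (Z zero j * det R (minor (Z ∘ suc) j)) ∎
  det-linear {suc n} (suc i) a b {X} {Y} {Z} p q e = trans (asum-cong term)
    (asum-linear a b (λ j → Y zero j * det R (minor (Y ∘ suc) j)) (λ j → Z zero j * det R (minor (Z ∘ suc) j)))
    where
    term : ∀ j → X zero j * det R (minor (X ∘ suc) j) ≈
           a * (Y zero j * det R (minor (Y ∘ suc) j)) + b * (Z zero j * det R (minor (Z ∘ suc) j))
    term j = begin
      X zero j * det R (minor (X ∘ suc) j)
        ≈⟨ *-congˡ (det-linear i a b (λ i′ ne l → p (suc i′) (suc-≢ ne) (punchIn j l))
                                     (λ i′ ne l → q (suc i′) (suc-≢ ne) (punchIn j l)) (λ l → e (punchIn j l))) ⟩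
      X zero j * (a * det R (minor (Y ∘ suc) j) + b * det R (minor (Z ∘ suc) j))
        ≈⟨ solve 5 (λ a b x y z → x :* (a :* y :+ b :* z) := a :* (x :* y) :+ b :* (x :* z)) refl a b _ _ _ ⟩
      a * (X zero j * det R (minor (Y ∘ suc) j)) + b * (X zero j * det R (minor (Z ∘ suc) j))
        ≈⟨ +-cong (*-congˡ (*-congʳ (p zero (λ ()) j))) (*-congˡ (*-congʳ (q zero (λ ()) j))) ⟩
      a * (Y zero j * det R (minor (Y ∘ suc) j)) + b * (Z zero j * det R (minor (Z ∘ suc) j)) ∎

  -- Laplace expansion along two equal rows: the terms for (j , l) and (l , j) cancel.
  equal-rows : ∀ {n} (r : Row (suc (suc n))) (d : (Fin n → Fin (suc (suc n))) → Carrier) →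
               (∀ {φ ψ} → (∀ i → φ i ≡ ψ i) → d φ ≈ d ψ) →
               asum (λ j → r j * asum (λ l → r (punchIn j l) * d (λ i → punchIn j (punchIn l i)))) ≈ 0#
  equal-rows {n} r d d-cong = begin
    r zero * A - asum (λ j → r (suc j) * (r zero * M j - V j))
      ≈⟨ +-congˡ (-‿cong (trans (asum-cong term)
                         (asum-difference (λ j → r zero * (r (suc j) * M j)) (λ j → r (suc j) * V j)))) ⟩
    r zero * A - (asum (λ j → r zero * (r (suc j) * M j)) - asum (λ j → r (suc j) * V j))
      ≈⟨ +-congˡ (-‿cong (+-cong (asum-scale (r zero) (λ j → r (suc j) * M j)) (-‿cong (rest n r d d-cong)))) ⟩
    r zero * A - (r zero * A - 0#)
      ≈⟨ trans (+-congˡ (-‿cong (trans (+-congˡ -0#≈0#) (+-identityʳ _)))) (-‿inverseʳ _) ⟩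
    0# ∎
    where
    M : Fin (suc n) → Carrier
    M j = d (λ i → suc (punchIn j i))
    A = asum (λ j → r (suc j) * M j)
    V : Fin (suc n) → Carrier
    V j = asum (λ l → r (suc (punchIn j l)) * d (λ i → punchIn (suc j) (punchIn (suc l) i)))
    term : ∀ j → r (suc j) * (r zero * M j - V j) ≈ r zero * (r (suc j) * M j) - r (suc j) * V j
    term j = solve 4 (λ x y z w → x :* (y :* z :- w) := y :* (x :* z) :- x :* w) refl (r (suc j)) (r zero) (M j) (V j)
    -- Once the terms involving column 0 have cancelled, column 0 belongs to every remaining
    -- selection of columns. Building it into `d′` gives a sum of the same shape and smaller size;
    -- this is why `d` is an arbitrary function of the selected columns.
    rest : ∀ n (r : Row (suc (suc n))) (d : (Fin n → Fin (suc (suc n))) → Carrier) →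
           (∀ {φ ψ} → (∀ i → φ i ≡ ψ i) → d φ ≈ d ψ) →
           asum (λ j → r (suc j) * asum (λ l → r (suc (punchIn j l)) * d (λ i → punchIn (suc j) (punchIn (suc l) i)))) ≈ 0#
    rest zero    r d d-cong = asum-zero λ j → zeroʳ (r (suc j))
    rest (suc n) r d d-cong = trans
      (asum-cong term′)
      (equal-rows (r ∘ suc) d′ (λ e → d-cong λ { zero → ≡.refl ; (suc i) → ≡.cong suc (e i) }))
      where
      d′ : (Fin n → Fin (suc (suc n))) → Carrier
      d′ φ = d (zero ∷ suc ∘ φ)
      term″ : ∀ j l → d (λ i → punchIn (suc j) (punchIn (suc l) i)) ≈ d′ (λ i → punchIn j (punchIn l i))
      term″ j l = d-cong λ { zero → ≡.refl ; (suc i) → ≡.refl }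
      term′ : ∀ j → r (suc j) * asum (λ l → r (suc (punchIn j l)) * d (λ i → punchIn (suc j) (punchIn (suc l) i))) ≈
              r (suc j) * asum (λ l → r (suc (punchIn j l)) * d′ (λ i → punchIn j (punchIn l i)))
      term′ j = *-congˡ (asum-cong λ l → *-congˡ {r (suc (punchIn j l))} (term″ j l))

  private
    -- Moving row `suc j` to the top of every minor costs the same factor `sign j` throughout. Its
    -- square is 1, so it can be introduced and removed, and in between the expansion has the shape
    -- treated by `equal-rows`.
    first-row : ∀ n → IsAlternating (det R {n}) → ∀ j {X : Matrix R (suc n)} →
                (∀ l → X zero l ≈ X (suc j) l) → det R X ≈ 0#
    first-row (suc n) D j {X} e = begin
      det R X
        ≈⟨ trans (*-congʳ (sign² j)) (*-identityˡ _) ⟨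
      sign j * sign j * det R X
        ≈⟨ *-assoc _ _ _ ⟩
      sign j * (sign j * det R X)
        ≈⟨ *-congˡ (asum-scale (sign j) (λ k → X zero k * d k)) ⟨
      sign j * asum (λ k → sign j * (X zero k * d k))
        ≈⟨ *-congˡ (asum-cong term) ⟩
      sign j * asum (λ k → X zero k * asum (λ l → X zero (punchIn k l) * d′ (λ i → punchIn k (punchIn l i))))
        ≈⟨ *-congˡ (equal-rows (X zero) d′ (λ p → det-cong λ i l → reflexive (≡.cong (removeAt (X ∘ suc) j i) (p l)))) ⟩
      sign j * 0#
        ≈⟨ zeroʳ _ ⟩
      0# ∎
      where
      d = λ k → det R (minor (X ∘ suc) k)
      d′ : (Fin n → Fin (suc (suc n))) → Carrier
      d′ φ = det R (λ i l → removeAt (X ∘ suc) j i (φ l))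
      term : ∀ k → sign j * (X zero k * d k) ≈
             X zero k * asum (λ l → X zero (punchIn k l) * d′ (λ i → punchIn k (punchIn l i)))
      term k = begin
        sign j * (X zero k * d k)
          ≈⟨ solve 3 (λ s x d → s :* (x :* d) := x :* (s :* d)) refl (sign j) (X zero k) (d k) ⟩
        X zero k * (sign j * d k)
          ≈⟨ *-congˡ (move-to-front D (minor (X ∘ suc) k) j) ⟨
        X zero k * asum (λ l → X (suc j) (punchIn k l) * d′ (λ i → punchIn k (punchIn l i)))
          ≈⟨ *-congˡ (asum-cong λ l → *-congʳ {d′ (λ i → punchIn k (punchIn l i))} (e (punchIn k l))) ⟨
        X zero k * asum (λ l → X zero (punchIn k l) * d′ (λ i → punchIn k (punchIn l i))) ∎

  det-alternating : ∀ n → IsAlternating (det R {n})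
  det-alternating n = record
    { cong        = det-cong
    ; linear      = det-linear
    ; alternating = vanish n
    }
    where
    vanish : ∀ n i j → i ≢ j → ∀ {X : Matrix R n} → (∀ l → X i l ≈ X j l) → det R X ≈ 0#
    vanish (suc n) zero    zero    ne e = ⊥-elim (ne ≡.refl)
    vanish (suc n) zero    (suc j) ne {X} e = first-row n (det-alternating n) j {X} e
    vanish (suc n) (suc i) zero    ne {X} e = first-row n (det-alternating n) i {X} (λ l → sym (e l))
    vanish (suc n) (suc i) (suc j) ne {X} e = asum-zero {f = λ k → X zero k * det R (minor (X ∘ suc) k)} λ k →
      trans (*-congˡ (vanish n i j (λ { ≡.refl → ne ≡.refl }) (λ l → e (punchIn k l)))) (zeroʳ _)

  1ᴹ : ∀ {n} → Matrix R n
  1ᴹ zero    zero    = 1#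
  1ᴹ zero    (suc j) = 0#
  1ᴹ (suc i) zero    = 0#
  1ᴹ (suc i) (suc j) = 1ᴹ i j

  1ᴹ-diagonal : ∀ {n} (i : Fin n) → 1ᴹ i i ≈ 1#
  1ᴹ-diagonal zero    = refl
  1ᴹ-diagonal (suc i) = 1ᴹ-diagonal i

  1ᴹ-off : ∀ {n} {i j : Fin n} → i ≢ j → 1ᴹ i j ≈ 0#
  1ᴹ-off {i = zero}  {zero}  ne = ⊥-elim (ne ≡.refl)
  1ᴹ-off {i = zero}  {suc j} ne = refl
  1ᴹ-off {i = suc i} {zero}  ne = refl
  1ᴹ-off {i = suc i} {suc j} ne = 1ᴹ-off {i = i} {j} λ { ≡.refl → ne ≡.refl }

  ∑-1ᴹʳ : ∀ {n} (a : Row n) l → ∑ R (λ j → a j * 1ᴹ j l) ≈ a l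
  ∑-1ᴹʳ a zero    = trans (+-cong (*-identityʳ _) (∑-0 λ i → zeroʳ (a (suc i)))) (+-identityʳ _)
  ∑-1ᴹʳ a (suc l) = trans (+-cong (zeroʳ _) (∑-1ᴹʳ (a ∘ suc) l)) (+-identityˡ _)

  ∑-1ᴹˡ : ∀ {n} (a : Row n) l → ∑ R (λ j → 1ᴹ l j * a j) ≈ a l
  ∑-1ᴹˡ a zero    = trans (+-cong (*-identityˡ _) (∑-0 λ i → zeroˡ (a (suc i)))) (+-identityʳ _)
  ∑-1ᴹˡ a (suc l) = trans (+-cong (zeroˡ _) (∑-1ᴹˡ (a ∘ suc) l)) (+-identityˡ _)

  ∑-1ᴹˡ′ : ∀ {n} (a : Row n) l → ∑ R (λ j → 1ᴹ j l * a j) ≈ a l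
  ∑-1ᴹˡ′ a zero    = trans (+-cong (*-identityˡ _) (∑-0 λ i → zeroˡ (a (suc i)))) (+-identityʳ _)
  ∑-1ᴹˡ′ a (suc l) = trans (+-cong (zeroˡ _) (∑-1ᴹˡ′ (a ∘ suc) l)) (+-identityˡ _)

  private
    insert : ∀ {n} → Fin (suc n) → Row n → Row (suc n)
    insert zero    r zero    = 0#
    insert zero    r (suc l) = r l
    insert {suc n} (suc j) r zero    = r zero
    insert {suc n} (suc j) r (suc l) = insert j (r ∘ suc) l

    insert-cong : ∀ {n} (j : Fin (suc n)) {r s : Row n} → (∀ l → r l ≈ s l) → ∀ l → insert j r l ≈ insert j s l
    insert-cong zero    e zero    = refl
    insert-cong zero    e (suc l) = e l
    insert-cong {suc n} (suc j) e zero    = e zero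
    insert-cong {suc n} (suc j) e (suc l) = insert-cong j (e ∘ suc) l

    insert-linear : ∀ {n} (j : Fin (suc n)) a b (r s : Row n) l →
                    insert j (λ i → a * r i + b * s i) l ≈ a * insert j r l + b * insert j s l
    insert-linear zero    a b r s zero    = sym (trans (+-cong (zeroʳ _) (zeroʳ _)) (+-identityˡ 0#))
    insert-linear zero    a b r s (suc l) = refl
    insert-linear {suc n} (suc j) a b r s zero    = refl
    insert-linear {suc n} (suc j) a b r s (suc l) = insert-linear j a b (r ∘ suc) (s ∘ suc) l

    cleared : ∀ {n} (j : Fin (suc n)) (r : Row (suc n)) l → r l ≈ insert j (r ∘ punchIn j) l + r j * 1ᴹ j l
    cleared zero    r zero    = sym (trans (+-identityˡ _) (*-identityʳ _))
    cleared zero    r (suc l) = sym (trans (+-congˡ (zeroʳ _)) (+-identityʳ _))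
    cleared {suc n} (suc j) r zero    = sym (trans (+-congˡ (zeroʳ _)) (+-identityʳ _))
    cleared {suc n} (suc j) r (suc l) = cleared j (r ∘ suc) l

    insert-1ᴹ : ∀ {n} (j : Fin (suc n)) i l → insert j (1ᴹ i) l ≈ 1ᴹ (punchIn j i) l
    insert-1ᴹ zero    i       zero    = refl
    insert-1ᴹ zero    i       (suc l) = refl
    insert-1ᴹ {suc n} (suc j) zero    zero    = refl
    insert-1ᴹ {suc n} (suc j) zero    (suc l) = go j l
      where
      go : ∀ {n} (j : Fin (suc n)) l → insert j (λ _ → 0#) l ≈ 0#
      go zero    zero    = refl
      go zero    (suc l) = refl
      go {suc n} (suc j) zero    = refl
      go {suc n} (suc j) (suc l) = go j l
    insert-1ᴹ {suc n} (suc j) (suc i) zero    = refl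
    insert-1ᴹ {suc n} (suc j) (suc i) (suc l) = insert-1ᴹ j i l

    -- The induction runs over the rows because `step` changes only one of them; for the later rows
    -- the first is absorbed into `g`, which is therefore an arbitrary function.
    shear : ∀ {m n} (g : (Fin n → Row m) → Carrier) (e : Row m) →
            (∀ {X Y} → (∀ i l → X i l ≈ Y i l) → g X ≈ g Y) →
            (∀ i {X Y} a → (∀ i′ → i′ ≢ i → ∀ l → X i′ l ≈ Y i′ l) → (∀ l → X i l ≈ Y i l + a * e l) → g X ≈ g Y) →
            ∀ X (a : Fin n → Carrier) → g (λ i l → X i l + a i * e l) ≈ g X
    shear {n = zero}  g e g-cong step X a = g-cong λ ()
    shear {n = suc n} g e g-cong step X a = begin
      g (λ i l → X i l + a i * e l)
        ≈⟨ g-cong (λ { zero l → refl ; (suc i) l → refl }) ⟩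
      g ((λ l → X zero l + a zero * e l) ∷ (λ i l → X (suc i) l + a (suc i) * e l))
        ≈⟨ shear (λ Y → g ((λ l → X zero l + a zero * e l) ∷ Y)) e (λ p → g-cong (cons-cong (λ _ → refl) p))
             (λ i b p q → step (suc i) b (off-suc p) q) (X ∘ suc) (a ∘ suc) ⟩
      g ((λ l → X zero l + a zero * e l) ∷ X ∘ suc)
        ≈⟨ step zero (a zero) (λ { zero ne l → ⊥-elim (ne ≡.refl) ; (suc i) ne l → refl }) (λ l → refl) ⟩
      g X ∎

  -- Write the first row in the standard basis. When it is `1ᴹ j`, column `j` of the other rows can
  -- be cleared, and what is left is an alternating form `g j` of the minor; by induction the sum
  -- becomes the Laplace expansion. Multiplicativity of the determinant follows, the determinant of
  -- a product being alternating in the left factor.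
  alternating-unique : ∀ {n} (f : Matrix R n → Carrier) → IsAlternating f → ∀ X → f X ≈ det R X * f 1ᴹ
  alternating-unique {zero}  f F X = trans (cong F λ ()) (sym (*-identityˡ _))
  alternating-unique {suc n} f F X = begin
    f X
      ≈⟨ update-same F X zero (λ l → sym (∑-1ᴹʳ (X zero) l)) ⟩
    f (updateAt X zero (const (λ l → ∑ R (λ j → X zero j * 1ᴹ j l))))
      ≈⟨ linear-∑ F zero X (X zero) 1ᴹ ⟩
    ∑ R (λ j → X zero j * f (updateAt X zero (const (1ᴹ j))))
      ≈⟨ ∑-cong term ⟩
    ∑ R (λ j → f 1ᴹ * (X zero j * d j * sign j))
      ≈⟨ *-∑ (f 1ᴹ) (λ j → X zero j * d j * sign j) ⟨
    f 1ᴹ * ∑ R (λ j → X zero j * d j * sign j)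
      ≈⟨ *-comm _ _ ⟩
    ∑ R (λ j → X zero j * d j * sign j) * f 1ᴹ
      ≈⟨ *-congʳ (asum≈∑ (λ j → X zero j * d j)) ⟨
    det R X * f 1ᴹ ∎
    where
    g : Fin (suc n) → Matrix R n → Carrier
    g j Y = f (1ᴹ j ∷ λ i → insert j (Y i))

    d : Fin (suc n) → Carrier
    d j = det R (minor (X ∘ suc) j)

    absorb : ∀ j i {Y Z : Fin n → Row (suc n)} a → (∀ i′ → i′ ≢ i → ∀ l → Y i′ l ≈ Z i′ l) →
             (∀ l → Y i l ≈ Z i l + a * 1ᴹ j l) → f (1ᴹ j ∷ Y) ≈ f (1ᴹ j ∷ Z)
    absorb j i {Y} {Z} a p q = begin
      f (1ᴹ j ∷ Y)
        ≈⟨ linear (tail-alternating F (1ᴹ j)) i 1# a p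
             (λ i′ ne l → trans (p i′ ne l) (reflexive (≡.cong (_$ l) (≡.sym (Vector.updateAt-minimal i′ i Z ne)))))
             (λ l → trans (q l) (+-cong (sym (*-identityˡ _))
               (*-congˡ (reflexive (≡.cong (_$ l) (≡.sym (Vector.updateAt-updates i Z))))))) ⟩
      1# * f (1ᴹ j ∷ Z) + a * f (1ᴹ j ∷ updateAt Z i (const (1ᴹ j)))
        ≈⟨ +-cong (*-identityˡ _) (trans (*-congˡ (alternating F zero (suc i) (λ ())
             (λ l → reflexive (≡.cong (_$ l) (≡.sym (Vector.updateAt-updates i Z)))))) (zeroʳ a)) ⟩
      f (1ᴹ j ∷ Z) + 0#
        ≈⟨ +-identityʳ _ ⟩
      f (1ᴹ j ∷ Z) ∎

    g-alternating : ∀ j → IsAlternating (g j)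
    g-alternating j = record
      { cong        = λ e → cong (tail-alternating F (1ᴹ j)) λ i → insert-cong j (e i)
      ; linear      = λ i a b p q e → linear (tail-alternating F (1ᴹ j)) i a b
          (λ i′ ne → insert-cong j (p i′ ne)) (λ i′ ne → insert-cong j (q i′ ne))
          (λ l → trans (insert-cong j e l) (insert-linear j a b _ _ l))
      ; alternating = λ i i′ ne e → alternating (tail-alternating F (1ᴹ j)) i i′ ne (insert-cong j e)
      }

    g-1ᴹ : ∀ j → g j 1ᴹ ≈ sign j * f 1ᴹ
    g-1ᴹ j = trans (cong (tail-alternating F (1ᴹ j)) (λ i l → insert-1ᴹ j i l)) (move-to-front F 1ᴹ j)

    term : ∀ j → X zero j * f (updateAt X zero (const (1ᴹ j))) ≈ f 1ᴹ * (X zero j * d j * sign j)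
    term j = begin
      X zero j * f (updateAt X zero (const (1ᴹ j)))
        ≈⟨ *-congˡ (cong F {updateAt X zero (const (1ᴹ j))} {1ᴹ j ∷ λ i l → insert j (minor (X ∘ suc) j i) l + X (suc i) j * 1ᴹ j l}
             λ { zero l → refl ; (suc i) l → cleared j (X (suc i)) l }) ⟩
      X zero j * f (1ᴹ j ∷ λ i l → insert j (minor (X ∘ suc) j i) l + X (suc i) j * 1ᴹ j l)
        ≈⟨ *-congˡ (shear (λ Y → f (1ᴹ j ∷ Y)) (1ᴹ j) (cong (tail-alternating F (1ᴹ j))) (absorb j)
             (λ i → insert j (minor (X ∘ suc) j i)) (λ i → X (suc i) j)) ⟩
      X zero j * g j (minor (X ∘ suc) j)
        ≈⟨ *-congˡ (alternating-unique (g j) (g-alternating j) (minor (X ∘ suc) j)) ⟩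
      X zero j * (d j * g j 1ᴹ)
        ≈⟨ *-congˡ (*-congˡ (g-1ᴹ j)) ⟩
      X zero j * (d j * (sign j * f 1ᴹ))
        ≈⟨ solve 4 (λ x d s y → x :* (d :* (s :* y)) := y :* (x :* d :* s)) refl (X zero j) (d j) (sign j) (f 1ᴹ) ⟩
      f 1ᴹ * (X zero j * d j * sign j) ∎

  infixl 7 _*ᴹ_
  _*ᴹ_ : ∀ {l m n} → (Fin l → Row m) → (Fin m → Row n) → Fin l → Row n
  (X *ᴹ Y) i j = ∑ R (λ k → X i k * Y k j)

  det-1ᴹ : ∀ n → det R (1ᴹ {n}) ≈ 1#
  det-1ᴹ zero    = refl
  det-1ᴹ (suc n) = trans (+-cong (trans (*-identityˡ _) (det-1ᴹ n)) (-‿cong (asum-zero (λ j → zeroˡ (det R (minor {n} (1ᴹ {suc n} ∘ suc) (suc j)))))))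
    (trans (+-congˡ -0#≈0#) (+-identityʳ 1#))

  det-* : ∀ {n} (X Y : Matrix R n) → det R (X *ᴹ Y) ≈ det R X * det R Y
  det-* {n} X Y = trans (alternating-unique (λ X → det R (X *ᴹ Y)) alt X) (*-congˡ (det-cong λ i j → ∑-1ᴹˡ (λ k → Y k j) i))
    where
    alt : IsAlternating (λ X → det R (X *ᴹ Y))
    alt = record
      { cong        = λ e → det-cong λ i j → ∑-cong λ k → *-congʳ (e i k)
      ; linear      = λ i a b {X} {X′} {X″} p q e → det-linear i a b
          (λ i′ ne j → ∑-cong λ k → *-congʳ (p i′ ne k)) (λ i′ ne j → ∑-cong λ k → *-congʳ (q i′ ne k))
          (λ j → begin
            ∑ R (λ k → X i k * Y k j)
              ≈⟨ ∑-cong (λ k → trans (*-congʳ (e k))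
                   (solve 5 (λ a b x y z → (a :* x :+ b :* y) :* z := a :* (x :* z) :+ b :* (y :* z)) refl a b _ _ _)) ⟩
            ∑ R (λ k → a * (X′ i k * Y k j) + b * (X″ i k * Y k j))
              ≈⟨ ∑-+ (λ k → a * (X′ i k * Y k j)) (λ k → b * (X″ i k * Y k j)) ⟩
            ∑ R (λ k → a * (X′ i k * Y k j)) + ∑ R (λ k → b * (X″ i k * Y k j))
              ≈⟨ +-cong (*-∑ a (λ k → X′ i k * Y k j)) (*-∑ b (λ k → X″ i k * Y k j)) ⟨
            a * ∑ R (λ k → X′ i k * Y k j) + b * ∑ R (λ k → X″ i k * Y k j) ∎)
      ; alternating = λ i j ne e → alternating (det-alternating n) i j ne λ l → ∑-cong λ k → *-congʳ (e k)
      }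

  adjugate : ∀ {n} → Matrix R n → Matrix R n
  adjugate X j l = det R (updateAt X l (const (1ᴹ j)))

  -- Linearity in row `l` turns the entry into the determinant of `X` with row `l` replaced by row
  -- `i`: this is `X` itself if `i ≡ l`, and has a repeated row otherwise.
  adjugate-inverse : ∀ {n} (X : Matrix R n) i l → (X *ᴹ adjugate X) i l ≈ det R X * 1ᴹ i l
  adjugate-inverse {n} X i l = trans (sym (linear-∑ (det-alternating n) l X (X i) 1ᴹ)) (go (i Fin.≟ l))
    where
    r = λ j → ∑ R (λ k → X i k * 1ᴹ k j)
    go : Dec (i ≡ l) → det R (updateAt X l (const r)) ≈ det R X * 1ᴹ i l
    go (yes ≡.refl) = trans (sym (update-same (det-alternating n) X i (λ j → sym (∑-1ᴹʳ (X i) j))))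
      (trans (sym (*-identityʳ _)) (*-congˡ (sym (1ᴹ-diagonal i))))
    go (no ne) = trans (alternating (det-alternating n) i l ne λ j → trans
        (reflexive (≡.cong (_$ j) (Vector.updateAt-minimal i l X ne)))
        (trans (sym (∑-1ᴹʳ (X i) j)) (reflexive (≡.sym (≡.cong (_$ j) (Vector.updateAt-updates l X))))))
      (sym (trans (*-congˡ (1ᴹ-off ne)) (zeroʳ _)))

module Homomorphism {a ℓ₁ b ℓ₂} {R : CommutativeRing a ℓ₁} {S : CommutativeRing b ℓ₂}
  (φ : RingHomomorphism (CommutativeRing.rawRing R) (CommutativeRing.rawRing S)) where
  private
    module R = CommutativeRing R
  open CommutativeRing S hiding (zero)
  open RingHomomorphism φ

  ∑-homo : ∀ {n} (f : Fin n → R.Carrier) → ⟦ ∑ R f ⟧ ≈ ∑ S (λ i → ⟦ f i ⟧)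
  ∑-homo {zero}  f = 0#-homo
  ∑-homo {suc n} f = trans (+-homo _ _) (+-congˡ (∑-homo (f ∘ suc)))

  asum-homo : ∀ {n} (f : Fin n → R.Carrier) → ⟦ alternatingSum R f ⟧ ≈ alternatingSum S (λ i → ⟦ f i ⟧)
  asum-homo {zero}  f = 0#-homo
  asum-homo {suc n} f = trans (+-homo _ _) (+-congˡ (trans (-‿homo _) (-‿cong (asum-homo (f ∘ suc)))))

  det-homo : ∀ {n} (X : Matrix R n) → ⟦ det R X ⟧ ≈ det S (λ i j → ⟦ X i j ⟧)
  det-homo {zero}  X = 1#-homo
  det-homo {suc n} X = trans (asum-homo (λ j → X zero j R.* det R (λ i l → X (suc i) (punchIn j l))))
    (Determinant.asum-cong S (λ j → trans (*-homo (X zero j) _) (*-congˡ (det-homo (λ i l → X (suc i) (punchIn j l))))))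

module BlockDeterminant {c ℓ} (R : CommutativeRing c ℓ) where
  open CommutativeRing R hiding (zero)
  open Sums R
  open Determinant R
  open Exp semiring using (_^_)

  ∑-split : ∀ m {n} (f : Fin (m ℕ.+ n) → Carrier) →
            ∑ R f ≈ ∑ R (λ i → f (i Fin.↑ˡ n)) + ∑ R (λ i → f (m Fin.↑ʳ i))
  ∑-split zero    f = sym (+-identityˡ _)
  ∑-split (suc m) f = trans (+-congˡ (∑-split m (f ∘ suc))) (sym (+-assoc _ _ _))

  ∑-combine : ∀ m {n} (f : Fin (m ℕ.* n) → Carrier) → ∑ R f ≈ ∑ R (λ i → ∑ R (λ j → f (Fin.combine {m} i j)))
  ∑-combine zero        f = refl
  ∑-combine (suc m) {n} f = trans (∑-split n f) (+-congˡ (∑-combine m (λ i → f (n Fin.↑ʳ i))))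

  private
    punchIn-↑ˡ-↑ˡ : ∀ {m} n (j : Fin (suc m)) (l : Fin m) → punchIn (j Fin.↑ˡ n) (l Fin.↑ˡ n) ≡ punchIn j l Fin.↑ˡ n
    punchIn-↑ˡ-↑ˡ n zero    l       = ≡.refl
    punchIn-↑ˡ-↑ˡ n (suc j) zero    = ≡.refl
    punchIn-↑ˡ-↑ˡ n (suc j) (suc l) = ≡.cong suc (punchIn-↑ˡ-↑ˡ n j l)

    punchIn-↑ˡ-↑ʳ : ∀ m {n} (j : Fin (suc m)) (l : Fin n) → punchIn (j Fin.↑ˡ n) (m Fin.↑ʳ l) ≡ suc m Fin.↑ʳ l
    punchIn-↑ˡ-↑ʳ m       zero    l = ≡.refl
    punchIn-↑ˡ-↑ʳ (suc m) (suc j) l = ≡.cong suc (punchIn-↑ˡ-↑ʳ m j l)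

    asum-left : ∀ m {n} (f : Fin (m ℕ.+ n) → Carrier) → (∀ i → f (m Fin.↑ʳ i) ≈ 0#) →
                alternatingSum R f ≈ alternatingSum R (λ i → f (i Fin.↑ˡ n))
    asum-left zero    f e = asum-zero {f = f} e
    asum-left (suc m) f e = +-congˡ (-‿cong (asum-left m (f ∘ suc) e))

  det-⊕ : ∀ m {n} (X : Matrix R (m ℕ.+ n)) →
          (∀ i j → X (i Fin.↑ˡ n) (m Fin.↑ʳ j) ≈ 0#) → (∀ i j → X (m Fin.↑ʳ i) (j Fin.↑ˡ n) ≈ 0#) →
          det R X ≈ det R (λ i j → X (i Fin.↑ˡ n) (j Fin.↑ˡ n)) * det R (λ i j → X (m Fin.↑ʳ i) (m Fin.↑ʳ j))
  det-⊕ zero        X p q = sym (*-identityˡ _)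
  det-⊕ (suc m) {n} X p q = trans
    (asum-left (suc m) (λ j → X zero j * det R (minor (X ∘ suc) j)) (λ j → trans (*-congʳ (p zero j)) (zeroˡ _)))
    (trans (asum-cong term) (trans (asum-scale B (λ j → X zero (j Fin.↑ˡ n) * A j)) (*-comm _ _)))
    where
    A : Fin (suc m) → Carrier
    A j = det R (minor (λ i l → X (suc i Fin.↑ˡ n) (l Fin.↑ˡ n)) j)
    B = det R (λ i j → X (suc m Fin.↑ʳ i) (suc m Fin.↑ʳ j))
    at : ∀ {i j l} → j ≡ l → X i j ≈ X i l
    at ≡.refl = refl
    term : ∀ j → X zero (j Fin.↑ˡ n) * det R (minor (X ∘ suc) (j Fin.↑ˡ n)) ≈ B * (X zero (j Fin.↑ˡ n) * A j)
    term j = trans (*-congˡ (trans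
      (det-⊕ m (minor (X ∘ suc) (j Fin.↑ˡ n))
        (λ i l → trans (at (punchIn-↑ˡ-↑ʳ m j l)) (p (suc i) l))
        (λ i l → trans (at (punchIn-↑ˡ-↑ˡ n j l)) (q i (punchIn j l))))
      (*-cong (det-cong λ i l → at (punchIn-↑ˡ-↑ˡ n j l)) (det-cong λ i l → at (punchIn-↑ˡ-↑ʳ m j l)))))
      (trans (sym (*-assoc _ _ _)) (*-comm _ _))

  -- Meant for multiplication by an element of a subfield on the whole field, which splits into
  -- copies indexed by a basis over the subfield; the exponent is then the relative degree.
  det-copies : ∀ g {m} (X : Matrix R (g ℕ.* m)) (B : Matrix R m) →
               (∀ j i i′ → X (Fin.combine {g} j i) (Fin.combine j i′) ≈ B i i′) →
               (∀ j j′ i i′ → j ≢ j′ → X (Fin.combine {g} j i) (Fin.combine j′ i′) ≈ 0#) →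
               det R X ≈ det R B ^ g
  det-copies zero        X B p q = refl
  det-copies (suc g) {m} X B p q = trans
    (det-⊕ m X (λ i j → off i j (Fin.remQuot {g} m j) (sur j)) (λ i j → off′ i j (Fin.remQuot {g} m i) (sur i)))
    (*-cong (det-cong (p zero))
      (det-copies g (λ i j → X (m Fin.↑ʳ i) (m Fin.↑ʳ j)) B (p ∘ suc)
        (λ j j′ i i′ ne → q (suc j) (suc j′) i i′ λ { ≡.refl → ne ≡.refl })))
    where
    sur : ∀ j → Fin.combine {g} (proj₁ (Fin.remQuot {g} m j)) (proj₂ (Fin.remQuot {g} m j)) ≡ j
    sur = Fin.combine-remQuot {g} m
    off : ∀ i j (x : Fin g × Fin m) → Fin.combine (proj₁ x) (proj₂ x) ≡ j → X (i Fin.↑ˡ g ℕ.* m) (m Fin.↑ʳ j) ≈ 0#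
    off i _ (j , i′) ≡.refl = q zero (suc j) i i′ λ ()
    off′ : ∀ i j (x : Fin g × Fin m) → Fin.combine (proj₁ x) (proj₂ x) ≡ i → X (m Fin.↑ʳ i) (j Fin.↑ˡ g ℕ.* m) ≈ 0#
    off′ _ j (i , i′) ≡.refl = q (suc i) zero i′ j λ ()

-- Classical logic and dimension over a field

module Classical (em : ExcludedMiddle (lsuc 0ℓ)) where
  decide₁ : (P : Set₁) → Dec P
  decide₁ P = em

  decide : (P : Set) → Dec P
  decide P with em {Lift (lsuc 0ℓ) P}
  ... | yes (lift p) = yes p
  ... | no ¬p        = no λ p → ¬p (lift p)

  by-contradiction : ∀ {P : Set} → ¬ ¬ P → P
  by-contradiction {P} ¬¬p with decide P
  ... | yes p = p
  ... | no ¬p = ⊥-elim (¬¬p ¬p)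

  all-or : ∀ {A : Set} (P : A → Set) → (∀ x → P x) ⊎ ∃[ x ] ¬ P x
  all-or P with decide (∃[ x ] ¬ P x)
  ... | yes h = inj₂ h
  ... | no ¬h = inj₁ λ x → by-contradiction λ ¬p → ¬h (x , ¬p)

module FieldProperties (K : Field) where
  open Field K
  open RingProperties ring
  open SetoidReasoning setoid

  *-cancel-0 : ∀ {x y} → ¬ x ≈ 0# → x * y ≈ 0# → y ≈ 0#
  *-cancel-0 {x} {y} x≉0 e with invertible x x≉0
  ... | x⁻¹ , f = begin
    y             ≈⟨ *-identityˡ y ⟨
    1# * y        ≈⟨ *-congʳ (trans (sym f) (*-comm x x⁻¹)) ⟩
    x⁻¹ * x * y   ≈⟨ *-assoc _ _ _ ⟩
    x⁻¹ * (x * y) ≈⟨ *-congˡ e ⟩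
    x⁻¹ * 0#      ≈⟨ zeroʳ _ ⟩
    0#            ∎

  unit≉0 : ∀ {x y} → x * y ≈ 1# → ¬ x ≈ 0#
  unit≉0 e x≈0 = 0≉1 (trans (sym (zeroˡ _)) (trans (*-congʳ (sym x≈0)) e))

module LinearAlgebra (em : ExcludedMiddle (lsuc 0ℓ)) where
  open Classical em

  module _ (K : Field) where
    open Field K hiding (zero)
    open FieldProperties K
    private R = commutativeRing
    open Sums R
    open RingSolver R
    open SetoidReasoning setoid
    private module Sum = MonoidSum +-commutativeMonoid

    -- Gaussian elimination: with a pivot in the first equation, the variable `j₀` is expressed by
    -- the others and substituted into the remaining equations; without one, the first equation
    -- holds for every `u` and is dropped.
    nontrivial-solution : ∀ m n → m ℕ.< n → (A : Fin m → Fin n → Carrier) →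
      Σ[ u ∈ (Fin n → Carrier) ] (∃[ j ] ¬ u j ≈ 0#) × (∀ i → ∑ R (λ j → A i j * u j) ≈ 0#)
    nontrivial-solution zero    (suc n) _ A = const 1# , (zero , λ e → 0≉1 (sym e)) , λ ()
    nontrivial-solution (suc m) (suc n) m<n A with all-or (λ j → A zero j ≈ 0#)
    ... | inj₁ row with nontrivial-solution m (suc n) (ℕ.<-trans (ℕ.n<1+n m) m<n) (A ∘ suc)
    ...   | u , nz , e = u , nz , λ
            { zero → ∑-0 {f = λ j → A zero j * u j} λ j → trans (*-congʳ (row j)) (zeroˡ _) ; (suc i) → e i }
    nontrivial-solution (suc m) (suc n) m<n A | inj₂ (j₀ , pivot) with invertible (A zero j₀) pivot
    ... | p , Ap≈1 with nontrivial-solution m n (ℕ.s<s⁻¹ m<n)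
                          (λ i j → A (suc i) (punchIn j₀ j) - A (suc i) j₀ * (p * A zero (punchIn j₀ j)))
    ...   | u , (j₁ , nz) , e = w , (punchIn j₀ j₁ , λ h → nz (trans (sym (w-other j₁)) h)) , solves
      where
      s = ∑ R (λ j → A zero (punchIn j₀ j) * u j)
      w = insertAt u j₀ (- (p * s))
      w-pivot : w j₀ ≈ - (p * s)
      w-pivot = reflexive (Vector.insertAt-lookup u j₀ (- (p * s)))
      w-other : ∀ j → w (punchIn j₀ j) ≈ u j
      w-other j = reflexive (Vector.insertAt-punchIn u j₀ (- (p * s)) j)
      expand : ∀ i → ∑ R (λ j → A i j * w j) ≈ A i j₀ * - (p * s) + ∑ R (λ j → A i (punchIn j₀ j) * u j)
      expand i = trans (Sum.sum-remove {i = j₀} (λ j → A i j * w j))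
        (+-cong (*-congˡ w-pivot) (∑-cong λ j → *-congˡ {A i (punchIn j₀ j)} (w-other j)))
      solves : ∀ i → ∑ R (λ j → A i j * w j) ≈ 0#
      solves zero = begin
        ∑ R (λ j → A zero j * w j)    ≈⟨ expand zero ⟩
        A zero j₀ * - (p * s) + s     ≈⟨ solve 3 (λ a p s → a :* (:- (p :* s)) :+ s := s :- a :* p :* s) refl _ _ _ ⟩
        s - A zero j₀ * p * s         ≈⟨ +-congˡ (-‿cong (*-congʳ Ap≈1)) ⟩
        s - 1# * s                    ≈⟨ solve 1 (λ s → s :- con (1 , 0) :* s := con (0 , 0)) refl s ⟩
        0#                            ∎
      solves (suc i) = begin
        ∑ R (λ j → A (suc i) j * w j)
          ≈⟨ expand (suc i) ⟩
        a * - (p * s) + ∑ R (λ j → A (suc i) (punchIn j₀ j) * u j)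
          ≈⟨ solve 4 (λ a p s x → a :* (:- (p :* s)) :+ x := x :+ (:- (a :* p)) :* s) refl _ _ _ _ ⟩
        ∑ R (λ j → A (suc i) (punchIn j₀ j) * u j) + - (a * p) * s
          ≈⟨ +-congˡ (*-∑ (- (a * p)) (λ j → A zero (punchIn j₀ j) * u j)) ⟩
        ∑ R (λ j → A (suc i) (punchIn j₀ j) * u j) + ∑ R (λ j → - (a * p) * (A zero (punchIn j₀ j) * u j))
          ≈⟨ ∑-+ (λ j → A (suc i) (punchIn j₀ j) * u j) (λ j → - (a * p) * (A zero (punchIn j₀ j) * u j)) ⟨
        ∑ R (λ j → A (suc i) (punchIn j₀ j) * u j + - (a * p) * (A zero (punchIn j₀ j) * u j))
          ≈⟨ ∑-cong (λ j → solve 5 (λ x u a p y → x :* u :+ (:- (a :* p)) :* (y :* u) := (x :- a :* (p :* y)) :* u) refl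
                              (A (suc i) (punchIn j₀ j)) (u j) a p (A zero (punchIn j₀ j))) ⟩
        ∑ R (λ j → (A (suc i) (punchIn j₀ j) - a * (p * A zero (punchIn j₀ j))) * u j)
          ≈⟨ e i ⟩
        0# ∎
        where a = A (suc i) j₀

  module _ {k : Field} (E : Extension k) where
    open Extension E hiding (zero)
    private
      module k = Field k
      kR = k.commutativeRing
      R = commutativeRing
    open FieldProperties top
    open Sums R
    open Homomorphism {R = kR} {R} embed
    open RingSolver R
    open SetoidReasoning setoid

    ι-injective : ∀ {a} → ι a ≈ 0# → a k.≈ k.0#
    ι-injective {a} e = by-contradiction λ a≉0 → let b , ab≈1 = k.invertible a a≉0 in
      unit≉0 (trans (sym (ι.*-homo a b)) (trans (ι.⟦⟧-cong ab≈1) ι.1#-homo)) e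

    combination : ∀ {n} → (Fin n → k.Carrier) → (Fin n → Carrier) → Carrier
    combination a v = ∑ R (λ i → ι (a i) * v i)

    Independent : ∀ {n} → (Fin n → Carrier) → Set
    Independent {n} v = ∀ (a : Fin n → k.Carrier) → combination a v ≈ 0# → ∀ i → a i k.≈ k.0#

    Spanning : ∀ {n} → (Fin n → Carrier) → Set
    Spanning v = ∀ x → ∃[ a ] x ≈ combination a v

    combination-linear : ∀ {m n} (u : Fin n → k.Carrier) (A : Fin m → Fin n → k.Carrier) (v : Fin m → Carrier) →
      combination (λ i → ∑ kR (λ j → A i j k.* u j)) v ≈ combination u (λ j → combination (λ i → A i j) v)
    combination-linear u A v = begin
      ∑ R (λ i → ι (∑ kR (λ j → A i j k.* u j)) * v i)
        ≈⟨ ∑-cong (λ i → trans (*-congʳ (trans (∑-homo (λ j → A i j k.* u j)) (∑-cong λ j → ι.*-homo (A i j) (u j))))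
             (∑-* (v i) (λ j → ι (A i j) * ι (u j)))) ⟩
      ∑ R (λ i → ∑ R (λ j → ι (A i j) * ι (u j) * v i))
        ≈⟨ ∑-comm (λ i j → ι (A i j) * ι (u j) * v i) ⟩
      ∑ R (λ j → ∑ R (λ i → ι (A i j) * ι (u j) * v i))
        ≈⟨ ∑-cong (λ j → trans (∑-cong λ i → solve 3 (λ a u v → a :* u :* v := u :* (a :* v)) refl (ι (A i j)) (ι (u j)) (v i))
             (sym (*-∑ (ι (u j)) (λ i → ι (A i j) * v i)))) ⟩
      ∑ R (λ j → ι (u j) * ∑ R (λ i → ι (A i j) * v i)) ∎

    independent≤spanning : ∀ {m n} {v : Fin m → Carrier} {w : Fin n → Carrier} → Independent v → Spanning w → m ℕ.≤ n
    independent≤spanning {m} {n} {v} {w} ind span with m ℕ.≤? n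
    ... | yes m≤n = m≤n
    ... | no m≰n with nontrivial-solution k n m (ℕ.≰⇒> m≰n) (λ i j → proj₁ (span (v j)) i)
    ...   | u , (j , nz) , e = ⊥-elim (nz (ind u (begin
      combination u v
        ≈⟨ ∑-cong (λ j → *-congˡ {ι (u j)} (proj₂ (span (v j)))) ⟩
      combination u (λ j → combination (proj₁ (span (v j))) w)
        ≈⟨ combination-linear u (λ i j → proj₁ (span (v j)) i) w ⟨
      combination (λ i → ∑ kR (λ j → proj₁ (span (v j)) i k.* u j)) w
        ≈⟨ ∑-0 {f = λ i → ι (∑ kR (λ j → proj₁ (span (v j)) i k.* u j)) * w i}
             (λ i → trans (*-congʳ (trans (ι.⟦⟧-cong (e i)) ι.0#-homo)) (zeroˡ _)) ⟩
      0# ∎) j))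

    basis-independent : ∀ {n} (e : Basis E n) → Independent (Basis.basis e)
    basis-independent e = Basis.independent e

    basis-spanning : ∀ {n} (e : Basis E n) → Spanning (Basis.basis e)
    basis-spanning e = Basis.coordinates e

    dimension-unique : ∀ {m n} → Basis E m → Basis E n → m ≡ n
    dimension-unique e f = ℕ.≤-antisym
      (independent≤spanning (basis-independent e) (basis-spanning f))
      (independent≤spanning (basis-independent f) (basis-spanning e))

    extend-independent : ∀ {n} {v : Fin n → Carrier} {x} → Independent v → ¬ (∃[ a ] x ≈ combination a v) → Independent (x ∷ v)
    extend-independent {n} {v} {x} ind out a e = result (decide (a zero k.≈ k.0#))
      where
      result : Dec (a zero k.≈ k.0#) → ∀ i → a i k.≈ k.0#
      result (yes a₀≈0) zero    = a₀≈0
      result (yes a₀≈0) (suc i) = ind (a ∘ suc) (trans (sym (trans (+-congʳ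
        (trans (*-congʳ (trans (ι.⟦⟧-cong a₀≈0) ι.0#-homo)) (zeroˡ _))) (+-identityˡ _))) e) i
      result (no a₀≉0) i with k.invertible (a zero) a₀≉0
      ... | b , ab≈1 = ⊥-elim (out ((λ j → k.- b k.* a (suc j)) , (begin
        x
          ≈⟨ solve 3 (λ x a b → x := (con (1 , 0) :- a :* b) :* x :+ b :* (a :* x)) refl x (ι (a zero)) (ι b) ⟩
        (1# - ι (a zero) * ι b) * x + ι b * (ι (a zero) * x)
          ≈⟨ +-congʳ (trans (*-congʳ (trans (+-congˡ (-‿cong (trans (sym (ι.*-homo _ _)) (trans (ι.⟦⟧-cong ab≈1) ι.1#-homo))))
                               (-‿inverseʳ 1#))) (zeroˡ x)) ⟩
        0# + ι b * (ι (a zero) * x)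
          ≈⟨ solve 3 (λ b y s → con (0 , 0) :+ b :* y := b :* (y :+ s) :+ (:- b) :* s) refl (ι b) _ (combination (a ∘ suc) v) ⟩
        ι b * combination a (x ∷ v) + - ι b * combination (a ∘ suc) v
          ≈⟨ +-congʳ (trans (*-congˡ e) (zeroʳ _)) ⟩
        0# + - ι b * combination (a ∘ suc) v
          ≈⟨ trans (+-identityˡ _) (*-∑ (- ι b) (λ j → ι (a (suc j)) * v j)) ⟩
        ∑ R (λ j → - ι b * (ι (a (suc j)) * v j))
          ≈⟨ ∑-cong (λ j → trans (sym (*-assoc (- ι b) (ι (a (suc j))) (v j)))
               (*-congʳ {v j} (trans (*-congʳ (sym (ι.-‿homo b))) (sym (ι.*-homo (k.- b) (a (suc j))))))) ⟩
        combination (λ j → k.- b k.* a (suc j)) v ∎)))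

    -- An independent family is enlarged until it spans. The invariant that `fuel` and the size of
    -- the family together exceed `N` makes running out of fuel contradict the bound.
    bounded⇒finite : ∀ N → (∀ {m} {v : Fin m → Carrier} → Independent v → m ℕ.≤ N) → IsFinite E
    bounded⇒finite N bound = grow (suc N) {0} {λ ()} (λ _ _ ()) (ℕ.≤-reflexive (≡.sym (ℕ.+-identityʳ (suc N))))
      where
      grow : ∀ fuel {m} {v : Fin m → Carrier} → Independent v → suc N ℕ.≤ fuel ℕ.+ m → IsFinite E
      grow zero       ind h = ⊥-elim (ℕ.<⇒≱ h (bound ind))
      grow (suc fuel) {m} {v} ind h with all-or (λ x → ∃[ a ] x ≈ combination a v)
      ... | inj₁ span      = m , record { basis = v ; coordinates = span ; independent = ind }
      ... | inj₂ (x , out) = grow fuel {v = x ∷ v} (extend-independent {v = v} {x} ind out) (≡.subst (suc N ℕ.≤_) (≡.sym (ℕ.+-suc fuel m)) h)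

module RemQuotSums {c ℓ} (R : CommutativeRing c ℓ) where
  open CommutativeRing R hiding (zero)
  open Sums R
  open BlockDeterminant R

  ∑-remQuot : ∀ m {n} (f : Fin m × Fin n → Carrier) →
              ∑ R {m ℕ.* n} (λ x → f (Fin.remQuot n x)) ≈ ∑ R (λ i → ∑ R (λ j → f (i , j)))
  ∑-remQuot m {n} f = trans (∑-combine m {n} (λ x → f (Fin.remQuot n x)))
    (∑-cong λ i → ∑-cong λ j → reflexive (≡.cong f (Fin.remQuot-combine {m} i j)))

module _ {k : Field} (K : Extension k) (F : Subextension K) where
  private
    module K = Extension K
    module F = Subextension F

  over : Extension (subfield K F)
  over = record
    { top   = K.top
    ; embed = record
      { ⟦_⟧ = proj₁
      ; isRingHomomorphism = record
        { isSemiringHomomorphism = record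
          { isNearSemiringHomomorphism = record
            { +-isMonoidHomomorphism = record
              { isMagmaHomomorphism = record
                { isRelHomomorphism = record { cong = id } ; homo = λ _ _ → K.refl }
              ; ε-homo = K.refl
              }
            ; *-homo = λ _ _ → K.refl
            }
          ; 1#-homo = K.refl
          }
        ; -‿homo = λ _ → K.refl
        }
      }
    }

module Towers (em : ExcludedMiddle (lsuc 0ℓ)) {k : Field} (K : Extension k) (F : Subextension K) where
  open LinearAlgebra em
  private
    module K = Extension K
    module k = Field k
    Fₖ = asExtension K F
    K/F = over K F
    module F = Extension Fₖ
    R = K.commutativeRing
  open K using (_≈_; _*_; ι; *-congʳ; sym; trans)
  open Sums R
  open RemQuotSums R
  open Homomorphism {R = F.commutativeRing} {R} (Extension.embed K/F)
  open RingSolver R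
  open SetoidReasoning K.setoid

  sub-combination : ∀ {n} (a : Fin n → k.Carrier) (v : Fin n → F.Carrier) →
                    proj₁ (combination Fₖ a v) ≈ combination K a (proj₁ ∘ v)
  sub-combination a v = ∑-homo (λ i → F.ι (a i) F.* v i)

  independent-sub : ∀ {n} {v : Fin n → F.Carrier} → Independent Fₖ v → Independent K (proj₁ ∘ v)
  independent-sub {v = v} ind a e = ind a (trans (sub-combination a v) e)

  independent-over : ∀ {n} {v : Fin n → K.Carrier} → Independent K/F v → Independent K v
  independent-over ind a e i = ι-injective K (ind (λ i → F.ι (a i)) e i)

  sub-finite : ∀ {n} → Basis K n → IsFinite Fₖ
  sub-finite {n} e = bounded⇒finite Fₖ n λ {_} {v} ind →
    independent≤spanning K {v = proj₁ ∘ v} (independent-sub {v = v} ind) (basis-spanning K e)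

  over-finite : ∀ {n} → Basis K n → IsFinite K/F
  over-finite {n} e = bounded⇒finite K/F n λ {_} {v} ind →
    independent≤spanning K {v = v} (independent-over {v = v} ind) (basis-spanning K e)

  module _ {m g} (f : Basis Fₖ m) (b : Basis K/F g) where
    private
      module f = Basis f
      module b = Basis b

    -- The index of the basis over `F` comes first, so that multiplication by an element of `F` is
    -- block diagonal in this basis.
    tower-vector : Fin g × Fin m → K.Carrier
    tower-vector (j , i) = b.basis j * proj₁ (f.basis i)

    tower-combination : (a : Fin g × Fin m → k.Carrier) →
      combination K {g ℕ.* m} (λ x → a (Fin.remQuot m x)) (λ x → tower-vector (Fin.remQuot m x)) ≈
      combination K/F (λ j → combination Fₖ (λ i → a (j , i)) f.basis) b.basis
    tower-combination a = begin
      combination K {g ℕ.* m} (λ x → a (Fin.remQuot m x)) (λ x → tower-vector (Fin.remQuot m x))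
        ≈⟨ ∑-remQuot g (λ x → ι (a x) * tower-vector x) ⟩
      ∑ R (λ j → ∑ R (λ i → ι (a (j , i)) * (b.basis j * proj₁ (f.basis i))))
        ≈⟨ ∑-cong (λ j → trans (∑-cong λ i → solve 3 (λ x y z → x :* (y :* z) := x :* z :* y) K.refl
                                  (ι (a (j , i))) (b.basis j) (proj₁ (f.basis i)))
             (sym (∑-* (b.basis j) (λ i → ι (a (j , i)) * proj₁ (f.basis i))))) ⟩
      ∑ R (λ j → combination K (λ i → a (j , i)) (proj₁ ∘ f.basis) * b.basis j)
        ≈⟨ ∑-cong (λ j → *-congʳ {b.basis j} (sub-combination (λ i → a (j , i)) f.basis)) ⟨
      combination K/F (λ j → combination Fₖ (λ i → a (j , i)) f.basis) b.basis ∎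

    tower : Basis K (g ℕ.* m)
    tower = record
      { basis       = λ x → tower-vector (Fin.remQuot m x)
      ; coordinates = λ x → let c , e = b.coordinates x ; d = λ j → proj₁ (f.coordinates (c j)) in
          (λ y → d (proj₁ (Fin.remQuot {g} m y)) (proj₂ (Fin.remQuot {g} m y))) ,
          trans e (trans (∑-cong λ j → *-congʳ {b.basis j} (proj₂ (f.coordinates (c j))))
                         (sym (tower-combination λ { (j , i) → d j i })))
      ; independent = λ a e x → k.trans (k.reflexive (≡.cong a (≡.sym (Fin.combine-remQuot {g} m x))))
          (f.independent (λ i → a (Fin.combine (proj₁ (Fin.remQuot {g} m x)) i))
            (b.independent (λ j → combination Fₖ (λ i → a (Fin.combine j i)) f.basis)
              (trans (sym (tower-combination λ { (j , i) → a (Fin.combine j i) }))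
                (trans (∑-cong λ y → *-congʳ (K.ι.⟦⟧-cong (k.reflexive (≡.cong a (Fin.combine-remQuot {g} m y))))) e))
              (proj₁ (Fin.remQuot {g} m x)))
            (proj₂ (Fin.remQuot {g} m x)))
      }

-- Norms and bases

module MatrixAlgebra {c ℓ} (R : CommutativeRing c ℓ) where
  open CommutativeRing R hiding (zero)
  open Sums R
  open Determinant R using (_*ᴹ_; 1ᴹ; ∑-1ᴹˡ; ∑-1ᴹʳ)
  open RingSolver R
  open SetoidReasoning setoid

  infix 4 _≋_
  _≋_ : ∀ {m n} → (Fin m → Fin n → Carrier) → (Fin m → Fin n → Carrier) → Set ℓ
  X ≋ Y = ∀ i j → X i j ≈ Y i j

  *ᴹ-cong : ∀ {l m n} {X X′ : Fin l → Fin m → Carrier} {Y Y′ : Fin m → Fin n → Carrier} →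
            X ≋ X′ → Y ≋ Y′ → X *ᴹ Y ≋ X′ *ᴹ Y′
  *ᴹ-cong p q i j = ∑-cong λ k → *-cong (p i k) (q k j)

  *ᴹ-assoc : ∀ {l m n o} (X : Fin l → Fin m → Carrier) (Y : Fin m → Fin n → Carrier) (Z : Fin n → Fin o → Carrier) →
             (X *ᴹ Y) *ᴹ Z ≋ X *ᴹ (Y *ᴹ Z)
  *ᴹ-assoc X Y Z i j = begin
    ∑ R (λ b → ∑ R (λ a → X i a * Y a b) * Z b j)
      ≈⟨ ∑-cong (λ b → ∑-* (Z b j) (λ a → X i a * Y a b)) ⟩
    ∑ R (λ b → ∑ R (λ a → X i a * Y a b * Z b j))
      ≈⟨ ∑-comm (λ b a → X i a * Y a b * Z b j) ⟩
    ∑ R (λ a → ∑ R (λ b → X i a * Y a b * Z b j))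
      ≈⟨ ∑-cong (λ a → trans (∑-cong λ b → *-assoc (X i a) (Y a b) (Z b j)) (sym (*-∑ (X i a) (λ b → Y a b * Z b j)))) ⟩
    ∑ R (λ a → X i a * ∑ R (λ b → Y a b * Z b j)) ∎

  *ᴹ-identityˡ : ∀ {m n} (X : Fin m → Fin n → Carrier) → 1ᴹ *ᴹ X ≋ X
  *ᴹ-identityˡ X i j = ∑-1ᴹˡ (λ k → X k j) i

  *ᴹ-identityʳ : ∀ {m n} (X : Fin m → Fin n → Carrier) → X *ᴹ 1ᴹ ≋ X
  *ᴹ-identityʳ X i j = ∑-1ᴹʳ (X i) j

  *ᴹ-∑ˡ : ∀ {l m n r} (X : Fin r → Fin l → Fin m → Carrier) (Y : Fin m → Fin n → Carrier) →
          (λ i j → ∑ R (λ s → X s i j)) *ᴹ Y ≋ (λ i j → ∑ R (λ s → (X s *ᴹ Y) i j))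
  *ᴹ-∑ˡ X Y i j = trans (∑-cong λ k → ∑-* (Y k j) (λ s → X s i k)) (∑-comm (λ k s → X s i k * Y k j))

  *ᴹ-∑ʳ : ∀ {l m n r} (X : Fin l → Fin m → Carrier) (Y : Fin r → Fin m → Fin n → Carrier) →
          X *ᴹ (λ i j → ∑ R (λ s → Y s i j)) ≋ (λ i j → ∑ R (λ s → (X *ᴹ Y s) i j))
  *ᴹ-∑ʳ X Y i j = trans (∑-cong λ k → *-∑ (X i k) (λ s → Y s k j)) (∑-comm (λ k s → X i k * Y s k j))

module RegularRepresentation (em : ExcludedMiddle (lsuc 0ℓ)) {k : Field} (E : Extension k) where
  open LinearAlgebra em
  open Extension E hiding (zero)
  private
    module k = Field k
    kR = k.commutativeRing
    R = commutativeRing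
  open Sums R
  open Homomorphism {R = kR} {R} embed
  open RingSolver R
  open SetoidReasoning setoid
  open Determinant kR using (1ᴹ; _*ᴹ_)
  open MatrixAlgebra kR using (_≋_)

  combination-+ : ∀ {n} (a b : Fin n → k.Carrier) (v : Fin n → Carrier) →
                  combination E (λ i → a i k.+ b i) v ≈ combination E a v + combination E b v
  combination-+ a b v = trans (∑-cong λ i → trans (*-congʳ (ι.+-homo (a i) (b i))) (distribʳ (v i) (ι (a i)) (ι (b i))))
    (∑-+ (λ i → ι (a i) * v i) (λ i → ι (b i) * v i))

  combination-difference : ∀ {n} (a : Fin n → k.Carrier) (v : Fin n → Carrier) →
                  combination E (λ i → k.- a i) v ≈ - combination E a v
  combination-difference a v = begin
    combination E (λ i → k.- a i) v
      ≈⟨ ∑-cong (λ i → trans (*-congʳ (ι.-‿homo (a i))) (solve 2 (λ a v → (:- a) :* v := (:- con (1 , 0)) :* (a :* v)) refl (ι (a i)) (v i))) ⟩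
    ∑ R (λ i → - 1# * (ι (a i) * v i))
      ≈⟨ *-∑ (- 1#) (λ i → ι (a i) * v i) ⟨
    - 1# * combination E a v
      ≈⟨ solve 1 (λ x → (:- con (1 , 0)) :* x := :- x) refl (combination E a v) ⟩
    - combination E a v ∎

  *-combination : ∀ {n} x (a : Fin n → k.Carrier) (v : Fin n → Carrier) →
                  x * combination E a v ≈ combination E a (λ i → x * v i)
  *-combination x a v = trans (*-∑ x (λ i → ι (a i) * v i))
    (∑-cong λ i → solve 3 (λ x a v → x :* (a :* v) := a :* (x :* v)) refl x (ι (a i)) (v i))

  module _ {n} (e : Basis E n) where
    open Basis e

    coordinate : Carrier → Fin n → k.Carrier
    coordinate x = proj₁ (coordinates x)

    coordinate-unique : ∀ (a b : Fin n → k.Carrier) → combination E a basis ≈ combination E b basis → ∀ i → a i k.≈ b i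
    coordinate-unique a b h i = k.trans (k.trans (k.sym (k.+-identityʳ _))
      (k.trans (k.+-congˡ (k.sym (k.-‿inverseˡ (b i)))) (k.sym (k.+-assoc _ _ _))))
      (k.trans (k.+-congʳ (independent (λ i → a i k.- b i) (begin
        combination E (λ i → a i k.- b i) basis                ≈⟨ combination-+ a (λ i → k.- b i) basis ⟩
        combination E a basis + combination E (λ i → k.- b i) basis ≈⟨ +-cong h (combination-difference b basis) ⟩
        combination E b basis - combination E b basis          ≈⟨ -‿inverseʳ _ ⟩
        0#                                                     ∎) i))
      (k.+-identityˡ _))

    coordinate-≈ : ∀ x (a : Fin n → k.Carrier) → x ≈ combination E a basis → ∀ i → coordinate x i k.≈ a i
    coordinate-≈ x a h = coordinate-unique (coordinate x) a (trans (sym (proj₂ (coordinates x))) h)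

    regular : Carrier → Matrix kR n
    regular x i j = coordinate (x * basis j) i

    regular-action : ∀ x j → x * basis j ≈ combination E (λ i → regular x i j) basis
    regular-action x j = proj₂ (coordinates (x * basis j))

    regular-unique : ∀ x (M : Matrix kR n) → (∀ j → x * basis j ≈ combination E (λ i → M i j) basis) → regular x ≋ M
    regular-unique x M h i j = coordinate-≈ (x * basis j) (λ i → M i j) (h j) i

    regular-cong : ∀ {x y} → x ≈ y → regular x ≋ regular y
    regular-cong {x} {y} x≈y = regular-unique x (regular y) λ j → trans (*-congʳ x≈y) (regular-action y j)

    regular-+ : ∀ x y → regular (x + y) ≋ (λ i j → regular x i j k.+ regular y i j)
    regular-+ x y = regular-unique (x + y) _ λ j → trans (distribʳ _ x y)
      (trans (+-cong (regular-action x j) (regular-action y j)) (sym (combination-+ (λ i → regular x i j) (λ i → regular y i j) basis)))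

    regular-0 : ∀ {x} → x ≈ 0# → ∀ i j → regular x i j k.≈ k.0#
    regular-0 {x} x≈0 = regular-unique x (λ _ _ → k.0#) λ j → trans (*-congʳ x≈0) (trans (zeroˡ _)
      (sym (∑-0 {f = λ i → ι k.0# * basis i} λ i → trans (*-congʳ ι.0#-homo) (zeroˡ _))))

    regular-∑ : ∀ {r} (x : Fin r → Carrier) → regular (∑ R x) ≋ (λ i j → ∑ kR (λ s → regular (x s) i j))
    regular-∑ {zero}  x = regular-0 refl
    regular-∑ {suc r} x i j = k.trans (regular-+ (x zero) (∑ R (x ∘ suc)) i j) (k.+-congˡ (regular-∑ (x ∘ suc) i j))

    regular-* : ∀ x y → regular (x * y) ≋ regular x *ᴹ regular y
    regular-* x y = regular-unique (x * y) _ λ j → begin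
      x * y * basis j
        ≈⟨ *-assoc _ _ _ ⟩
      x * (y * basis j)
        ≈⟨ *-congˡ (regular-action y j) ⟩
      x * combination E (λ i → regular y i j) basis
        ≈⟨ *-combination x (λ i → regular y i j) basis ⟩
      combination E (λ i → regular y i j) (λ i → x * basis i)
        ≈⟨ ∑-cong (λ l → *-congˡ {ι (regular y l j)} (regular-action x l)) ⟩
      combination E (λ l → regular y l j) (λ l → combination E (λ i → regular x i l) basis)
        ≈⟨ combination-linear E (λ l → regular y l j) (regular x) basis ⟨
      combination E (λ i → (regular x *ᴹ regular y) i j) basis ∎

    basis-self : ∀ j → basis j ≈ combination E (λ i → 1ᴹ i j) basis
    basis-self j = sym (trans (∑-cong λ i → *-congʳ (ι-1ᴹ i j)) (Determinant.∑-1ᴹˡ′ R basis j))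
      where
      ι-1ᴹ : ∀ {n} (i j : Fin n) → ι (1ᴹ i j) ≈ Determinant.1ᴹ R i j
      ι-1ᴹ zero    zero    = ι.1#-homo
      ι-1ᴹ zero    (suc j) = ι.0#-homo
      ι-1ᴹ (suc i) zero    = ι.0#-homo
      ι-1ᴹ (suc i) (suc j) = ι-1ᴹ i j

    regular-1 : ∀ {x} → x ≈ 1# → regular x ≋ 1ᴹ
    regular-1 {x} x≈1 = regular-unique x 1ᴹ λ j → trans (trans (*-congʳ x≈1) (*-identityˡ _)) (basis-self j)

    regular-scale : ∀ a x → regular (ι a * x) ≋ (λ i j → a k.* regular x i j)
    regular-scale a x = regular-unique (ι a * x) _ λ j → trans (*-assoc _ _ _) (trans (*-congˡ (regular-action x j))
      (trans (*-∑ (ι a) (λ i → ι (regular x i j) * basis i))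
        (∑-cong λ i → trans (sym (*-assoc (ι a) (ι (regular x i j)) (basis i))) (*-congʳ (sym (ι.*-homo a (regular x i j)))))))

  change : ∀ {m n} → Basis E m → Basis E n → Fin m → Fin n → k.Carrier
  change e f i j = coordinate e (Basis.basis f j) i

  change-inverse : ∀ {m n} (e : Basis E m) (f : Basis E n) → change e f *ᴹ change f e ≋ 1ᴹ
  change-inverse e f i j = coordinate-unique e _ (λ i → 1ᴹ i j) (begin
    combination E (λ i → (change e f *ᴹ change f e) i j) (Basis.basis e)
      ≈⟨ combination-linear E (λ l → change f e l j) (change e f) (Basis.basis e) ⟩
    combination E (λ l → change f e l j) (λ l → combination E (λ i → change e f i l) (Basis.basis e))
      ≈⟨ ∑-cong (λ l → *-congˡ {ι (change f e l j)} (proj₂ (Basis.coordinates e (Basis.basis f l)))) ⟨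
    combination E (λ l → change f e l j) (Basis.basis f)
      ≈⟨ proj₂ (Basis.coordinates f (Basis.basis e j)) ⟨
    Basis.basis e j
      ≈⟨ basis-self e j ⟩
    combination E (λ i → 1ᴹ i j) (Basis.basis e) ∎) i

  -- The intertwining form of similarity makes sense for bases whose sizes have not yet been
  -- identified, and does not mention the inverse of `change e f`.
  regular-change : ∀ {m n} (e : Basis E m) (f : Basis E n) x → regular e x *ᴹ change e f ≋ change e f *ᴹ regular f x
  regular-change e f x i j = coordinate-unique e _ (λ i → (change e f *ᴹ regular f x) i j) (begin
    combination E (λ i → (regular e x *ᴹ change e f) i j) e.basis
      ≈⟨ combination-linear E (λ l → change e f l j) (regular e x) e.basis ⟩
    combination E (λ l → change e f l j) (λ l → combination E (λ i → regular e x i l) e.basis)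
      ≈⟨ ∑-cong (λ l → *-congˡ {ι (change e f l j)} (regular-action e x l)) ⟨
    combination E (λ l → change e f l j) (λ l → x * e.basis l)
      ≈⟨ *-combination x (λ l → change e f l j) e.basis ⟨
    x * combination E (λ l → change e f l j) e.basis
      ≈⟨ *-congˡ (proj₂ (e.coordinates (f.basis j))) ⟨
    x * f.basis j
      ≈⟨ regular-action f x j ⟩
    combination E (λ l → regular f x l j) f.basis
      ≈⟨ ∑-cong (λ l → *-congˡ {ι (regular f x l j)} (proj₂ (e.coordinates (f.basis l)))) ⟩
    combination E (λ l → regular f x l j) (λ l → combination E (λ i → change e f i l) e.basis)
      ≈⟨ combination-linear E (λ l → regular f x l j) (change e f) e.basis ⟨
    combination E (λ i → (change e f *ᴹ regular f x) i j) e.basis ∎) i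
    where
    module e = Basis e
    module f = Basis f

  conjugate : Automorphism E → ∀ {n} → Basis E n → Basis E n
  conjugate σ e = record
    { basis       = σ.⟦_⟧ ∘ e.basis
    ; coordinates = λ x → let a , h = e.coordinates (σ.⟦ x ⟧⁻¹) in
        a , trans (sym (σ.to∘from x)) (trans (σ.⟦⟧-cong h) (apply a))
    ; independent = λ a h → e.independent a (trans (sym (σ.from∘to _))
        (trans (σ.⟦⟧⁻¹-cong (trans (apply a) h)) (RingHomomorphism.0#-homo σ.from)))
    }
    where
    module σ = Automorphism σ
    module e = Basis e
    apply : ∀ a → σ.⟦ combination E a e.basis ⟧ ≈ combination E a (σ.⟦_⟧ ∘ e.basis)
    apply a = trans (Homomorphism.∑-homo {R = R} {R} σ.to (λ i → ι (a i) * e.basis i))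
      (∑-cong λ i → trans (RingHomomorphism.*-homo σ.to (ι (a i)) (e.basis i)) (*-congʳ (σ.fixes (a i))))

  -- `σ` transports the equation defining the matrix and fixes its entries. Combined with a change
  -- of basis this realises `σ` as conjugation by a matrix, so that conjugate elements have equal
  -- norms.
  regular-conjugate : ∀ σ {n} (e : Basis E n) x → regular (conjugate σ e) (Automorphism.⟦_⟧ σ x) ≋ regular e x
  regular-conjugate σ e x = regular-unique (conjugate σ e) (σ.⟦ x ⟧) (regular e x) λ j →
    trans (sym (RingHomomorphism.*-homo σ.to x (e.basis j)))
      (trans (σ.⟦⟧-cong (regular-action e x j))
        (trans (Homomorphism.∑-homo {R = R} {R} σ.to (λ i → ι (regular e x i j) * e.basis i))
          (∑-cong λ i → trans (RingHomomorphism.*-homo σ.to (ι (regular e x i j)) (e.basis i))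
                          (*-congʳ (σ.fixes (regular e x i j))))))
    where
    module σ = Automorphism σ
    module e = Basis e

-- Elements of R ⊗ₖ E are given as formal sums ∑ₛ cₛ ⊗ xₛ with cₛ ∈ R and
-- xₛ ∈ E. Ordinary norms are the case R = k, idèlic norms the case R = 𝔸ₖ.
module FormalNorms (em : ExcludedMiddle (lsuc 0ℓ)) {k : Field} (E : Extension k) {a ℓ} (R : CommutativeRing a ℓ)
  (φ : RingHomomorphism (Field.rawRing k) (CommutativeRing.rawRing R)) where
  open LinearAlgebra em
  open RegularRepresentation em E
  open CommutativeRing R hiding (zero)
  private
    module k = Field k
    kR = k.commutativeRing
    module E = Extension E
    module φ = RingHomomorphism φ
    module Mₖ = Determinant kR
  open φ using (⟦_⟧)
  open Sums R
  open Determinant R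
  open MatrixAlgebra R
  open RingSolver R
  open Homomorphism {R = kR} {R} φ
  open SetoidReasoning setoid

  map-* : ∀ {l m n} (X : Fin l → Fin m → k.Carrier) (Y : Fin m → Fin n → k.Carrier) i j →
          ⟦ (X Mₖ.*ᴹ Y) i j ⟧ ≈ ((λ i j → ⟦ X i j ⟧) *ᴹ (λ i j → ⟦ Y i j ⟧)) i j
  map-* X Y i j = trans (∑-homo (λ l → X i l k.* Y l j)) (∑-cong λ l → φ.*-homo (X i l) (Y l j))

  map-1 : ∀ {n} (i j : Fin n) → ⟦ Mₖ.1ᴹ i j ⟧ ≈ 1ᴹ i j
  map-1 zero    zero    = φ.1#-homo
  map-1 zero    (suc j) = φ.0#-homo
  map-1 (suc i) zero    = φ.0#-homo
  map-1 (suc i) (suc j) = map-1 i j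

  matrix : ∀ {n r} → Basis E n → (Fin r → Carrier) → (Fin r → E.Carrier) → Matrix R n
  matrix e c x i j = ∑ R (λ s → c s * ⟦ regular e (x s) i j ⟧)

  norm : ∀ {n r} → Basis E n → (Fin r → Carrier) → (Fin r → E.Carrier) → Carrier
  norm e c x = det R (matrix e c x)

  changeᴿ : ∀ {m n} → Basis E m → Basis E n → Fin m → Fin n → Carrier
  changeᴿ e f i j = ⟦ change e f i j ⟧

  changeᴿ-inverse : ∀ {m n} (e : Basis E m) (f : Basis E n) → changeᴿ e f *ᴹ changeᴿ f e ≋ 1ᴹ
  changeᴿ-inverse e f i j = trans (sym (map-* (change e f) (change f e) i j))
    (trans (φ.⟦⟧-cong (change-inverse e f i j)) (map-1 i j))

  matrix-change : ∀ {m n r} (e : Basis E m) (f : Basis E n) (c : Fin r → Carrier) x →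
                  matrix e c x *ᴹ changeᴿ e f ≋ changeᴿ e f *ᴹ matrix f c x
  matrix-change e f c x i j = begin
    ∑ R (λ l → ∑ R (λ s → c s * ⟦ regular e (x s) i l ⟧) * ⟦ P l j ⟧)
      ≈⟨ *ᴹ-∑ˡ (λ s i l → c s * ⟦ regular e (x s) i l ⟧) (changeᴿ e f) i j ⟩
    ∑ R (λ s → ∑ R (λ l → c s * ⟦ regular e (x s) i l ⟧ * ⟦ P l j ⟧))
      ≈⟨ ∑-cong (λ s → trans (∑-cong λ l → *-assoc (c s) ⟦ regular e (x s) i l ⟧ ⟦ P l j ⟧) (sym (*-∑ (c s) (λ l → ⟦ regular e (x s) i l ⟧ * ⟦ P l j ⟧)))) ⟩
    ∑ R (λ s → c s * ∑ R (λ l → ⟦ regular e (x s) i l ⟧ * ⟦ P l j ⟧))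
      ≈⟨ ∑-cong (λ s → *-congˡ {c s} (trans (sym (map-* (regular e (x s)) P i j))
           (trans (φ.⟦⟧-cong (regular-change e f (x s) i j)) (map-* P (regular f (x s)) i j)))) ⟩
    ∑ R (λ s → c s * ∑ R (λ l → ⟦ P i l ⟧ * ⟦ regular f (x s) l j ⟧))
      ≈⟨ ∑-cong (λ s → trans (*-∑ (c s) (λ l → ⟦ P i l ⟧ * ⟦ regular f (x s) l j ⟧))
           (∑-cong λ l → solve 3 (λ c p q → c :* (p :* q) := p :* (c :* q)) refl (c s) ⟦ P i l ⟧ ⟦ regular f (x s) l j ⟧)) ⟩
    ∑ R (λ s → ∑ R (λ l → ⟦ P i l ⟧ * (c s * ⟦ regular f (x s) l j ⟧)))
      ≈⟨ *ᴹ-∑ʳ (changeᴿ e f) (λ s l j → c s * ⟦ regular f (x s) l j ⟧) i j ⟨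
    ∑ R (λ l → ⟦ P i l ⟧ * ∑ R (λ s → c s * ⟦ regular f (x s) l j ⟧)) ∎
    where P = change e f

  det-similar : ∀ {n} (X Y P Q : Matrix R n) → P *ᴹ Q ≋ 1ᴹ → X *ᴹ P ≋ P *ᴹ Y → det R X ≈ det R Y
  det-similar {n} X Y P Q PQ XP = begin
    det R X                       ≈⟨ *-identityʳ _ ⟨
    det R X * 1#                  ≈⟨ *-congˡ unit ⟨
    det R X * (det R P * det R Q) ≈⟨ *-assoc _ _ _ ⟨
    det R X * det R P * det R Q   ≈⟨ *-congʳ (trans (sym (det-* X P)) (trans (det-cong XP) (det-* P Y))) ⟩
    det R P * det R Y * det R Q   ≈⟨ solve 3 (λ p y q → p :* y :* q := y :* (p :* q)) refl _ _ _ ⟩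
    det R Y * (det R P * det R Q) ≈⟨ *-congˡ unit ⟩
    det R Y * 1#                  ≈⟨ *-identityʳ _ ⟩
    det R Y                       ∎
    where
    unit : det R P * det R Q ≈ 1#
    unit = trans (sym (det-* P Q)) (trans (det-cong PQ) (det-1ᴹ n))

  norm-independent : ∀ {m n r} (e : Basis E m) (f : Basis E n) (c : Fin r → Carrier) x → norm e c x ≈ norm f c x
  norm-independent e f c x with dimension-unique E e f
  ... | ≡.refl = det-similar (matrix e c x) (matrix f c x) (changeᴿ e f) (changeᴿ f e)
                   (changeᴿ-inverse e f) (matrix-change e f c x)

  matrix-cong : ∀ {n r} (e : Basis E n) {c c′ : Fin r → Carrier} {x x′ : Fin r → E.Carrier} →
                (∀ s → c s ≈ c′ s) → (∀ s → x s E.≈ x′ s) → matrix e c x ≋ matrix e c′ x′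
  matrix-cong e p q i j = ∑-cong λ s → *-cong (p s) (φ.⟦⟧-cong (regular-cong e (q s) i j))

  -- A formal norm is recorded with coefficients on a basis, whereas the arguments produce arbitrary
  -- formal sums; expanding each `x s` in the basis reconciles the two.
  matrix-collect : ∀ {n r} (e : Basis E n) (c : Fin r → Carrier) (x : Fin r → E.Carrier) →
    matrix e c x ≋ matrix e (λ i → ∑ R (λ s → c s * ⟦ coordinate e (x s) i ⟧)) (Basis.basis e)
  matrix-collect e c x i j = begin
    ∑ R (λ s → c s * ⟦ regular e (x s) i j ⟧)
      ≈⟨ ∑-cong (λ s → *-congˡ {c s} (expand s)) ⟩
    ∑ R (λ s → c s * ∑ R (λ l → ⟦ coordinate e (x s) l ⟧ * ⟦ regular e (b l) i j ⟧))
      ≈⟨ ∑-cong (λ s → trans (*-∑ (c s) (λ l → ⟦ coordinate e (x s) l ⟧ * ⟦ regular e (b l) i j ⟧))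
           (∑-cong λ l → sym (*-assoc (c s) ⟦ coordinate e (x s) l ⟧ ⟦ regular e (b l) i j ⟧))) ⟩
    ∑ R (λ s → ∑ R (λ l → c s * ⟦ coordinate e (x s) l ⟧ * ⟦ regular e (b l) i j ⟧))
      ≈⟨ ∑-comm (λ s l → c s * ⟦ coordinate e (x s) l ⟧ * ⟦ regular e (b l) i j ⟧) ⟩
    ∑ R (λ l → ∑ R (λ s → c s * ⟦ coordinate e (x s) l ⟧ * ⟦ regular e (b l) i j ⟧))
      ≈⟨ ∑-cong (λ l → ∑-* ⟦ regular e (b l) i j ⟧ (λ s → c s * ⟦ coordinate e (x s) l ⟧)) ⟨
    ∑ R (λ l → ∑ R (λ s → c s * ⟦ coordinate e (x s) l ⟧) * ⟦ regular e (b l) i j ⟧) ∎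
    where
    b = Basis.basis e
    expand : ∀ s → ⟦ regular e (x s) i j ⟧ ≈ ∑ R (λ l → ⟦ coordinate e (x s) l ⟧ * ⟦ regular e (b l) i j ⟧)
    expand s = begin
      ⟦ regular e (x s) i j ⟧
        ≈⟨ φ.⟦⟧-cong (k.trans (regular-cong e (proj₂ (Basis.coordinates e (x s))) i j)
             (regular-∑ e (λ l → E.ι (coordinate e (x s) l) E.* b l) i j)) ⟩
      ⟦ ∑ kR (λ l → regular e (E.ι (coordinate e (x s) l) E.* b l) i j) ⟧
        ≈⟨ ∑-homo (λ l → regular e (E.ι (coordinate e (x s) l) E.* b l) i j) ⟩
      ∑ R (λ l → ⟦ regular e (E.ι (coordinate e (x s) l) E.* b l) i j ⟧)
        ≈⟨ ∑-cong (λ l → trans (φ.⟦⟧-cong (regular-scale e (coordinate e (x s) l) (b l) i j)) (φ.*-homo (coordinate e (x s) l) (regular e (b l) i j))) ⟩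
      ∑ R (λ l → ⟦ coordinate e (x s) l ⟧ * ⟦ regular e (b l) i j ⟧) ∎

  record IsFormalNorm (β : Carrier) : Set (a ⊔ ℓ) where
    constructor formalNorm
    field
      {n} : ℕ
      e   : Basis E n
      c   : Fin n → Carrier
      β≈  : β ≈ norm e c (Basis.basis e)

  norm-formal : ∀ {n r β} (e : Basis E n) (c : Fin r → Carrier) (x : Fin r → E.Carrier) → β ≈ norm e c x → IsFormalNorm β
  norm-formal e c x β≈ = formalNorm e _ $ trans β≈ (det-cong (matrix-collect e c x))

  module _ {n r} (e : Basis E n) (c : Fin r → Carrier) (x : Fin r → E.Carrier) (N′ : Carrier) (unit : norm e c x * N′ ≈ 1#) where
    private
      M = matrix e c x
      u : Fin n → Carrier
      u l = ⟦ coordinate e E.1# l ⟧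

    -- Cramer's solution of the linear system saying that the product with the given element is 1;
    -- `u` holds the coordinates of 1.
    inverse : Fin n → Carrier
    inverse j = ∑ R (λ l → adjugate M j l * (N′ * u l))

    M*inverse : ∀ i → ∑ R (λ j → M i j * inverse j) ≈ u i
    M*inverse i = begin
      ∑ R (λ j → M i j * ∑ R (λ l → adjugate M j l * (N′ * u l)))
        ≈⟨ *ᴹ-assoc M (adjugate M) (λ l (_ : Fin 1) → N′ * u l) i zero ⟨
      ∑ R (λ l → (M *ᴹ adjugate M) i l * (N′ * u l))
        ≈⟨ ∑-cong (λ l → trans (*-congʳ (adjugate-inverse M i l))
             (solve 4 (λ d o n u → d :* o :* (n :* u) := o :* (d :* n :* u)) refl (det R M) (1ᴹ i l) N′ (u l))) ⟩
      ∑ R (λ l → 1ᴹ i l * (det R M * N′ * u l))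
        ≈⟨ ∑-1ᴹˡ (λ l → det R M * N′ * u l) i ⟩
      det R M * N′ * u i
        ≈⟨ trans (*-congʳ unit) (*-identityˡ _) ⟩
      u i ∎

-- An element of R ⊗ E whose norm is a unit is itself a unit, by Cramer's rule;
-- this is applied in rings T into which R ⊗ E maps.
module FormalNormValues (em : ExcludedMiddle (lsuc 0ℓ)) {k : Field} (E : Extension k) {a ℓ} (R : CommutativeRing a ℓ)
  (φ : RingHomomorphism (Field.rawRing k) (CommutativeRing.rawRing R)) {t ℓ′} (T : CommutativeRing t ℓ′)
  (ψ : RingHomomorphism (CommutativeRing.rawRing R) (CommutativeRing.rawRing T))
  (χ : RingHomomorphism (Extension.rawRing E) (CommutativeRing.rawRing T))
  (agree : ∀ x → CommutativeRing._≈_ T (RingHomomorphism.⟦_⟧ ψ (RingHomomorphism.⟦_⟧ φ x)) (RingHomomorphism.⟦_⟧ χ (Extension.ι E x))) where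
  open LinearAlgebra em
  open RegularRepresentation em E
  open FormalNorms em E R φ
  open CommutativeRing R using (Carrier; _≈_; _*_; 1#; *-comm)
  open RingHomomorphism φ using (⟦_⟧)
  private
    module k = Field k
    module E = Extension E
    module T = CommutativeRing T
    module ψ = RingHomomorphism ψ
    module χ = RingHomomorphism χ
    module Sᵀ = Sums T
    module Hχ = Homomorphism {R = E.commutativeRing} {T} χ
    module Hψ = Homomorphism {R = R} {T} ψ
    module RSᵀ = RingSolver T
  open SetoidReasoning T.setoid

  value : ∀ {r} → (Fin r → Carrier) → (Fin r → E.Carrier) → T.Carrier
  value c x = ∑ T (λ s → ψ.⟦ c s ⟧ T.* χ.⟦ x s ⟧)

  value-combination : ∀ {r} (a : Fin r → k.Carrier) x → χ.⟦ combination E a x ⟧ T.≈ value (λ s → ⟦ a s ⟧) x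
  value-combination a x = T.trans (Hχ.∑-homo (λ s → E.ι (a s) E.* x s))
    (Sᵀ.∑-cong λ s → T.trans (χ.*-homo (E.ι (a s)) (x s)) (T.*-congʳ (T.sym (agree (a s)))))

  value-linear : ∀ {m n} (u : Fin n → Carrier) (A : Fin m → Fin n → Carrier) x →
    ∑ T (λ j → ψ.⟦ u j ⟧ T.* value (λ i → A i j) x) T.≈ value (λ i → ∑ R (λ j → A i j * u j)) x
  value-linear u A x = begin
    ∑ T (λ j → ψ.⟦ u j ⟧ T.* ∑ T (λ i → ψ.⟦ A i j ⟧ T.* χ.⟦ x i ⟧))
      ≈⟨ Sᵀ.∑-cong (λ j → T.trans (Sᵀ.*-∑ ψ.⟦ u j ⟧ (λ i → ψ.⟦ A i j ⟧ T.* χ.⟦ x i ⟧))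
           (Sᵀ.∑-cong λ i → T.trans (rearrange ψ.⟦ u j ⟧ ψ.⟦ A i j ⟧ χ.⟦ x i ⟧) (T.*-congʳ (T.sym (ψ.*-homo (A i j) (u j)))))) ⟩
    ∑ T (λ j → ∑ T (λ i → ψ.⟦ A i j * u j ⟧ T.* χ.⟦ x i ⟧))
      ≈⟨ Sᵀ.∑-comm (λ j i → ψ.⟦ A i j * u j ⟧ T.* χ.⟦ x i ⟧) ⟩
    ∑ T (λ i → ∑ T (λ j → ψ.⟦ A i j * u j ⟧ T.* χ.⟦ x i ⟧))
      ≈⟨ Sᵀ.∑-cong (λ i → T.trans (T.sym (Sᵀ.∑-* χ.⟦ x i ⟧ (λ j → ψ.⟦ A i j * u j ⟧)))
           (T.*-congʳ (T.sym (Hψ.∑-homo (λ j → A i j * u j))))) ⟩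
    value (λ i → ∑ R (λ j → A i j * u j)) x ∎
    where
    rearrange : ∀ u a x → u T.* (a T.* x) T.≈ a T.* u T.* x
    rearrange = RSᵀ.solve 3 (λ u a x → u RSᵀ.:* (a RSᵀ.:* x) RSᵀ.:= a RSᵀ.:* u RSᵀ.:* x) T.refl

  value-action : ∀ {n r} (e : Basis E n) (c : Fin r → Carrier) x j →
    value c x T.* χ.⟦ Basis.basis e j ⟧ T.≈ value (λ i → matrix e c x i j) (Basis.basis e)
  value-action e c x j = begin
    value c x T.* χ.⟦ b j ⟧
      ≈⟨ Sᵀ.∑-* χ.⟦ b j ⟧ (λ s → ψ.⟦ c s ⟧ T.* χ.⟦ x s ⟧) ⟩
    ∑ T (λ s → ψ.⟦ c s ⟧ T.* χ.⟦ x s ⟧ T.* χ.⟦ b j ⟧)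
      ≈⟨ Sᵀ.∑-cong (λ s → T.trans (T.*-assoc ψ.⟦ c s ⟧ χ.⟦ x s ⟧ χ.⟦ b j ⟧) (T.*-congˡ {ψ.⟦ c s ⟧}
           (T.trans (T.sym (χ.*-homo (x s) (b j))) (T.trans (χ.⟦⟧-cong (regular-action e (x s) j))
             (value-combination (λ i → regular e (x s) i j) b))))) ⟩
    ∑ T (λ s → ψ.⟦ c s ⟧ T.* value (λ i → ⟦ regular e (x s) i j ⟧) b)
      ≈⟨ value-linear c (λ i s → ⟦ regular e (x s) i j ⟧) b ⟩
    value (λ i → ∑ R (λ s → ⟦ regular e (x s) i j ⟧ * c s)) b
      ≈⟨ Sᵀ.∑-cong (λ i → T.*-congʳ {χ.⟦ b i ⟧} (ψ.⟦⟧-cong (Sums.∑-cong R λ s → *-comm ⟦ regular e (x s) i j ⟧ (c s)))) ⟩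
    value (λ i → matrix e c x i j) b ∎
    where b = Basis.basis e

  value-inverse : ∀ {n r} (e : Basis E n) (c : Fin r → Carrier) x N′ (unit : norm e c x * N′ ≈ 1#) →
    value c x T.* value (inverse e c x N′ unit) (Basis.basis e) T.≈ T.1#
  value-inverse {n} e c x N′ unit = begin
    value c x T.* value inv b
      ≈⟨ Sᵀ.*-∑ (value c x) (λ j → ψ.⟦ inv j ⟧ T.* χ.⟦ b j ⟧) ⟩
    ∑ T (λ j → value c x T.* (ψ.⟦ inv j ⟧ T.* χ.⟦ b j ⟧))
      ≈⟨ Sᵀ.∑-cong (λ j → T.trans (rearrange (value c x) ψ.⟦ inv j ⟧ χ.⟦ b j ⟧)
           (T.*-congˡ {ψ.⟦ inv j ⟧} (value-action e c x j))) ⟩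
    ∑ T (λ j → ψ.⟦ inv j ⟧ T.* value (λ i → M i j) b)
      ≈⟨ value-linear inv M b ⟩
    value (λ i → ∑ R (λ j → M i j * inv j)) b
      ≈⟨ Sᵀ.∑-cong (λ i → T.*-congʳ {χ.⟦ b i ⟧} (ψ.⟦⟧-cong (M*inverse e c x N′ unit i))) ⟩
    value u b
      ≈⟨ value-combination (coordinate e E.1#) b ⟨
    χ.⟦ combination E (coordinate e E.1#) b ⟧
      ≈⟨ T.trans (χ.⟦⟧-cong (E.sym (proj₂ (Basis.coordinates e E.1#)))) χ.1#-homo ⟩
    T.1# ∎
    where
    b = Basis.basis e
    inv = inverse e c x N′ unit
    M = matrix e c x
    u : Fin n → Carrier
    u l = ⟦ coordinate e E.1# l ⟧
    rearrange : ∀ v d x → v T.* (d T.* x) T.≈ d T.* (v T.* x)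
    rearrange = RSᵀ.solve 3 (λ v d x → v RSᵀ.:* (d RSᵀ.:* x) RSᵀ.:= d RSᵀ.:* (v RSᵀ.:* x)) T.refl

-- Galois theory

module Dedekind (em : ExcludedMiddle (lsuc 0ℓ)) (K : Field) where
  open Classical em
  open Field K hiding (zero)
  open FieldProperties K
  private R = commutativeRing
  open Sums R
  open RingSolver R
  open RingProperties ring using (x∙y⁻¹≈ε⇒x≈y)
  open SetoidReasoning setoid

  -- Subtracting `f zero x` times the relation at `y` from the relation at `x * y` removes the first
  -- character. A later coefficient `u (suc i)` is multiplied by `f (suc i) x - f zero x`, and `x`
  -- is chosen to make this difference nonzero.
  characters-independent : ∀ h (f : Fin h → Carrier → Carrier) →
    (∀ i x y → f i (x * y) ≈ f i x * f i y) → (∀ i → f i 1# ≈ 1#) →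
    (∀ i j → i ≢ j → ∃[ x ] ¬ f i x ≈ f j x) →
    (u : Fin h → Carrier) → (∀ x → ∑ R (λ i → u i * f i x) ≈ 0#) → ∀ i → u i ≈ 0#
  characters-independent (suc h) f mult one distinct u e = λ { zero → first ; (suc i) → rest i }
    where
    shorter : ∀ x y → ∑ R (λ i → u (suc i) * (f (suc i) x - f zero x) * f (suc i) y) ≈ 0#
    shorter x y = begin
      ∑ R (λ i → u (suc i) * (f (suc i) x - f zero x) * f (suc i) y)
        ≈⟨ ∑-cong (λ i → trans (solve 4 (λ u x z y → u :* (x :- z) :* y := u :* (x :* y) :+ (:- z) :* (u :* y)) refl
                                     (u (suc i)) (f (suc i) x) (f zero x) (f (suc i) y))
                            (+-congʳ (*-congˡ {u (suc i)} (sym (mult (suc i) x y))))) ⟩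
      ∑ R (λ i → u (suc i) * f (suc i) (x * y) + - f zero x * (u (suc i) * f (suc i) y))
        ≈⟨ ∑-+ (λ i → u (suc i) * f (suc i) (x * y)) (λ i → - f zero x * (u (suc i) * f (suc i) y)) ⟩
      S (x * y) + ∑ R (λ i → - f zero x * (u (suc i) * f (suc i) y))
        ≈⟨ +-congˡ (sym (*-∑ (- f zero x) (λ i → u (suc i) * f (suc i) y))) ⟩
      S (x * y) + - f zero x * S y
        ≈⟨ solve 5 (λ s z t u y → s :+ (:- z) :* t := (u :* (z :* y) :+ s) :+ (:- z) :* (u :* y :+ t)) refl
             (S (x * y)) (f zero x) (S y) (u zero) (f zero y) ⟩
      (u zero * (f zero x * f zero y) + S (x * y)) + - f zero x * (u zero * f zero y + S y)
        ≈⟨ +-cong (trans (+-congʳ (*-congˡ (sym (mult zero x y)))) (e (x * y))) (trans (*-congˡ (e y)) (zeroʳ _)) ⟩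
      0# + 0#
        ≈⟨ +-identityˡ 0# ⟩
      0# ∎
      where
      S : Carrier → Carrier
      S y = ∑ R (λ i → u (suc i) * f (suc i) y)

    rest : ∀ i → u (suc i) ≈ 0#
    rest i with distinct (suc i) zero (λ ())
    ... | x , ne = *-cancel-0 (λ d → ne (x∙y⁻¹≈ε⇒x≈y _ _ d)) (trans (*-comm _ _)
      (characters-independent h (f ∘ suc) (mult ∘ suc) (one ∘ suc) (λ i j i≢j → distinct (suc i) (suc j) λ { ≡.refl → i≢j ≡.refl })
        (λ i → u (suc i) * (f (suc i) x - f zero x)) (shorter x) i))

    first : u zero ≈ 0#
    first = begin
      u zero                                        ≈⟨ *-identityʳ _ ⟨
      u zero * 1#                                   ≈⟨ *-congˡ (one zero) ⟨
      u zero * f zero 1#                            ≈⟨ +-identityʳ _ ⟨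
      u zero * f zero 1# + 0#                       ≈⟨ +-congˡ (∑-0 {f = λ i → u (suc i) * f (suc i) 1#} λ i → trans (*-congʳ (rest i)) (zeroˡ _)) ⟨
      ∑ R (λ i → u i * f i 1#)                      ≈⟨ e 1# ⟩
      0#                                            ∎

-- Closure under composition is recorded through left translations as permutations of the indices,
-- the form needed for reindexing sums and products over the group.
record FiniteGroup {k : Field} (E : Extension k) (h : ℕ) : Set where
  open Extension E using (Carrier; _≈_)
  field
    σ           : Fin h → Automorphism E
    distinct    : ∀ i j → (∀ x → Automorphism.⟦_⟧ (σ i) x ≈ Automorphism.⟦_⟧ (σ j) x) → i ≡ j
    unit        : Fin h
    unit-id     : ∀ x → Automorphism.⟦_⟧ (σ unit) x ≈ x
    translate   : Fin h → Permutation′ h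
    translate-σ : ∀ l i x → Automorphism.⟦_⟧ (σ l) (Automorphism.⟦_⟧ (σ i) x) ≈
                  Automorphism.⟦_⟧ (σ (translate l ⟨$⟩ʳ i)) x

  act : Fin h → Carrier → Carrier
  act i = Automorphism.⟦_⟧ (σ i)

  module act i = Automorphism (σ i)

finiteGroup : ∀ {k} {E : Extension k} {p h} (H : Subgroup (Gal E) p) → HasOrder (subgroup H) h → FiniteGroup E h
finiteGroup {E = E} {h = h} H order = record
  { σ           = λ i → proj₁ (to i)
  ; distinct    = λ i j e → ≡.trans (≡.sym (strictlyInverseʳ i)) (≡.trans (from-cong e) (strictlyInverseʳ j))
  ; unit        = from H.ε
  ; unit-id     = strictlyInverseˡ H.ε
  ; translate   = λ l → permutation (λ i → from (to l H.∙ to i)) (λ i → from (to l H.⁻¹ H.∙ to i))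
      (λ i → ≡.trans (from-cong λ x → E.trans (Automorphism.⟦⟧-cong (proj₁ (to l)) (strictlyInverseˡ (to l H.⁻¹ H.∙ to i) x))
                                        (Automorphism.to∘from (proj₁ (to l)) _)) (strictlyInverseʳ i))
      (λ i → ≡.trans (from-cong λ x → E.trans (Automorphism.⟦⟧⁻¹-cong (proj₁ (to l)) (strictlyInverseˡ (to l H.∙ to i) x))
                                        (Automorphism.from∘to (proj₁ (to l)) _)) (strictlyInverseʳ i))
  ; translate-σ = λ l i x → E.sym (strictlyInverseˡ (to l H.∙ to i) x)
  }
  where
  open Inverse order
  module H = Group (subgroup H)
  module E = Extension E

module Automorphisms (em : ExcludedMiddle (lsuc 0ℓ)) {k : Field} (E : Extension k) {h : ℕ} (σ : Fin h → Automorphism E)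
  (distinct : ∀ i j → (∀ x → Extension._≈_ E (Automorphism.⟦_⟧ (σ i) x) (Automorphism.⟦_⟧ (σ j) x)) → i ≡ j) where
  open Classical em
  open LinearAlgebra em
  open Extension E hiding (zero)
  private
    module k = Field k
    R = commutativeRing
  open Sums R
  open RingSolver R
  open SetoidReasoning setoid

  private
    act : Fin h → Carrier → Carrier
    act i = Automorphism.⟦_⟧ (σ i)

    module act i = Automorphism (σ i)

  act-independent : (u : Fin h → Carrier) → (∀ x → ∑ R (λ i → u i * act i x) ≈ 0#) → ∀ i → u i ≈ 0#
  act-independent = Dedekind.characters-independent em top h act
    (λ i → RingHomomorphism.*-homo (act.to i)) (λ i → RingHomomorphism.1#-homo (act.to i)) separated
    where
    separated : ∀ i j → i ≢ j → ∃[ x ] ¬ act i x ≈ act j x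
    separated i j i≢j with all-or (λ x → act i x ≈ act j x)
    ... | inj₁ e = ⊥-elim (i≢j (distinct i j e))
    ... | inj₂ w = w

  act-∑ : ∀ l {n} (f : Fin n → Carrier) → act l (∑ R f) ≈ ∑ R (λ i → act l (f i))
  act-∑ l = Homomorphism.∑-homo {R = R} {R} (act.to l)

  act-combination : ∀ (u : Fin h → Carrier) {n} (a : Fin n → k.Carrier) (v : Fin n → Carrier) →
    ∑ R (λ i → u i * act i (combination E a v)) ≈ combination E a (λ j → ∑ R (λ i → act i (v j) * u i))
  act-combination u a v = begin
    ∑ R (λ i → u i * act i (combination E a v))
      ≈⟨ ∑-cong (λ i → *-congˡ {u i} (trans (act-∑ i (λ j → ι (a j) * v j))
           (∑-cong λ j → trans (RingHomomorphism.*-homo (act.to i) (ι (a j)) (v j)) (*-congʳ (act.fixes i (a j)))))) ⟩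
    ∑ R (λ i → u i * ∑ R (λ j → ι (a j) * act i (v j)))
      ≈⟨ ∑-cong (λ i → *-∑ (u i) (λ j → ι (a j) * act i (v j))) ⟩
    ∑ R (λ i → ∑ R (λ j → u i * (ι (a j) * act i (v j))))
      ≈⟨ ∑-comm (λ i j → u i * (ι (a j) * act i (v j))) ⟩
    ∑ R (λ j → ∑ R (λ i → u i * (ι (a j) * act i (v j))))
      ≈⟨ ∑-cong (λ j → trans (∑-cong λ i → solve 3 (λ u a x → u :* (a :* x) := a :* (x :* u)) refl (u i) (ι (a j)) (act i (v j)))
           (sym (*-∑ (ι (a j)) (λ i → act i (v j) * u i)))) ⟩
    combination E a (λ j → ∑ R (λ i → act i (v j) * u i)) ∎

  -- With fewer basis vectors than automorphisms, some nontrivial combination of the automorphisms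
  -- kills every basis vector and hence, by linearity over `k`, every element. This contradicts
  -- their independence.
  order≤degree : ∀ {n} → Basis E n → h ℕ.≤ n
  order≤degree {n} e with h ℕ.≤? n
  ... | yes h≤n = h≤n
  ... | no h≰n with nontrivial-solution top n h (ℕ.≰⇒> h≰n) (λ j i → act i (Basis.basis e j))
  ...   | u , (i₀ , nz) , solves = ⊥-elim (nz (act-independent u vanishing i₀))
    where
    module e = Basis e
    vanishing : ∀ x → ∑ R (λ i → u i * act i x) ≈ 0#
    vanishing x = trans (∑-cong λ i → *-congˡ {u i} (act.⟦⟧-cong i (proj₂ (e.coordinates x))))
      (trans (act-combination u (proj₁ (e.coordinates x)) e.basis)
        (∑-0 {f = λ j → ι (proj₁ (e.coordinates x) j) * ∑ R (λ i → act i (e.basis j) * u i)} λ j → trans (*-congˡ (solves j)) (zeroʳ _)))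

module Artin (em : ExcludedMiddle (lsuc 0ℓ)) {k : Field} (E : Extension k) {h : ℕ} (G : FiniteGroup E h)
  (fixed : ∀ x → (∀ i → Extension._≈_ E (FiniteGroup.act G i x) x) → ∃[ a ] Extension._≈_ E (Extension.ι E a) x) where
  open Classical em
  open LinearAlgebra em
  open FiniteGroup G
  open Extension E hiding (zero)
  private
    module k = Field k
    R = commutativeRing
    module Sum = MonoidSum +-commutativeMonoid
  open FieldProperties top
  open Sums R
  open RingSolver R
  open SetoidReasoning setoid

  open Automorphisms em E σ distinct public using (act-independent; act-∑; order≤degree)

  trace : Carrier → Carrier
  trace x = ∑ R (λ i → act i x)

  trace-fixed : ∀ x l → act l (trace x) ≈ trace x
  trace-fixed x l = begin
    act l (trace x)                            ≈⟨ act-∑ l (λ i → act i x) ⟩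
    ∑ R (λ i → act l (act i x))                ≈⟨ ∑-cong (λ i → translate-σ l i x) ⟩
    ∑ R (λ i → act (translate l ⟨$⟩ʳ i) x)     ≈⟨ Sum.sum-permute (λ i → act i x) (translate l) ⟨
    trace x                                    ∎

  ι-trace : ∀ x → ∃[ a ] ι a ≈ trace x
  ι-trace x = fixed (trace x) (trace-fixed x)

  trace-scale : ∀ a x → trace (ι a * x) ≈ ι a * trace x
  trace-scale a x = trans (∑-cong λ i → trans (RingHomomorphism.*-homo (act.to i) (ι a) x) (*-congʳ (act.fixes i a)))
    (sym (*-∑ (ι a) (λ i → act i x)))

  -- The trace is the combination of the automorphisms with all coefficients 1, so it does not
  -- vanish identically; its values lie in `k`, and a nonzero one can be scaled to 1.
  trace-one : ∃[ θ ] trace θ ≈ 1#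
  trace-one with all-or (λ x → trace x ≈ 0#)
  ... | inj₁ vanishing = ⊥-elim (0≉1 (sym (act-independent (const 1#)
          (λ x → trans (∑-cong λ i → *-identityˡ (act i x)) (vanishing x)) unit)))
  ... | inj₂ (x , nz) with ι-trace x
  ...   | a , ιa≈ with k.invertible a (λ a≈0 → nz (trans (sym ιa≈) (trans (ι.⟦⟧-cong a≈0) ι.0#-homo)))
  ...     | b , ab≈1 = ι b * x , (begin
    trace (ι b * x)  ≈⟨ trace-scale b x ⟩
    ι b * trace x    ≈⟨ *-congˡ ιa≈ ⟨
    ι b * ι a        ≈⟨ ι.*-homo b a ⟨
    ι (b k.* a)      ≈⟨ ι.⟦⟧-cong (k.trans (k.*-comm b a) ab≈1) ⟩
    ι k.1#           ≈⟨ ι.1#-homo ⟩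
    1#               ∎)

  -- Artin's argument. With more basis vectors than group elements, some nonzero `u` is orthogonal
  -- to all conjugates of the basis. Applying the group to these equations and summing replaces the
  -- coefficients by traces, which lie in `k`, and so relates the basis vectors. The factor `λ′`
  -- makes `λ′ * u j₀` equal to `θ`, of trace 1, so the relation is nontrivial.
  degree≤order : ∀ {n} → Basis E n → n ℕ.≤ h
  degree≤order {n} e with n ℕ.≤? h
  ... | yes n≤h = n≤h
  ... | no n≰h with nontrivial-solution top h n (ℕ.≰⇒> n≰h) (λ i j → act i (Basis.basis e j)) | trace-one
  ...   | u , (j₀ , nz) , solves | θ , Trθ≈1 with invertible (u j₀) nz
  ...     | v , uv≈1 = ⊥-elim (0≉1 (begin
    0#                       ≈⟨ ι.0#-homo ⟨
    ι k.0#                   ≈⟨ ι.⟦⟧-cong (e.independent a relation j₀) ⟨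
    ι (a j₀)                 ≈⟨ proj₂ (ι-trace (λ′ * u j₀)) ⟩
    trace (λ′ * u j₀)        ≈⟨ ∑-cong (λ i → act.⟦⟧-cong i (solve 3 (λ θ v u → θ :* v :* u := u :* v :* θ) refl θ v (u j₀))) ⟩
    trace (u j₀ * v * θ)     ≈⟨ ∑-cong (λ i → act.⟦⟧-cong i (trans (*-congʳ uv≈1) (*-identityˡ θ))) ⟩
    trace θ                  ≈⟨ Trθ≈1 ⟩
    1#                       ∎))
    where
    module e = Basis e
    λ′ = θ * v
    a : Fin n → k.Carrier
    a j = proj₁ (ι-trace (λ′ * u j))
    inv : Fin h → Fin h
    inv l = translate l ⟨$⟩ˡ unit
    inv-id : ∀ l x → act l (act (inv l) x) ≈ x
    inv-id l x = trans (translate-σ l (inv l) x)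
      (trans (reflexive (≡.cong (λ i → act i x) (Fin.inverseʳ (translate l)))) (unit-id x))
    relation : combination E a e.basis ≈ 0#
    relation = begin
      ∑ R (λ j → ι (a j) * e.basis j)
        ≈⟨ ∑-cong (λ j → trans (*-congʳ {e.basis j} (proj₂ (ι-trace (λ′ * u j)))) (∑-* (e.basis j) (λ l → act l (λ′ * u j)))) ⟩
      ∑ R (λ j → ∑ R (λ l → act l (λ′ * u j) * e.basis j))
        ≈⟨ ∑-comm (λ j l → act l (λ′ * u j) * e.basis j) ⟩
      ∑ R (λ l → ∑ R (λ j → act l (λ′ * u j) * e.basis j))
        ≈⟨ ∑-0 {f = λ l → ∑ R (λ j → act l (λ′ * u j) * e.basis j)} row ⟩
      0# ∎
      where
      row : ∀ l → ∑ R (λ j → act l (λ′ * u j) * e.basis j) ≈ 0#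
      row l = begin
        ∑ R (λ j → act l (λ′ * u j) * e.basis j)
          ≈⟨ ∑-cong (λ j → trans (*-congˡ (sym (inv-id l (e.basis j)))) (sym (RingHomomorphism.*-homo (act.to l) (λ′ * u j) (act (inv l) (e.basis j))))) ⟩
        ∑ R (λ j → act l (λ′ * u j * act (inv l) (e.basis j)))
          ≈⟨ act-∑ l (λ j → λ′ * u j * act (inv l) (e.basis j)) ⟨
        act l (∑ R (λ j → λ′ * u j * act (inv l) (e.basis j)))
          ≈⟨ act.⟦⟧-cong l (trans (∑-cong λ j → solve 3 (λ p u x → p :* u :* x := p :* (x :* u)) refl λ′ (u j) (act (inv l) (e.basis j)))
               (sym (*-∑ λ′ (λ j → act (inv l) (e.basis j) * u j)))) ⟩
        act l (λ′ * ∑ R (λ j → act (inv l) (e.basis j) * u j))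
          ≈⟨ act.⟦⟧-cong l (trans (*-congˡ (solves (inv l))) (zeroʳ λ′)) ⟩
        act l 0#
          ≈⟨ RingHomomorphism.0#-homo (act.to l) ⟩
        0# ∎

  degree≡order : ∀ {n} → Basis E n → n ≡ h
  degree≡order e = ℕ.≤-antisym (degree≤order e) (order≤degree e)

module FixedField (em : ExcludedMiddle (lsuc 0ℓ)) {k : Field} (K : Extension k) (H : Subgroup (Gal K) 0ℓ)
  {h : ℕ} (order : HasOrder (subgroup H) h) where
  private
    F = fixedField K H
    module K = Extension K
    module H = Subgroup H
    module Order = Inverse order

  group : FiniteGroup K h
  group = finiteGroup H order

  open FiniteGroup group

  fixed⇒∈ : ∀ x → (∀ i → act i x K.≈ x) → Subextension._∈F F x
  fixed⇒∈ x e τ τ∈H = K.trans (K.sym (Order.strictlyInverseˡ (τ , τ∈H) x)) (e (Order.from (τ , τ∈H)))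

  group/F : FiniteGroup (over K F) h
  group/F = record
    { σ           = λ i → record
      { to = act.to i ; from = act.from i ; from∘to = act.from∘to i ; to∘from = act.to∘from i
      ; fixes = λ { (x , x∈F) → x∈F (σ i) (proj₂ (Order.to i)) } }
    ; distinct    = distinct
    ; unit        = unit
    ; unit-id     = unit-id
    ; translate   = translate
    ; translate-σ = translate-σ
    }

  open Artin em (over K F) group/F (λ x e → (x , fixed⇒∈ x e) , K.refl) public
    using (trace; trace-fixed; trace-one; degree≡order)

-- Norms from a field and from the fixed field of a finite group

module NormTransfer (em : ExcludedMiddle (lsuc 0ℓ)) {k : Field} (K : Extension k) (H : Subgroup (Gal K) 0ℓ)
  {h : ℕ} (order : HasOrder (subgroup H) h) {n} (e : Basis K n)
  {a ℓ} (R : CommutativeRing a ℓ) (φ : RingHomomorphism (Field.rawRing k) (CommutativeRing.rawRing R)) where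
  open LinearAlgebra em
  open FixedField em K H order
  open FiniteGroup group
  private
    F = fixedField K H
    Fₖ = asExtension K F
    K/F = over K F
    module k = Field k
    module K = Extension K
    module F = Extension Fₖ
    module NK = FormalNorms em K R φ
    module NF = FormalNorms em Fₖ R φ
    module RK = RegularRepresentation em K
    module RF = RegularRepresentation em Fₖ
    module SK = Sums K.commutativeRing
    module DK = Determinant K.commutativeRing
    module Dk = Determinant k.commutativeRing
    module φ = RingHomomorphism φ
  open φ using (⟦_⟧)
  open CommutativeRing R hiding (zero)
  open Sums R
  open Determinant R
  open BlockDeterminant R using (det-copies)
  open MatrixAlgebra R
  open RemQuotSums R
  open RingSolver R
  open Homomorphism {R = k.commutativeRing} {R} φ
  open Exp semiring using (_^_; ^-congˡ)
  open SetoidReasoning setoid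
  open Towers em K F using (tower; tower-vector; tower-combination; sub-combination; over-finite; sub-finite)

  module _ {m g} (f : Basis Fₖ m) (b : Basis K/F g) where
    private
      module f = Basis f
      module b = Basis b
      t = tower f b

    -- `K` is the direct sum of the lines over `F` through the basis vectors of `b`, and `x` acts on
    -- each of them as on `F`: the matrix is a Kronecker product with an identity matrix.
    regular-tower : ∀ (x : F.Carrier) p q → RK.regular t (proj₁ x) p q k.≈
      (Dk.1ᴹ (proj₁ (Fin.remQuot {g} m p)) (proj₁ (Fin.remQuot {g} m q)) k.*
       RF.regular f x (proj₂ (Fin.remQuot {g} m p)) (proj₂ (Fin.remQuot {g} m q)))
    regular-tower x = RK.regular-unique t (proj₁ x) _ λ q → action (Fin.remQuot {g} m q)
      where
      ι-1ᴹ : ∀ {n} (i j : Fin n) → K.ι (Dk.1ᴹ i j) K.≈ DK.1ᴹ i j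
      ι-1ᴹ zero    zero    = K.ι.1#-homo
      ι-1ᴹ zero    (suc j) = K.ι.0#-homo
      ι-1ᴹ (suc i) zero    = K.ι.0#-homo
      ι-1ᴹ (suc i) (suc j) = ι-1ᴹ i j
      action : ∀ ((j′ , i′) : Fin g × Fin m) → proj₁ x K.* tower-vector f b (j′ , i′) K.≈
        combination K {g ℕ.* m} (λ p → Dk.1ᴹ (proj₁ (Fin.remQuot {g} m p)) j′ k.* RF.regular f x (proj₂ (Fin.remQuot {g} m p)) i′)
          (Basis.basis t)
      action (j′ , i′) = K.trans left (K.sym (K.trans
        (tower-combination f b (λ { (j , i) → Dk.1ᴹ j j′ k.* RF.regular f x i i′ })) right))
        where
        c = combination Fₖ (λ i → RF.regular f x i i′) f.basis
        left : proj₁ x K.* (b.basis j′ K.* proj₁ (f.basis i′)) K.≈ proj₁ c K.* b.basis j′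
        left = K.trans (K.sym (K.*-assoc _ _ _)) (K.trans (K.*-congʳ (K.*-comm _ _)) (K.trans (K.*-assoc _ _ _)
          (K.trans (K.*-congˡ (RF.regular-action f x i′)) (K.*-comm _ _))))
        inner : ∀ j → proj₁ (combination Fₖ (λ i → Dk.1ᴹ j j′ k.* RF.regular f x i i′) f.basis) K.≈ DK.1ᴹ j j′ K.* proj₁ c
        inner j = K.trans (sub-combination (λ i → Dk.1ᴹ j j′ k.* RF.regular f x i i′) f.basis)
          (K.trans (SK.∑-cong λ i → K.trans (K.*-congʳ {proj₁ (f.basis i)} (K.trans (K.ι.*-homo (Dk.1ᴹ j j′) (RF.regular f x i i′))
                       (K.*-congʳ {K.ι (RF.regular f x i i′)} (ι-1ᴹ j j′)))) (K.*-assoc (DK.1ᴹ j j′) (K.ι (RF.regular f x i i′)) (proj₁ (f.basis i))))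
          (K.trans (K.sym (SK.*-∑ (DK.1ᴹ j j′) (λ i → K.ι (RF.regular f x i i′) K.* proj₁ (f.basis i))))
            (K.*-congˡ (K.sym (sub-combination (λ i → RF.regular f x i i′) f.basis)))))
        right : combination K/F (λ j → combination Fₖ (λ i → Dk.1ᴹ j j′ k.* RF.regular f x i i′) f.basis) b.basis K.≈
                proj₁ c K.* b.basis j′
        right = K.trans (SK.∑-cong λ j → K.trans (K.*-congʳ {b.basis j} (K.trans (inner j) (K.*-comm (DK.1ᴹ j j′) (proj₁ c)))) (K.*-assoc (proj₁ c) (DK.1ᴹ j j′) (b.basis j)))
          (K.trans (K.sym (SK.*-∑ (proj₁ c) (λ j → DK.1ᴹ j j′ K.* b.basis j))) (K.*-congˡ (DK.∑-1ᴹˡ′ b.basis j′)))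

    norm-tower : ∀ {r} (c : Fin r → Carrier) (x : Fin r → F.Carrier) → NK.norm t c (proj₁ ∘ x) ≈ NF.norm f c x ^ g
    norm-tower c x = det-copies g (NK.matrix t c (proj₁ ∘ x)) (NF.matrix f c x)
      (λ j i i′ → ∑-cong λ s → *-congˡ {c s} (φ.⟦⟧-cong (k.trans (entry s j j i i′) (k.trans (k.*-congʳ (Dk.1ᴹ-diagonal j)) (k.*-identityˡ _)))))
      (λ j j′ i i′ ne → ∑-0 {f = λ s → c s * ⟦ RK.regular t (proj₁ (x s)) (Fin.combine {g} j i) (Fin.combine j′ i′) ⟧} λ s → trans (*-congˡ {c s}
        (trans (φ.⟦⟧-cong (k.trans (entry s j j′ i i′) (k.trans (k.*-congʳ (Dk.1ᴹ-off ne)) (k.zeroˡ _)))) φ.0#-homo)) (zeroʳ (c s)))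
      where
      entry : ∀ s j j′ i i′ → RK.regular t (proj₁ (x s)) (Fin.combine {g} j i) (Fin.combine j′ i′) k.≈
              (Dk.1ᴹ j j′ k.* RF.regular f (x s) i i′)
      entry s j j′ i i′ = k.trans (regular-tower (x s) (Fin.combine {g} j i) (Fin.combine j′ i′))
        (k.reflexive (≡.cong₂ (λ p q → Dk.1ᴹ (proj₁ p) (proj₁ q) k.* RF.regular f (x s) (proj₂ p) (proj₂ q))
          (Fin.remQuot-combine {g} j i) (Fin.remQuot-combine {g} j′ i′)))

  K/F-basis : Basis K/F h
  K/F-basis = ≡.subst (Basis K/F) (degree≡order (proj₂ (over-finite e))) (proj₂ (over-finite e))

  norm-up : ∀ {m r} (f : Basis Fₖ m) (c : Fin r → Carrier) (x : Fin r → F.Carrier) → NK.norm e c (proj₁ ∘ x) ≈ NF.norm f c x ^ h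
  norm-up f c x = trans (NK.norm-independent e (tower f K/F-basis) c (proj₁ ∘ x)) (norm-tower f K/F-basis c x)

  formalNorm-up : ∀ {β} → NF.IsFormalNorm β → NK.IsFormalNorm (β ^ h)
  formalNorm-up (NF.formalNorm f c β≈) = NK.norm-formal e c (proj₁ ∘ Basis.basis f)
    (trans (^-congˡ h β≈) (sym (norm-up f c (Basis.basis f))))

  private
    -- The image of R ⊗ K in the matrix ring. Its elements commute, which is what allows a product
    -- over the group to be reindexed by a translation.
    InSpan : Matrix R n → Set (a ⊔ ℓ)
    InSpan X = Σ[ r ∈ ℕ ] Σ[ c ∈ (Fin r → Carrier) ] Σ[ x ∈ (Fin r → K.Carrier) ] X ≋ NK.matrix e c x

    ≋-sym : ∀ {X Y : Matrix R n} → X ≋ Y → Y ≋ X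
    ≋-sym p i j = sym (p i j)

    ≋-trans : ∀ {X Y Z : Matrix R n} → X ≋ Y → Y ≋ Z → X ≋ Z
    ≋-trans p q i j = trans (p i j) (q i j)

    ≋-refl : ∀ {X : Matrix R n} → X ≋ X
    ≋-refl i j = refl

    matrix-product : ∀ {r r′} (c : Fin r → Carrier) x (c′ : Fin r′ → Carrier) x′ → NK.matrix e c x *ᴹ NK.matrix e c′ x′ ≋
      (λ i j → ∑ R (λ s → ∑ R (λ t → c s * c′ t * ⟦ RK.regular e (x s K.* x′ t) i j ⟧)))
    matrix-product c x c′ x′ i j = begin
      (NK.matrix e c x *ᴹ NK.matrix e c′ x′) i j
        ≈⟨ *ᴹ-∑ˡ (λ s i l → c s * ⟦ RK.regular e (x s) i l ⟧) (NK.matrix e c′ x′) i j ⟩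
      ∑ R (λ s → ∑ R (λ l → c s * ⟦ RK.regular e (x s) i l ⟧ * NK.matrix e c′ x′ l j))
        ≈⟨ ∑-cong (λ s → *ᴹ-∑ʳ (λ i l → c s * ⟦ RK.regular e (x s) i l ⟧) (λ t l j → c′ t * ⟦ RK.regular e (x′ t) l j ⟧) i j) ⟩
      ∑ R (λ s → ∑ R (λ t → ∑ R (λ l → c s * ⟦ RK.regular e (x s) i l ⟧ * (c′ t * ⟦ RK.regular e (x′ t) l j ⟧))))
        ≈⟨ ∑-cong (λ s → ∑-cong λ t → entry s t) ⟩
      ∑ R (λ s → ∑ R (λ t → c s * c′ t * ⟦ RK.regular e (x s K.* x′ t) i j ⟧)) ∎
      where
      entry : ∀ s t → ∑ R (λ l → c s * ⟦ RK.regular e (x s) i l ⟧ * (c′ t * ⟦ RK.regular e (x′ t) l j ⟧)) ≈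
              c s * c′ t * ⟦ RK.regular e (x s K.* x′ t) i j ⟧
      entry s t = trans
        (∑-cong λ l → solve 4 (λ c x d y → c :* x :* (d :* y) := c :* d :* (x :* y)) refl (c s) ⟦ RK.regular e (x s) i l ⟧ (c′ t) ⟦ RK.regular e (x′ t) l j ⟧)
        (trans (sym (*-∑ (c s * c′ t) (λ l → ⟦ RK.regular e (x s) i l ⟧ * ⟦ RK.regular e (x′ t) l j ⟧)))
          (*-congˡ (trans (sym (NK.map-* (RK.regular e (x s)) (RK.regular e (x′ t)) i j)) (φ.⟦⟧-cong (k.sym (RK.regular-* e (x s) (x′ t) i j))))))

    span-* : ∀ {X Y} → InSpan X → InSpan Y → InSpan (X *ᴹ Y)
    span-* (r , c , x , p) (r′ , c′ , x′ , q) = r ℕ.* r′ ,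
      (λ y → c (proj₁ (Fin.remQuot {r} r′ y)) * c′ (proj₂ (Fin.remQuot {r} r′ y))) ,
      (λ y → x (proj₁ (Fin.remQuot {r} r′ y)) K.* x′ (proj₂ (Fin.remQuot {r} r′ y))) ,
      ≋-trans (*ᴹ-cong p q) (≋-trans (matrix-product c x c′ x′)
        (λ i j → sym (∑-remQuot r (λ { (s , t) → c s * c′ t * ⟦ RK.regular e (x s K.* x′ t) i j ⟧ }))))

    span-comm : ∀ {X Y} → InSpan X → InSpan Y → X *ᴹ Y ≋ Y *ᴹ X
    span-comm {X} {Y} (r , c , x , p) (r′ , c′ , x′ , q) i j = begin
      (X *ᴹ Y) i j
        ≈⟨ *ᴹ-cong p q i j ⟩
      (NK.matrix e c x *ᴹ NK.matrix e c′ x′) i j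
        ≈⟨ matrix-product c x c′ x′ i j ⟩
      ∑ R (λ s → ∑ R (λ t → c s * c′ t * ⟦ RK.regular e (x s K.* x′ t) i j ⟧))
        ≈⟨ ∑-comm (λ s t → c s * c′ t * ⟦ RK.regular e (x s K.* x′ t) i j ⟧) ⟩
      ∑ R (λ t → ∑ R (λ s → c s * c′ t * ⟦ RK.regular e (x s K.* x′ t) i j ⟧))
        ≈⟨ ∑-cong (λ t → ∑-cong λ s → *-cong (*-comm (c s) (c′ t)) (φ.⟦⟧-cong (RK.regular-cong e (K.*-comm (x s) (x′ t)) i j))) ⟩
      ∑ R (λ t → ∑ R (λ s → c′ t * c s * ⟦ RK.regular e (x′ t K.* x s) i j ⟧))
        ≈⟨ matrix-product c′ x′ c x i j ⟨
      (NK.matrix e c′ x′ *ᴹ NK.matrix e c x) i j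
        ≈⟨ *ᴹ-cong q p i j ⟨
      (Y *ᴹ X) i j ∎

    span-1 : InSpan 1ᴹ
    span-1 = 1 , const 1# , const K.1# , λ i j → sym (trans (+-identityʳ _) (trans (*-identityˡ _)
      (trans (φ.⟦⟧-cong (RK.regular-1 e K.refl i j)) (NK.map-1 i j))))

    span : CommutativeMonoid (a ⊔ ℓ) ℓ
    span = record
      { Carrier = Σ (Matrix R n) InSpan
      ; _≈_     = λ X Y → proj₁ X ≋ proj₁ Y
      ; _∙_     = λ X Y → proj₁ X *ᴹ proj₁ Y , span-* (proj₂ X) (proj₂ Y)
      ; ε       = 1ᴹ , span-1
      ; isCommutativeMonoid = record
        { isMonoid = record
          { isSemigroup = record
            { isMagma = record
              { isEquivalence = record { refl = λ i j → refl ; sym = ≋-sym ; trans = ≋-trans }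
              ; ∙-cong        = *ᴹ-cong
              }
            ; assoc = λ X Y Z → *ᴹ-assoc (proj₁ X) (proj₁ Y) (proj₁ Z)
            }
          ; identity = (λ X → *ᴹ-identityˡ (proj₁ X)) , (λ X → *ᴹ-identityʳ (proj₁ X))
          }
        ; comm = λ X Y → span-comm (proj₂ X) (proj₂ Y)
        }
      }
    module Span = CommutativeMonoid span
    module SpanSum = MonoidSum span

    det-product : ∀ {r} (X : Fin r → Span.Carrier) d → (∀ i → det R (proj₁ (X i)) ≈ d) → det R (proj₁ (SpanSum.sum X)) ≈ d ^ r
    det-product {zero}  X d e = det-1ᴹ n
    det-product {suc r} X d e = trans (det-* (proj₁ (X zero)) _) (*-cong (e zero) (det-product (X ∘ suc) d (e ∘ suc)))

    P Q : Fin h → Matrix R n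
    P l = NK.changeᴿ e (RK.conjugate (σ l) e)
    Q l = NK.changeᴿ (RK.conjugate (σ l) e) e

    -- On the image of R ⊗ K this is the action of `σ l`, by `conj-matrix`. As conjugation by a
    -- change of basis it respects products of arbitrary matrices.
    conj : Fin h → Matrix R n → Matrix R n
    conj l X = (P l *ᴹ X) *ᴹ Q l

    conj-* : ∀ l X Y → conj l (X *ᴹ Y) ≋ conj l X *ᴹ conj l Y
    conj-* l X Y = ≋-trans (*ᴹ-cong {Y = Q l} (≋-sym (*ᴹ-assoc (P l) X Y)) ≋-refl) (≋-trans (*ᴹ-assoc (P l *ᴹ X) Y (Q l))
      (≋-trans (*ᴹ-cong {X = P l *ᴹ X} ≋-refl middle) (≋-sym (*ᴹ-assoc (P l *ᴹ X) (Q l) (conj l Y)))))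
      where
      middle : Y *ᴹ Q l ≋ Q l *ᴹ conj l Y
      middle = ≋-trans (*ᴹ-cong {Y = Q l} (≋-trans (≋-sym (*ᴹ-identityˡ Y))
          (≋-trans (*ᴹ-cong {Y = Y} (≋-sym (NK.changeᴿ-inverse (RK.conjugate (σ l) e) e)) ≋-refl) (*ᴹ-assoc (Q l) (P l) Y))) ≋-refl)
        (*ᴹ-assoc (Q l) (P l *ᴹ Y) (Q l))

    conj-cong : ∀ l {X Y} → X ≋ Y → conj l X ≋ conj l Y
    conj-cong l p = *ᴹ-cong {Y = Q l} (*ᴹ-cong {X = P l} ≋-refl p) ≋-refl

    conj-product : ∀ l {r} (X Y : Fin r → Span.Carrier) → (∀ i → conj l (proj₁ (X i)) ≋ proj₁ (Y i)) →
                   conj l (proj₁ (SpanSum.sum X)) ≋ proj₁ (SpanSum.sum Y)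
    conj-product l {zero}  X Y p = ≋-trans (*ᴹ-cong {Y = Q l} (*ᴹ-identityʳ (P l)) ≋-refl) (NK.changeᴿ-inverse e (RK.conjugate (σ l) e))
    conj-product l {suc r} X Y p = ≋-trans (conj-* l (proj₁ (X zero)) _) (*ᴹ-cong (p zero) (conj-product l (X ∘ suc) (Y ∘ suc) (p ∘ suc)))

    conj-matrix : ∀ l {r} (c : Fin r → Carrier) x → NK.matrix e c (act l ∘ x) ≋ conj l (NK.matrix e c x)
    conj-matrix l c x = ≋-trans (≋-sym (*ᴹ-identityʳ M)) (≋-trans (*ᴹ-cong {X = M} ≋-refl (≋-sym (NK.changeᴿ-inverse e f)))
      (≋-trans (≋-sym (*ᴹ-assoc M (P l) (Q l))) (*ᴹ-cong {Y = Q l} (≋-trans (NK.matrix-change e f c (act l ∘ x))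
        (*ᴹ-cong {X = P l} ≋-refl (λ i j → ∑-cong λ s → *-congˡ {c s} (φ.⟦⟧-cong (RK.regular-conjugate (σ l) e (x s) i j))))) ≋-refl)))
      where
      f = RK.conjugate (σ l) e
      M = NK.matrix e c (act l ∘ x)

    module _ {r} (c : Fin r → Carrier) (x : Fin r → K.Carrier) where
      C : Fin h → Span.Carrier
      C i = NK.matrix e c (act i ∘ x) , r , c , act i ∘ x , ≋-refl

      -- The relative norm of the formal sum from R ⊗ K to R ⊗ F, as the product of its conjugates;
      -- a translation only permutes the factors, whence `Z-fixed`.
      Z : Span.Carrier
      Z = SpanSum.sum C

      det-Z : det R (proj₁ Z) ≈ NK.norm e c x ^ h
      det-Z = det-product C (NK.norm e c x) λ i →
        NK.det-similar (NK.matrix e c (act i ∘ x)) (NK.matrix e c x) (P i) (Q i) (NK.changeᴿ-inverse e (RK.conjugate (σ i) e))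
          (≋-trans (NK.matrix-change e (RK.conjugate (σ i) e) c (act i ∘ x))
            (*ᴹ-cong {X = P i} ≋-refl (λ j l → ∑-cong λ s → *-congˡ {c s} (φ.⟦⟧-cong (RK.regular-conjugate (σ i) e (x s) j l)))))

      Z-fixed : ∀ l → conj l (proj₁ Z) ≋ proj₁ Z
      Z-fixed l = ≋-trans (conj-product l C (λ i → C (translate l ⟨$⟩ʳ i)) λ i →
          ≋-trans (≋-sym (conj-matrix l c (act i ∘ x))) (NK.matrix-cong e (λ _ → refl) (λ s → translate-σ l i (x s))))
        (≋-sym {proj₁ Z} (SpanSum.sum-permute C (translate l)))

      -- Averaging with an element θ of trace 1 writes the invariant Z in terms of F.
      descent : ∀ (θ : K.Carrier) → trace θ K.≈ K.1# → ∀ {r} (z : Fin r → Carrier) (y : Fin r → K.Carrier) →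
                proj₁ Z ≋ NK.matrix e z y → NK.matrix e z (λ s → trace (θ K.* y s)) ≋ proj₁ Z
      descent θ Trθ≈1 z y Z≋ i j = begin
        ∑ R (λ s → z s * ⟦ RK.regular e (trace (θ K.* y s)) i j ⟧)
          ≈⟨ ∑-cong (λ s → trans (*-congˡ {z s} (trans (φ.⟦⟧-cong (RK.regular-∑ e (λ l → act l (θ K.* y s)) i j))
               (∑-homo (λ l → RK.regular e (act l (θ K.* y s)) i j)))) (*-∑ (z s) (λ l → ⟦ RK.regular e (act l (θ K.* y s)) i j ⟧))) ⟩
        ∑ R (λ s → ∑ R (λ l → z s * ⟦ RK.regular e (act l (θ K.* y s)) i j ⟧))
          ≈⟨ ∑-comm (λ s l → z s * ⟦ RK.regular e (act l (θ K.* y s)) i j ⟧) ⟩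
        ∑ R (λ l → NK.matrix e z (λ s → act l (θ K.* y s)) i j)
          ≈⟨ ∑-cong (λ l → term l) ⟩
        ∑ R (λ l → (Θ l *ᴹ proj₁ Z) i j)
          ≈⟨ *ᴹ-∑ˡ Θ (proj₁ Z) i j ⟨
        ((λ i j → ∑ R (λ l → Θ l i j)) *ᴹ proj₁ Z) i j
          ≈⟨ *ᴹ-cong {Y = proj₁ Z} (λ i j → trans (sym (∑-homo (λ l → RK.regular e (act l θ) i j)))
               (trans (φ.⟦⟧-cong (k.trans (k.sym (RK.regular-∑ e (λ l → act l θ) i j)) (RK.regular-1 e Trθ≈1 i j))) (NK.map-1 i j))) ≋-refl i j ⟩
        (1ᴹ *ᴹ proj₁ Z) i j
          ≈⟨ *ᴹ-identityˡ (proj₁ Z) i j ⟩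
        proj₁ Z i j ∎
        where
        Θ : Fin h → Matrix R n
        Θ l i j = ⟦ RK.regular e (act l θ) i j ⟧
        single : ∀ {r} (z : Fin r → Carrier) (y : Fin r → K.Carrier) w → NK.matrix e z (λ s → w K.* y s) ≋
                 (λ i j → ⟦ RK.regular e w i j ⟧) *ᴹ NK.matrix e z y
        single z y w i j = sym (trans (*ᴹ-∑ʳ (λ i j → ⟦ RK.regular e w i j ⟧) (λ s l j → z s * ⟦ RK.regular e (y s) l j ⟧) i j)
          (∑-cong λ s → trans (∑-cong λ l → solve 3 (λ w z y → w :* (z :* y) := z :* (w :* y)) refl ⟦ RK.regular e w i l ⟧ (z s) ⟦ RK.regular e (y s) l j ⟧)
            (trans (sym (*-∑ (z s) (λ l → ⟦ RK.regular e w i l ⟧ * ⟦ RK.regular e (y s) l j ⟧)))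
              (*-congˡ {z s} (trans (sym (NK.map-* (RK.regular e w) (RK.regular e (y s)) i j)) (φ.⟦⟧-cong (k.sym (RK.regular-* e w (y s) i j))))))))
        term : ∀ l → NK.matrix e z (λ s → act l (θ K.* y s)) i j ≈ (Θ l *ᴹ proj₁ Z) i j
        term l = begin
          NK.matrix e z (λ s → act l (θ K.* y s)) i j
            ≈⟨ NK.matrix-cong e {c = z} (λ _ → refl) (λ s → RingHomomorphism.*-homo (act.to l) θ (y s)) i j ⟩
          NK.matrix e z (λ s → act l θ K.* act l (y s)) i j
            ≈⟨ single z (act l ∘ y) (act l θ) i j ⟩
          (Θ l *ᴹ NK.matrix e z (act l ∘ y)) i j
            ≈⟨ *ᴹ-cong {X = Θ l} ≋-refl (≋-trans (conj-matrix l z y) (≋-trans (conj-cong l (≋-sym Z≋)) (Z-fixed l))) i j ⟩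
          (Θ l *ᴹ proj₁ Z) i j ∎

  -- The determinant of `Z` is the `h`-th power of `β`; since `Z` can be written with elements of
  -- `F`, `norm-up` shows that it is also the `h`-th power of a norm from `F`. Transitivity of norms
  -- would identify `γ` with `β`, but later comparisons are only made up to powers prime to p.
  formalNorm-down : ∀ {β} → NK.IsFormalNorm β → ∃[ γ ] NF.IsFormalNorm γ × β ^ h ≈ γ ^ h
  formalNorm-down {β} (NK.formalNorm e′ c β≈) = descend trace-one (sub-finite e) (proj₂ (Z c b′))
    where
    b′ = Basis.basis e′
    descend : ∃[ θ ] trace θ K.≈ K.1# → IsFinite Fₖ → InSpan (proj₁ (Z c b′)) → ∃[ γ ] NF.IsFormalNorm γ × β ^ h ≈ γ ^ h
    descend (θ , Trθ≈1) (m , f) (r , z , y , Z≋) = NF.norm f z w , NF.norm-formal f z w refl , (begin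
      β ^ h                     ≈⟨ ^-congˡ h (trans β≈ (NK.norm-independent e′ e c b′)) ⟩
      NK.norm e c b′ ^ h        ≈⟨ det-Z c b′ ⟨
      det R (proj₁ (Z c b′))    ≈⟨ det-cong (descent c b′ θ Trθ≈1 z y Z≋) ⟨
      NK.norm e z (proj₁ ∘ w)   ≈⟨ norm-up f z w ⟩
      NF.norm f z w ^ h         ∎)
      where
      w : Fin r → F.Carrier
      w s = trace (θ K.* y s) , fixed⇒∈ _ (trace-fixed (θ K.* y s))

-- Absolute values and adèles

module RationalPowers where
  open Exp (CommutativeRing.semiring ℚ.+-*-commutativeRing) public using (_^_)
  open RingSolver ℚ.+-*-commutativeRing

  0<1 : 0ℚ ℚ.< 1ℚ
  0<1 = ℚ.positive⁻¹ 1ℚ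

  *-positive : ∀ {p q} → 0ℚ ℚ.< p → 0ℚ ℚ.< q → 0ℚ ℚ.< p ℚ.* q
  *-positive {p} {q} 0<p 0<q = ≡.subst (ℚ._< p ℚ.* q) (ℚ.*-zeroʳ p) (ℚ.*-monoʳ-<-pos p 0<q)
    where instance _ = ℚ.positive 0<p

  *-mono-≤-pos : ∀ {p q} r → 0ℚ ℚ.< r → p ℚ.≤ q → p ℚ.* r ℚ.≤ q ℚ.* r
  *-mono-≤-pos r 0<r = ℚ.*-monoʳ-≤-nonNeg r
    where instance _ = ℚ.pos⇒nonNeg r {{ℚ.positive 0<r}}

  reciprocal : ∀ p → 0ℚ ℚ.< p → ∃[ s ] 0ℚ ℚ.< s × p ℚ.* s ≡ 1ℚ
  reciprocal p 0<p = ℚ.1/ p , ℚ.positive⁻¹ (ℚ.1/ p) {{ℚ.1/pos⇒pos p}} , ℚ.*-inverseʳ p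
    where
    instance
      _ = ℚ.positive 0<p
      _ = ℚ.pos⇒nonZero p

  natural : ℕ → ℚ
  natural zero    = 0ℚ
  natural (suc n) = 1ℚ ℚ.+ natural n

  toℚᵘ-natural : ∀ n → ℚ.toℚᵘ (natural n) ℚᵘ.≃ ℚᵘ.mkℚᵘ (ℤ.+ n) 0
  toℚᵘ-natural zero    = ℚᵘ.≃-refl
  toℚᵘ-natural (suc n) = ℚᵘ.≃-trans (ℚ.toℚᵘ-homo-+ 1ℚ (natural n))
    (ℚᵘ.≃-trans (ℚᵘ.+-congʳ ℚᵘ.1ℚᵘ (toℚᵘ-natural n))
      (ℚᵘ.*≡* (≡.cong (λ m → (ℤ.+ 1 ℤ.+ m) ℤ.* ℤ.+ 1) (ℤ.*-identityʳ (ℤ.+ n)))))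

  natural-unbounded : ∀ p → ∃[ n ] p ℚ.≤ natural n
  natural-unbounded p@(ℚ.mkℚ (ℤ.+ n) d _) = n , ℚ.toℚᵘ-cancel-≤ (ℚᵘ.≤-respʳ-≃ (ℚᵘ.≃-sym (toℚᵘ-natural n))
    (ℚᵘ.*≤* (≡.subst₂ ℤ._≤_ (ℤ.pos-* n 1) (ℤ.pos-* n (suc d)) (ℤ.+≤+ (ℕ.*-monoʳ-≤ n (ℕ.s≤s ℕ.z≤n))))))
  natural-unbounded p@(ℚ.mkℚ (ℤ.-[1+ n ]) d _) = 0 , ℚ.<⇒≤ (ℚ.negative⁻¹ p)

  ^-positive : ∀ {s} n → 0ℚ ℚ.< s → 0ℚ ℚ.< s ^ n
  ^-positive zero    0<s = 0<1
  ^-positive (suc n) 0<s = *-positive 0<s (^-positive n 0<s)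

  -- Bernoulli: (1 + N d) sᴺ ≤ 1 when s (1 + d) = 1.
  power-small : ∀ s B ε → 0ℚ ℚ.< s → s ℚ.< 1ℚ → 0ℚ ℚ.< B → 0ℚ ℚ.< ε → ∃[ N ] s ^ N ℚ.* B ℚ.≤ ε
  power-small s B ε 0<s s<1 0<B 0<ε with reciprocal s 0<s | reciprocal ε 0<ε
  ... | t , 0<t , st≡1 | ε⁻¹ , 0<ε⁻¹ , εε⁻¹≡1 = N , (begin
    s ^ N ℚ.* B                       ≡⟨ solve 4 (λ x B e i → x :* B := con (1 , 0) :* x :* B) ≡.refl (s ^ N) B ε ε⁻¹ ⟩
    1ℚ ℚ.* s ^ N ℚ.* B                ≡⟨ ≡.cong (λ u → u ℚ.* s ^ N ℚ.* B) εε⁻¹≡1 ⟨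
    ε ℚ.* ε⁻¹ ℚ.* s ^ N ℚ.* B         ≡⟨ solve 4 (λ x B e i → e :* i :* x :* B := (B :* i) :* (x :* e)) ≡.refl (s ^ N) B ε ε⁻¹ ⟩
    C ℚ.* (s ^ N ℚ.* ε)               ≤⟨ *-mono-≤-pos (s ^ N ℚ.* ε) (*-positive (^-positive N 0<s) 0<ε) C≤ ⟩
    (1ℚ ℚ.+ natural N ℚ.* d) ℚ.* (s ^ N ℚ.* ε) ≡⟨ ℚ.*-assoc (1ℚ ℚ.+ natural N ℚ.* d) (s ^ N) ε ⟨
    (1ℚ ℚ.+ natural N ℚ.* d) ℚ.* s ^ N ℚ.* ε ≤⟨ *-mono-≤-pos ε 0<ε (bernoulli N) ⟩
    1ℚ ℚ.* ε                          ≡⟨ ℚ.*-identityˡ ε ⟩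
    ε                                 ∎)
    where
    open ℚ.≤-Reasoning
    d = t ℚ.- 1ℚ
    C = B ℚ.* ε⁻¹
    1<t : 1ℚ ℚ.< t
    1<t = ℚ.*-cancelˡ-<-nonNeg s (≡.subst₂ ℚ._<_ (≡.sym (ℚ.*-identityʳ s)) (≡.sym st≡1) s<1)
      where instance _ = ℚ.pos⇒nonNeg s {{ℚ.positive 0<s}}
    0<d : 0ℚ ℚ.< d
    0<d = ≡.subst (ℚ._< d) (ℚ.+-inverseʳ 1ℚ) (ℚ.+-monoˡ-< (ℚ.- 1ℚ) 1<t)
    d⁻¹ = proj₁ (reciprocal d 0<d)
    N = proj₁ (natural-unbounded (C ℚ.* d⁻¹))
    C≤ : C ℚ.≤ 1ℚ ℚ.+ natural N ℚ.* d
    C≤ = begin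
      C                       ≡⟨ ℚ.*-identityʳ C ⟨
      C ℚ.* 1ℚ                ≡⟨ ≡.cong (C ℚ.*_) (proj₂ (proj₂ (reciprocal d 0<d))) ⟨
      C ℚ.* (d ℚ.* d⁻¹)       ≡⟨ solve 3 (λ C d i → C :* (d :* i) := C :* i :* d) ≡.refl C d d⁻¹ ⟩
      C ℚ.* d⁻¹ ℚ.* d         ≤⟨ *-mono-≤-pos d 0<d (proj₂ (natural-unbounded (C ℚ.* d⁻¹))) ⟩
      natural N ℚ.* d         ≡⟨ ℚ.+-identityˡ (natural N ℚ.* d) ⟨
      0ℚ ℚ.+ natural N ℚ.* d  ≤⟨ ℚ.+-monoˡ-≤ (natural N ℚ.* d) (ℚ.<⇒≤ 0<1) ⟩
      1ℚ ℚ.+ natural N ℚ.* d  ∎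
    bernoulli : ∀ N → (1ℚ ℚ.+ natural N ℚ.* d) ℚ.* s ^ N ℚ.≤ 1ℚ
    bernoulli zero    = ℚ.≤-reflexive (solve 1 (λ d → (con (1 , 0) :+ con (0 , 0) :* d) :* con (1 , 0) := con (1 , 0)) ≡.refl d)
    bernoulli (suc N) = begin
      (1ℚ ℚ.+ (1ℚ ℚ.+ natural N) ℚ.* d) ℚ.* (s ℚ.* s ^ N)
        ≤⟨ *-mono-≤-pos (s ℚ.* s ^ N) (*-positive 0<s (^-positive N 0<s)) step ⟩
      (1ℚ ℚ.+ natural N ℚ.* d) ℚ.* t ℚ.* (s ℚ.* s ^ N)
        ≡⟨ solve 4 (λ a t s x → a :* t :* (s :* x) := s :* t :* (a :* x)) ≡.refl (1ℚ ℚ.+ natural N ℚ.* d) t s (s ^ N) ⟩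
      s ℚ.* t ℚ.* ((1ℚ ℚ.+ natural N ℚ.* d) ℚ.* s ^ N)
        ≡⟨ ≡.trans (≡.cong (ℚ._* ((1ℚ ℚ.+ natural N ℚ.* d) ℚ.* s ^ N)) st≡1) (ℚ.*-identityˡ _) ⟩
      (1ℚ ℚ.+ natural N ℚ.* d) ℚ.* s ^ N
        ≤⟨ bernoulli N ⟩
      1ℚ ∎
      where
      0≤ : ∀ n → 0ℚ ℚ.≤ natural n
      0≤ zero    = ℚ.≤-refl
      0≤ (suc n) = ℚ.≤-trans (ℚ.<⇒≤ 0<1) (≡.subst (ℚ._≤ 1ℚ ℚ.+ natural n) (ℚ.+-identityʳ 1ℚ) (ℚ.+-monoʳ-≤ 1ℚ (0≤ n)))
      step : 1ℚ ℚ.+ (1ℚ ℚ.+ natural N) ℚ.* d ℚ.≤ (1ℚ ℚ.+ natural N ℚ.* d) ℚ.* t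
      step = begin
        1ℚ ℚ.+ (1ℚ ℚ.+ natural N) ℚ.* d
          ≡⟨ ℚ.+-identityʳ _ ⟨
        1ℚ ℚ.+ (1ℚ ℚ.+ natural N) ℚ.* d ℚ.+ 0ℚ
          ≤⟨ ℚ.+-monoʳ-≤ (1ℚ ℚ.+ (1ℚ ℚ.+ natural N) ℚ.* d) nd² ⟩
        1ℚ ℚ.+ (1ℚ ℚ.+ natural N) ℚ.* d ℚ.+ natural N ℚ.* d ℚ.* d
          ≡⟨ solve 2 (λ n t → con (1 , 0) :+ (con (1 , 0) :+ n) :* (t :- con (1 , 0)) :+ n :* (t :- con (1 , 0)) :* (t :- con (1 , 0))
                            := (con (1 , 0) :+ n :* (t :- con (1 , 0))) :* t) ≡.refl (natural N) t ⟩
        (1ℚ ℚ.+ natural N ℚ.* d) ℚ.* t ∎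
        where
        nd² : 0ℚ ℚ.≤ natural N ℚ.* d ℚ.* d
        nd² = ≡.subst (ℚ._≤ natural N ℚ.* d ℚ.* d) (≡.trans (≡.cong (ℚ._* d) (ℚ.*-zeroˡ d)) (ℚ.*-zeroˡ d))
          (*-mono-≤-pos d 0<d (*-mono-≤-pos d 0<d (0≤ N)))

  abstract
    power-vanishes : ∀ s B ε → 0ℚ ℚ.< s → s ℚ.< 1ℚ → 0ℚ ℚ.< B → 0ℚ ℚ.< ε → ∃[ N ] s ^ N ℚ.* B ℚ.≤ ε
    power-vanishes = power-small

module AbsoluteValues (em : ExcludedMiddle (lsuc 0ℓ)) {K : Field} where
  open Classical em
  open Field K hiding (zero)
  open FieldProperties K
  open RingSolver commutativeRing
  open RingProperties ring using (-0#≈0#)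
  open Exp semiring public using (_^_; ^-homo-*)
  private module ^ℚ = RationalPowers
  open RationalPowers using (0<1; reciprocal; power-vanishes)

  ^-inverse : ∀ {x y} → x * y ≈ 1# → ∀ n → x ^ n * y ^ n ≈ 1#
  ^-inverse e zero = *-identityˡ 1#
  ^-inverse {x} {y} e (suc n) = trans (solve 4 (λ x p y q → x :* p :* (y :* q) := x :* y :* (p :* q)) refl x (x ^ n) y (y ^ n))
    (trans (*-cong e (^-inverse e n)) (*-identityˡ 1#))

  inverse-* : ∀ {x x⁻¹ y y⁻¹} → x * x⁻¹ ≈ 1# → y * y⁻¹ ≈ 1# → x * y * (x⁻¹ * y⁻¹) ≈ 1#
  inverse-* {x} {x⁻¹} {y} {y⁻¹} e f = trans (solve 4 (λ x p y q → x :* y :* (p :* q) := x :* p :* (y :* q)) refl x x⁻¹ y y⁻¹)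
    (trans (*-cong e f) (*-identityˡ 1#))

  module _ (v : AbsoluteValue K) where
    open AbsoluteValue v

    -- In terms of upper cuts, an absolute value below 1 means that 1 lies in the cut, and one at
    -- most 1 that every rational above 1 does. In the nonarchimedean case `Small` and `Int` are the
    -- maximal ideal and the valuation ring.
    Small : Carrier → Set
    Small x = ∣ x ∣ ≺ 1ℚ

    Int : Carrier → Set
    Int x = ∀ q → 1ℚ ℚ.< q → ∣ x ∣ ≺ q

    small⇒int : ∀ {x} → Small x → Int x
    small⇒int {x} s q 1<q = ℝ≥0.upward ∣ x ∣ (ℚ.<⇒≤ 1<q) s

    int-cong : ∀ {x y} → x ≈ y → Int x → Int y
    int-cong e i q 1<q = cong e (i q 1<q)

    small-0 : ∀ {x} → x ≈ 0# → Small x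
    small-0 e = cong (sym e) (∣0∣≤0 0<1)

    ^-bound : ∀ {x y s B} → ∣ x ∣ ≺ s → ∣ y ∣ ≺ B → ∀ n → ∣ x ^ n * y ∣ ≺ s ^ℚ.^ n ℚ.* B
    ^-bound {x} {y} {s} {B} p q zero    = ≡.subst (∣ 1# * y ∣ ≺_) (≡.sym (ℚ.*-identityˡ B)) (cong (sym (*-identityˡ y)) q)
    ^-bound {x} {y} {s} {B} p q (suc n) = ≡.subst (∣ x * x ^ n * y ∣ ≺_) (≡.sym (ℚ.*-assoc s (s ^ℚ.^ n) B))
      (cong (sym (*-assoc x (x ^ n) y)) (∣xy∣≤∣x∣∣y∣ p (^-bound p q n)))

    archimedean : ∀ {c} → Small c → ∀ y ε → 0ℚ ℚ.< ε → ∃[ n ] ∣ c ^ n * y ∣ ≺ ε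
    archimedean {c} small y ε 0<ε with ℝ≥0.rounded ∣ c ∣ small | ℝ≥0.inhabited ∣ y ∣
    ... | s , s<1 , c<s | B , y<B with power-vanishes s B ε (ℝ≥0.positive ∣ c ∣ c<s) s<1 (ℝ≥0.positive ∣ y ∣ y<B) 0<ε
    ...   | n , le = n , ℝ≥0.upward ∣ c ^ n * y ∣ le (^-bound c<s y<B n)

    1^n : ∀ n → 1# ^ n * 1# ≈ 1#
    1^n zero    = *-identityˡ 1#
    1^n (suc n) = trans (*-congʳ (*-identityˡ (1# ^ n))) (1^n n)

    1-not-small : ¬ Small 1#
    1-not-small s = 0≉1 (sym (∣x∣≤0⇒x≈0 below))
      where
      below : ∀ q → 0ℚ ℚ.< q → ∣ 1# ∣ ≺ q
      below q 0<q with archimedean s 1# q 0<q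
      ... | n , b = cong (1^n n) b

    small≉0 : ∀ {x} → ¬ Small x → ¬ x ≈ 0#
    small≉0 ns e = ns (small-0 e)

    not-small⇒int-inverse : ∀ {x y} → x * y ≈ 1# → ¬ Small x → Int y
    not-small⇒int-inverse {x} {y} e ns q 1<q with ∣x∣∣y∣≤∣xy∣ (cong (sym e) (∣1∣≤1 1<q))
    ... | p , r , x<p , y<r , pr≤q = ℝ≥0.upward ∣ y ∣ r≤q y<r
      where
      1<p : 1ℚ ℚ.≤ p
      1<p = ℚ.<⇒≤ $ ℚ.≰⇒> λ p≤1 → ns (ℝ≥0.upward ∣ x ∣ p≤1 x<p)
      r≤q : r ℚ.≤ q
      r≤q = ℚ.≤-trans (≡.subst (ℚ._≤ p ℚ.* r) (ℚ.*-identityˡ r) (^ℚ.*-mono-≤-pos r (ℝ≥0.positive ∣ y ∣ y<r) 1<p)) pr≤q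

    small-*-int : ∀ {x y} → Small x → Int y → Small (x * y)
    small-*-int {x} {y} sx iy with ℝ≥0.rounded ∣ x ∣ sx
    ... | s , s<1 , x<s with reciprocal s (ℝ≥0.positive ∣ x ∣ x<s)
    ...   | t , 0<t , st≡1 = ≡.subst (∣ x * y ∣ ≺_) st≡1 (∣xy∣≤∣x∣∣y∣ x<s (iy t 1<t))
      where
      1<t : 1ℚ ℚ.< t
      1<t = ℚ.*-cancelˡ-<-nonNeg s (≡.subst₂ ℚ._<_ (≡.sym (ℚ.*-identityʳ s)) (≡.sym st≡1) s<1)
        where instance _ = ℚ.pos⇒nonNeg s {{ℚ.positive (ℝ≥0.positive ∣ x ∣ x<s)}}

    int-*-small : ∀ {x y} → Int x → Small y → Small (x * y)
    int-*-small ix sy = cong (*-comm _ _) (small-*-int sy ix)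

    int⇒inverse-not-small : ∀ {x y} → x * y ≈ 1# → Int y → ¬ Small x
    int⇒inverse-not-small e iy sx = 1-not-small (cong e (small-*-int sx iy))

    int-* : ∀ {x y} → Int x → Int y → Int (x * y)
    int-* {x} {y} ix iy = let N , h = integral-* v (constant v x) (constant v y) (0 , λ _ _ → ix) (0 , λ _ _ → iy) in h N ℕ.≤-refl

    int-neg : ∀ {x} → Int x → Int (- x)
    int-neg {x} ix = let N , h = integral-neg v (constant v x) (0 , λ _ _ → ix) in h N ℕ.≤-refl

    int-0 : ∀ {x} → x ≈ 0# → Int x
    int-0 e = small⇒int (small-0 e)

    int-1 : Int 1#
    int-1 q = ∣1∣≤1

    int-^ : ∀ {x} → Int x → ∀ n → Int (x ^ n)
    int-^ ix zero    = int-1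
    int-^ ix (suc n) = int-* ix (int-^ ix n)

    small-neg : ∀ {x} → Small x → Small (- x)
    small-neg {x} sx = cong (solve 1 (λ x → (:- con (1 , 0)) :* x := :- x) refl x) (int-*-small (int-neg int-1) sx)

    small-^ : ∀ {x} → Small x → ∀ n → Small (x ^ suc n)
    small-^ sx n = small-*-int sx (int-^ (small⇒int sx) n)

    not-int⇒inverse-small : ∀ {x y} → x * y ≈ 1# → ¬ Int x → Small y
    not-int⇒inverse-small {x} {y} e ni with decide (Small y)
    ... | yes s = s
    ... | no ns = ⊥-elim (ni (not-small⇒int-inverse (trans (*-comm y x) e) ns))

    module _ (na : NonArchimedean v) where
      small-+ : ∀ {x y} → Small x → Small y → Small (x + y)
      small-+ = na

      int-+ : ∀ {x y} → Int x → Int y → Int (x + y)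
      int-+ ix iy q 1<q = na (ix q 1<q) (iy q 1<q)

      small-∑ : ∀ {n} (f : Fin n → Carrier) → (∀ i → Small (f i)) → Small (∑ commutativeRing f)
      small-∑ {zero}  f s = small-0 refl
      small-∑ {suc n} f s = small-+ (s zero) (small-∑ (f ∘ suc) (s ∘ suc))

      int-∑ : ∀ {n} (f : Fin n → Carrier) → (∀ i → Int (f i)) → Int (∑ commutativeRing f)
      int-∑ {zero}  f s = int-0 refl
      int-∑ {suc n} f s = int-+ (s zero) (int-∑ (f ∘ suc) (s ∘ suc))

      1+small : ∀ {x y} → Small x → (1# + x) * y ≈ 1# → Int y
      1+small {x} sx e = not-small⇒int-inverse e λ s → 1-not-small
        (cong (solve 1 (λ x → con (1 , 0) :+ x :- x := con (1 , 0)) refl x) (small-+ s (small-neg sx)))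

  -- Comparison of absolute values through their open unit balls.
  module _ {v w : AbsoluteValue K} where
    private
      module v = AbsoluteValue v
      module w = AbsoluteValue w

    -- Take `c` small at `v` with inverse `d`, and `n` so large that `c ^ n` is below ε at `w`. If
    -- `x` is close enough to 0 at `v`, then `x * d ^ n` is small at `v`, hence at `w`, and
    -- multiplying back by `c ^ n` bounds `x` at `w`.
    small-⊆⇒≼ : (∀ {x} → Small v x → Small w x) → v ≼ w
    small-⊆⇒≼ sub ε 0<ε with v.nontrivial
    ... | c , c≉0 , c<1 with archimedean w (sub c<1) 1# ε 0<ε | invertible c c≉0
    ...   | n , cⁿ<ε | d , cd≈1 with ℝ≥0.inhabited (v.∣ d ^ n ∣)
    ...     | B , d<B with reciprocal B (ℝ≥0.positive (v.∣ d ^ n ∣) d<B)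
    ...       | δ , 0<δ , Bδ≡1 = δ , 0<δ , λ x x<δ →
      ≡.subst (w.∣ x ∣ ≺_) (ℚ.*-identityˡ ε) (w.cong (restore x) (w.∣xy∣≤∣x∣∣y∣
        (sub (≡.subst (v.∣ x * d ^ n ∣ ≺_) (≡.trans (ℚ.*-comm δ B) Bδ≡1) (v.∣xy∣≤∣x∣∣y∣ x<δ d<B))) cⁿ<ε))
      where
      restore : ∀ x → x * d ^ n * (c ^ n * 1#) ≈ x
      restore x = trans (solve 3 (λ x d c → x :* d :* (c :* con (1 , 0)) := c :* d :* x) refl x (d ^ n) (c ^ n))
        (trans (*-congʳ (^-inverse cd≈1 n)) (*-identityˡ x))

    -- Suppose `x` is small at `w` but not at `v`, and let `y` be its inverse. For `c` small at `v`
    -- every `c * y ^ n` is small at `v` and so at `w`. But for large `n` its inverse `x ^ n * d` is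
    -- small at `w` as well.
    small-⊆⇒⊇ : (∀ {x} → Small v x → Small w x) → ∀ {x} → Small w x → Small v x
    small-⊆⇒⊇ sub {x} sx = by-contradiction λ ns → absurd ns (v.nontrivial) (invertible x (small≉0 v ns))
      where
      absurd : ¬ Small v x → ∃[ c ] ¬ c ≈ 0# × v.∣ c ∣ ≺ 1ℚ → ∃[ y ] x * y ≈ 1# → ⊥
      absurd ns (c , c≉0 , c<1) (y , xy≈1) with invertible c c≉0
      ... | d , cd≈1 with archimedean w sx d 1ℚ 0<1
      ...   | n , xⁿd<1 = 1-not-small w (w.cong
          (trans (solve 4 (λ c y x d → c :* y :* (x :* d) := x :* y :* (c :* d)) refl c (y ^ n) (x ^ n) d)
            (trans (*-cong (^-inverse xy≈1 n) cd≈1) (*-identityˡ 1#)))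
          (small-*-int w (sub (small-*-int v c<1 (int-^ v (not-small⇒int-inverse v xy≈1 ns) n))) (small⇒int w xⁿd<1)))

    ≼⇒small-⊆ : v ≼ w → ∀ {x} → Small v x → Small w x
    ≼⇒small-⊆ v≼w {x} sx = by-contradiction λ ns → absurd ns (invertible x (small≉0 w ns))
      where
      absurd : ¬ Small w x → ∃[ y ] x * y ≈ 1# → ⊥
      absurd ns (y , xy≈1) with v≼w 1ℚ 0<1
      ... | δ , 0<δ , f with archimedean v sx 1# δ 0<δ
      ...   | n , xⁿ<δ = 1-not-small w (w.cong (trans (*-congʳ (*-identityʳ (x ^ n))) (^-inverse xy≈1 n))
        (small-*-int w (f (x ^ n * 1#) xⁿ<δ) (int-^ w (not-small⇒int-inverse w xy≈1 ns) n)))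

  small-⊆⇒∼ : ∀ {v w} → (∀ {x} → Small v x → Small w x) → v ∼ w
  small-⊆⇒∼ {v} {w} sub = small-⊆⇒≼ {v} {w} sub , small-⊆⇒≼ {w} {v} (small-⊆⇒⊇ {v} {w} sub)

  ∼-sym : ∀ {u v : AbsoluteValue K} → u ∼ v → v ∼ u
  ∼-sym (p , q) = q , p

  private
    difference : ∀ v w → ¬ v ∼ w → ∃[ a ] Small v a × ¬ Small w a
    difference v w v≁w with all-or (λ x → Small v x → Small w x)
    ... | inj₁ sub = ⊥-elim (v≁w (small-⊆⇒∼ {v} {w} λ {x} → sub x))
    ... | inj₂ (a , h) = a , by-contradiction (λ ns → h λ s → ⊥-elim (ns s)) , λ s → h λ _ → s

    Separator : AbsoluteValue K → ∀ {r} → (Fin r → AbsoluteValue K) → Set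
    Separator v w = Σ[ z ∈ Carrier ] Σ[ z⁻¹ ∈ Carrier ] z * z⁻¹ ≈ 1# × Small v z⁻¹ × (∀ j → Small (w j) z)

    separate-two : ∀ v w → ¬ v ∼ w → Separator v (λ (_ : Fin 1) → w)
    separate-two v w v≁w with difference v w v≁w | difference w v (v≁w ∘ ∼-sym {w} {v})
    ... | a , sva , nwa | b , swb , nvb with invertible a (small≉0 w nwa) | invertible b (small≉0 v nvb)
    ...   | a⁻¹ , aa⁻¹≈1 | b⁻¹ , bb⁻¹≈1 = b * a⁻¹ , b⁻¹ * a , inverse-* bb⁻¹≈1 (trans (*-comm a⁻¹ a) aa⁻¹≈1) ,
      int-*-small v (not-small⇒int-inverse v bb⁻¹≈1 nvb) sva ,
      λ _ → small-*-int w swb (not-small⇒int-inverse w aa⁻¹≈1 nwa)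

    uniform : ∀ {r} (P : Fin r → ℕ → Set) → (∀ j n → P j n → P j (suc n)) → (∀ j → ∃ (P j)) → ∃[ n ] (∀ j → P j n)
    uniform {zero}  P mono ex = 0 , λ ()
    uniform {suc r} P mono ex with ex zero | uniform (P ∘ suc) (mono ∘ suc) (ex ∘ suc)
    ... | m , p | n , q = m ℕ.+ n , λ
      { zero → ≡.subst (P zero) (ℕ.+-comm n m) (later zero n p) ; (suc j) → later (suc j) m (q j) }
      where
      later : ∀ j d {m} → P j m → P j (d ℕ.+ m)
      later j zero    p = p
      later j (suc d) p = mono j _ (later j d p)

    -- The element `e` is small at the later places, at least 1 at `v` and at most 1 at `w zero`,
    -- while `y` is decisive at these two. A high power of `e` outweighs `y` at the later places
    -- without spoiling the other two.
    combine : ∀ v {r} (w : Fin (suc r) → AbsoluteValue K) {y y⁻¹} → y * y⁻¹ ≈ 1# → Small v y⁻¹ → Small (w zero) y →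
              ∀ {e e⁻¹} → e * e⁻¹ ≈ 1# → Int v e⁻¹ → Int (w zero) e → (∀ j → Small (w (suc j)) e) → Separator v w
    combine v w {y} {y⁻¹} yy⁻¹≈1 vy⁻¹ wy {e} {e⁻¹} ee⁻¹≈1 ve⁻¹ we we′ = result
      (uniform (λ j n → Small (w (suc j)) (e ^ n * y))
        (λ j n s → AbsoluteValue.cong (w (suc j)) (sym (*-assoc e (e ^ n) y)) (small-*-int (w (suc j)) (we′ j) (small⇒int (w (suc j)) s)))
        (λ j → archimedean (w (suc j)) (we′ j) y 1ℚ 0<1))
      where
      result : ∃[ n ] (∀ j → Small (w (suc j)) (e ^ n * y)) → Separator v w
      result (n , s) = e ^ n * y , e⁻¹ ^ n * y⁻¹ , inverse-* (^-inverse ee⁻¹≈1 n) yy⁻¹≈1 ,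
        int-*-small v (int-^ v ve⁻¹ n) vy⁻¹ ,
        λ { zero → int-*-small (w zero) (int-^ (w zero) we n) wy ; (suc j) → s j }

    1+≉0 : ∀ w {z z⁻¹} → z * z⁻¹ ≈ 1# → Small w z⁻¹ → ¬ 1# + z ≈ 0#
    1+≉0 w {z} {z⁻¹} zz⁻¹≈1 wz⁻¹ e = 1-not-small w (AbsoluteValue.cong w -z⁻¹≈1 (small-neg w wz⁻¹))
      where
      -z⁻¹≈1 : - z⁻¹ ≈ 1#
      -z⁻¹≈1 = trans (solve 2 (λ z i → :- i := z :* i :- i :* (con (1 , 0) :+ z)) refl z z⁻¹)
        (trans (+-cong zz⁻¹≈1 (-‿cong (trans (*-congˡ e) (zeroʳ z⁻¹)))) (trans (+-congˡ -0#≈0#) (+-identityʳ 1#)))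

    [z/1+z]⁻¹ : ∀ {z z⁻¹ g} → z * z⁻¹ ≈ 1# → (1# + z) * g ≈ 1# → z * g * (1# + z⁻¹) ≈ 1#
    [z/1+z]⁻¹ {z} {z⁻¹} {g} zz⁻¹≈1 e = trans (solve 3 (λ z g i → z :* g :* (con (1 , 0) :+ i) := (z :+ z :* i) :* g) refl z g z⁻¹)
      (trans (*-congʳ (trans (+-congˡ zz⁻¹≈1) (+-comm z 1#))) e)

  -- The central step of the Artin-Whaples approximation theorem. A separator `z` for the later
  -- places serves as it stands if it is at most 1 at `w zero`; otherwise its place is taken by z /
  -- (1 + z), which has absolute value 1 at both `v` and `w zero`.
  separate : ∀ v {r} (w : Fin r → AbsoluteValue K) → NonArchimedean v → (∀ j → NonArchimedean (w j)) →
             (∀ j → ¬ v ∼ w j) → Separator v w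
  separate v {zero} w na nas ≁ with AbsoluteValue.nontrivial v
  ... | c , c≉0 , sc with invertible c c≉0
  ...   | d , cd≈1 = d , c , trans (*-comm d c) cd≈1 , sc , λ ()
  separate v {suc r} w na nas ≁ = result (separate v (w ∘ suc) na (nas ∘ suc) (≁ ∘ suc)) (separate-two v (w zero) (≁ zero))
    where
    result : Separator v (w ∘ suc) → Separator v (λ (_ : Fin 1) → w zero) → Separator v w
    result (z , z⁻¹ , zz⁻¹≈1 , vz⁻¹ , wz) (y , y⁻¹ , yy⁻¹≈1 , vy⁻¹ , wy) = go (decide (Int (w zero) z))
      where
      go : Dec (Int (w zero) z) → Separator v w
      go (yes iz) = combine v w yy⁻¹≈1 vy⁻¹ (wy zero) zz⁻¹≈1 (small⇒int v vz⁻¹) iz wz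
      go (no niz) = with-inverse (invertible (1# + z) (1+≉0 (w zero) zz⁻¹≈1 wz⁻¹))
        where
        wz⁻¹ : Small (w zero) z⁻¹
        wz⁻¹ = not-int⇒inverse-small (w zero) zz⁻¹≈1 niz
        -- z / (1 + z) is close to 1 where z is large and to 0 where z is small.
        with-inverse : ∃[ g ] (1# + z) * g ≈ 1# → Separator v w
        with-inverse (g , e) = combine v w yy⁻¹≈1 vy⁻¹ (wy zero) ([z/1+z]⁻¹ zz⁻¹≈1 e)
          (int-+ v na (int-1 v) (small⇒int v vz⁻¹))
          (1+small (w zero) (nas zero) wz⁻¹ (trans (*-comm (1# + z⁻¹) (z * g)) ([z/1+z]⁻¹ zz⁻¹≈1 e)))
          (λ j → small-*-int (w (suc j)) (wz j) (1+small (w (suc j)) (nas (suc j)) (wz j) e))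

  -- Maximality of the absolute value of `a i` is expressed without comparing two real numbers: all
  -- quotients by `a i` are integral.
  largest : ∀ v → NonArchimedean v → ∀ {n} (a : Fin n → Carrier) → ∃[ i ] ¬ a i ≈ 0# →
            Σ[ i ∈ Fin n ] Σ[ y ∈ Carrier ] a i * y ≈ 1# × (∀ j → Int v (a j * y))
  largest v na {suc n} a (i₀ , nz) with decide (∃[ i ] ¬ a (suc i) ≈ 0#)
  ... | no none = zero , y , ay≈1 , λ
      { zero → int-cong v (sym ay≈1) (int-1 v)
      ; (suc j) → int-0 v (trans (*-congʳ (by-contradiction λ ne → none (j , ne))) (zeroˡ y)) }
    where
    head≉0 : ¬ a zero ≈ 0#
    head≉0 = go i₀ nz
      where
      go : ∀ i → ¬ a i ≈ 0# → ¬ a zero ≈ 0#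
      go zero    nz = nz
      go (suc i) nz = ⊥-elim (none (i , nz))
    y = proj₁ (invertible (a zero) head≉0)
    ay≈1 = proj₂ (invertible (a zero) head≉0)
  ... | yes ex with largest v na (a ∘ suc) ex
  ...   | i , y , ay≈1 , ints = compare (decide (Int v (a zero * y)))
    where
    compare : Dec (Int v (a zero * y)) → Σ[ i ∈ Fin (suc n) ] Σ[ y ∈ Carrier ] a i * y ≈ 1# × (∀ j → Int v (a j * y))
    compare (yes i₀≤) = suc i , y , ay≈1 , λ { zero → i₀≤ ; (suc j) → ints j }
    compare (no big) with invertible (a zero) (λ e → big (int-0 v (trans (*-congʳ e) (zeroˡ y))))
    ... | y₀ , ay₀≈1 = zero , y₀ , ay₀≈1 , λ
      { zero → int-cong v (sym ay₀≈1) (int-1 v)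
      ; (suc j) → int-cong v (trans (solve 4 (λ aj y ai y₀ → aj :* y :* (ai :* y₀) := ai :* y :* (aj :* y₀)) refl (a (suc j)) y (a (suc i)) y₀)
                    (trans (*-congʳ ay≈1) (*-identityˡ _)))
          (int-* v (ints j) (small⇒int v (not-int⇒inverse-small v
            (trans (solve 4 (λ a y b z → a :* y :* (b :* z) := a :* z :* (b :* y)) refl (a zero) y (a (suc i)) y₀)
              (trans (*-cong ay₀≈1 ay≈1) (*-identityˡ 1#))) big))) }

HasFinitelyManyPoles : ExcludedMiddle (lsuc 0ℓ) → Field → Set₁
HasFinitelyManyPoles em K = ∀ x → Σ[ T ∈ List (AbsoluteValue K) ]
  (∀ v → NonArchimedean v → ¬ AbsoluteValues.Int em v x → Any (_∼ v) T)

-- Places of a finite extension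

module Places (em : ExcludedMiddle (lsuc 0ℓ)) {k : Field} (E : Extension k) {n : ℕ} (e : Basis E n) where
  open Classical em
  open LinearAlgebra em
  private
    module k = Field k
    module E = Extension E
    module Vₖ = AbsoluteValues em {k}
    R = E.commutativeRing
  open AbsoluteValues em {E.top}
  open E using (Carrier; _≈_; _+_; _*_; -_; 0#; 1#; ι; refl; sym; trans)
  open Basis e
  open FieldProperties E.top
  open RingSolver R
  open RingProperties E.ring using (-0#≈0#)
  private module Sum = MonoidSum E.+-commutativeMonoid

  ι-inverse : ∀ {a b} → a k.* b k.≈ k.1# → ι a * ι b ≈ 1#
  ι-inverse {a} {b} ab≈1 = trans (sym (ι.*-homo a b)) (trans (ι.⟦⟧-cong ab≈1) ι.1#-homo)

  private
    -- If w were trivial on k, it would be bounded on the whole of E.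
    module _ (w : AbsoluteValue E.top) (trivial : ∀ a → ¬ a k.≈ k.0# → ¬ Small w (ι a)) where
      private module w = AbsoluteValue w

      int-ι : ∀ a → Int w (ι a)
      int-ι a = go (decide (a k.≈ k.0#))
        where
        go : Dec (a k.≈ k.0#) → Int w (ι a)
        go (yes a≈0) = int-0 w (trans (ι.⟦⟧-cong a≈0) ι.0#-homo)
        go (no a≉0) with k.invertible a a≉0
        ... | b , ab≈1 = not-small⇒int-inverse w (trans (E.*-comm (ι b) (ι a)) (ι-inverse ab≈1))
          (trivial b (FieldProperties.unit≉0 k (k.trans (k.*-comm b a) ab≈1)))

      combination-bound : ∀ {m} (v : Fin m → Carrier) → ∃[ C ] 0ℚ ℚ.< C × (∀ a → w.∣ combination E a v ∣ ≺ C)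
      combination-bound {zero}  v = 1ℚ , RationalPowers.0<1 , λ a → small-0 w refl
      combination-bound {suc m} v with ℝ≥0.inhabited (w.∣ v zero ∣) | combination-bound (v ∘ suc)
      -- The coefficient `ι (a zero)` has absolute value at most 1, and 2 serves as a rational
      -- number strictly above it.
      ... | B , v<B | C , 0<C , bound = two ℚ.* B ℚ.+ C ,
        ≡.subst (ℚ._< two ℚ.* B ℚ.+ C) (ℚ.+-identityʳ 0ℚ) (ℚ.+-mono-< (RationalPowers.*-positive 0<2 (ℝ≥0.positive (w.∣ v zero ∣) v<B)) 0<C) ,
        λ a → w.triangle (w.∣xy∣≤∣x∣∣y∣ (int-ι (a zero) two 1<2) v<B) (bound (a ∘ suc))
        where
        two = 1ℚ ℚ.+ 1ℚ
        1<2 : 1ℚ ℚ.< two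
        1<2 = ≡.subst (ℚ._< two) (ℚ.+-identityʳ 1ℚ) (ℚ.+-monoʳ-< 1ℚ RationalPowers.0<1)
        0<2 : 0ℚ ℚ.< two
        0<2 = ℚ.<-trans RationalPowers.0<1 1<2

      not-trivial : ⊥
      not-trivial with w.nontrivial
      ... | c , c≉0 , c<1 with E.invertible c c≉0 | combination-bound basis
      ...   | d , cd≈1 | C , 0<C , bound with RationalPowers.reciprocal C 0<C
      ...     | δ , 0<δ , Cδ≡1 with archimedean w c<1 1# δ 0<δ
      ...       | m , cᵐ<δ = 1-not-small w (w.cong power
          (≡.subst (w.∣ d ^ m * (c ^ m * 1#) ∣ ≺_) Cδ≡1 (w.∣xy∣≤∣x∣∣y∣ (w.cong (sym (proj₂ (coordinates (d ^ m)))) (bound (proj₁ (coordinates (d ^ m))))) cᵐ<δ)))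
        where
        power : d ^ m * (c ^ m * 1#) ≈ 1#
        power = trans (solve 2 (λ d c → d :* (c :* con (1 , 0)) := c :* d) refl (d ^ m) (c ^ m)) (^-inverse cd≈1 m)

    restriction-nontrivial : ∀ w → ∃[ a ] ¬ a k.≈ k.0# × Small w (ι a)
    restriction-nontrivial w = go (decide (∃[ a ] ¬ a k.≈ k.0# × Small w (ι a)))
      where
      go : Dec (∃[ a ] ¬ a k.≈ k.0# × Small w (ι a)) → ∃[ a ] ¬ a k.≈ k.0# × Small w (ι a)
      go (yes h) = h
      go (no ¬h) = ⊥-elim (not-trivial w λ a a≉0 s → ¬h (a , a≉0 , s))

  restrict : AbsoluteValue E.top → AbsoluteValue k
  restrict w = record
    { ∣_∣         = λ a → w.∣ ι a ∣
    ; cong        = λ e → w.cong (ι.⟦⟧-cong e)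
    ; ∣0∣≤0       = λ 0<q → w.cong (sym ι.0#-homo) (w.∣0∣≤0 0<q)
    ; ∣x∣≤0⇒x≈0   = λ h → ι-injective E (w.∣x∣≤0⇒x≈0 h)
    ; ∣1∣≤1       = λ 1<q → w.cong (sym ι.1#-homo) (w.∣1∣≤1 1<q)
    ; ∣xy∣≤∣x∣∣y∣ = λ p q → w.cong (sym (ι.*-homo _ _)) (w.∣xy∣≤∣x∣∣y∣ p q)
    ; ∣x∣∣y∣≤∣xy∣ = λ p → w.∣x∣∣y∣≤∣xy∣ (w.cong (ι.*-homo _ _) p)
    ; triangle    = λ p q → w.cong (sym (ι.+-homo _ _)) (w.triangle p q)
    ; nontrivial  = restriction-nontrivial w
    }
    where module w = AbsoluteValue w

  restrict-nonArchimedean : ∀ w → NonArchimedean w → NonArchimedean (restrict w)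
  restrict-nonArchimedean w na p q = AbsoluteValue.cong w (sym (ι.+-homo _ _)) (na p q)

  private
    -- Elements that separate each place from the others are linearly independent over `k`. Divide a
    -- relation by its term with the largest coefficient; which one is largest can be decided at
    -- `w zero`, because all restrictions to `k` have the same small elements. At the place of that
    -- term the relation then reads 1 plus small terms.
    inequivalent-bound : ∀ {m} (w : Fin m → AbsoluteValue E.top) → (∀ i → NonArchimedean (w i)) →
      (∀ i j → i ≢ j → ¬ w i ∼ w j) → (∀ i j a → Small (w i) (ι a) → Small (w j) (ι a)) → m ℕ.≤ n
    inequivalent-bound {zero}  w na ≁ compatible = ℕ.z≤n
    inequivalent-bound {suc m} w na ≁ compatible = independent≤spanning E {v = λ i → z i} independent-z (basis-spanning E e)
      where
      module w i = AbsoluteValue (w i)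
      separator = λ i → separate (w i) (removeAt w i) (na i) (λ j → na (punchIn i j))
                          (λ j → ≁ i (punchIn i j) (λ eq → Fin.punchInᵢ≢i i j (≡.sym eq)))
      z z⁻¹ : Fin (suc m) → Carrier
      z i   = proj₁ (separator i)
      z⁻¹ i = proj₁ (proj₂ (separator i))

      zz⁻¹≈1 : ∀ i → z i * z⁻¹ i ≈ 1#
      zz⁻¹≈1 i = proj₁ (proj₂ (proj₂ (separator i)))
      small-z⁻¹ : ∀ i → Small (w i) (z⁻¹ i)
      small-z⁻¹ i = proj₁ (proj₂ (proj₂ (proj₂ (separator i))))
      small-z : ∀ i j → i ≢ j → Small (w j) (z i)
      small-z i j i≢j = ≡.subst (λ l → Small (w l) (z i)) (Fin.punchIn-punchOut i≢j)
        (proj₂ (proj₂ (proj₂ (proj₂ (separator i)))) (Fin.punchOut i≢j))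

      int-transfer : ∀ i b → Int (w zero) (ι b) → Int (w i) (ι b)
      int-transfer i b ib = go (decide (b k.≈ k.0#))
        where
        go : Dec (b k.≈ k.0#) → Int (w i) (ι b)
        go (yes b≈0) = int-0 (w i) (trans (ι.⟦⟧-cong b≈0) ι.0#-homo)
        go (no b≉0) with k.invertible b b≉0
        ... | c , bc≈1 = not-small⇒int-inverse (w i) (trans (E.*-comm (ι c) (ι b)) (ι-inverse bc≈1))
          λ s → int⇒inverse-not-small (w zero) (trans (E.*-comm (ι c) (ι b)) (ι-inverse bc≈1)) ib (compatible i zero c s)

      dominated : ∀ (a : Fin (suc m) → k.Carrier) → combination E a z ≈ 0# →
        Σ[ i ∈ Fin (suc m) ] Σ[ y ∈ k.Carrier ] a i k.* y k.≈ k.1# × (∀ j → Int (w zero) (ι (a j k.* y))) → ⊥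
      dominated a rel (i , y , ay≈1 , ints) = 1-not-small (w i) (w.cong i -S≈1 (small-neg (w i) small-S))
        where
        t : Fin (suc m) → Carrier
        t j = ι (a j k.* y) * (z j * z⁻¹ i)
        S = ∑ R (λ j → t (punchIn i j))
        small-S : Small (w i) S
        small-S = small-∑ (w i) (na i) (λ j → t (punchIn i j)) λ j → int-*-small (w i) (int-transfer i (a (punchIn i j) k.* y) (ints (punchIn i j)))
          (small-*-int (w i) (small-z (punchIn i j) i (Fin.punchInᵢ≢i i j)) (small⇒int (w i) (small-z⁻¹ i)))
        total : 1# + S ≈ 0#
        total = trans (E.+-congʳ (sym (trans (E.*-cong (trans (ι.⟦⟧-cong ay≈1) ι.1#-homo) (zz⁻¹≈1 i)) (E.*-identityˡ 1#))))
          (trans (sym (Sum.sum-remove {i = i} t)) (trans (Sums.∑-cong R λ j → trans (E.*-congʳ {z j * z⁻¹ i} (ι.*-homo (a j) y))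
              (solve 4 (λ a y z i → a :* y :* (z :* i) := y :* i :* (a :* z)) refl (ι (a j)) (ι y) (z j) (z⁻¹ i)))
            (trans (sym (Sums.*-∑ R (ι y * z⁻¹ i) (λ j → ι (a j) * z j))) (trans (E.*-congˡ rel) (E.zeroʳ _)))))
        -S≈1 : - S ≈ 1#
        -S≈1 = trans (solve 1 (λ s → :- s := con (1 , 0) :- (con (1 , 0) :+ s)) refl S)
          (trans (E.+-congˡ (trans (E.-‿cong total) -0#≈0#)) (E.+-identityʳ 1#))

      independent-z : Independent E z
      independent-z a rel = go (all-or (λ i → a i k.≈ k.0#))
        where
        go : (∀ i → a i k.≈ k.0#) ⊎ (∃[ i ] ¬ a i k.≈ k.0#) → ∀ i → a i k.≈ k.0#
        go (inj₁ h)  = h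
        go (inj₂ nz) = ⊥-elim (dominated a rel
          (Vₖ.largest (restrict (w zero)) (restrict-nonArchimedean (w zero) (na zero)) a nz))

  IsAbove : AbsoluteValue k → AbsoluteValue E.top → Set
  IsAbove v w = NonArchimedean w × restrict w ∼ v

  finitely-many-above : ∀ v → Σ[ T ∈ List (AbsoluteValue E.top) ] (∀ w → IsAbove v w → Any (_∼ w) T)
  finitely-many-above v = grow (suc n) {0} (λ ()) (λ ()) (λ ()) (ℕ.≤-reflexive (≡.sym (ℕ.+-identityʳ (suc n))))
    where
    grow : ∀ fuel {m} (w : Fin m → AbsoluteValue E.top) → (∀ i → IsAbove v (w i)) → (∀ i j → i ≢ j → ¬ w i ∼ w j) →
           suc n ℕ.≤ fuel ℕ.+ m → Σ[ T ∈ List (AbsoluteValue E.top) ] (∀ w → IsAbove v w → Any (_∼ w) T)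
    grow zero w above ≁ h = ⊥-elim (ℕ.<⇒≱ h (inequivalent-bound w (proj₁ ∘ above) ≁
      λ i j a s → Vₖ.≼⇒small-⊆ {v = v} {restrict (w j)} (proj₂ (proj₂ (above j)))
                    (Vₖ.≼⇒small-⊆ {v = restrict (w i)} {v} (proj₁ (proj₂ (above i))) s)))
    grow (suc fuel) {m} w above ≁ h = go (decide₁ (Σ[ u ∈ AbsoluteValue E.top ] IsAbove v u × (∀ i → ¬ w i ∼ u)))
      where
      go : Dec (Σ[ u ∈ AbsoluteValue E.top ] IsAbove v u × (∀ i → ¬ w i ∼ u)) → Σ[ T ∈ List (AbsoluteValue E.top) ] (∀ w → IsAbove v w → Any (_∼ w) T)
      go (yes (u , above-u , new)) = grow fuel (u ∷ w) (λ { zero → above-u ; (suc i) → above i })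
        (λ { zero zero ne → ⊥-elim (ne ≡.refl) ; zero (suc j) _ → new j ∘ ∼-sym {u = u} {w j} ; (suc i) zero _ → new i
           ; (suc i) (suc j) ne → ≁ i j λ { ≡.refl → ne ≡.refl } })
        (≡.subst (suc n ℕ.≤_) (≡.sym (ℕ.+-suc fuel m)) h)
      go (no none) = List.tabulate w , λ u above-u → covered u above-u (all-or (λ i → ¬ w i ∼ u))
        where
        covered : ∀ u → IsAbove v u → (∀ i → ¬ w i ∼ u) ⊎ (∃[ i ] ¬ ¬ w i ∼ u) → Any (_∼ u) (List.tabulate w)
        covered u above-u (inj₁ h)       = ⊥-elim (none (u , above-u , h))
        covered u above-u (inj₂ (i , h)) = Any.tabulate⁺ i (by-contradiction h)

  -- The poles of x lie above those of the entries of a matrix of multiplication by x.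
  poles-extend : HasFinitelyManyPoles em k → HasFinitelyManyPoles em E.top
  poles-extend poles x = List.concatMap (λ v → proj₁ (finitely-many-above v)) below , λ w na pole → covers w na pole
    where
    M : Fin n → Fin n → k.Carrier
    M i j = proj₁ (coordinates (x * basis j)) i
    below : List (AbsoluteValue k)
    below = List.concat (List.tabulate λ i → List.concat (List.tabulate λ j → proj₁ (poles (M i j))))
    -- Dividing the expansion of `x * basis i` by a basis vector `basis i` of largest absolute value
    -- at `w` writes `x` as a combination of the matrix entries with integral coefficients.
    integral : ∀ w → NonArchimedean w → (∀ i j → Int w (ι (M i j))) → Int w x
    integral w na ints with largest w na basis nonzero
      where
      nonzero : ∃[ i ] ¬ basis i ≈ 0#
      nonzero = go (all-or (λ i → basis i ≈ 0#))
        where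
        go : (∀ i → basis i ≈ 0#) ⊎ (∃[ i ] ¬ basis i ≈ 0#) → ∃[ i ] ¬ basis i ≈ 0#
        go (inj₂ h) = h
        go (inj₁ h) = ⊥-elim (E.0≉1 (sym (trans (proj₂ (coordinates 1#))
          (Sums.∑-0 R {f = λ i → ι (proj₁ (coordinates 1#) i) * basis i} λ i → trans (E.*-congˡ (h i)) (E.zeroʳ _)))))
    ... | i , y , ey≈1 , ints′ = int-cong w (sym expansion)
      (int-∑ w na (λ l → ι (M l i) * (basis l * y)) (λ l → int-* w (ints l i) (ints′ l)))
      where
      expansion : x ≈ ∑ R (λ l → ι (M l i) * (basis l * y))
      expansion = trans (sym (trans (E.*-congˡ ey≈1) (E.*-identityʳ x))) (trans (sym (E.*-assoc x (basis i) y))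
        (trans (E.*-congʳ (proj₂ (coordinates (x * basis i)))) (trans (Sums.∑-* R y (λ l → ι (M l i) * basis l))
          (Sums.∑-cong R λ l → E.*-assoc (ι (M l i)) (basis l) y))))
    covers : ∀ w → NonArchimedean w → ¬ Int w x → Any (_∼ w) (List.concatMap (λ v → proj₁ (finitely-many-above v)) below)
    covers w na pole = go (all-or (λ { (i , j) → Int w (ι (M i j)) }))
      where
      go : (∀ ij → Int w (ι (M (proj₁ ij) (proj₂ ij)))) ⊎ (∃[ ij ] ¬ Int w (ι (M (proj₁ ij) (proj₂ ij)))) →
           Any (_∼ w) (List.concatMap (λ v → proj₁ (finitely-many-above v)) below)
      go (inj₁ h)              = ⊥-elim (pole (integral w na λ i j → h (i , j)))
      go (inj₂ ((i , j) , ni)) = Any.concat⁺ (Any.map⁺ (Any.map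
        (λ {v} v∼ → proj₂ (finitely-many-above v) w (na , Vₖ.∼-sym {u = v} {restrict w} v∼))
        (Any.concat⁺ (Any.tabulate⁺ i (Any.concat⁺ (Any.tabulate⁺ j
          (proj₂ (poles (M i j)) (restrict w) (restrict-nonArchimedean w na) ni)))))))

-- Finiteness of poles over ℚ and 𝔽ₚ(t)

prime∤⇒coprime : ∀ {p c} → Prime p → p ∤ c → Coprime p c
prime∤⇒coprime pr p∤c (d∣p , d∣c) with prime⇒irreducible pr d∣p
... | inj₁ d≡1    = d≡1
... | inj₂ ≡.refl = ⊥-elim (p∤c d∣c)

least : ExcludedMiddle (lsuc 0ℓ) → (P : ℕ → Set) → ∃ P → ∃[ m ] P m × (∀ j → j ℕ.< m → ¬ P j)
least em P (n , p) = go n p (<-wellFounded n)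
  where
  open Classical em
  go : ∀ n → P n → Acc ℕ._<_ n → ∃[ m ] P m × (∀ j → j ℕ.< m → ¬ P j)
  go n p (acc rs) with decide (∃[ j ] j ℕ.< n × P j)
  ... | yes (j , j<n , q) = go j q (rs j<n)
  ... | no none           = n , p , λ j j<n q → none (j , j<n , q)

module _ (em : ExcludedMiddle (lsuc 0ℓ)) {K : Field} where
  open Classical em

  -- A set of places is finite up to equivalence once its members carry labels from a finite list
  -- that determine them; for each label that occurs one representative is chosen.
  representatives : {A : Set} (I : List A) (P : A → AbsoluteValue K → Set) → (∀ a u v → P a u → P a v → u ∼ v) →
                    Σ[ T ∈ List (AbsoluteValue K) ] (∀ v a → a ∈ˡ I → P a v → Any (_∼ v) T)
  representatives List.[] P same = List.[] , λ v a ()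
  representatives (a List.∷ I) P same with representatives I P same | decide₁ (Σ[ u ∈ AbsoluteValue K ] P a u)
  ... | T , covers | yes (u , p) = u List.∷ T , λ { v _ (here ≡.refl) q → here (same a u v p q) ; v b (there b∈) q → there (covers v b b∈ q) }
  ... | T , covers | no none     = T , λ { v _ (here ≡.refl) q → ⊥-elim (none (v , q)) ; v b (there b∈) q → covers v b b∈ q }

module Naturals (em : ExcludedMiddle (lsuc 0ℓ)) (K : Field) where
  open Classical em
  open Field K hiding (zero)
  open AbsoluteValues em {K}
  open Mult semiring renaming (_×_ to _·_)

  natural : ℕ → Carrier
  natural n = n · 1#

  natural-+ : ∀ m n → natural (m ℕ.+ n) ≈ natural m + natural n
  natural-+ m n = ×-homo-+ 1# m n

  natural-* : ∀ m n → natural (m ℕ.* n) ≈ natural m * natural n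
  natural-* = ×1-homo-*

  natural-≡ : ∀ {m n} → m ≡ n → natural m ≈ natural n
  natural-≡ = ×-congˡ

  int-natural : ∀ v → NonArchimedean v → ∀ n → Int v (natural n)
  int-natural v na zero    = int-0 v refl
  int-natural v na (suc n) = int-+ v na (int-1 v) (int-natural v na n)

IsFraction : (K : Field) → Field.Carrier K → ℕ → ℕ → Set
IsFraction K x n d = 0 ℕ.< d × Coprime n d × (x * (d · 1#) ≈ n · 1# ⊎ x * (d · 1#) ≈ - (n · 1#))
  where
  open Field K
  open Mult semiring renaming (_×_ to _·_)

-- A nonarchimedean absolute value on such a field K is determined by the least
-- positive integer that it makes small.
module RationalPoles (em : ExcludedMiddle (lsuc 0ℓ)) (K : Field)
  (fraction : ∀ x → ∃[ n ] ∃[ d ] IsFraction K x n d) where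
  open Classical em
  open Field K hiding (zero)
  open AbsoluteValues em {K}
  open Naturals em K
  open RingSolver commutativeRing

  private
    IsLeast : ℕ → AbsoluteValue K → Set
    IsLeast m v = NonArchimedean v × (0 ℕ.< m × Small v (natural m)) × (∀ j → j ℕ.< m → ¬ (0 ℕ.< j × Small v (natural j)))

    small⇒∣ : ∀ {m v} → IsLeast m v → ∀ n → Small v (natural n) → m ∣ n
    small⇒∣ {suc m-1} {v} (na , (0<m , sm) , min) n sn = go (n % m) ≡.refl
      where
      m = suc m-1
      division : n ≡ n % m ℕ.+ n / m ℕ.* m
      division = m≡m%n+[m/n]*n n m
      go : ∀ r → n % m ≡ r → m ∣ n
      go zero    eq = divides (n / m) (≡.trans division (≡.cong (ℕ._+ n / m ℕ.* m) eq))
      go (suc r) eq = ⊥-elim (min (n % m) (m%n<n n m) (≡.subst (0 ℕ.<_) (≡.sym eq) (ℕ.s≤s ℕ.z≤n) , AbsoluteValue.cong v remainder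
              (small-+ v na sn (small-neg v (int-*-small v (int-natural v na (n / m)) sm)))))
        where
        remainder : natural n - natural (n / m) * natural m ≈ natural (n % m)
        remainder = trans (+-cong (trans (natural-≡ division) (natural-+ (n % m) (n / m ℕ.* m))) (-‿cong (sym (natural-* (n / m) m))))
          (solve 2 (λ a b → a :+ b :- b := a) refl (natural (n % m)) (natural (n / m ℕ.* m)))

    ∣⇒small : ∀ {m v} → IsLeast m v → ∀ {n} → m ∣ n → Small v (natural n)
    ∣⇒small {m} {v} (na , (0<m , sm) , min) (divides q eq) =
      AbsoluteValue.cong v (sym (trans (natural-≡ eq) (natural-* q m))) (int-*-small v (int-natural v na q) sm)

    numerator-small : ∀ v {y n} → y ≈ natural n ⊎ y ≈ - natural n → Small v y → Small v (natural n)
    numerator-small v (inj₁ e) s = AbsoluteValue.cong v e s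
    numerator-small v {y} {n} (inj₂ e) s = AbsoluteValue.cong v
      (trans (-‿cong e) (solve 1 (λ x → :- (:- x) := x) refl (natural n))) (small-neg v s)

    small-numerator : ∀ v {y n} → y ≈ natural n ⊎ y ≈ - natural n → Small v (natural n) → Small v y
    small-numerator v (inj₁ e) s = AbsoluteValue.cong v (sym e) s
    small-numerator v (inj₂ e) s = AbsoluteValue.cong v (sym e) (small-neg v s)

    int-numerator : ∀ v → NonArchimedean v → ∀ {y n} → y ≈ natural n ⊎ y ≈ - natural n → Int v y
    int-numerator v na {n = n} (inj₁ e) = int-cong v (sym e) (int-natural v na n)
    int-numerator v na {n = n} (inj₂ e) = int-cong v (sym e) (int-neg v (int-natural v na n))

    divide : ∀ {x y z} → y * z ≈ 1# → x * y * z ≈ x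
    divide {x} {y} {z} e = trans (*-assoc x y z) (trans (*-congˡ e) (*-identityʳ x))

    least-unique : ∀ m u v → IsLeast m u → IsLeast m v → u ∼ v
    least-unique m u v Lu Lv = small-⊆⇒∼ {u} {v} λ {x} s → transfer x s (fraction x)
      where
      transfer : ∀ x → Small u x → ∃[ n ] ∃[ d ] IsFraction K x n d → Small v x
      transfer x s (n , d , 0<d , coprime , xd≈n) = finish (decide (m ∣ d))
        where
        m∣n : m ∣ n
        m∣n = small⇒∣ {v = u} Lu n (numerator-small u {n = n} xd≈n (small-*-int u s (int-natural u (proj₁ Lu) d)))
        finish : Dec (m ∣ d) → Small v x
        -- `m` divides both terms of a fraction in lowest terms, so it is 1, which is never small.
        finish (yes m∣d) = ⊥-elim (1-not-small u (AbsoluteValue.cong u (trans (natural-≡ (coprime (m∣n , m∣d))) (+-identityʳ 1#))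
          (proj₂ (proj₁ (proj₂ Lu)))))
        finish (no m∤d) = with-inverse (invertible (natural d) (small≉0 v ns))
          where
          ns : ¬ Small v (natural d)
          ns sd = m∤d (small⇒∣ {v = v} Lv d sd)
          with-inverse : ∃[ d⁻¹ ] natural d * d⁻¹ ≈ 1# → Small v x
          with-inverse (d⁻¹ , e) = AbsoluteValue.cong v (divide e)
            (small-*-int v (small-numerator v {n = n} xd≈n (∣⇒small {v = v} Lv m∣n)) (not-small⇒int-inverse v e ns))

  -- At a pole of n / d the denominator is small, so the least positive small integer, which
  -- determines the place, is at most `d`.
  poles : HasFinitelyManyPoles em K
  poles x with fraction x
  ... | n , d , 0<d , coprime , xd≈n = proj₁ reps , covers
    where
    reps : Σ[ T ∈ List (AbsoluteValue K) ] (∀ v m → m ∈ˡ List.upTo (suc d) → IsLeast m v → Any (_∼ v) T)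
    reps = representatives em (List.upTo (suc d)) IsLeast least-unique
    small-d : ∀ v → NonArchimedean v → ¬ Int v x → Small v (natural d)
    small-d v na pole = by-contradiction λ ns → contra ns (invertible (natural d) (small≉0 v ns))
      where
      contra : ¬ Small v (natural d) → ∃[ d⁻¹ ] natural d * d⁻¹ ≈ 1# → ⊥
      contra ns (d⁻¹ , e) = pole (int-cong v (divide e) (int-* v (int-numerator v na {n = n} xd≈n) (not-small⇒int-inverse v e ns)))
    covers : ∀ v → NonArchimedean v → ¬ Int v x → Any (_∼ v) (proj₁ reps)
    covers v na pole = go (least em (λ m → 0 ℕ.< m × Small v (natural m)) (d , 0<d , small-d v na pole))
      where
      go : ∃[ m ] (0 ℕ.< m × Small v (natural m)) × (∀ j → j ℕ.< m → ¬ (0 ℕ.< j × Small v (natural j))) → Any (_∼ v) (proj₁ reps)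
      go (m , p , min) = proj₂ reps v m (Membership.∈-upTo⁺ (bound (m ℕ.≤? d))) (na , p , min)
        where
        bound : Dec (m ℕ.≤ d) → m ℕ.< suc d
        bound (yes m≤d) = ℕ.s≤s m≤d
        bound (no m≰d)  = ⊥-elim (min d (ℕ.≰⇒> m≰d) (0<d , small-d v na pole))

private
  natural≡ : ∀ n → RationalPowers.natural n ≡ Mult._×_ (Field.semiring ℚ-field) n 1ℚ
  natural≡ zero    = ≡.refl
  natural≡ (suc n) = ≡.cong (1ℚ ℚ.+_) (natural≡ n)

  clear-denominator : ∀ x i → ℚ.toℚᵘ i ℚᵘ.≃ ℚᵘ.mkℚᵘ (ℚ.↥ x) 0 → x ℚ.* RationalPowers.natural (ℚ.↧ₙ x) ≡ i
  clear-denominator x@(ℚ.mkℚ n d-1 c) i e = ℚ.toℚᵘ-injective (ℚᵘ.≃-trans (ℚ.toℚᵘ-homo-* x (RationalPowers.natural (suc d-1)))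
    (ℚᵘ.≃-trans (ℚᵘ.*-congˡ {ℚ.toℚᵘ x} (RationalPowers.toℚᵘ-natural (suc d-1))) (ℚᵘ.≃-trans
      (ℚᵘ.*≡* (≡.trans (ℤ.*-identityʳ (n ℤ.* ℤ.+ suc d-1)) (≡.cong (λ m → n ℤ.* ℤ.+ m) (≡.sym (ℕ.*-identityʳ (suc d-1))))))
      (ℚᵘ.≃-sym e))))

ℚ-fraction : ∀ x → ∃[ n ] ∃[ d ] IsFraction ℚ-field x n d
ℚ-fraction x = ℤ.∣ ℚ.↥ x ∣ , ℚ.↧ₙ x , ℕ.s≤s ℕ.z≤n , lowest-terms x , numerator (ℚ.↥ x) ≡.refl
  where
  lowest-terms : ∀ x → Coprime ℤ.∣ ℚ.↥ x ∣ (ℚ.↧ₙ x)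
  lowest-terms (ℚ.mkℚ n d-1 c) = Coprimality.recompute c
  numerator : ∀ i → ℚ.↥ x ≡ i → x ℚ.* (Mult._×_ (Field.semiring ℚ-field) (ℚ.↧ₙ x) 1ℚ) ≡ Mult._×_ (Field.semiring ℚ-field) ℤ.∣ i ∣ 1ℚ ⊎
                                 x ℚ.* (Mult._×_ (Field.semiring ℚ-field) (ℚ.↧ₙ x) 1ℚ) ≡ ℚ.- (Mult._×_ (Field.semiring ℚ-field) ℤ.∣ i ∣ 1ℚ)
  numerator (ℤ.+ n) eq = inj₁ (≡.subst₂ (λ a b → x ℚ.* a ≡ b) (natural≡ (ℚ.↧ₙ x)) (natural≡ n)
    (clear-denominator x (RationalPowers.natural n) (≡.subst (λ i → _ ℚᵘ.≃ ℚᵘ.mkℚᵘ i 0) (≡.sym eq) (RationalPowers.toℚᵘ-natural n))))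
  numerator ℤ.-[1+ n ] eq = inj₂ (≡.subst₂ (λ a b → x ℚ.* a ≡ ℚ.- b) (natural≡ (ℚ.↧ₙ x)) (natural≡ (suc n))
    (clear-denominator x (ℚ.- RationalPowers.natural (suc n)) (≡.subst (λ i → ℚ.toℚᵘ (ℚ.- RationalPowers.natural (suc n)) ℚᵘ.≃ ℚᵘ.mkℚᵘ i 0) (≡.sym eq)
      (ℚᵘ.≃-trans (ℚ.toℚᵘ-homo‿- (RationalPowers.natural (suc n))) (ℚᵘ.-‿cong (RationalPowers.toℚᵘ-natural (suc n)))))))

module FunctionFieldPoles (em : ExcludedMiddle (lsuc 0ℓ)) (p : ℕ) (isPrime : Prime p) (K : Field)
  (rational : IsRationalFunctionField p K) where
  open Classical em
  open Field K hiding (zero)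
  open FieldProperties K
  open AbsoluteValues em {K}
  open Naturals em K
  open RingSolver commutativeRing
  open IsRationalFunctionField rational using (characteristic; t; generated)

  private
    instance
      p≢0 : ℕ.NonZero p
      p≢0 = prime⇒nonZero isPrime

    natural-p : ∀ n → natural (n ℕ.* p) ≈ 0#
    natural-p n = trans (natural-* n p) (trans (*-congˡ characteristic) (zeroʳ _))

    constant-zero : ∀ {c} → p ∣ c → natural c ≈ 0#
    constant-zero (divides q eq) = trans (natural-≡ eq) (natural-p q)

    constant-inverse : ∀ {c} → p ∤ c → ∃[ c⁻¹ ] natural c⁻¹ * natural c ≈ 1#
    constant-inverse {c} p∤c with coprime-Bézout (prime∤⇒coprime isPrime p∤c)
    ... | Bézout.-+ x y eq = y , trans (sym (natural-* y c)) (trans (natural-≡ (≡.sym eq))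
            (trans (+-congˡ (natural-p x)) (+-identityʳ 1#)))
    -- Here 1 + y c is a multiple of `p`, so `y` is the negative of an inverse of `c`. Its opposite
    -- is expressed with natural numbers as y (y c), because y c is -1.
    ... | Bézout.+- x y eq = y ℕ.* (y ℕ.* c) , (trans (*-congʳ (trans (natural-* y (y ℕ.* c)) (*-congˡ (natural-* y c))))
            (trans (solve 2 (λ y c → y :* (y :* c) :* c := (con (1 , 0) :+ y :* c) :* (y :* c :- con (1 , 0)) :+ con (1 , 0)) refl (natural y) (natural c))
              (trans (+-congʳ (trans (*-congʳ vanishes) (zeroˡ _))) (+-identityˡ 1#))))
      where
      vanishes : 1# + natural y * natural c ≈ 0#
      vanishes = trans (+-congˡ (sym (natural-* y c))) (trans (natural-≡ eq) (natural-p x))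

    opposite : ∃[ m ] natural m ≈ - 1#
    opposite = p ℕ.∸ 1 , trans (solve 1 (λ x → x := (con (1 , 0) :+ x) :- con (1 , 0)) refl _)
      (trans (+-congʳ (trans (natural-≡ (ℕ.m+[n∸m]≡n {1} {p} (ℕ.>-nonZero⁻¹ p))) characteristic)) (+-identityˡ _))

    -- Poly n y: y is a polynomial in t of degree < n.
    data Poly : ℕ → Carrier → Set where
      nil  : ∀ {y} → y ≈ 0# → Poly 0 y
      cons : ∀ {n y} c {z} → Poly n z → y ≈ natural c + t * z → Poly (suc n) y

    Poly-cong : ∀ {n x y} → x ≈ y → Poly n x → Poly n y
    Poly-cong e (nil f)      = nil (trans (sym e) f)
    Poly-cong e (cons c d f) = cons c d (trans (sym e) f)

    Poly-0 : ∀ {n y} → y ≈ 0# → Poly n y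
    Poly-0 {zero}  e = nil e
    Poly-0 {suc n} e = cons 0 (Poly-0 refl) (trans e (sym (trans (+-identityˡ _) (zeroʳ t))))

    Poly-constant : ∀ c → Poly 1 (natural c)
    Poly-constant c = cons c (nil refl) (sym (trans (+-congˡ (zeroʳ t)) (+-identityʳ _)))

    Poly-+ : ∀ {n x y} → Poly n x → Poly n y → Poly n (x + y)
    Poly-+ (nil e) (nil f) = nil (trans (+-cong e f) (+-identityˡ 0#))
    Poly-+ (cons c {x} d e) (cons c′ {y} d′ e′) = cons (c ℕ.+ c′) (Poly-+ d d′) (trans (+-cong e e′)
      (trans (solve 5 (λ c c′ t x y → (c :+ t :* x) :+ (c′ :+ t :* y) := (c :+ c′) :+ t :* (x :+ y)) refl (natural c) (natural c′) t x y)
        (+-congʳ (sym (natural-+ c c′)))))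

    Poly-scale : ∀ {n x} a → Poly n x → Poly n (natural a * x)
    Poly-scale a (nil e) = nil (trans (*-congˡ e) (zeroʳ _))
    Poly-scale a (cons c {x} d e) = cons (a ℕ.* c) (Poly-scale a d) (trans (*-congˡ e)
      (trans (solve 4 (λ a c t x → a :* (c :+ t :* x) := a :* c :+ t :* (a :* x)) refl (natural a) (natural c) t x)
        (+-congʳ (sym (natural-* a c)))))

    Poly-neg : ∀ {n x} → Poly n x → Poly n (- x)
    Poly-neg {x = x} d = Poly-cong (trans (*-congʳ (proj₂ opposite)) (solve 1 (λ x → (:- con (1 , 0)) :* x := :- x) refl x))
      (Poly-scale (proj₁ opposite) d)

    Poly-shift : ∀ {n x} → Poly n x → Poly (suc n) (t * x)
    Poly-shift d = cons 0 d (sym (+-identityˡ _))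

    Poly-shift^ : ∀ j {n x} → Poly n x → Poly (j ℕ.+ n) (t ^ j * x)
    Poly-shift^ zero    d = Poly-cong (sym (*-identityˡ _)) d
    Poly-shift^ (suc j) d = Poly-cong (sym (*-assoc t (t ^ j) _)) (Poly-shift (Poly-shift^ j d))

    Poly-suc : ∀ {n x} → Poly n x → Poly (suc n) x
    Poly-suc (nil e)      = Poly-0 e
    Poly-suc (cons c d e) = cons c (Poly-suc d) e

    Poly-≤ : ∀ {m n x} → m ℕ.≤ n → Poly m x → Poly n x
    Poly-≤ {n = n} ℕ.z≤n       (nil e)      = Poly-0 e
    Poly-≤         (ℕ.s≤s m≤n) (cons c d e) = cons c (Poly-≤ m≤n d) e

    leading : ∀ {n y} → Poly (suc n) y → ∃[ c ] ∃[ z ] Poly n z × y ≈ z + natural c * t ^ n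
    leading (cons c (nil z≈0) e) = c , 0# , nil refl , trans e (trans (+-congˡ (trans (*-congˡ z≈0) (zeroʳ t)))
      (solve 1 (λ c → c :+ con (0 , 0) := con (0 , 0) :+ c :* con (1 , 0)) refl (natural c)))
    leading {suc n} (cons c {z} d@(cons _ _ _) e) with leading d
    ... | a , w , dw , f = a , natural c + t * w , cons c dw refl , trans e (trans (+-congˡ (*-congˡ f))
      (solve 5 (λ c t w a q → c :+ t :* (w :+ a :* q) := (c :+ t :* w) :+ a :* (t :* q)) refl (natural c) t w (natural a) (t ^ n)))

    ⟦_⟧ₜ : List ℕ → Carrier
    ⟦ f ⟧ₜ = evaluateℕ commutativeRing f t

    evaluate-Poly : ∀ f → Poly (List.length f) (⟦ f ⟧ₜ)
    evaluate-Poly List.[]      = nil refl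
    evaluate-Poly (c List.∷ f) = cons c (evaluate-Poly f) refl

    Monic : ℕ → Carrier → Set
    Monic m π = ∃[ r ] Poly m r × π ≈ t ^ m + r

    normalise : ∀ n {y} → Poly n y → y ≈ 0# ⊎ (Σ[ j ∈ ℕ ] Σ[ c ∈ ℕ ] Σ[ c⁻¹ ∈ ℕ ] Σ[ π ∈ Carrier ]
                  j ℕ.< n × Monic j π × natural c⁻¹ * natural c ≈ 1# × y ≈ natural c * π)
    normalise zero    (nil e) = inj₁ e
    normalise (suc n) {y} d with leading d
    ... | c , z , dz , e with p ∣? c
    ...   | yes p∣c with normalise n (Poly-cong (sym (trans e (trans (+-congˡ (trans (*-congʳ (constant-zero p∣c)) (zeroˡ _))) (+-identityʳ z)))) dz)
    ...     | inj₁ y≈0                             = inj₁ y≈0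
    ...     | inj₂ (j , a , b , π , j<n , rest) = inj₂ (j , a , b , π , ℕ.m<n⇒m<1+n j<n , rest)
    normalise (suc n) {y} d | c , z , dz , e | no p∤c with constant-inverse p∤c
    ... | c⁻¹ , c⁻¹c≈1 = inj₂ (n , c , c⁻¹ , natural c⁻¹ * y , ℕ.n<1+n n ,
      (natural c⁻¹ * z , Poly-scale c⁻¹ dz , trans (*-congˡ e)
        (trans (solve 4 (λ i z c q → i :* (z :+ c :* q) := i :* c :* q :+ i :* z) refl (natural c⁻¹) z (natural c) (t ^ n))
          (+-congʳ (trans (*-congʳ c⁻¹c≈1) (*-identityˡ _))))) ,
      c⁻¹c≈1 , sym (trans (solve 3 (λ c i y → c :* (i :* y) := i :* c :* y) refl (natural c) (natural c⁻¹) y)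
        (trans (*-congʳ c⁻¹c≈1) (*-identityˡ y))))

    division : ∀ {m π} → Monic m π → ∀ n {y} → Poly n y → ∃[ q ] ∃[ r ] Poly (n ℕ.∸ m) q × Poly m r × y ≈ q * π + r
    division {m} {π} (r₀ , dr₀ , π≈) n {y} d = go n d (n ℕ.≤? m)
      where
      go : ∀ n {y} → Poly n y → Dec (n ℕ.≤ m) → ∃[ q ] ∃[ r ] Poly (n ℕ.∸ m) q × Poly m r × y ≈ q * π + r
      go n {y} d (yes n≤m) = 0# , y , Poly-0 refl , Poly-≤ n≤m d , sym (trans (+-congʳ (zeroˡ π)) (+-identityˡ y))
      go zero d (no n≰m) = ⊥-elim (n≰m ℕ.z≤n)
      go (suc n) {y} d (no n≰m) = finish (leading d)
        where
        m≤n : m ℕ.≤ n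
        m≤n = ℕ.s≤s⁻¹ (ℕ.≰⇒> n≰m)
        j = n ℕ.∸ m
        finish : ∃[ c ] ∃[ z ] Poly n z × y ≈ z + natural c * t ^ n → ∃[ q ] ∃[ r ] Poly (suc n ℕ.∸ m) q × Poly m r × y ≈ q * π + r
        finish (c , z , dz , e) = assemble (go n
            (Poly-+ dz (Poly-neg (Poly-scale c (≡.subst (λ l → Poly l (t ^ j * r₀)) (ℕ.m∸n+n≡m m≤n) (Poly-shift^ j dr₀))))) (n ℕ.≤? m))
          where
          open SetoidReasoning setoid
          tⁿ : t ^ n ≈ t ^ j * t ^ m
          tⁿ = trans (reflexive (≡.cong (t ^_) (≡.sym (ℕ.m∸n+n≡m m≤n)))) (^-homo-* t j m)
          assemble : ∃[ q ] ∃[ r ] Poly j q × Poly m r × z - natural c * (t ^ j * r₀) ≈ q * π + r →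
                     ∃[ q ] ∃[ r ] Poly (suc n ℕ.∸ m) q × Poly m r × y ≈ q * π + r
          assemble (q , r , dq , dr , f) = q + natural c * t ^ j , r ,
            ≡.subst (λ l → Poly l (q + natural c * t ^ j)) (≡.sym (ℕ.+-∸-assoc 1 m≤n))
              (Poly-+ (Poly-suc dq) (Poly-scale c (Poly-cong (*-identityʳ _) (≡.subst (λ l → Poly l (t ^ j * 1#)) (ℕ.+-comm j 1)
                (Poly-shift^ j (Poly-cong (+-identityʳ 1#) (Poly-constant 1))))))) ,
            dr , (begin
              y
                ≈⟨ e ⟩
              z + natural c * t ^ n
                ≈⟨ +-congˡ (*-congˡ tⁿ) ⟩
              z + natural c * (t ^ j * t ^ m)
                ≈⟨ solve 5 (λ z c u v r → z :+ c :* (u :* v) := (z :- c :* (u :* r)) :+ c :* u :* (v :+ r)) refl z (natural c) (t ^ j) (t ^ m) r₀ ⟩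
              (z - natural c * (t ^ j * r₀)) + natural c * t ^ j * (t ^ m + r₀)
                ≈⟨ +-cong f (*-congˡ (sym π≈)) ⟩
              (q * π + r) + natural c * t ^ j * π
                ≈⟨ solve 4 (λ q π r a → (q :* π :+ r) :+ a :* π := (q :+ a) :* π :+ r) refl q π r (natural c * t ^ j) ⟩
              (q + natural c * t ^ j) * π + r ∎)

    module _ (v : AbsoluteValue K) (na : NonArchimedean v) (it : Int v t) where
      int-Poly : ∀ {n y} → Poly n y → Int v y
      int-Poly (nil e)      = int-0 v e
      int-Poly (cons c d e) = int-cong v (sym e) (int-+ v na (int-natural v na c) (int-* v it (int-Poly d)))

    -- `π` is the monic irreducible polynomial belonging to the place, characterised as a small
    -- monic polynomial of least degree. Integrality of `t` excludes the place at infinity.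
    IsLeast : ℕ × Carrier → AbsoluteValue K → Set
    IsLeast (m , π) v = NonArchimedean v × Int v t × Monic m π × Small v π × (∀ j → j ℕ.< m → ¬ (∃[ ρ ] Monic j ρ × Small v ρ))

    small⇒multiple : ∀ {m π v} → IsLeast (m , π) v → ∀ {n y} → Poly n y → Small v y → ∃[ q ] Poly (n ℕ.∸ m) q × y ≈ q * π
    small⇒multiple {m} {π} {v} (na , it , monic , sπ , min) {n} {y} d sy = go (division monic n d)
      where
      go : ∃[ q ] ∃[ r ] Poly (n ℕ.∸ m) q × Poly m r × y ≈ q * π + r → ∃[ q ] Poly (n ℕ.∸ m) q × y ≈ q * π
      go (q , r , dq , dr , e) = remainder (normalise m dr)
        where
        sr : Small v r
        sr = AbsoluteValue.cong v (trans (+-congʳ e) (solve 2 (λ a r → a :+ r :- a := r) refl (q * π) r))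
          (small-+ v na sy (small-neg v (int-*-small v (int-Poly v na it dq) sπ)))
        remainder : r ≈ 0# ⊎ (Σ[ j ∈ ℕ ] Σ[ c ∈ ℕ ] Σ[ c⁻¹ ∈ ℕ ] Σ[ ρ ∈ Carrier ]
                  j ℕ.< m × Monic j ρ × natural c⁻¹ * natural c ≈ 1# × r ≈ natural c * ρ) → ∃[ q ] Poly (n ℕ.∸ m) q × y ≈ q * π
        remainder (inj₁ r≈0) = q , dq , trans e (trans (+-congˡ r≈0) (+-identityʳ _))
        remainder (inj₂ (j , c , c⁻¹ , ρ , j<m , mρ , ci , r≈)) = ⊥-elim (min j j<m (ρ , mρ , AbsoluteValue.cong v {natural c⁻¹ * r} {ρ}
          (trans (*-congˡ r≈) (trans (sym (*-assoc _ _ _)) (trans (*-congʳ ci) (*-identityˡ ρ))))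
          (int-*-small v (int-natural v na c⁻¹) sr)))

    multiple⇒small : ∀ {m π v} → IsLeast (m , π) v → ∀ {n y q} → Poly n q → y ≈ q * π → Small v y
    multiple⇒small {v = v} (na , it , monic , sπ , min) dq e = AbsoluteValue.cong v (sym e) (int-*-small v (int-Poly v na it dq) sπ)

    -- Fractions are not given in lowest terms, so common factors `π` are cancelled from numerator
    -- and denominator until the denominator is no longer small. Each cancellation shortens the
    -- denominator because `π` has positive degree, and `fuel` bounds its length.
    least-unique : ∀ mπ u v → IsLeast mπ u → IsLeast mπ v → u ∼ v
    least-unique (m , π) u v Lu@(nu , iu , monic , sπ , min) Lv@(nv , iv , _) = small-⊆⇒∼ {u} {v} λ {x} s → start x s (generated x)
      where
      0<m : ∀ m → Monic m π → 0 ℕ.< m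
      0<m zero    (r , nil r≈0 , π≈) = ⊥-elim (1-not-small u (AbsoluteValue.cong u (trans π≈ (trans (+-congˡ r≈0) (+-identityʳ 1#))) sπ))
      0<m (suc m) _ = ℕ.s≤s ℕ.z≤n
      transfer : ∀ fuel n → n ℕ.≤ fuel → ∀ {x a b l} → Poly l a → Poly n b → ¬ b ≈ 0# → x * b ≈ a → Small u x → Small v x
      transfer fuel       zero    h da (nil b≈0) b≉0 xb≈a sx = ⊥-elim (b≉0 b≈0)
      transfer (suc fuel) (suc n) h {x} {a} {b} {l} da db b≉0 xb≈a sx =
        go (decide (Small u b)) (small⇒multiple {v = u} Lu da (AbsoluteValue.cong u xb≈a (small-*-int u sx (int-Poly u nu iu db))))
        where
        go : Dec (Small u b) → ∃[ q ] Poly (l ℕ.∸ m) q × a ≈ q * π → Small v x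
        go (no ns) (qa , dqa , a≈) = with-inverse (invertible b b≉0)
          where
          nsv : ¬ Small v b
          nsv sb = let q , dq , b≈ = small⇒multiple {v = v} Lv db sb in ns (multiple⇒small {v = u} Lu dq b≈)
          with-inverse : ∃[ b⁻¹ ] b * b⁻¹ ≈ 1# → Small v x
          with-inverse (b⁻¹ , e) = AbsoluteValue.cong v (trans (*-congʳ (sym xb≈a)) (trans (*-assoc x b b⁻¹) (trans (*-congˡ e) (*-identityʳ x))))
            (small-*-int v (multiple⇒small {v = v} Lv dqa a≈) (not-small⇒int-inverse v e nsv))
        go (yes sb) (qa , dqa , a≈) = cancel (small⇒multiple {v = u} Lu db sb)
          where
          cancel : ∃[ q ] Poly (suc n ℕ.∸ m) q × b ≈ q * π → Small v x
          cancel (qb , dqb , b≈) = transfer fuel (suc n ℕ.∸ m) (ℕ.≤-trans (smaller m (0<m m monic)) (ℕ.s≤s⁻¹ h)) {x} {qa} {qb} dqa dqb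
            (λ q≈0 → b≉0 (trans b≈ (trans (*-congʳ q≈0) (zeroˡ π)))) xqb≈qa sx
            where
            smaller : ∀ m → 0 ℕ.< m → suc n ℕ.∸ m ℕ.≤ n
            smaller (suc m) _ = ℕ.m∸n≤m n m
            π≉0 : ¬ π ≈ 0#
            π≉0 π≈0 = b≉0 (trans b≈ (trans (*-congˡ π≈0) (zeroʳ qb)))
            difference : x * qb - qa ≈ 0#
            difference = *-cancel-0 π≉0 (trans (solve 4 (λ p x b a → p :* (x :* b :- a) := x :* (b :* p) :- a :* p) refl π x qb qa)
              (trans (+-cong (trans (*-congˡ (sym b≈)) xb≈a) (-‿cong (sym a≈))) (-‿inverseʳ a)))
            xqb≈qa : x * qb ≈ qa
            xqb≈qa = trans (solve 2 (λ y a → y := (y :- a) :+ a) refl (x * qb) qa) (trans (+-congʳ difference) (+-identityˡ qa))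
      start : ∀ x → Small u x → ∃[ f ] ∃[ g ] ¬ evaluateℕ commutativeRing g t ≈ 0# ×
                x * evaluateℕ commutativeRing g t ≈ evaluateℕ commutativeRing f t → Small v x
      start x s (f , g , g≉0 , xg≈f) = transfer (List.length g) (List.length g) ℕ.≤-refl (evaluate-Poly f) (evaluate-Poly g) g≉0 xg≈f s

    IsInfinite : AbsoluteValue K → Set
    IsInfinite v = NonArchimedean v × ∃[ s ] t * s ≈ 1# × Small v s

    module _ (v : AbsoluteValue K) (na : NonArchimedean v) {s : Carrier} (ts≈1 : t * s ≈ 1#) (small-s : Small v s) where
      shrink : ∀ {n r} → Poly n r → Small v (r * s ^ n)
      shrink (nil e) = small-0 v (trans (*-congʳ e) (zeroˡ _))
      shrink {suc n} (cons c {z} d e) = AbsoluteValue.cong v (sym (trans (*-congʳ e)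
          (trans (solve 5 (λ c t z s q → (c :+ t :* z) :* (s :* q) := c :* (s :* q) :+ t :* s :* (z :* q)) refl (natural c) t z s (s ^ n))
            (+-congˡ (trans (*-congʳ ts≈1) (*-identityˡ _))))))
        (small-+ v na (int-*-small v (int-natural v na c) (small-^ v small-s n)) (shrink d))

      -- Multiplying a polynomial of degree `j` by the `j`-th power of s = 1 / t gives its leading
      -- coefficient times 1 + small, so the product and its inverse are both integral.
      unit : ∀ {j c c⁻¹ π y} → Monic j π → natural c⁻¹ * natural c ≈ 1# → y ≈ natural c * π →
             Int v (y * s ^ j) × (∀ {z} → y * s ^ j * z ≈ 1# → Int v z)
      unit {j} {c} {c⁻¹} {π} {y} (r , dr , π≈) ci y≈ =
        int-cong v (sym β≈) (int-* v (int-natural v na c) (int-+ v na (int-1 v) (small⇒int v (shrink dr)))) ,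
        λ {z} e → int-cong v (trans (sym (*-assoc _ _ _)) (trans (*-congʳ ci) (*-identityˡ z)))
          (int-* v (int-natural v na c⁻¹) (1+small v na (shrink dr)
            (trans (solve 3 (λ u c z → u :* (c :* z) := c :* u :* z) refl (1# + r * s ^ j) (natural c) z) (trans (*-congʳ (sym β≈)) e))))
        where
        β≈ : y * s ^ j ≈ natural c * (1# + r * s ^ j)
        β≈ = trans (*-congʳ (trans y≈ (*-congˡ π≈))) (trans (solve 4 (λ c u r q → c :* (u :+ r) :* q := c :* (u :* q :+ r :* q)) refl (natural c) (t ^ j) r (s ^ j))
          (*-congˡ (+-congʳ (^-inverse ts≈1 j))))

    Nonzero : ℕ → Carrier → Set
    Nonzero n y = Σ[ j ∈ ℕ ] Σ[ c ∈ ℕ ] Σ[ c⁻¹ ∈ ℕ ] Σ[ π ∈ Carrier ] j ℕ.< n × Monic j π × natural c⁻¹ * natural c ≈ 1# × y ≈ natural c * π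

    -- A fraction is small at infinity exactly when its numerator has smaller degree than its
    -- denominator, a condition that does not mention the absolute value.
    infinite-unique : ∀ u v → IsInfinite u → IsInfinite v → u ∼ v
    infinite-unique u v (nu , s , ts≈1 , su) (nv , s′ , ts′≈1 , sv′) = small-⊆⇒∼ {u} {v} λ {x} sx → start x sx (generated x)
      where
      sv : Small v s
      sv = AbsoluteValue.cong v (trans (sym (*-identityʳ s′)) (trans (*-congˡ (sym ts≈1)) (trans
        (solve 3 (λ s′ t s → s′ :* (t :* s) := s :* (t :* s′)) refl s′ t s) (trans (*-congˡ ts′≈1) (*-identityʳ s))))) sv′
      s≉0 : ∀ n → ¬ s ^ n ≈ 0#
      s≉0 n = unit≉0 (^-inverse (trans (*-comm s t) ts≈1) n)
      product≉0 : ∀ {y n} → ¬ y ≈ 0# → ¬ y * s ^ n ≈ 0#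
      product≉0 {y} {n} y≉0 e = s≉0 n (*-cancel-0 y≉0 e)
      compare : ∀ {x a b m n} → x * b ≈ a → ¬ a ≈ 0# → ¬ b ≈ 0# → Small u x → Nonzero m a → Nonzero n b → Small v x
      compare {x} {a} {b} xb≈a a≉0 b≉0 sx (i , c , c⁻¹ , π , _ , mπ , ci , a≈) (j , d , d⁻¹ , ρ , _ , mρ , di , b≈) =
        go (i ℕ.<? j) (invertible (a * s ^ i) (product≉0 {a} {i} a≉0)) (invertible (b * s ^ j) (product≉0 {b} {j} b≉0))
        where
        go : Dec (i ℕ.< j) → ∃[ α′ ] a * s ^ i * α′ ≈ 1# → ∃[ β′ ] b * s ^ j * β′ ≈ 1# → Small v x
        go (yes i<j) _ (β′ , ββ′≈1) = AbsoluteValue.cong v (begin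
            a * s ^ i * (s * s ^ l) * β′ ≈⟨ *-congʳ (trans (*-assoc a _ _) (*-congˡ (sym sʲ))) ⟩
            a * s ^ j * β′               ≈⟨ *-congʳ (*-congʳ xb≈a) ⟨
            x * b * s ^ j * β′           ≈⟨ solve 4 (λ x b q z → x :* b :* q :* z := x :* (b :* q :* z)) refl x b (s ^ j) β′ ⟩
            x * (b * s ^ j * β′)         ≈⟨ trans (*-congˡ ββ′≈1) (*-identityʳ x) ⟩
            x                            ∎)
          (small-*-int v (int-*-small v (proj₁ (unit v nv ts≈1 sv {i} {c} {c⁻¹} mπ ci a≈)) (small-^ v sv l))
            (proj₂ (unit v nv ts≈1 sv {j} {d} {d⁻¹} mρ di b≈) ββ′≈1))
          where
          open SetoidReasoning setoid
          l = j ℕ.∸ suc i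
          sʲ : s ^ j ≈ s ^ i * (s * s ^ l)
          sʲ = trans (reflexive (≡.cong (s ^_) (≡.trans (≡.sym (ℕ.m+[n∸m]≡n i<j)) (≡.sym (ℕ.+-suc i l))))) (^-homo-* s i (suc l))
        go (no i≮j) (α′ , αα′≈1) _ = ⊥-elim (1-not-small u (AbsoluteValue.cong u (begin
            x * (b * s ^ j * s ^ l * α′) ≈⟨ solve 5 (λ x b q r z → x :* (b :* q :* r :* z) := x :* b :* (q :* r) :* z) refl x b (s ^ j) (s ^ l) α′ ⟩
            x * b * (s ^ j * s ^ l) * α′ ≈⟨ *-congʳ (*-cong xb≈a (sym sⁱ)) ⟩
            a * s ^ i * α′               ≈⟨ αα′≈1 ⟩
            1#                           ∎)
          (small-*-int u sx (int-* u (int-* u (proj₁ (unit u nu ts≈1 su {j} {d} {d⁻¹} mρ di b≈)) (int-^ u (small⇒int u su) l))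
            (proj₂ (unit u nu ts≈1 su {i} {c} {c⁻¹} mπ ci a≈) αα′≈1)))))
          where
          open SetoidReasoning setoid
          l = i ℕ.∸ j
          sⁱ : s ^ i ≈ s ^ j * s ^ l
          sⁱ = trans (reflexive (≡.cong (s ^_) (≡.sym (ℕ.m+[n∸m]≡n (ℕ.≮⇒≥ i≮j))))) (^-homo-* s j l)
      start : ∀ x → Small u x → ∃[ f ] ∃[ g ] ¬ ⟦ g ⟧ₜ ≈ 0# × x * ⟦ g ⟧ₜ ≈ ⟦ f ⟧ₜ → Small v x
      start x sx (f , g , g≉0 , xg≈f) = go (decide (⟦ f ⟧ₜ ≈ 0#))
        (normalise (List.length f) (evaluate-Poly f)) (normalise (List.length g) (evaluate-Poly g))
        where
        go : Dec (⟦ f ⟧ₜ ≈ 0#) → ⟦ f ⟧ₜ ≈ 0# ⊎ Nonzero (List.length f) ⟦ f ⟧ₜ → ⟦ g ⟧ₜ ≈ 0# ⊎ Nonzero (List.length g) ⟦ g ⟧ₜ → Small v x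
        go (yes f≈0) _ _ = small-0 v (*-cancel-0 g≉0 (trans (*-comm _ x) (trans xg≈f f≈0)))
        go (no f≉0) (inj₁ f≈0) _ = ⊥-elim (f≉0 f≈0)
        go (no f≉0) (inj₂ _) (inj₁ g≈0) = ⊥-elim (g≉0 g≈0)
        go (no f≉0) (inj₂ nf) (inj₂ ng) = compare {x} {⟦ f ⟧ₜ} {⟦ g ⟧ₜ} xg≈f f≉0 g≉0 sx nf ng

    -- With coefficients reduced modulo `p` there are finitely many polynomials below a given
    -- degree, as is required of the labels of places.
    reduced : ℕ → List (List ℕ)
    reduced zero    = List.[] List.∷ List.[]
    reduced (suc n) = List.cartesianProductWith List._∷_ (List.upTo p) (reduced n)

    reduced-complete : ∀ {n y} → Poly n y → ∃[ f ] f ∈ˡ reduced n × y ≈ ⟦ f ⟧ₜ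
    reduced-complete (nil e) = List.[] , here ≡.refl , e
    reduced-complete (cons c d e) with reduced-complete d
    ... | f , f∈ , z≈ = c % p List.∷ f , Membership.∈-cartesianProductWith⁺ List._∷_ (Membership.∈-upTo⁺ (m%n<n c p)) f∈ ,
      trans e (+-cong (trans (natural-≡ (m≡m%n+[m/n]*n c p)) (trans (natural-+ (c % p) (c / p ℕ.* p))
        (trans (+-congˡ (natural-p (c / p))) (+-identityʳ _)))) (*-congˡ z≈))

    -- A place is either the pole of t or given by a monic polynomial.
    Place : Maybe (ℕ × List ℕ) → AbsoluteValue K → Set
    Place nothing        v = IsInfinite v
    Place (just (m , f)) v = IsLeast (m , t ^ m + ⟦ f ⟧ₜ) v

    Place-unique : ∀ a u v → Place a u → Place a v → u ∼ v
    Place-unique nothing        = infinite-unique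
    Place-unique (just (m , f)) = least-unique (m , t ^ m + ⟦ f ⟧ₜ)

  -- At a pole of f / g where `t` is integral, `g` is small, so the polynomial of the place has
  -- degree below the length of `g`; the other poles lie at infinity.
  poles : HasFinitelyManyPoles em K
  poles x = go (generated x)
    where
    go : ∃[ f ] ∃[ g ] ¬ ⟦ g ⟧ₜ ≈ 0# × x * ⟦ g ⟧ₜ ≈ ⟦ f ⟧ₜ → Σ[ T ∈ List (AbsoluteValue K) ] (∀ v → NonArchimedean v → ¬ Int v x → Any (_∼ v) T)
    go (f , g , g≉0 , xg≈f) = proj₁ reps , λ v na pole → covers v na pole (decide (Int v t))
      where
      N = List.length g
      index : List (Maybe (ℕ × List ℕ))
      index = nothing List.∷ List.concatMap (λ m → List.map (λ f → just (m , f)) (reduced m)) (List.upTo N)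
      index-complete : ∀ {m f} → m ℕ.< N → f ∈ˡ reduced m → just (m , f) ∈ˡ index
      index-complete {m} m<N f∈ = there (Membership.∈-concat⁺′ (Membership.∈-map⁺ (λ f → just (m , f)) f∈)
        (Membership.∈-map⁺ (λ m → List.map (λ f → just (m , f)) (reduced m)) (Membership.∈-upTo⁺ m<N)))
      reps : Σ[ T ∈ List (AbsoluteValue K) ] (∀ v a → a ∈ˡ index → Place a v → Any (_∼ v) T)
      reps = representatives em index Place Place-unique
      covers : ∀ v → NonArchimedean v → ¬ Int v x → Dec (Int v t) → Any (_∼ v) (proj₁ reps)
      covers v na pole (no big) = infinite (invertible t λ t≈0 → big (int-0 v t≈0))
        where
        infinite : ∃[ s ] t * s ≈ 1# → Any (_∼ v) (proj₁ reps)
        infinite (s , ts≈1) = proj₂ reps v nothing (here ≡.refl) (na , s , ts≈1 , not-int⇒inverse-small v ts≈1 big)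
      covers v na pole (yes it) = finite (normalise N (evaluate-Poly g))
        where
        small-g : Small v ⟦ g ⟧ₜ
        small-g = by-contradiction λ ns → contra ns (invertible ⟦ g ⟧ₜ g≉0)
          where
          contra : ¬ Small v ⟦ g ⟧ₜ → ∃[ g⁻¹ ] ⟦ g ⟧ₜ * g⁻¹ ≈ 1# → ⊥
          contra ns (g⁻¹ , e) = pole (int-cong v (trans (*-congʳ (sym xg≈f)) (trans (*-assoc x _ _) (trans (*-congˡ e) (*-identityʳ x))))
            (int-* v (int-Poly v na it (evaluate-Poly f)) (not-small⇒int-inverse v e ns)))
        HasMonic : ℕ → Set
        HasMonic m = ∃[ π ] Monic m π × Small v π
        finite : ⟦ g ⟧ₜ ≈ 0# ⊎ Nonzero N ⟦ g ⟧ₜ → Any (_∼ v) (proj₁ reps)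
        finite (inj₁ g≈0) = ⊥-elim (g≉0 g≈0)
        finite (inj₂ (j , c , c⁻¹ , π , j<N , mπ , ci , g≈)) = minimal (least em HasMonic (j , π , mπ , AbsoluteValue.cong v
            (trans (*-congˡ g≈) (trans (sym (*-assoc _ _ _)) (trans (*-congʳ ci) (*-identityˡ π)))) (int-*-small v (int-natural v na c⁻¹) small-g)))
          where
          minimal : ∃[ m ] HasMonic m × (∀ j → j ℕ.< m → ¬ HasMonic j) → Any (_∼ v) (proj₁ reps)
          minimal (m , (ρ , (r , dr , ρ≈) , sρ) , min) = place (reduced-complete dr)
            where
            m≤j : m ℕ.≤ j
            m≤j = ℕ.≮⇒≥ λ j<m → min j j<m (π , mπ , AbsoluteValue.cong v
              (trans (*-congˡ g≈) (trans (sym (*-assoc _ _ _)) (trans (*-congʳ ci) (*-identityˡ π)))) (int-*-small v (int-natural v na c⁻¹) small-g))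
            place : ∃[ f ] f ∈ˡ reduced m × r ≈ ⟦ f ⟧ₜ → Any (_∼ v) (proj₁ reps)
            place (f , f∈ , r≈) = proj₂ reps v (just (m , f)) (index-complete (ℕ.≤-<-trans m≤j j<N) f∈)
              (na , it , (⟦ f ⟧ₜ , Poly-cong r≈ dr , refl) , AbsoluteValue.cong v (trans ρ≈ (+-congˡ r≈)) sρ , min)

global-poles : (em : ExcludedMiddle (lsuc 0ℓ)) (k : Field) → IsGlobal k → HasFinitelyManyPoles em k
global-poles em k (numberField (ι , n , e)) =
  Places.poles-extend em (record { top = k ; embed = ι }) e (RationalPoles.poles em ℚ-field ℚ-fraction)
global-poles em k (functionField p isPrime F rational (ι , n , e)) =
  Places.poles-extend em (record { top = k ; embed = ι }) e (FunctionFieldPoles.poles em p isPrime F rational)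

-- Completions and the diagonal embedding

module _ {K : Field} where
  private module K = Field K

  pointwise : ∀ (v : AbsoluteValue K) {s t : ℕ → K.Carrier} → (∀ n → s n K.≈ t n) → Null v (λ n → s n K.- t n)
  pointwise v e ε 0<ε = 0 , λ n _ → AbsoluteValue.cong v (K.sym (K.trans (K.+-congʳ (e n)) (K.-‿inverseʳ _))) (AbsoluteValue.∣0∣≤0 v 0<ε)

  constantHom : ∀ (v : AbsoluteValue K) → RingHomomorphism K.rawRing (CommutativeRing.rawRing (Completion v))
  constantHom v = record
    { ⟦_⟧ = constant v
    ; isRingHomomorphism = record
      { isSemiringHomomorphism = record
        { isNearSemiringHomomorphism = record
          { +-isMonoidHomomorphism = record
            { isMagmaHomomorphism = record
              { isRelHomomorphism = record { cong = constant-cong v }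
              ; homo = λ _ _ → pointwise v λ _ → K.refl }
            ; ε-homo = pointwise v λ _ → K.refl }
          ; *-homo = λ _ _ → pointwise v λ _ → K.refl }
        ; 1#-homo = pointwise v λ _ → K.refl }
      ; -‿homo = λ _ → pointwise v λ _ → K.refl }
    }

  transportHom : ∀ {v w : AbsoluteValue K} → v ≼ w → RingHomomorphism (CommutativeRing.rawRing (Completion v)) (CommutativeRing.rawRing (Completion w))
  transportHom {v} {w} v≼w = record
    { ⟦_⟧ = transport v≼w
    ; isRingHomomorphism = record
      { isSemiringHomomorphism = record
        { isNearSemiringHomomorphism = record
          { +-isMonoidHomomorphism = record
            { isMagmaHomomorphism = record
              { isRelHomomorphism = record { cong = λ null ε 0<ε → let δ , 0<δ , f = v≼w ε 0<ε ; N , h = null δ 0<δ in N , λ n hn → f _ (h n hn) }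
              ; homo = λ _ _ → pointwise w λ _ → K.refl }
            ; ε-homo = pointwise w λ _ → K.refl }
          ; *-homo = λ _ _ → pointwise w λ _ → K.refl }
        ; 1#-homo = pointwise w λ _ → K.refl }
      ; -‿homo = λ _ → pointwise w λ _ → K.refl }
    }

  atHom : ∀ (v : AbsoluteValue K) → RingHomomorphism (CommutativeRing.rawRing (adèleRing K)) (CommutativeRing.rawRing (Completion v))
  atHom v = record
    { ⟦_⟧ = λ α → Adèle.at α v
    ; isRingHomomorphism = record
      { isSemiringHomomorphism = record
        { isNearSemiringHomomorphism = record
          { +-isMonoidHomomorphism = record
            { isMagmaHomomorphism = record
              { isRelHomomorphism = record { cong = λ e → e v }
              ; homo = λ _ _ → pointwise v λ _ → K.refl }
            ; ε-homo = pointwise v λ _ → K.refl }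
          ; *-homo = λ _ _ → pointwise v λ _ → K.refl }
        ; 1#-homo = pointwise v λ _ → K.refl }
      ; -‿homo = λ _ → pointwise v λ _ → K.refl }
    }

extendHom : ∀ {k : Field} (E : Extension k) {v w} → _∣ᵖ_ E w v →
            RingHomomorphism (CommutativeRing.rawRing (Completion v)) (CommutativeRing.rawRing (Completion w))
extendHom E {v} {w} w∣v = record
  { ⟦_⟧ = extend E w∣v
  ; isRingHomomorphism = record
    { isSemiringHomomorphism = record
      { isNearSemiringHomomorphism = record
        { +-isMonoidHomomorphism = record
          { isMagmaHomomorphism = record
            { isRelHomomorphism = record { cong = λ null ε 0<ε → let N , h = null ε 0<ε in N , λ n hn → AbsoluteValue.cong w
                (E.trans (E.ι.+-homo _ _) (E.+-congˡ (E.ι.-‿homo _))) (proj₁ w∣v _ (h n hn)) }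
            ; homo = λ _ _ → pointwise w λ _ → E.ι.+-homo _ _ }
          ; ε-homo = pointwise w λ _ → E.ι.0#-homo }
        ; *-homo = λ _ _ → pointwise w λ _ → E.ι.*-homo _ _ }
      ; 1#-homo = pointwise w λ _ → E.ι.1#-homo }
    ; -‿homo = λ _ → pointwise w λ _ → E.ι.-‿homo _ }
  }
  where module E = Extension E

module DiagonalEmbedding (em : ExcludedMiddle (lsuc 0ℓ)) {K : Field} (poles : HasFinitelyManyPoles em K) where
  open Classical em
  private module K = Field K

  integral-constant : ∀ x → Σ[ S ∈ List (AbsoluteValue K) ] (∀ v → NonArchimedean v → Any (_∼ v) S ⊎ Integral v (constant v x))
  integral-constant x = proj₁ (poles x) , λ v na → go v na (decide (AbsoluteValues.Int em v x))
    where
    go : ∀ v → NonArchimedean v → Dec (AbsoluteValues.Int em v x) → Any (_∼ v) (proj₁ (poles x)) ⊎ Integral v (constant v x)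
    go v na (yes i)   = inj₂ (0 , λ _ _ → i)
    go v na (no pole) = inj₁ (proj₂ (poles x) v na pole)

  diagonal : K.Carrier → Adèle K
  diagonal x = record
    { at       = λ v → constant v x
    ; coherent = λ v w _ → pointwise w λ _ → K.refl
    ; integral = integral-constant x
    }

  abstract
    diagonal-isRingHomomorphism : IsRingHomomorphism K.rawRing (CommutativeRing.rawRing (adèleRing K)) diagonal
    diagonal-isRingHomomorphism = record
      { isSemiringHomomorphism = record
        { isNearSemiringHomomorphism = record
          { +-isMonoidHomomorphism = record
            { isMagmaHomomorphism = record
              { isRelHomomorphism = record { cong = λ e v → constant-cong v e }
              ; homo = λ _ _ v → pointwise v λ _ → K.refl }
            ; ε-homo = λ v → pointwise v λ _ → K.refl }
          ; *-homo = λ _ _ v → pointwise v λ _ → K.refl }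
        ; 1#-homo = λ v → pointwise v λ _ → K.refl }
      ; -‿homo = λ _ v → pointwise v λ _ → K.refl }

  diagonalHom : RingHomomorphism (Field.rawRing K) (CommutativeRing.rawRing (adèleRing K))
  diagonalHom = record { ⟦_⟧ = diagonal ; isRingHomomorphism = diagonal-isRingHomomorphism }

-- Adèlic norms as formal norms over 𝔸ₖ

module AdèlicNorms (em : ExcludedMiddle (lsuc 0ℓ)) {k : Field} (poles : HasFinitelyManyPoles em k) (E : Extension k) where
  open Classical em
  open DiagonalEmbedding em {k} poles
  private
    module k = Field k
    module E = Extension E
    module 𝔸 = CommutativeRing (adèleRing k)
  open FormalNorms em E (adèleRing k) (DiagonalEmbedding.diagonalHom em {k} poles)
  open RegularRepresentation em E using (regular; regular-unique)

  private
    -- By uniqueness of coordinates any admissible `structure` is the regular representation, and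
    -- evaluation at `v` commutes with sums and determinants.
    norm-at : ∀ {n} (e : Basis E n) (structure : Fin n → Matrix k.commutativeRing n) →
      (∀ i j → Basis.basis e i E.* Basis.basis e j E.≈ ∑ E.commutativeRing (λ l → E.ι (structure i l j) E.* Basis.basis e l)) →
      (c : Fin n → Adèle k) → ∀ v → CommutativeRing._≈_ (Completion v) (Adèle.at (norm e c (Basis.basis e)) v)
        (det (Completion v) (λ l j → ∑ (Completion v) (λ i → CommutativeRing._*_ (Completion v) (Adèle.at (c i) v) (constant v (structure i l j)))))
    norm-at {n} e structure action c v = V.trans {Adèle.at (norm e c (Basis.basis e)) v}
      {det (Completion v) (λ l j → Adèle.at (matrix e c (Basis.basis e) l j) v)} {det (Completion v) (λ l j → ∑ (Completion v) (entry l j))}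
      (Homomorphism.det-homo {R = (adèleRing k)} {Completion v} (atHom v) (matrix e c (Basis.basis e)))
      (Determinant.det-cong (Completion v) {X = λ l j → Adèle.at (matrix e c (Basis.basis e) l j) v} {λ l j → ∑ (Completion v) (entry l j)} λ l j →
        V.trans {Adèle.at (matrix e c (Basis.basis e) l j) v} {∑ (Completion v) (entry′ l j)} {∑ (Completion v) (entry l j)}
          (Homomorphism.∑-homo {R = (adèleRing k)} {Completion v} (atHom v) (λ i → c i 𝔸.* diagonal (regular e (Basis.basis e i) l j)))
          (Sums.∑-cong (Completion v) {f = entry′ l j} {entry l j} λ i →
            V.*-congˡ {Adèle.at (c i) v} {constant v (regular e (Basis.basis e i) l j)} {constant v (structure i l j)}
              (constant-cong v (regular-unique e (Basis.basis e i) (structure i) (action i) l j))))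
      where
      module V = CommutativeRing (Completion v)
      entry entry′ : Fin n → Fin n → Fin n → CauchySequence v
      entry  l j i = Adèle.at (c i) v V.* constant v (structure i l j)
      entry′ l j i = Adèle.at (c i) v V.* constant v (regular e (Basis.basis e i) l j)

  adèlicNorm⇒formalNorm : ∀ {α β} → IsAdèlicNorm E α β → IsFormalNorm β
  adèlicNorm⇒formalNorm {α} {β} N = formalNorm N.e N.c λ v → CommutativeRing.trans (Completion v)
      {Adèle.at β v}
      {det (Completion v) (λ l j → ∑ (Completion v) (λ i → CommutativeRing._*_ (Completion v) (Adèle.at (N.c i) v) (constant v (N.structure i l j))))}
      {Adèle.at (norm N.e N.c (Basis.basis N.e)) v} (N.value v)
    (CommutativeRing.sym (Completion v) {Adèle.at (norm N.e N.c (Basis.basis N.e)) v}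
      {det (Completion v) (λ l j → ∑ (Completion v) (λ i → CommutativeRing._*_ (Completion v) (Adèle.at (N.c i) v) (constant v (N.structure i l j))))} (norm-at N.e N.structure N.action N.c v))
    where module N = IsAdèlicNorm N

  module _ {n} (e : Basis E n) where
    open Basis e
    open Places em E e
    private
      restrict-∣ : ∀ w → _∣ᵖ_ E w (restrict w)
      restrict-∣ w = (λ _ → id) , (λ _ → id)

    module At (w : AbsoluteValue E.top) where
      ψ : RingHomomorphism 𝔸.rawRing (CommutativeRing.rawRing (Completion w))
      ψ = record
        { ⟦_⟧ = λ α → extend E (restrict-∣ w) (Adèle.at α (restrict w))
        ; isRingHomomorphism = Composition.isRingHomomorphism (λ {x} {y} {z} → CommutativeRing.trans (Completion w) {x} {y} {z})
            (RingHomomorphism.isRingHomomorphism (atHom (restrict w))) (RingHomomorphism.isRingHomomorphism (extendHom E {restrict w} {w} (restrict-∣ w)))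
        }
      open FormalNormValues em E (adèleRing k) (DiagonalEmbedding.diagonalHom em {k} poles) (Completion w) ψ (constantHom w) (λ x → pointwise w λ _ → E.refl) public

    -- The image of a formal sum in the adèle ring of `E`. At `w` the coefficients are read at
    -- `restrict w`; the result is integral away from the places above the exceptional ones of the
    -- `c s` and from the poles of the `x s`.
    realise : ∀ {r} → (Fin r → Adèle k) → (Fin r → E.Carrier) → Adèle E.top
    realise c x = record
      { at       = λ w → At.value w c x
      ; coherent = λ w w′ w∼w′ → coherence w w′ w∼w′
      ; integral = integral-sum c x
      }
      where
      restrict-≼ : ∀ w w′ → w ≼ w′ → restrict w ≼ restrict w′
      restrict-≼ w w′ w≼w′ ε 0<ε = let δ , 0<δ , f = w≼w′ ε 0<ε in δ , 0<δ , λ a → f (E.ι a)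

      term : ∀ w s → CauchySequence w
      term w s = CommutativeRing._*_ (Completion w) (extend E (restrict-∣ w) (Adèle.at (c s) (restrict w))) (constant w (x s))

      coherence : ∀ w w′ (w∼w′ : w ∼ w′) → CommutativeRing._≈_ (Completion w′) (transport (proj₁ w∼w′) (At.value w c x)) (At.value w′ c x)
      coherence w w′ w∼w′ = W.trans {transport (proj₁ w∼w′) (At.value w c x)} {∑ (Completion w′) (λ s → transport (proj₁ w∼w′) (term w s))} {At.value w′ c x}
        (Homomorphism.∑-homo {R = Completion w} {Completion w′} (transportHom (proj₁ w∼w′)) (term w))
        (Sums.∑-cong (Completion w′) {f = λ s → transport (proj₁ w∼w′) (term w s)} {term w′} λ s →
          W.*-congʳ {constant w′ (x s)} {extend E (restrict-∣ w′) (moved s)} {extend E (restrict-∣ w′) (Adèle.at (c s) (restrict w′))}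
            (RingHomomorphism.⟦⟧-cong (extendHom E {restrict w′} {w′} (restrict-∣ w′)) {moved s} {Adèle.at (c s) (restrict w′)}
              (Adèle.coherent (c s) (restrict w) (restrict w′) (restrict-≼ w w′ (proj₁ w∼w′) , restrict-≼ w′ w (proj₂ w∼w′)))))
        where
        module W = CommutativeRing (Completion w′)
        moved : ∀ s → CauchySequence (restrict w′)
        moved s = transport (restrict-≼ w w′ (proj₁ w∼w′)) (Adèle.at (c s) (restrict w))

      above : List (AbsoluteValue k) → List (AbsoluteValue E.top)
      above = List.concatMap (λ v → proj₁ (finitely-many-above v))

      above-covers : ∀ S w → NonArchimedean w → Any (_∼ restrict w) S → Any (_∼ w) (above S)
      above-covers S w na h = Any.concat⁺ (Any.map⁺ (Any.map (λ {v} v∼ → proj₂ (finitely-many-above v) w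
        (na , AbsoluteValues.∼-sym em {u = v} {restrict w} v∼)) h))

      integral-sum : ∀ {r} (c : Fin r → Adèle k) (x : Fin r → E.Carrier) →
        Σ[ S ∈ List (AbsoluteValue E.top) ] (∀ w → NonArchimedean w → Any (_∼ w) S ⊎ Integral w (At.value w c x))
      integral-sum {zero}  c x = List.[] , λ w na → inj₂ (integral-0 w)
      integral-sum {suc r} c x = S₁ List.++ (S₂ List.++ S₃) , λ w na →
        go w na (proj₂ (Adèle.integral (c zero)) (restrict w) (restrict-nonArchimedean w na))
          (proj₂ (DiagonalEmbedding.integral-constant em {E.top} (poles-extend poles) (x zero)) w na) (proj₂ (integral-sum (c ∘ suc) (x ∘ suc)) w na)
        where
        S₁ = above (proj₁ (Adèle.integral (c zero)))
        S₂ = proj₁ (DiagonalEmbedding.integral-constant em {E.top} (poles-extend poles) (x zero))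
        S₃ = proj₁ (integral-sum (c ∘ suc) (x ∘ suc))
        go : ∀ w → NonArchimedean w →
          Any (_∼ restrict w) (proj₁ (Adèle.integral (c zero))) ⊎ Integral (restrict w) (Adèle.at (c zero) (restrict w)) →
          Any (_∼ w) S₂ ⊎ Integral w (constant w (x zero)) → Any (_∼ w) S₃ ⊎ Integral w (At.value w (c ∘ suc) (x ∘ suc)) →
          Any (_∼ w) (S₁ List.++ (S₂ List.++ S₃)) ⊎ Integral w (At.value w c x)
        go w na (inj₁ p) _ _ = inj₁ (Any.++⁺ˡ (above-covers _ w na p))
        go w na (inj₂ _) (inj₁ p) _ = inj₁ (Any.++⁺ʳ S₁ (Any.++⁺ˡ p))
        go w na (inj₂ _) (inj₂ _) (inj₁ p) = inj₁ (Any.++⁺ʳ S₁ (Any.++⁺ʳ S₂ p))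
        go w na (inj₂ i) (inj₂ j) (inj₂ l) = inj₂ (integral-+ w na
          (CommutativeRing._*_ (Completion w) (RingHomomorphism.⟦_⟧ (At.ψ w) (c zero)) (constant w (x zero))) (At.value w (c ∘ suc) (x ∘ suc))
          (integral-* w (RingHomomorphism.⟦_⟧ (At.ψ w) (c zero)) (constant w (x zero)) i j) l)

    -- The inverse of the idèle is the realisation of Cramer's solution, whose coefficients are
    -- again adèles of `k`.
    formalNorm⇒adèlicNorm : ∀ (c : Fin n → Adèle k) {β β⁻¹} → β 𝔸.≈ norm e c basis → β 𝔸.* β⁻¹ 𝔸.≈ 𝔸.1# →
      Σ[ α ∈ AbelianGroup.Carrier (Idèles E.top) ] IsAdèlicNorm E (proj₁ α) β
    formalNorm⇒adèlicNorm c {β} {β⁻¹} β≈ ββ⁻¹≈1 =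
      (realise c basis , realise (inverse e c basis β⁻¹ unit) basis , λ w → At.value-inverse w e c basis β⁻¹ unit) , record
      { e         = e
      ; structure = λ i → regular e (basis i)
      ; action    = structure-action
      ; c         = c
      ; expansion = λ v w w∣v → Sums.∑-cong (Completion w)
          {f = λ i → CommutativeRing._*_ (Completion w) (extend E (restrict-∣ w) (Adèle.at (c i) (restrict w))) (constant w (basis i))}
          {λ i → CommutativeRing._*_ (Completion w) (extend E w∣v (Adèle.at (c i) v)) (constant w (basis i))} λ i → CommutativeRing.*-congʳ (Completion w) {constant w (basis i)}
          {extend E (restrict-∣ w) (Adèle.at (c i) (restrict w))} {extend E w∣v (Adèle.at (c i) v)} (same v w w∣v (c i))
      ; value     = λ v → CommutativeRing.trans (Completion v) {Adèle.at β v} {Adèle.at (norm e c basis) v}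
          {det (Completion v) (λ l j → ∑ (Completion v) (λ i → CommutativeRing._*_ (Completion v) (Adèle.at (c i) v) (constant v (regular e (basis i) l j))))} (β≈ v)
          (norm-at e (λ i → regular e (basis i)) structure-action c v)
      }
      where
      unit : norm e c basis 𝔸.* β⁻¹ 𝔸.≈ 𝔸.1#
      unit = 𝔸.trans {norm e c basis 𝔸.* β⁻¹} {β 𝔸.* β⁻¹} {𝔸.1#} (𝔸.*-congʳ {β⁻¹} {norm e c basis} {β} (𝔸.sym {β} {norm e c basis} β≈)) ββ⁻¹≈1
      structure-action : ∀ i j → basis i E.* basis j E.≈ ∑ E.commutativeRing (λ l → E.ι (regular e (basis i) l j) E.* basis l)
      structure-action i j = RegularRepresentation.regular-action em E e (basis i) j
      -- `expansion` concerns every `v` below `w`. Such a `v` takes the same values as `restrict w`,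
      -- so the two are equivalent, and coherence of `a` identifies its components.
      same : ∀ v w (w∣v : _∣ᵖ_ E w v) (a : Adèle k) → CommutativeRing._≈_ (Completion w)
        (extend E (restrict-∣ w) (Adèle.at a (restrict w))) (extend E w∣v (Adèle.at a v))
      same v w w∣v a = CommutativeRing.sym (Completion w) {extend E w∣v (Adèle.at a v)} {extend E (restrict-∣ w) (Adèle.at a (restrict w))}
        (RingHomomorphism.⟦⟧-cong (extendHom E {restrict w} {w} (restrict-∣ w)) {transport (proj₁ v∼) (Adèle.at a v)} {Adèle.at a (restrict w)}
          (Adèle.coherent a v (restrict w) v∼))
        where
        v∼ : v ∼ restrict w
        v∼ = (λ ε 0<ε → ε , 0<ε , λ x → proj₁ w∣v x) , (λ ε 0<ε → ε , 0<ε , λ x → proj₂ w∣v x)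

  formalNorm⇒idèle : ∀ {β β⁻¹} → IsFormalNorm β → β 𝔸.* β⁻¹ 𝔸.≈ 𝔸.1# → Σ[ α ∈ AbelianGroup.Carrier (Idèles E.top) ] IsAdèlicNorm E (proj₁ α) β
  formalNorm⇒idèle {β} {β⁻¹} (formalNorm e c β≈) = formalNorm⇒adèlicNorm e c {β} {β⁻¹} β≈

-- Nilpotent groups and nilpotent extensions

prime-divisor : ∀ n → 1 ℕ.< n → ∃[ q ] Prime q × q ∣ n
prime-divisor n 1<n = go (factorise n {{ℕ.>-nonZero (ℕ.<-trans (ℕ.s≤s ℕ.z≤n) 1<n)}})
  where
  go : PrimeFactorisation n → ∃[ q ] Prime q × q ∣ n
  go record { factors = List.[] ; isFactorisation = n≡1 } = ⊥-elim (ℕ.<⇒≢ 1<n (≡.sym n≡1))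
  go record { factors = q List.∷ qs ; isFactorisation = n≡ ; factorsPrime = pr All.∷ _ } =
    q , pr , divides (ListAction.product qs) (≡.trans n≡ (ℕ.*-comm q (ListAction.product qs)))

prime-∤-prime : ∀ {p q} → Prime p → Prime q → p ≢ q → p ∤ q
prime-∤-prime pr qr p≢q p∣q with prime⇒irreducible qr p∣q
... | inj₁ ≡.refl = ¬prime[1] pr
... | inj₂ p≡q    = p≢q p≡q

prime∣^⇒≡ : ∀ {p q} → Prime p → ∀ n → Prime q → q ∣ p ℕ.^ n → q ≡ p
prime∣^⇒≡ pr zero    qr q∣1 = ⊥-elim (¬prime[1] (≡.subst Prime (ℕ.∣1⇒≡1 q∣1) qr))
prime∣^⇒≡ {p} {q} pr (suc n) qr q∣ with euclidsLemma p (p ℕ.^ n) qr q∣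
... | inj₂ q∣pⁿ = prime∣^⇒≡ pr n qr q∣pⁿ
... | inj₁ q∣p with q ℕ.≟ p
...   | yes q≡p = q≡p
...   | no q≢p  = ⊥-elim (prime-∤-prime qr pr q≢p q∣p)

coprime-* : ∀ {a b c} → Coprime a c → Coprime b c → Coprime (a ℕ.* b) c
coprime-* {a} {b} {c} ac bc {d} (d∣ab , d∣c) = bc (Coprimality.coprime-divisor (λ { (e∣d , e∣a) → ac (e∣a , ℕ.∣-trans e∣d d∣c) }) d∣ab , d∣c)

coprime-^ : ∀ {a c} n → Coprime a c → Coprime (a ℕ.^ n) c
coprime-^ zero    ac (d∣1 , _) = ℕ.∣1⇒≡1 d∣1
coprime-^ (suc n) ac = coprime-* ac (coprime-^ n ac)

∣-product : ∀ {r} (q : Fin r → ℕ) j → q j ∣ ListAction.product (List.tabulate q)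
∣-product q zero    = ℕ.m∣m*n _
∣-product q (suc j) = ℕ.∣n⇒∣m*n (q zero) (∣-product (q ∘ suc) j)

coprime-product : ∀ {r} (q : Fin r → ℕ) {m} → (∀ j → Coprime (q j) m) → Coprime (ListAction.product (List.tabulate q)) m
coprime-product {zero}  q h (d∣1 , _) = ℕ.∣1⇒≡1 d∣1
coprime-product {suc r} q h = coprime-* (h zero) (coprime-product (q ∘ suc) (h ∘ suc))

module FiniteGroups (em : ExcludedMiddle (lsuc 0ℓ)) (G : Group 0ℓ 0ℓ) where
  open Classical em
  open Group G
  open GroupProperties G using (⁻¹-anti-homo-∙; ε⁻¹≈ε; ∙-cancelˡ)
  open MonoidMult monoid using (×-homo-+; ×-congˡ; ×-assocˡ) renaming (_×_ to _·_)
  open SetoidReasoning setoid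

  private
    Sub : Set₁
    Sub = Subgroup G 0ℓ

  whole : Sub
  whole = record { _∈S = λ _ → Unit.⊤ ; resp = λ _ _ → Unit.tt ; ε∈ = Unit.tt ; ∙∈ = λ _ _ → Unit.tt ; ⁻¹∈ = λ _ → Unit.tt }

  infix 4 _⊑_
  _⊑_ : Sub → Sub → Set
  A ⊑ B = ∀ {x} → x ∈ A → x ∈ B

  mkOrder : ∀ (S : Sub) {n} (f : Fin n → Carrier) → (∀ i → f i ∈ S) → (∀ i j → f i ≈ f j → i ≡ j) →
            (∀ x → x ∈ S → ∃[ i ] f i ≈ x) → HasOrder (subgroup S) n
  mkOrder S f f∈ inj sur = record
    { to        = λ i → f i , f∈ i
    ; from      = λ { (x , x∈) → proj₁ (sur x x∈) }
    ; to-cong   = λ { ≡.refl → refl }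
    ; from-cong = λ { {x , x∈} {y , y∈} x≈y → inj _ _ (trans (proj₂ (sur x x∈)) (trans x≈y (sym (proj₂ (sur y y∈))))) }
    ; inverse   = (λ { {x , x∈} ≡.refl → proj₂ (sur x x∈) }) , (λ { {i} {y , y∈} e → inj _ _ (trans (proj₂ (sur y y∈)) e) })
    }

  module _ (S : Sub) {n} (order : HasOrder (subgroup S) n) where
    element : Fin n → Carrier
    element i = proj₁ (Inverse.to order i)

    element∈ : ∀ i → element i ∈ S
    element∈ i = proj₂ (Inverse.to order i)

    element-injective : ∀ i j → element i ≈ element j → i ≡ j
    element-injective i j e = ≡.trans (≡.sym (Inverse.strictlyInverseʳ order i))
      (≡.trans (Inverse.from-cong order e) (Inverse.strictlyInverseʳ order j))

    index : ∀ x → x ∈ S → ∃[ i ] element i ≈ x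
    index x x∈ = Inverse.from order (x , x∈) , Inverse.strictlyInverseˡ order (x , x∈)

  order-≤ : ∀ {S T : Sub} {m n} → HasOrder (subgroup S) m → HasOrder (subgroup T) n → S ⊑ T → m ℕ.≤ n
  order-≤ {S} {T} oS oT sub = Fin.injective⇒≤ {f = λ i → proj₁ (index T oT (element S oS i) (sub (element∈ S oS i)))}
    λ {i} {j} e → element-injective S oS i j (trans (sym (proj₂ (index T oT (element S oS i) (sub (element∈ S oS i)))))
      (trans (reflexive (≡.cong (element T oT) e)) (proj₂ (index T oT (element S oS j) (sub (element∈ S oS j))))))

  order-positive : ∀ {S : Sub} {n} → HasOrder (subgroup S) n → 0 ℕ.< n
  order-positive {S} o = ℕ.≤-<-trans ℕ.z≤n (Fin.toℕ<n (proj₁ (index S o ε (Subgroup.ε∈ S))))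

  -- Finiteness without an enumeration: for a Galois group the degree bounds the number of distinct
  -- automorphisms, and excluded middle then enumerates every subgroup.
  Bounded : ℕ → Set
  Bounded N = ∀ {m} (f : Fin m → Carrier) → (∀ i j → f i ≈ f j → i ≡ j) → m ℕ.≤ N

  finite-order : ∀ {N} → Bounded N → (S : Sub) → ∃[ n ] HasOrder (subgroup S) n
  finite-order {N} bound S = grow (suc N) {0} (λ ()) (λ ()) (λ ()) (ℕ.≤-reflexive (≡.sym (ℕ.+-identityʳ (suc N))))
    where
    grow : ∀ fuel {m} (f : Fin m → Carrier) → (∀ i → f i ∈ S) → (∀ i j → f i ≈ f j → i ≡ j) → suc N ℕ.≤ fuel ℕ.+ m →
           ∃[ n ] HasOrder (subgroup S) n
    grow zero f f∈ inj h = ⊥-elim (ℕ.<⇒≱ h (bound f inj))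
    grow (suc fuel) {m} f f∈ inj h with decide (∃[ x ] x ∈ S × (∀ i → ¬ f i ≈ x))
    ... | yes (x , x∈ , new) = grow fuel (x ∷ f) (λ { zero → x∈ ; (suc i) → f∈ i })
      (λ { zero zero _ → ≡.refl ; zero (suc j) e → ⊥-elim (new j (sym e)) ; (suc i) zero e → ⊥-elim (new i e)
         ; (suc i) (suc j) e → ≡.cong suc (inj i j e) })
      (≡.subst (suc N ℕ.≤_) (≡.sym (ℕ.+-suc fuel m)) h)
    ... | no none = m , mkOrder S f f∈ inj covered
      where
      covered : ∀ x → x ∈ S → ∃[ i ] f i ≈ x
      covered x x∈ = by-contradiction λ out → none (x , x∈ , λ i e → out (i , e))

  product-order-≤ : ∀ {S T U : Sub} {l m n} → HasOrder (subgroup S) l → HasOrder (subgroup T) m → HasOrder (subgroup U) n →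
    (∀ g → Σ[ x ∈ Carrier ] Σ[ y ∈ Carrier ] x ∈ S × y ∈ T × g ≈ x ∙ y) → n ℕ.≤ l ℕ.* m
  product-order-≤ {S} {T} {U} oS oT oU decompose = Fin.injective⇒≤ {f = λ i → Fin.combine (proj₁ (left i)) (proj₁ (right i))}
    λ {i} {j} e → element-injective U oU i j (trans (sym (split i)) (trans
      (∙-cong (reflexive (≡.cong (element S oS) (proj₁ (Fin.combine-injective (proj₁ (left i)) (proj₁ (right i)) (proj₁ (left j)) (proj₁ (right j)) e))))
              (reflexive (≡.cong (element T oT) (proj₂ (Fin.combine-injective (proj₁ (left i)) (proj₁ (right i)) (proj₁ (left j)) (proj₁ (right j)) e)))))
      (split j)))
    where
    factors = λ i → decompose (element U oU i)
    left : ∀ i → ∃[ s ] element S oS s ≈ proj₁ (factors i)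
    left i = index S oS _ (proj₁ (proj₂ (proj₂ (factors i))))
    right : ∀ i → ∃[ t ] element T oT t ≈ proj₁ (proj₂ (factors i))
    right i = index T oT _ (proj₁ (proj₂ (proj₂ (proj₂ (factors i)))))
    split : ∀ i → element S oS (proj₁ (left i)) ∙ element T oT (proj₁ (right i)) ≈ element U oU i
    split i = trans (∙-cong (proj₂ (left i)) (proj₂ (right i))) (sym (proj₂ (proj₂ (proj₂ (proj₂ (factors i))))))

  module _ (A : Sub) where
    open Subgroup A

    power∈ : ∀ {x} n → x ∈ A → n · x ∈ A
    power∈ zero    x∈ = ε∈
    power∈ (suc n) x∈ = ∙∈ x∈ (power∈ n x∈)

    cancel∈ˡ : ∀ {x y} → x ∈ A → x ∙ y ∈ A → y ∈ A
    cancel∈ˡ {x} {y} x∈ xy∈ = resp (trans (sym (assoc _ _ _)) (trans (∙-congʳ (inverseˡ x)) (identityˡ y))) (∙∈ (⁻¹∈ x∈) xy∈)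

    cancel∈ʳ : ∀ {x y} → y ∈ A → x ∙ y ∈ A → x ∈ A
    cancel∈ʳ {x} {y} y∈ xy∈ = resp (trans (assoc _ _ _) (trans (∙-congˡ (inverseʳ y)) (identityʳ x))) (∙∈ xy∈ (⁻¹∈ y∈))

    coprime-powers∈ : ∀ {m n x} → Coprime m n → m · x ∈ A → n · x ∈ A → x ∈ A
    coprime-powers∈ {m} {n} {x} cop mx∈ nx∈ = go (coprime-Bézout cop)
      where
      combine : ∀ {a b} u w → 1 ℕ.+ w ℕ.* b ≡ u ℕ.* a → a · x ∈ A → b · x ∈ A → x ∈ A
      combine {a} {b} u w eq ax∈ bx∈ = cancel∈ʳ (resp (×-assocˡ x w b) (power∈ w bx∈))
        (resp (trans (×-assocˡ x u a) (×-congˡ (≡.sym eq))) (power∈ u ax∈))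
      go : Bézout.Identity 1 m n → x ∈ A
      go (Bézout.+- u w eq) = combine u w eq mx∈ nx∈
      go (Bézout.-+ u w eq) = combine w u eq nx∈ mx∈

  Normalises : Carrier → Sub → Set
  Normalises a A = ∀ {s} → s ∈ A → a ∙ s ∙ a ⁻¹ ∈ A

  normalises-power : ∀ {a A} n → Normalises a A → Normalises (n · a) A
  normalises-power {a} {A} zero    na s∈ = Subgroup.resp A (sym (trans (∙-congˡ ε⁻¹≈ε) (trans (identityʳ _) (identityˡ _)))) s∈
  normalises-power {a} {A} (suc n) na {s} s∈ = Subgroup.resp A (sym (trans (∙-congˡ (⁻¹-anti-homo-∙ a (n · a)))
      (trans (sym (assoc _ _ _)) (∙-congʳ (trans (∙-congʳ (assoc a (n · a) s)) (assoc _ _ _))))))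
    (na (normalises-power {a} {A} n na s∈))

  module Adjoin (A : Sub) (a : Carrier) (na : Normalises a A) (q : ℕ) (qr : Prime q) (aq∈ : q · a ∈ A) where
    private
      module A = Subgroup A
      instance
        q≢0 : ℕ.NonZero q
        q≢0 = prime⇒nonZero qr

    -- Powers are written additively, so this says that `x` lies in the coset of `A` by the `i`-th
    -- power of the inverse of `a`. The union of these cosets is `adjoin`, and `i` matters only
    -- modulo `q`.
    Graded : ℕ → Carrier → Set
    Graded i x = (i · a) ∙ x ∈ A

    graded-∙ : ∀ {i j x y} → Graded i x → Graded j y → Graded (j ℕ.+ i) (x ∙ y)
    graded-∙ {i} {j} {x} {y} gx gy = A.resp (begin
      (j · a) ∙ ((i · a) ∙ x) ∙ (j · a) ⁻¹ ∙ ((j · a) ∙ y)    ≈⟨ assoc _ _ _ ⟩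
      (j · a) ∙ ((i · a) ∙ x) ∙ ((j · a) ⁻¹ ∙ ((j · a) ∙ y))  ≈⟨ ∙-congˡ (trans (sym (assoc _ _ _)) (trans (∙-congʳ (inverseˡ _)) (identityˡ y))) ⟩
      (j · a) ∙ ((i · a) ∙ x) ∙ y                             ≈⟨ ∙-congʳ (assoc _ _ _) ⟨
      (j · a) ∙ (i · a) ∙ x ∙ y                               ≈⟨ assoc _ _ _ ⟩
      (j · a) ∙ (i · a) ∙ (x ∙ y)                             ≈⟨ ∙-congʳ (×-homo-+ a j i) ⟨
      ((j ℕ.+ i) · a) ∙ (x ∙ y)                               ∎)
      (A.∙∈ (normalises-power {a} {A} j na gx) gy)

    multiple∈ : ∀ {n} → q ∣ n → n · a ∈ A
    multiple∈ (divides k eq) = A.resp (trans (×-assocˡ a k q) (×-congˡ (≡.sym eq))) (power∈ A k aq∈)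

    -- The exponent (q ∸ 1) i represents − i modulo q.
    complement : ∀ i → q ∣ (q ℕ.∸ 1) ℕ.* i ℕ.+ i
    complement i = divides i (≡.trans (≡.trans (ℕ.+-comm ((q ℕ.∸ 1) ℕ.* i) i) (≡.cong (ℕ._* i) (ℕ.m+[n∸m]≡n (ℕ.>-nonZero⁻¹ q)))) (ℕ.*-comm q i))

    adjoin : Sub
    adjoin = record
      { _∈S  = λ x → ∃[ i ] Graded i x
      ; resp = λ { x≈y (i , g) → i , A.resp (∙-congˡ x≈y) g }
      ; ε∈   = 0 , A.resp (sym (identityˡ ε)) A.ε∈
      ; ∙∈   = λ { {x} {y} (i , g) (j , g′) → j ℕ.+ i , graded-∙ {i} {j} {x} {y} g g′ }
      ; ⁻¹∈  = λ { {x} (i , g) → (q ℕ.∸ 1) ℕ.* i , graded-⁻¹ {x} i g }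
      }
      where
      graded-⁻¹ : ∀ {x} i → Graded i x → Graded ((q ℕ.∸ 1) ℕ.* i) (x ⁻¹)
      graded-⁻¹ {x} i g = A.resp (begin
        (j · a) ∙ ((i · a) ∙ x) ⁻¹ ∙ (j · a) ⁻¹ ∙ ((j ℕ.+ i) · a)    ≈⟨ ∙-congˡ (×-homo-+ a j i) ⟩
        (j · a) ∙ ((i · a) ∙ x) ⁻¹ ∙ (j · a) ⁻¹ ∙ ((j · a) ∙ (i · a)) ≈⟨ assoc _ _ _ ⟩
        (j · a) ∙ ((i · a) ∙ x) ⁻¹ ∙ ((j · a) ⁻¹ ∙ ((j · a) ∙ (i · a))) ≈⟨ ∙-congˡ (trans (sym (assoc _ _ _)) (trans (∙-congʳ (inverseˡ _)) (identityˡ _))) ⟩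
        (j · a) ∙ ((i · a) ∙ x) ⁻¹ ∙ (i · a)                         ≈⟨ trans (assoc _ _ _) (∙-congˡ (trans (∙-congʳ (⁻¹-anti-homo-∙ (i · a) x)) (trans (assoc _ _ _) (trans (∙-congˡ (inverseˡ _)) (identityʳ _))))) ⟩
        (j · a) ∙ x ⁻¹                                               ∎)
        (A.∙∈ (normalises-power {a} {A} j na (A.⁻¹∈ g)) (multiple∈ (complement i)))
        where j = (q ℕ.∸ 1) ℕ.* i

    ⊑-adjoin : A ⊑ adjoin
    ⊑-adjoin x∈ = 0 , A.resp (sym (identityˡ _)) x∈

    q-power∈ : ∀ {x} → x ∈ adjoin → q · x ∈ A
    q-power∈ {x} (i , g) = cancel∈ˡ A (multiple∈ (divides i (ℕ.*-comm q i))) (go q)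
      where
      go : ∀ m → Graded (m ℕ.* i) (m · x)
      go zero    = A.resp (sym (identityˡ ε)) A.ε∈
      go (suc m) = A.resp (∙-congʳ (×-congˡ (ℕ.+-comm (m ℕ.* i) i))) (graded-∙ {i} {m ℕ.* i} {x} {m · x} g (go m))

    -- For 0 < d < q the power `d · a` is outside `A`, since otherwise two coprime powers of `a`
    -- would put `a` itself in `A`. Hence the first `q` powers of `a` represent distinct cosets.
    adjoin-order : ¬ a ∈ A → ∀ {n} → HasOrder (subgroup A) n → HasOrder (subgroup adjoin) (q ℕ.* n)
    adjoin-order a∉ {n} order = mkOrder adjoin f f∈ injective surjective
      where
      e = element A order
      g : Fin q × Fin n → Carrier
      g (i , s) = (toℕ i · a) ∙ e s
      f : Fin (q ℕ.* n) → Carrier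
      f x = g (Fin.remQuot n x)
      g∈ : ∀ x → g x ∈ adjoin
      g∈ (i , s) = (q ℕ.∸ 1) ℕ.* toℕ i , A.resp (trans (∙-congʳ (×-homo-+ a ((q ℕ.∸ 1) ℕ.* toℕ i) (toℕ i))) (assoc _ _ _))
        (A.∙∈ (multiple∈ (complement (toℕ i))) (element∈ A order s))
      f∈ : ∀ x → f x ∈ adjoin
      f∈ x = g∈ (Fin.remQuot n x)
      exponent-zero : ∀ d → d ℕ.< q → d · a ∈ A → d ≡ 0
      exponent-zero zero    _   _   = ≡.refl
      exponent-zero (suc d) d<q da∈ = ⊥-elim (a∉ (coprime-powers∈ A
        (prime∤⇒coprime qr (λ q∣d → ℕ.<⇒≱ d<q (ℕ.∣⇒≤ q∣d))) aq∈ da∈))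
      ordered : ∀ i j s s′ → toℕ i ℕ.≤ toℕ j → g (i , s) ≈ g (j , s′) → i ≡ j
      ordered i j s s′ i≤j eq = Fin.toℕ-injective (ℕ.≤-antisym i≤j (ℕ.m∸n≡0⇒m≤n (exponent-zero (toℕ j ℕ.∸ toℕ i)
        (ℕ.≤-<-trans (ℕ.m∸n≤m (toℕ j) (toℕ i)) (Fin.toℕ<n j)) (cancel∈ʳ A (element∈ A order s′) (A.resp (∙-cancelˡ (toℕ i · a) _ _ (begin
          (toℕ i · a) ∙ e s
            ≈⟨ eq ⟩
          (toℕ j · a) ∙ e s′
            ≈⟨ ∙-congʳ (trans (×-congˡ (≡.sym (ℕ.m+[n∸m]≡n i≤j))) (×-homo-+ a (toℕ i) (toℕ j ℕ.∸ toℕ i))) ⟩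
          (toℕ i · a) ∙ ((toℕ j ℕ.∸ toℕ i) · a) ∙ e s′
            ≈⟨ assoc _ _ _ ⟩
          (toℕ i · a) ∙ (((toℕ j ℕ.∸ toℕ i) · a) ∙ e s′) ∎)) (element∈ A order s))))))
      g-injective : ∀ x y → g x ≈ g y → x ≡ y
      g-injective (i , s) (j , s′) eq = same (equal (ℕ.≤-total (toℕ i) (toℕ j)))
        where
        equal : toℕ i ℕ.≤ toℕ j ⊎ toℕ j ℕ.≤ toℕ i → i ≡ j
        equal (inj₁ i≤j) = ordered i j s s′ i≤j eq
        equal (inj₂ j≤i) = ≡.sym (ordered j i s′ s j≤i (sym eq))
        same : i ≡ j → (i , s) ≡ (j , s′)
        same ≡.refl = ≡.cong (i ,_) (element-injective A order s s′ (∙-cancelˡ (toℕ i · a) _ _ eq))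
      injective : ∀ x y → f x ≈ f y → x ≡ y
      injective x y eq = ≡.trans (≡.sym (Fin.combine-remQuot {q} n x)) (≡.trans (≡.cong (λ z → Fin.combine (proj₁ z) (proj₂ z))
        (g-injective (Fin.remQuot n x) (Fin.remQuot n y) eq)) (Fin.combine-remQuot {q} n y))
      surjective : ∀ x → x ∈ adjoin → ∃[ y ] f y ≈ x
      surjective x (i , gx) = Fin.combine r (proj₁ s) ,
        trans (reflexive (≡.cong g (Fin.remQuot-combine {q} r (proj₁ s)))) (trans (∙-congˡ (proj₂ s))
          (trans (sym (assoc _ _ _)) (trans (∙-congʳ (inverseʳ _)) (identityˡ x))))
        where
        -- The grade `i` of `x` means exponent - i as a coset, which `m` represents modulo `q`.
        m = (q ℕ.∸ 1) ℕ.* i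
        r : Fin q
        r = Fin.fromℕ< (m%n<n m q)
        divisible : q ∣ i ℕ.+ toℕ r
        divisible = ℕ.∣m+n∣m⇒∣n {m = m / q ℕ.* q} (≡.subst (q ∣_) arrangement (complement i)) (divides (m / q) ≡.refl)
          where
          arrangement : m ℕ.+ i ≡ m / q ℕ.* q ℕ.+ (i ℕ.+ toℕ r)
          arrangement = ≡.trans (≡.cong (ℕ._+ i) (≡.trans (m≡m%n+[m/n]*n m q) (ℕ.+-comm (m % q) (m / q ℕ.* q))))
            (≡.trans (ℕ.+-assoc (m / q ℕ.* q) (m % q) i) (≡.cong (m / q ℕ.* q ℕ.+_)
              (≡.trans (ℕ.+-comm (m % q) i) (≡.cong (i ℕ.+_) (≡.sym (Fin.toℕ-fromℕ< (m%n<n m q)))))))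
        s : ∃[ l ] e l ≈ (toℕ r · a) ⁻¹ ∙ x
        s = index A order _ (A.resp (begin
          ((i ℕ.+ toℕ r) · a) ⁻¹ ∙ ((i · a) ∙ x)          ≈⟨ ∙-congʳ (trans (⁻¹-cong (×-homo-+ a i (toℕ r))) (⁻¹-anti-homo-∙ (i · a) (toℕ r · a))) ⟩
          (toℕ r · a) ⁻¹ ∙ (i · a) ⁻¹ ∙ ((i · a) ∙ x)     ≈⟨ assoc _ _ _ ⟩
          (toℕ r · a) ⁻¹ ∙ ((i · a) ⁻¹ ∙ ((i · a) ∙ x))   ≈⟨ ∙-congˡ (trans (sym (assoc _ _ _)) (trans (∙-congʳ (inverseˡ _)) (identityˡ x))) ⟩
          (toℕ r · a) ⁻¹ ∙ x                              ∎)
          (A.∙∈ (A.⁻¹∈ (multiple∈ divisible)) gx))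

module NilpotentGroups (em : ExcludedMiddle (lsuc 0ℓ)) (G : Group 0ℓ 0ℓ) (nilpotent : IsNilpotent G)
  {N : ℕ} (bound : FiniteGroups.Bounded em G N) where
  open Classical em
  open FiniteGroups em G
  open Group G
  open GroupProperties G using (⁻¹-involutive; ∙-cancelˡ)
  open MonoidMult monoid using (×-homo-+; ×-congˡ; ×-assocˡ; ×-homo-1) renaming (_×_ to _·_)
  open SetoidReasoning setoid

  private
    Sub : Set₁
    Sub = Subgroup G 0ℓ

  -- Take the last term of the lower central series that is not contained in `A`, and `a` in it
  -- outside `A`. The commutator of the inverse of `s` with `a` lies in the next term, hence in `A`,
  -- and multiplying it by `s` gives the conjugate of `s` by `a`.
  normaliser-grows : ∀ A → (∃[ g ] ¬ g ∈ A) → ∃[ a ] ¬ a ∈ A × Normalises a A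
  normaliser-grows A (g , g∉) = descend (proj₁ nilpotent) λ x γ → A.resp (sym (proj₂ nilpotent x γ)) A.ε∈
    where
    module A = Subgroup A
    Below : ℕ → Set
    Below i = ∀ x → LowerCentral G i x → x ∈ A
    descend : ∀ i → Below i → ∃[ a ] ¬ a ∈ A × Normalises a A
    descend zero    below = ⊥-elim (g∉ (below g Unit.tt))
    descend (suc i) below with all-or (λ x → LowerCentral G i x → x ∈ A)
    ... | inj₁ below′ = descend i below′
    ... | inj₂ (a , h) = a , (λ a∈ → h λ _ → a∈) , λ {s} s∈ → A.resp (conjugate s)
            (A.∙∈ s∈ (below _ (gen (s ⁻¹ , a , by-contradiction (λ ¬γ → h λ γ → ⊥-elim (¬γ γ)) , refl))))
      where
      conjugate : ∀ s → s ∙ (s ⁻¹ ∙ a ∙ s ⁻¹ ⁻¹ ∙ a ⁻¹) ≈ a ∙ s ∙ a ⁻¹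
      conjugate s = begin
        s ∙ (s ⁻¹ ∙ a ∙ s ⁻¹ ⁻¹ ∙ a ⁻¹)    ≈⟨ assoc _ _ _ ⟨
        s ∙ (s ⁻¹ ∙ a ∙ s ⁻¹ ⁻¹) ∙ a ⁻¹    ≈⟨ ∙-congʳ (trans (sym (assoc _ _ _)) (∙-cong (trans (sym (assoc _ _ _)) (trans (∙-congʳ (inverseʳ s)) (identityˡ a))) (⁻¹-involutive s))) ⟩
        a ∙ s ∙ a ⁻¹                       ∎

  torsion : ∀ a → ∃[ r ] 0 ℕ.< r × r · a ≈ ε
  torsion a with all-or (λ { (i , j) → toℕ {suc N} i · a ≈ toℕ {suc N} j · a → i ≡ j })
  ... | inj₁ injective = ⊥-elim (ℕ.<-irrefl ≡.refl (bound (λ i → toℕ {suc N} i · a) (λ i j → injective (i , j))))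
  ... | inj₂ ((i , j) , h) = result (ℕ.<-cmp (toℕ i) (toℕ j))
    where
    eq : toℕ i · a ≈ toℕ j · a
    eq = by-contradiction λ ne → h λ e → ⊥-elim (ne e)
    difference : ∀ {i j} → i ℕ.< j → i · a ≈ j · a → ∃[ r ] 0 ℕ.< r × r · a ≈ ε
    difference {i} {j} i<j e = j ℕ.∸ i , ℕ.m<n⇒0<n∸m i<j , ∙-cancelˡ (i · a) _ _ (trans (sym (×-homo-+ a i (j ℕ.∸ i)))
      (trans (×-congˡ (ℕ.m+[n∸m]≡n (ℕ.<⇒≤ i<j))) (trans (sym e) (sym (identityʳ _)))))
    result : Tri (toℕ i ℕ.< toℕ j) (toℕ i ≡ toℕ j) (toℕ j ℕ.< toℕ i) → ∃[ r ] 0 ℕ.< r × r · a ≈ ε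
    result (tri< i<j _ _) = difference i<j eq
    result (tri> _ _ j<i) = difference j<i (sym eq)
    result (tri≈ _ i≡j _) = ⊥-elim (h λ _ → Fin.toℕ-injective i≡j)

  PrimeStep : Sub → Set
  PrimeStep A = ∃[ a ] ∃[ q ] ¬ a ∈ A × Normalises a A × Prime q × q · a ∈ A

  -- If `r` is the least positive exponent with `r · a` in `A` and `q` is a prime divisor of `r`,
  -- then the power of `a` with exponent r / q is still outside `A`, and its `q`-th power is inside.
  prime-step : ∀ A → (∃[ g ] ¬ g ∈ A) → PrimeStep A
  prime-step A out with normaliser-grows A out
  ... | a , a∉ , na with torsion a
  ...   | r₀ , 0<r₀ , r₀a≈ε with least em (λ r → 0 ℕ.< r × r · a ∈ A) (r₀ , 0<r₀ , Subgroup.resp A (sym r₀a≈ε) (Subgroup.ε∈ A))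
  ...     | r , (0<r , ra∈) , min = go (prime-divisor r (1<r r 0<r ra∈))
    where
    1<r : ∀ r → 0 ℕ.< r → r · a ∈ A → 1 ℕ.< r
    1<r (suc zero)    _ a∈ = ⊥-elim (a∉ (Subgroup.resp A (×-homo-1 a) a∈))
    1<r (suc (suc r)) _ _  = ℕ.s≤s (ℕ.s≤s ℕ.z≤n)
    go : ∃[ q ] Prime q × q ∣ r → PrimeStep A
    go (q , qr , divides d r≡) = d · a , q , (λ da∈ → min d d<r (0<d , da∈)) , normalises-power {a} {A} d na , qr ,
      Subgroup.resp A (sym (trans (×-assocˡ a q d) (×-congˡ (≡.trans (ℕ.*-comm q d) (≡.sym r≡))))) ra∈
      where
      0<d : 0 ℕ.< d
      0<d = ℕ.n≢0⇒n>0 λ { ≡.refl → ℕ.<⇒≢ 0<r (≡.sym r≡) }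
      d<r : d ℕ.< r
      d<r = ≡.subst (d ℕ.<_) (≡.sym r≡) (ℕ.m<m*n d q {{ℕ.>-nonZero 0<d}} (ℕ.nonTrivial⇒n>1 q {{prime⇒nonTrivial qr}}))

  private
    order-whole : ∃[ n ] HasOrder (subgroup whole) n
    order-whole = finite-order bound whole
    n = proj₁ order-whole

    bounded-order : ∀ {A m} → HasOrder (subgroup A) m → m ℕ.≤ n
    bounded-order {A} o = order-≤ {A} {whole} o (proj₂ order-whole) (λ _ → Unit.tt)

    grows : ∀ q {m} → Prime q → 0 ℕ.< m → m ℕ.< q ℕ.* m
    grows q {m} qr 0<m = ≡.subst (m ℕ.<_) (ℕ.*-comm m q) (ℕ.m<m*n m q {{ℕ.>-nonZero 0<m}} (ℕ.nonTrivial⇒n>1 q {{prime⇒nonTrivial qr}}))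

    fuel-step : ∀ {fuel m m′} → n ℕ.≤ suc fuel ℕ.+ m → m ℕ.< m′ → n ℕ.≤ fuel ℕ.+ m′
    fuel-step {fuel} {m} {m′} h m<m′ = ℕ.≤-trans h (≡.subst (ℕ._≤ fuel ℕ.+ m′) (ℕ.+-suc fuel m) (ℕ.+-monoʳ-≤ fuel m<m′))

    fuel-empty : ∀ {A : Sub} {m q} → Prime q → HasOrder (subgroup A) (q ℕ.* m) → 0 ℕ.< m → ¬ n ℕ.≤ m
    fuel-empty {A} {q = q} qr o 0<m h = ℕ.<⇒≱ (grows q qr 0<m) (ℕ.≤-trans (bounded-order {A} o) h)

  -- A subgroup of exponent prime to p lies in every subgroup S all of whose
  -- overgroups only admit prime steps of index p.
  absorb : ∀ p M (H S : Sub) → Coprime M p → (∀ {x} → x ∈ H → M · x ≈ ε) →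
           (∀ A B q m → S ⊑ A → A ⊑ B → Prime q → HasOrder (subgroup A) m → HasOrder (subgroup B) (q ℕ.* m) → q ≡ p) → H ⊑ S
  absorb p M H S cop exponent index = go n S id (proj₂ (finite-order bound S)) (ℕ.m≤m+n n _)
    where
    go : ∀ fuel A {m} → S ⊑ A → HasOrder (subgroup A) m → n ℕ.≤ fuel ℕ.+ m → H ⊑ A
    go fuel A {m} S⊑A o h {x} x∈H = decided (decide (∃[ g ] ¬ g ∈ A))
      where
      stepped : ∀ fuel → n ℕ.≤ fuel ℕ.+ m → PrimeStep A → x ∈ A
      stepped zero h (a , q , a∉ , na , qr , qa∈) = ⊥-elim (fuel-empty {adjoin} qr (adjoin-order a∉ o) (order-positive {A} o) h)
        where open Adjoin A a na q qr qa∈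
      -- By recursion `x` lies in the larger group, so its `q`-th power lies in `A`. Its `M`-th
      -- power is trivial, and `M` is prime to `q`, which the assumption on prime steps identifies
      -- with `p`.
      stepped (suc fuel) h (a , q , a∉ , na , qr , qa∈) = coprime-powers∈ A
        (Coprimality.sym (≡.subst (Coprime M) (≡.sym (index A adjoin q m S⊑A ⊑-adjoin qr o (adjoin-order a∉ o))) cop))
        (q-power∈ (go fuel adjoin (λ s → ⊑-adjoin (S⊑A s)) (adjoin-order a∉ o) (fuel-step {fuel} h (grows q qr (order-positive {A} o))) x∈H))
        (Subgroup.resp A (sym (exponent x∈H)) (Subgroup.ε∈ A))
        where open Adjoin A a na q qr qa∈
      decided : Dec (∃[ g ] ¬ g ∈ A) → x ∈ A
      decided (no none) = by-contradiction λ x∉ → none (x , x∉)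
      decided (yes out) = stepped fuel h (prime-step A out)

  -- The complement of a Sylow `p`-subgroup. The exponent `M` is carried along by the construction,
  -- which multiplies it by the prime of each step enlarging `H`; `total` says that the index is a
  -- power of `p`.
  record HallSubgroup (p : ℕ) : Set₁ where
    field
      H          : Sub
      {h}        : ℕ
      order      : HasOrder (subgroup H) h
      coprime    : Coprime h p
      M          : ℕ
      M-coprime  : Coprime M p
      exponent   : ∀ {x} → x ∈ H → M · x ≈ ε
      j          : ℕ
      total      : HasOrder (subgroup whole) (p ℕ.^ j ℕ.* h)

  -- The search keeps `H` of order prime to `p` inside `A`, with index a power of `p`. A step over
  -- `A` with prime `p` enlarges `A`. A step with another prime yields an element enlarging `H`
  -- itself, and the search restarts with `A` equal to the new `H`. Hence the two measures: `fuelA`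
  -- is renewed whenever `fuelH` drops.
  hallSubgroup : ∀ p → Prime p → HallSubgroup p
  hallSubgroup p pr = go n n trivial trivial-order 1-coprime 1 1-coprime (λ x≈ε → trans (identityʳ _) x≈ε)
      trivial 0 trivial-order′ id (λ x≈ε → trans (identityʳ _) x≈ε) (ℕ.m≤m+n n 1) (ℕ.m≤m+n n _)
    where
    1-coprime : Coprime 1 p
    1-coprime (d∣1 , _) = ℕ.∣1⇒≡1 d∣1
    trivial : Sub
    trivial = record { _∈S = _≈ ε ; resp = λ e f → trans (sym e) f ; ε∈ = refl
                     ; ∙∈ = λ e f → trans (∙-cong e f) (identityˡ ε) ; ⁻¹∈ = λ e → trans (⁻¹-cong e) (GroupProperties.ε⁻¹≈ε G) }
    trivial-order : HasOrder (subgroup trivial) 1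
    trivial-order = mkOrder trivial {1} (λ _ → ε) (λ _ → refl) (λ { zero zero _ → ≡.refl }) (λ x x≈ε → zero , sym x≈ε)
    trivial-order′ : HasOrder (subgroup trivial) (p ℕ.^ 0 ℕ.* 1)
    trivial-order′ = trivial-order

    go : ∀ fuelH fuelA (H : Sub) {h} → HasOrder (subgroup H) h → Coprime h p → ∀ M → Coprime M p → (∀ {x} → x ∈ H → M · x ≈ ε) →
         (A : Sub) → ∀ j → HasOrder (subgroup A) (p ℕ.^ j ℕ.* h) → H ⊑ A → (∀ {x} → x ∈ A → (p ℕ.^ j) · x ∈ H) →
         n ℕ.≤ fuelH ℕ.+ h → n ℕ.≤ fuelA ℕ.+ p ℕ.^ j ℕ.* h → HallSubgroup p
    go fuelH fuelA H {h} oH cop M Mcop exponent A j oA H⊑A powers hH hA = decided (decide (∃[ g ] ¬ g ∈ A))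
      where
      same-prime : ∀ fuelA → n ℕ.≤ fuelA ℕ.+ p ℕ.^ j ℕ.* h → ∀ a q → ¬ a ∈ A → Normalises a A → Prime q → q · a ∈ A → q ≡ p → HallSubgroup p
      same-prime zero hA a q a∉ na qr qa∈ ≡.refl = ⊥-elim (fuel-empty {adjoin} qr (adjoin-order a∉ oA) (order-positive {A} oA) hA)
        where open Adjoin A a na q qr qa∈
      same-prime (suc fuelA) hA a q a∉ na qr qa∈ ≡.refl = go fuelH fuelA H oH cop M Mcop exponent adjoin (suc j)
        (≡.subst (HasOrder (subgroup adjoin)) (≡.sym (ℕ.*-assoc p (p ℕ.^ j) h)) (adjoin-order a∉ oA)) (λ x∈ → ⊑-adjoin (H⊑A x∈))
        (λ {x} x∈ → Subgroup.resp H (trans (×-assocˡ x (p ℕ.^ j) p) (×-congˡ (ℕ.*-comm (p ℕ.^ j) p))) (powers (q-power∈ x∈)))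
        hH (fuel-step {fuelA} hA (≡.subst (p ℕ.^ j ℕ.* h ℕ.<_) (≡.sym (ℕ.*-assoc p (p ℕ.^ j) h)) (grows p qr (order-positive {A} oA))))
        where open Adjoin A a na q qr qa∈

      other-prime : ∀ fuelH → n ℕ.≤ fuelH ℕ.+ h → ∀ a q → ¬ a ∈ A → Normalises a A → Prime q → q · a ∈ A → q ≢ p → HallSubgroup p
      other-prime fuelH hH a q a∉ na qr qa∈ q≢p = finish fuelH hH
        where
        -- This power carries `A` into `H`. Since the exponent is prime to `q`, the element `b`
        -- stays outside `A`, whereas its `q`-th power now lies in `H`.
        b = (p ℕ.^ j) · a
        q⊥p : Coprime q p
        q⊥p = prime∤⇒coprime qr (prime-∤-prime qr pr q≢p)
        b∉A : ¬ b ∈ A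
        b∉A b∈ = a∉ (coprime-powers∈ A (coprime-^ j (Coprimality.sym q⊥p)) b∈ qa∈)
        conjugate-power : ∀ s m → m · (b ∙ s ∙ b ⁻¹) ≈ b ∙ (m · s) ∙ b ⁻¹
        conjugate-power s zero    = sym (trans (∙-congʳ (identityʳ b)) (inverseʳ b))
        conjugate-power s (suc m) = begin
          b ∙ s ∙ b ⁻¹ ∙ (m · (b ∙ s ∙ b ⁻¹))      ≈⟨ ∙-congˡ (conjugate-power s m) ⟩
          b ∙ s ∙ b ⁻¹ ∙ (b ∙ (m · s) ∙ b ⁻¹)      ≈⟨ assoc _ _ _ ⟩
          b ∙ s ∙ (b ⁻¹ ∙ (b ∙ (m · s) ∙ b ⁻¹))    ≈⟨ ∙-congˡ (trans (sym (assoc _ _ _)) (∙-congʳ (trans (sym (assoc _ _ _)) (trans (∙-congʳ (inverseˡ b)) (identityˡ _))))) ⟩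
          b ∙ s ∙ ((m · s) ∙ b ⁻¹)                 ≈⟨ trans (sym (assoc _ _ _)) (∙-congʳ (assoc _ _ _)) ⟩
          b ∙ (s ∙ (m · s)) ∙ b ⁻¹                 ∎
        -- H consists of the elements of A of exponent M, hence is normalised by what normalises A.
        nb : Normalises b H
        nb {s} s∈ = coprime-powers∈ H (coprime-^ j (Coprimality.sym Mcop)) (powers (normalises-power {a} {A} (p ℕ.^ j) na (H⊑A s∈)))
          (Subgroup.resp H (sym (trans (conjugate-power s M) (trans (∙-congʳ (trans (∙-congˡ (exponent s∈)) (identityʳ b))) (inverseʳ b)))) (Subgroup.ε∈ H))
        qb∈ : q · b ∈ H
        qb∈ = Subgroup.resp H (trans (×-assocˡ a (p ℕ.^ j) q) (trans (×-congˡ (ℕ.*-comm (p ℕ.^ j) q)) (sym (×-assocˡ a q (p ℕ.^ j))))) (powers qa∈)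
        open Adjoin H b nb q qr qb∈
        o′ : HasOrder (subgroup adjoin) (q ℕ.* h)
        o′ = adjoin-order (λ b∈ → b∉A (H⊑A b∈)) oH
        finish : ∀ fuelH → n ℕ.≤ fuelH ℕ.+ h → HallSubgroup p
        finish zero        hH = ⊥-elim (fuel-empty {adjoin} qr o′ (order-positive {H} oH) hH)
        finish (suc fuelH) hH = go fuelH n adjoin o′ (coprime-* q⊥p cop) (M ℕ.* q) (coprime-* Mcop q⊥p)
          (λ {x} x∈ → trans (sym (×-assocˡ x M q)) (exponent (q-power∈ x∈)))
          adjoin 0 (≡.subst (HasOrder (subgroup adjoin)) (≡.sym (ℕ.*-identityˡ (q ℕ.* h))) o′) id
          (λ {x} x∈ → Subgroup.resp adjoin (sym (identityʳ x)) x∈)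
          (fuel-step {fuelH} hH (grows q qr (order-positive {H} oH))) (ℕ.m≤m+n n _)

      stepped : PrimeStep A → HallSubgroup p
      stepped (a , q , a∉ , na , qr , qa∈) = choose (q ℕ.≟ p)
        where
        choose : Dec (q ≡ p) → HallSubgroup p
        choose (yes q≡p) = same-prime fuelA hA a q a∉ na qr qa∈ q≡p
        choose (no q≢p)  = other-prime fuelH hH a q a∉ na qr qa∈ q≢p

      decided : Dec (∃[ g ] ¬ g ∈ A) → HallSubgroup p
      decided (no none) = record
        { H = H ; order = oH ; coprime = cop ; M = M ; M-coprime = Mcop ; exponent = exponent ; j = j
        ; total = mkOrder whole (element A oA) (λ _ → Unit.tt) (element-injective A oA)
            (λ x _ → index A oA x (by-contradiction λ x∉ → none (x , x∉))) }
      decided (yes out) = stepped (prime-step A out)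

-- Galois extensions and their subfields of p-power degree

module GaloisExtensions (em : ExcludedMiddle (lsuc 0ℓ)) {k : Field} (K : Extension k) (galois : IsGalois K) where
  open Classical em
  open LinearAlgebra em
  private
    module k = Field k
    module K = Extension K
    R = K.commutativeRing
    open IsGalois galois
    n = proj₁ finite
    e : Basis K n
    e = proj₂ finite

  bounded : FiniteGroups.Bounded em (Gal K) n
  bounded f distinct = Automorphisms.order≤degree em K f distinct e

  order≡degree : ∀ {N} → HasOrder (subgroup (FiniteGroups.whole em (Gal K))) N → n ≡ N
  order≡degree order = Artin.degree≡order em K (finiteGroup (FiniteGroups.whole em (Gal K)) order)
    (λ x h → fixed x λ σ → K.trans (K.sym (Inverse.strictlyInverseˡ order (σ , Unit.tt) x)) (h (Inverse.from order (σ , Unit.tt)))) e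

  module _ (H : Subgroup (Gal K) 0ℓ) {h} (order : HasOrder (subgroup H) h) where
    private
      F = fixedField K H
      open Towers em K F using (sub-finite; over-finite; tower)

    fixedField-degree : ∃[ m ] Basis (asExtension K F) m × n ≡ h ℕ.* m
    fixedField-degree = m , f , ≡.trans (dimension-unique K e (tower f b)) (≡.cong (ℕ._* m) (FixedField.degree≡order em K H order b))
      where
      m = proj₁ (sub-finite e)
      f = proj₂ (sub-finite e)
      b = proj₂ (over-finite e)

  module _ (F : Subextension K) where
    private
      module F = Subextension F
      K/F = over K F
      open Towers em K F using (over-finite)
      g = proj₁ (over-finite e)
      b : Basis K/F g
      b = proj₂ (over-finite e)
      module b = Basis b

    stabiliser : Subgroup (Gal K) 0ℓ
    stabiliser = record
      { _∈S  = λ σ → ∀ x → x F.∈F → Automorphism.⟦_⟧ σ x K.≈ x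
      ; resp = λ σ≈τ h x x∈ → K.trans (K.sym (σ≈τ x)) (h x x∈)
      ; ε∈   = λ _ _ → K.refl
      ; ∙∈   = λ {σ} h h′ x x∈ → K.trans (Automorphism.⟦⟧-cong σ (h′ x x∈)) (h x x∈)
      ; ⁻¹∈  = λ {σ} h x x∈ → K.trans (Automorphism.⟦⟧⁻¹-cong σ (K.sym (h x x∈))) (Automorphism.from∘to σ x)
      }

    -- An F-linear functional ℓ is a K-linear combination of automorphisms; by
    -- Dedekind only automorphisms fixing F occur, so ℓ(x) = x ℓ(1) for x fixed by them.
    fixed-by-stabiliser : ∀ x → (∀ σ → σ ∈ stabiliser → Automorphism.⟦_⟧ σ x K.≈ x) → x F.∈F
    fixed-by-stabiliser x x-fixed = conclude nonzero-coordinate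
      where
      open Sums R
      open RingSolver R
      open FieldProperties K.top
      open SetoidReasoning K.setoid
      open K using (_≈_; _*_; _+_; _-_; -_; 0#; 1#; ι; refl; sym; trans)
      W = FiniteGroups.whole em (Gal K)
      orderW = FiniteGroups.finite-order em (Gal K) bounded W
      N = proj₁ orderW
      G : FiniteGroup K N
      G = finiteGroup W (proj₂ orderW)
      open FiniteGroup G
      open Automorphisms em K σ distinct
      open RegularRepresentation em K/F using (coordinate; coordinate-≈; combination-+)
      module F′ = Field (subfield K F)

      ℓ : Fin g → K.Carrier → K.Carrier
      ℓ j z = proj₁ (coordinate b z j)

      ℓ-scale : ∀ j y → y F.∈F → ∀ z → ℓ j (y * z) ≈ y * ℓ j z
      ℓ-scale j y y∈ z = coordinate-≈ b (y * z) (λ i → (y , y∈) F′.* coordinate b z i)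
        (trans (K.*-congˡ (proj₂ (b.coordinates z))) (trans (*-∑ y (λ i → proj₁ (coordinate b z i) * b.basis i))
          (∑-cong λ i → sym (K.*-assoc y (proj₁ (coordinate b z i)) (b.basis i))))) j

      ℓ-+ : ∀ j y z → ℓ j (y + z) ≈ ℓ j y + ℓ j z
      ℓ-+ j y z = coordinate-≈ b (y + z) (λ i → coordinate b y i F′.+ coordinate b z i)
        (trans (K.+-cong (proj₂ (b.coordinates y)) (proj₂ (b.coordinates z))) (sym (combination-+ (coordinate b y) (coordinate b z) b.basis))) j

      ℓ-cong : ∀ j {y z} → y ≈ z → ℓ j y ≈ ℓ j z
      ℓ-cong j {y} {z} y≈z = coordinate-≈ b y (coordinate b z) (trans y≈z (proj₂ (b.coordinates z))) j

      ℓ-0 : ∀ j {z} → z ≈ 0# → ℓ j z ≈ 0#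
      ℓ-0 j {z} z≈0 = trans (ℓ-cong j (trans z≈0 (sym (K.zeroˡ 0#)))) (trans (ℓ-scale j 0# (F.resp K.ι.0#-homo (F.ι∈ k.0#)) 0#) (K.zeroˡ _))

      ℓ-combination : ∀ j {m} (a : Fin m → k.Carrier) v → ℓ j (combination K a v) ≈ combination K a (λ i → ℓ j (v i))
      ℓ-combination j {zero}  a v = ℓ-0 j refl
      ℓ-combination j {suc m} a v = trans (ℓ-+ j _ _) (K.+-cong (ℓ-scale j (ι (a zero)) (F.ι∈ (a zero)) (v zero)) (ℓ-combination j (a ∘ suc) (v ∘ suc)))

      nonzero-coordinate : ∃[ j ] ¬ ℓ j 1# ≈ 0#
      nonzero-coordinate = go (all-or (λ j → ℓ j 1# ≈ 0#))
        where
        go : (∀ j → ℓ j 1# ≈ 0#) ⊎ (∃[ j ] ¬ ℓ j 1# ≈ 0#) → ∃[ j ] ¬ ℓ j 1# ≈ 0#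
        go (inj₂ h) = h
        go (inj₁ h) = ⊥-elim (K.0≉1 (sym (trans (proj₂ (b.coordinates 1#))
          (∑-0 {f = λ i → ℓ i 1# * b.basis i} λ i → trans (K.*-congʳ (h i)) (K.zeroˡ _)))))

      module _ (j : Fin g) (t : K.Carrier) (u : Fin N → K.Carrier)
        (represent : ∀ z → ∑ R (λ i → u i * act i z) ≈ t * ℓ j z) (t≉0 : ¬ t ≈ 0#) where
        supported : ∀ i y → y F.∈F → u i * (act i y - y) ≈ 0#
        supported i y y∈ = act-independent (λ i → u i * (act i y - y)) vanishing i
          where
          vanishing : ∀ z → ∑ R (λ i → u i * (act i y - y) * act i z) ≈ 0#
          vanishing z = begin
            ∑ R (λ i → u i * (act i y - y) * act i z)
              ≈⟨ ∑-cong (λ i → trans (solve 4 (λ u a y z → u :* (a :- y) :* z := u :* (a :* z) :+ (:- y) :* (u :* z)) refl (u i) (act i y) y (act i z))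
                   (K.+-congʳ (K.*-congˡ {u i} (sym (RingHomomorphism.*-homo (act.to i) y z))))) ⟩
            ∑ R (λ i → u i * act i (y * z) + - y * (u i * act i z))
              ≈⟨ ∑-+ (λ i → u i * act i (y * z)) (λ i → - y * (u i * act i z)) ⟩
            ∑ R (λ i → u i * act i (y * z)) + ∑ R (λ i → - y * (u i * act i z))
              ≈⟨ K.+-cong (represent (y * z)) (trans (sym (*-∑ (- y) (λ i → u i * act i z))) (K.*-congˡ (represent z))) ⟩
            t * ℓ j (y * z) + - y * (t * ℓ j z)
              ≈⟨ K.+-congʳ (K.*-congˡ (ℓ-scale j y y∈ z)) ⟩
            t * (y * ℓ j z) + - y * (t * ℓ j z)
              ≈⟨ solve 3 (λ t y l → t :* (y :* l) :+ (:- y) :* (t :* l) := con (0 , 0)) refl t y (ℓ j z) ⟩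
            0# ∎
        moves : ∀ i → u i * act i x ≈ x * u i
        moves i = go (decide (u i ≈ 0#))
          where
          go : Dec (u i ≈ 0#) → u i * act i x ≈ x * u i
          go (yes u≈0) = trans (trans (K.*-congʳ u≈0) (K.zeroˡ _)) (sym (trans (K.*-congˡ u≈0) (K.zeroʳ x)))
          go (no u≉0)  = trans (K.*-congˡ (x-fixed (σ i) λ y y∈ → trans (solve 2 (λ a y → a := (a :- y) :+ y) refl (act i y) y)
            (trans (K.+-congʳ (*-cancel-0 u≉0 (supported i y y∈))) (K.+-identityˡ y)))) (K.*-comm (u i) x)
        scalar : ℓ j x ≈ x * ℓ j 1#
        scalar = trans (solve 2 (λ a c → a := (a :- c) :+ c) refl (ℓ j x) (x * ℓ j 1#)) (trans (K.+-congʳ (*-cancel-0 t≉0 (begin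
          t * (ℓ j x - x * ℓ j 1#)
            ≈⟨ solve 4 (λ t a x o → t :* (a :- x :* o) := t :* a :- x :* (t :* o)) refl t (ℓ j x) x (ℓ j 1#) ⟩
          t * ℓ j x - x * (t * ℓ j 1#)
            ≈⟨ K.+-cong (sym (represent x)) (K.-‿cong (K.*-congˡ (sym (represent 1#)))) ⟩
          ∑ R (λ i → u i * act i x) - x * ∑ R (λ i → u i * act i 1#)
            ≈⟨ K.+-cong (∑-cong moves) (K.-‿cong (trans (*-∑ x (λ i → u i * act i 1#))
                 (∑-cong λ i → K.*-congˡ {x} (trans (K.*-congˡ {u i} (RingHomomorphism.1#-homo (act.to i))) (K.*-identityʳ (u i)))))) ⟩
          ∑ R (λ i → x * u i) - ∑ R (λ i → x * u i)
            ≈⟨ K.-‿inverseʳ _ ⟩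
          0# ∎))) (K.+-identityˡ _))

      conclude : ∃[ j ] ¬ ℓ j 1# ≈ 0# → x F.∈F
      -- The unknowns are a scalar t, multiplying ℓ, and one coefficient for each automorphism: n +
      -- 1 of them, in n equations, one for each basis vector. Independence of the automorphisms
      -- forces t to be nonzero.
      conclude (j , ℓ1≉0) = go (nontrivial-solution K.top n (suc N) (ℕ.≤-reflexive (≡.cong suc (order≡degree (proj₂ orderW))))
          (λ i → (- ℓ j (Basis.basis e i)) ∷ (λ l → act l (Basis.basis e i))))
        where
        go : Σ[ w ∈ (Fin (suc N) → K.Carrier) ] (∃[ l ] ¬ w l ≈ 0#) ×
          (∀ i → ∑ R (λ l → ((- ℓ j (Basis.basis e i)) ∷ (λ l → act l (Basis.basis e i))) l * w l) ≈ 0#) → x F.∈F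
        go (w , (l₀ , nz) , solves) = F.resp (trans (K.*-congˡ ℓ1c≈1) (K.*-identityʳ x))
            (F.resp (trans (K.*-congʳ (scalar j (w zero) (w ∘ suc) represent t≉0)) (K.*-assoc x (ℓ j 1#) c))
              (F.*∈ (proj₂ (coordinate b x j)) (F.⁻¹∈ (proj₂ (coordinate b 1# j)) ℓ1c≈1)))
          where
          c = proj₁ (K.invertible (ℓ j 1#) ℓ1≉0)
          ℓ1c≈1 = proj₂ (K.invertible (ℓ j 1#) ℓ1≉0)
          on-basis : ∀ i → ∑ R (λ l → act l (Basis.basis e i) * w (suc l)) ≈ w zero * ℓ j (Basis.basis e i)
          on-basis i = trans (solve 3 (λ s m t → s := (:- m :* t :+ s) :+ t :* m) refl _ (ℓ j (Basis.basis e i)) (w zero))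
            (trans (K.+-congʳ (solves i)) (K.+-identityˡ _))
          represent : ∀ z → ∑ R (λ i → w (suc i) * act i z) ≈ w zero * ℓ j z
          represent z = begin
            ∑ R (λ i → w (suc i) * act i z)
              ≈⟨ ∑-cong (λ i → K.*-congˡ {w (suc i)} (act.⟦⟧-cong i z≈)) ⟩
            ∑ R (λ i → w (suc i) * act i (combination K a (Basis.basis e)))
              ≈⟨ act-combination (w ∘ suc) a (Basis.basis e) ⟩
            combination K a (λ i → ∑ R (λ l → act l (Basis.basis e i) * w (suc l)))
              ≈⟨ ∑-cong (λ i → trans (K.*-congˡ {ι (a i)} (on-basis i)) (solve 3 (λ a t m → a :* (t :* m) := t :* (a :* m)) refl (ι (a i)) (w zero) (ℓ j (Basis.basis e i)))) ⟩
            ∑ R (λ i → w zero * (ι (a i) * ℓ j (Basis.basis e i)))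
              ≈⟨ *-∑ (w zero) (λ i → ι (a i) * ℓ j (Basis.basis e i)) ⟨
            w zero * combination K a (λ i → ℓ j (Basis.basis e i))
              ≈⟨ K.*-congˡ (trans (ℓ-cong j z≈) (ℓ-combination j a (Basis.basis e))) ⟨
            w zero * ℓ j z ∎
            where
            a = proj₁ (Basis.coordinates e z)
            z≈ = proj₂ (Basis.coordinates e z)
          t≉0 : ¬ w zero ≈ 0#
          t≉0 t≈0 = nz (vanish l₀)
            where
            vanish : ∀ l → w l ≈ 0#
            vanish zero    = t≈0
            vanish (suc l) = act-independent (w ∘ suc) (λ z → trans (represent z) (trans (K.*-congʳ t≈0) (K.zeroˡ _))) l

  relative : ∀ (F F₀ : Subextension K) → (∀ {x} → Subextension._∈F F₀ x → Subextension._∈F F x) → Subextension (over K F₀)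
  relative F F₀ F₀⊆F = record
    { _∈F = F._∈F ; resp = F.resp ; ι∈ = λ { (a , a∈) → F₀⊆F a∈ } ; +∈ = F.+∈ ; *∈ = F.*∈ ; -∈ = F.-∈ ; ⁻¹∈ = F.⁻¹∈ }
    where module F = Subextension F

  -- By `absorb`, `H` lies in the stabiliser of `F`: for subgroups of orders `m` and `q * m`, one
  -- inside the other and both above that stabiliser, the tower of fixed fields shows that `q`
  -- divides [F : k], a power of `p`.
  ppower-subfield⊆fixedField : ∀ {p M} → Prime p → Coprime M p → (H : Subgroup (Gal K) 0ℓ) →
    IsNilpotent (Gal K) → (∀ σ → σ ∈ H → Group._≈_ (Gal K) (MonoidMult._×_ (Group.monoid (Gal K)) M σ) (Group.ε (Gal K))) →
    ∀ F → HasPPowerDegree p (asExtension K F) → ∀ {x} → Subextension._∈F F x → Subextension._∈F (fixedField K H) x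
  ppower-subfield⊆fixedField {p} {M} pr cop H nilpotent exponent F (c , f) {x} x∈F τ τ∈H =
    NilpotentGroups.absorb em (Gal K) nilpotent bounded p M H (stabiliser F) cop (λ {σ} → exponent σ) index {τ} τ∈H x x∈F
    where
    over-F = Towers.over-finite em K F e
    g = proj₁ over-F
    b = proj₂ over-F
    n≡ : n ≡ g ℕ.* p ℕ.^ c
    n≡ = dimension-unique K e (Towers.tower em K F f b)

    index : ∀ A B q m → (∀ {σ} → σ ∈ stabiliser F → σ ∈ A) → (∀ {σ} → σ ∈ A → σ ∈ B) → Prime q →
            HasOrder (subgroup A) m → HasOrder (subgroup B) (q ℕ.* m) → q ≡ p
    index A B q m S⊑A A⊑B qr oA oB = prime∣^⇒≡ pr c qr (divides (u ℕ.* w) p^c≡)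
      where
      Fᴬ = fixedField K A
      w = proj₁ (fixedField-degree B oB)
      F/Fᴬ = relative F Fᴬ λ {x} x∈ → fixed-by-stabiliser F x λ σ σ∈ → x∈ σ (S⊑A σ∈)
      bᴬ = proj₂ (Towers.over-finite em K Fᴬ e)
      fᴬ = Towers.sub-finite em (over K Fᴬ) F/Fᴬ bᴬ
      u = proj₁ fᴬ
      b′ : Basis (over (over K Fᴬ) F/Fᴬ) g
      b′ = record { basis = Basis.basis b ; coordinates = Basis.coordinates b ; independent = Basis.independent b }
      m≡ : m ≡ g ℕ.* u
      m≡ = ≡.trans (≡.sym (FixedField.degree≡order em K A oA bᴬ)) (dimension-unique (over K Fᴬ) bᴬ (Towers.tower em (over K Fᴬ) F/Fᴬ (proj₂ fᴬ) b′))
      g≢0 : ℕ.NonZero g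
      g≢0 = ℕ.≢-nonZero λ g≡0 → ℕ.<⇒≢ (FiniteGroups.order-positive em (Gal K) {A} oA) (≡.sym (≡.trans m≡ (≡.cong (ℕ._* u) g≡0)))
      p^c≡ : p ℕ.^ c ≡ u ℕ.* w ℕ.* q
      p^c≡ = ℕ.*-cancelˡ-≡ (p ℕ.^ c) (u ℕ.* w ℕ.* q) g {{g≢0}} (begin
        g ℕ.* p ℕ.^ c             ≡⟨ n≡ ⟨
        n                         ≡⟨ proj₂ (proj₂ (fixedField-degree B oB)) ⟩
        q ℕ.* m ℕ.* w             ≡⟨ ≡.cong (λ m → q ℕ.* m ℕ.* w) m≡ ⟩
        q ℕ.* (g ℕ.* u) ℕ.* w     ≡⟨ ℕ-solve q g u w ⟩
        g ℕ.* (u ℕ.* w ℕ.* q)     ∎)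
        where
        open ≡.≡-Reasoning
        ℕ-solve : ∀ q g u w → q ℕ.* (g ℕ.* u) ℕ.* w ≡ g ℕ.* (u ℕ.* w ℕ.* q)
        ℕ-solve = NS.solve 4 (λ q g u w → q NS.:* (g NS.:* u) NS.:* w NS.:= g NS.:* (u NS.:* w NS.:* q)) ≡.refl

-- Norm groups and the group Ш

identityHom : ∀ {c ℓ} (R : CommutativeRing c ℓ) → RingHomomorphism (CommutativeRing.rawRing R) (CommutativeRing.rawRing R)
identityHom R = record { ⟦_⟧ = id ; isRingHomomorphism = Identity.isRingHomomorphism (CommutativeRing.rawRing R) (CommutativeRing.refl R) }

generated-map : ∀ {c ℓ p q} (G : Group c ℓ) {P : Group.Carrier G → Set p} {Q : Group.Carrier G → Set q} →
                (∀ {x} → P x → Generated G Q x) → ∀ {x} → Generated G P x → Generated G Q x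
generated-map G f (gen p)     = f p
generated-map G f (gen-≈ e g) = gen-≈ e (generated-map G f g)
generated-map G f gen-ε       = gen-ε
generated-map G f (gen-∙ g h) = gen-∙ (generated-map G f g) (generated-map G f h)
generated-map G f (gen-⁻¹ g)  = gen-⁻¹ (generated-map G f g)

power-closed : ∀ {c ℓ p} {G : Group c ℓ} (S : Subgroup G p) n {x} → x ∈ S → MonoidMult._×_ (Group.monoid G) n x ∈ S
power-closed S zero    x∈ = Subgroup.ε∈ S
power-closed S (suc n) x∈ = Subgroup.∙∈ S x∈ (power-closed S n x∈)

module UnitGroups {a ℓ} (R : CommutativeRing a ℓ) where
  open CommutativeRing R hiding (zero)
  private module Prod = MonoidSum *-commutativeMonoid
  open RingSolver R
  open Exp semiring using (_^_)

  module U = AbelianGroup (Units R)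
  open MonoidMult U.monoid public using () renaming (_×_ to _·_)

  power-value : ∀ n (u : U.Carrier) → proj₁ (n · u) ≈ proj₁ u ^ n
  power-value zero    u = refl
  power-value (suc n) u = *-congˡ (power-value n u)

  factor-unit : ∀ {m} (z : Fin m → Carrier) {y y⁻¹} → y ≈ ∏ R z → y * y⁻¹ ≈ 1# → ∀ i → ∃[ w ] z i * w ≈ 1#
  factor-unit {suc m} z {y} {y⁻¹} y≈ e i = ∏ R (removeAt z i) * y⁻¹ , trans (sym (*-assoc _ _ _))
    (trans (*-congʳ (sym (trans y≈ (Prod.sum-remove {i = i} z)))) e)

  root-unit : ∀ {n} → 0 ℕ.< n → ∀ {x y y⁻¹} → y ≈ x ^ n → y * y⁻¹ ≈ 1# → ∃[ w ] x * w ≈ 1#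
  root-unit {suc n} _ {x} {y} {y⁻¹} y≈ e = x ^ n * y⁻¹ , trans (sym (*-assoc _ _ _)) (trans (*-congʳ (sym y≈)) e)

  module _ {m p} (N : Fin m → Carrier → Set p) where
    IsProduct : U.Carrier → Set (a ⊔ ℓ ⊔ p)
    IsProduct u = Σ[ z ∈ (Fin m → Carrier) ] (∀ i → N i (z i)) × proj₁ u ≈ ∏ R z

    single : (∀ i {x y} → x ≈ y → N i x → N i y) → (∀ i → N i 1#) → ∀ i u → N i (proj₁ u) → IsProduct u
    single N-cong N-1 i u h = z , (λ j → z∈ j (i Fin.≟ j)) , go i
      where
      z : Fin m → Carrier
      z = updateAt (λ _ → 1#) i (const (proj₁ u))
      z∈ : ∀ j → Dec (i ≡ j) → N j (z j)
      z∈ j (yes ≡.refl) = N-cong i (reflexive (≡.sym (Vector.updateAt-updates i (λ _ → 1#)))) h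
      z∈ j (no i≢j)     = N-cong j (reflexive (≡.sym (Vector.updateAt-minimal j i (λ _ → 1#) (i≢j ∘ ≡.sym)))) (N-1 j)
      ones : ∀ m → ∏ R {m} (λ _ → 1#) ≈ 1#
      ones zero    = refl
      ones (suc m) = trans (*-identityˡ _) (ones m)
      go : ∀ {m} (i : Fin m) → proj₁ u ≈ ∏ R (updateAt (λ _ → 1#) i (const (proj₁ u)))
      go {suc m} zero    = sym (trans (*-congˡ (ones m)) (*-identityʳ _))
      go {suc m} (suc i) = trans (go i) (sym (*-identityˡ _))

  private module UMult = CommutativeMonoidMult U.commutativeMonoid

  -- Every factor of a product that is a unit is itself a unit, so the factors can be split off one
  -- at a time and transferred separately.
  product-transfer : ∀ {m p q} (N : Fin m → Carrier → Set p) (S : Subgroup U.group q) c →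
    (∀ i u → N i (proj₁ u) → c · u ∈ S) → ∀ {u} → Generated U.group (IsProduct N) u → c · u ∈ S
  product-transfer N S c transfer (gen {u@(y , y⁻¹ , e)} (z , z∈ , y≈)) = go z (λ i → factor-unit z y≈ e i) transfer z∈ u y≈
    where
    module S = Subgroup S
    go : ∀ {m} (z : Fin m → Carrier) (w : ∀ i → ∃[ w ] z i * w ≈ 1#) {N : Fin m → Carrier → Set _} →
         (∀ i u → N i (proj₁ u) → c · u ∈ S) → (∀ i → N i (z i)) → ∀ u → proj₁ u ≈ ∏ R z → c · u ∈ S
    go {zero}  z w transfer z∈ u u≈ = S.resp (UMult.×-congʳ c {U.ε} {u} (sym u≈)) (power-closed S c S.ε∈)
    go {suc m} z w transfer z∈ u u≈ = S.resp (U.trans {c · v U.∙ c · (v U.⁻¹ U.∙ u)} {c · (v U.∙ (v U.⁻¹ U.∙ u))} {c · u}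
        (U.sym {c · (v U.∙ (v U.⁻¹ U.∙ u))} {c · v U.∙ c · (v U.⁻¹ U.∙ u)} (UMult.×-distrib-+ v (v U.⁻¹ U.∙ u) c))
        (UMult.×-congʳ c {v U.∙ (v U.⁻¹ U.∙ u)} {u} vv⁻¹u≈u))
      (S.∙∈ (transfer zero v (z∈ zero)) (go (z ∘ suc) (w ∘ suc) (transfer ∘ suc) (z∈ ∘ suc) (v U.⁻¹ U.∙ u) rest))
      where
      v : U.Carrier
      v = z zero , w zero
      vv⁻¹u≈u : proj₁ (v U.∙ (v U.⁻¹ U.∙ u)) ≈ proj₁ u
      vv⁻¹u≈u = trans (sym (*-assoc _ _ _)) (trans (*-congʳ (proj₂ (w zero))) (*-identityˡ _))
      rest : proj₁ (v U.⁻¹ U.∙ u) ≈ ∏ R (z ∘ suc)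
      rest = trans (*-congˡ u≈) (trans (solve 3 (λ i z p → i :* (z :* p) := z :* i :* p) refl (proj₁ (w zero)) (z zero) (∏ R (z ∘ suc)))
        (trans (*-congʳ (proj₂ (w zero))) (*-identityˡ _)))
  product-transfer N S c transfer (gen-≈ {x} {y} e g) = Subgroup.resp S (UMult.×-congʳ c {x} {y} e) (product-transfer N S c transfer g)
  product-transfer N S c transfer gen-ε               = power-closed S c (Subgroup.ε∈ S)
  product-transfer N S c transfer (gen-∙ {x} {y} g h) = Subgroup.resp S
    (U.sym {c · (x U.∙ y)} {c · x U.∙ c · y} (UMult.×-distrib-+ x y c)) (Subgroup.∙∈ S (product-transfer N S c transfer g) (product-transfer N S c transfer h))
  product-transfer N S c transfer (gen-⁻¹ {x} g)      = Subgroup.resp S (power-⁻¹ c)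
    (Subgroup.⁻¹∈ S (product-transfer N S c transfer g))
    where
    power-⁻¹ : ∀ n → proj₁ ((n · x) U.⁻¹) ≈ proj₁ (n · (x U.⁻¹))
    power-⁻¹ zero    = refl
    power-⁻¹ (suc n) = *-congˡ (power-⁻¹ n)

module _ (em : ExcludedMiddle (lsuc 0ℓ)) {k : Field} {a ℓ} (R : CommutativeRing a ℓ)
  (φ : RingHomomorphism (Field.rawRing k) (CommutativeRing.rawRing R)) where
  open CommutativeRing R hiding (zero)
  open UnitGroups R
  open Exp semiring using (_^_)

  IsNormOf : Extension k → Carrier → Set (a ⊔ ℓ)
  IsNormOf E = FormalNorms.IsFormalNorm em E R φ

  norm-cong : ∀ E {x y} → x ≈ y → IsNormOf E x → IsNormOf E y
  norm-cong E x≈y (FormalNorms.formalNorm e c x≈) = FormalNorms.formalNorm e c (trans (sym x≈y) x≈)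

  -- The scalar `x` acts as `x` times the identity. Consequently the degree of `E` kills the units
  -- of `R` modulo norms from `E`, which is where every exponent for Ш comes from.
  scalar-norm : ∀ E {n} → Basis E n → ∀ x → IsNormOf E (x ^ n)
  scalar-norm E {n} e x = FormalNorms.norm-formal em E R φ e (λ (_ : Fin 1) → x) (λ _ → Extension.1# E)
    (trans (sym (det-scalar n)) (Determinant.det-cong R λ i j → sym (trans (+-identityʳ _)
      (*-congˡ (trans (RingHomomorphism.⟦⟧-cong φ (RegularRepresentation.regular-1 em E e (Extension.refl E) i j)) (FormalNorms.map-1 em E R φ i j))))))
    where
    open Determinant R
    det-scalar : ∀ n → det R (λ i j → x * 1ᴹ {n} i j) ≈ x ^ n
    det-scalar zero    = refl
    det-scalar (suc n) = trans (+-cong (*-cong (*-identityʳ x) (det-scalar n)) (-‿cong (asum-zero (λ j →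
        trans (*-congʳ (zeroʳ x)) (zeroˡ (det R (minor {n} (λ i l → x * 1ᴹ (suc i) l) (suc j))))))))
      (trans (+-congˡ (trans (sym (+-identityˡ _)) (-‿inverseʳ 0#))) (+-identityʳ _))

  norm-1 : ∀ E → IsFinite E → IsNormOf E 1#
  norm-1 E (n , e) = norm-cong E (1^ n) (scalar-norm E e 1#)
    where
    1^ : ∀ n → 1# ^ n ≈ 1#
    1^ zero    = refl
    1^ (suc n) = trans (*-identityˡ _) (1^ n)

  -- Two multipliers are allowed so that one relation covers all cases: both are `h` when passing
  -- from `K` to the fixed field, `c` is `h` and `d` is 1 in the opposite direction, and both are 1
  -- for an unchanged factor.
  Transfers : Extension k → Extension k → ℕ → Set (a ⊔ ℓ)
  Transfers E F c = ∀ u → IsNormOf E (proj₁ u) → Σ[ γ ∈ U.Carrier ] Σ[ d ∈ ℕ ] IsNormOf F (proj₁ γ) × (c · u) U.≈ (d · γ)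

  transfers-refl : ∀ E → Transfers E E 1
  transfers-refl E u h = u , 1 , h , refl

  module _ (K : Extension k) (H : Subgroup (Gal K) 0ℓ) {h} (order : HasOrder (subgroup H) h) {n} (e : Basis K n) where
    private F = asExtension K (fixedField K H)

    transfers-down : Transfers K F h
    transfers-down u@(β , β⁻¹ , ββ⁻¹≈1) N = package (NormTransfer.formalNorm-down em K H order e R φ N)
      where
      package : ∃[ γ ] IsNormOf F γ × β ^ h ≈ γ ^ h → Σ[ γ ∈ U.Carrier ] Σ[ d ∈ ℕ ] IsNormOf F (proj₁ γ) × (h · u) U.≈ (d · γ)
      package (γ , Nγ , βʰ≈γʰ) = (γ , γ-unit) , h , Nγ , trans (power-value h u) (trans βʰ≈γʰ (sym (power-value h (γ , γ-unit))))
        where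
        γ-unit : ∃[ w ] γ * w ≈ 1#
        γ-unit = root-unit (ℕ.≤-<-trans ℕ.z≤n (Fin.toℕ<n (FiniteGroup.unit (finiteGroup H order))))
          (trans (power-value h u) βʰ≈γʰ) (proj₂ (proj₂ (h · u)))

    transfers-up : Transfers F K h
    transfers-up u N = h · u , 1 , norm-cong K (sym (power-value h u)) (NormTransfer.formalNorm-up em K H order e R φ N) ,
      sym (*-identityʳ _)

  module _ {m} (E F : Fin m → Extension k) (finite : ∀ i → IsFinite (F i)) where
    private N = λ (E : Fin m → Extension k) i → IsNormOf (E i)

    norm-generated : ∀ i u → IsNormOf (F i) (proj₁ u) → Generated U.group (IsProduct (N F)) u
    norm-generated i u h = gen (single (N F) (λ i → norm-cong (F i)) (λ i → norm-1 (F i) (finite i)) i u h)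

    products-transfer : ∀ c → (∀ i → ∃[ cᵢ ] cᵢ ∣ c × Transfers (E i) (F i) cᵢ) →
      ∀ {u} → Generated U.group (IsProduct (N E)) u → Generated U.group (IsProduct (N F)) (c · u)
    products-transfer c transfers {u} = product-transfer (N E) (⟨ U.group ⟩ (IsProduct (N F))) c go {u}
      where
      open MonoidMult U.monoid using (×-assocˡ; ×-congˡ)
      S = ⟨ U.group ⟩ (IsProduct (N F))
      go : ∀ i u → IsNormOf (E i) (proj₁ u) → c · u ∈ S
      go i u h = package (transfers i)
        where
        package : ∃[ cᵢ ] cᵢ ∣ c × Transfers (E i) (F i) cᵢ → c · u ∈ S
        package (cᵢ , divides q c≡qcᵢ , transfer) = conclude (transfer u h)
          where
          conclude : Σ[ γ ∈ U.Carrier ] Σ[ d ∈ ℕ ] IsNormOf (F i) (proj₁ γ) × (cᵢ · u) U.≈ (d · γ) → c · u ∈ S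
          conclude (γ , d , Nγ , e) = gen-≈ (trans (MonoidMult.×-congʳ U.monoid q {d · γ} {cᵢ · u} (sym e))
              (trans (×-assocˡ u q cᵢ) (×-congˡ {u} (≡.sym c≡qcᵢ))))
            (power-closed S q {d · γ} (power-closed S d {γ} (norm-generated i γ Nγ)))

module NormGroups (em : ExcludedMiddle (lsuc 0ℓ)) (k : Field) (poles : HasFinitelyManyPoles em k) where
  private
    module k = Field k
    kR = k.commutativeRing
    φ = identityHom kR
    module Uₖ = UnitGroups kR
    module U𝔸 = UnitGroups (adèleRing k)

  norm⇒formal : ∀ (E : Extension k) {x y} → IsNorm E x y → IsNormOf em {k} kR φ E y
  norm⇒formal E {x} {y} N = FormalNorms.norm-formal em E kR φ N.e (λ (_ : Fin 1) → k.1#) (λ _ → x)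
    (k.trans N.value (Determinant.det-cong kR λ i j → k.sym (k.trans (k.+-identityʳ _) (k.trans (k.*-identityˡ _)
      (RegularRepresentation.regular-unique em E N.e x N.matrix N.action i j)))))
    where module N = IsNorm N

  -- Over `k` itself the formal sum has a value in `E`, and its matrix is that of multiplication by
  -- this value; Cramer's rule supplies the inverse.
  formal⇒norm : ∀ (E : Extension k) {y y⁻¹} → y k.* y⁻¹ k.≈ k.1# → IsNormOf em {k} kR φ E y →
    Σ[ x ∈ AbelianGroup.Carrier (Units (Extension.commutativeRing E)) ] IsNorm E (proj₁ x) y
  formal⇒norm E {y} {y⁻¹} yy⁻¹≈1 (FormalNorms.formalNorm e c y≈) = (V.value c (Basis.basis e) ,
      V.value (FormalNorms.inverse em E kR φ e c (Basis.basis e) y⁻¹ unit) (Basis.basis e) , V.value-inverse e c (Basis.basis e) y⁻¹ unit) ,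
    record { e = e ; matrix = FormalNorms.matrix em E kR φ e c (Basis.basis e) ; action = V.value-action e c (Basis.basis e) ; value = y≈ }
    where
    module E = Extension E
    module V = FormalNormValues em E kR φ E.commutativeRing E.embed (identityHom E.commutativeRing) (λ _ → E.refl)
    unit : FormalNorms.norm em E kR φ e c (Basis.basis e) k.* y⁻¹ k.≈ k.1#
    unit = k.trans (k.*-congʳ (k.sym y≈)) yy⁻¹≈1

  module _ {m} (E : Fin m → Extension k) where
    private
      Nₖ : Fin m → k.Carrier → Set
      Nₖ = λ i → IsNormOf em {k} kR φ (E i)
      N𝔸 : Fin m → Adèle k → Set₁
      N𝔸 = λ i → IsNormOf em {k} (adèleRing k) (DiagonalEmbedding.diagonalHom em {k} poles) (E i)

    normFrom⇒product : ∀ {y} → IsNormFrom k E y → Uₖ.IsProduct Nₖ y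
    normFrom⇒product (x , z , N , y≈) = z , (λ i → norm⇒formal (E i) (N i)) , y≈

    product⇒normFrom : ∀ {y} → Uₖ.IsProduct Nₖ y → IsNormFrom k E y
    product⇒normFrom {y , y⁻¹ , e} (z , N , y≈) = (λ i → proj₁ (norm i)) , z , (λ i → proj₂ (norm i)) , y≈
      where
      norm : ∀ i → Σ[ x ∈ AbelianGroup.Carrier (Units (Extension.commutativeRing (E i))) ] IsNorm (E i) (proj₁ x) (z i)
      norm i = formal⇒norm (E i) (proj₂ (Uₖ.factor-unit z y≈ e i)) (N i)

    idèlicNormFrom⇒product : ∀ {β} → IsIdèlicNormFrom k E β → U𝔸.IsProduct N𝔸 β
    idèlicNormFrom⇒product (α , z , N , β≈) = z , (λ i → AdèlicNorms.adèlicNorm⇒formalNorm em {k} poles (E i) {proj₁ (α i)} {z i} (N i)) , β≈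

    product⇒idèlicNormFrom : ∀ {β} → U𝔸.IsProduct N𝔸 β → IsIdèlicNormFrom k E β
    product⇒idèlicNormFrom {b , b⁻¹ , e} (z , N , β≈) = (λ i → proj₁ (norm i)) , z , (λ i → proj₂ (norm i)) , β≈
      where
      norm : ∀ i → Σ[ α ∈ AbelianGroup.Carrier (Idèles (Extension.top (E i))) ] IsAdèlicNorm (E i) (proj₁ α) (z i)
      norm i = AdèlicNorms.formalNorm⇒idèle em {k} poles (E i) {z i} {proj₁ (U𝔸.factor-unit z {b} {b⁻¹} β≈ e i)}
        (N i) (proj₂ (U𝔸.factor-unit z {b} {b⁻¹} β≈ e i))

  degree-power∈ : ∀ {m} (E : Fin m → Extension k) → (∀ i → IsFinite (E i)) → ∀ i {n} → Basis (E i) n → ∀ x → n Uₖ.· x ∈ normGroup k E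
  degree-power∈ E finite i {n} e x = generated-map Uₖ.U.group (λ {y} p → gen (product⇒normFrom E {y} p))
    (norm-generated em {k} kR φ E E finite i (n Uₖ.· x) (norm-cong em {k} kR φ (E i) (k.sym (Uₖ.power-value n x)) (scalar-norm em {k} kR φ (E i) e (proj₁ x))))

  record Linked {m} (E F : Fin m → Extension k) (c : ℕ) : Set₁ where
    field
      finite     : ∀ i → IsFinite (F i)
      ordinary   : ∀ i → ∃[ cᵢ ] cᵢ ∣ c × Transfers em {k} kR φ (E i) (F i) cᵢ
      idèlic     : ∀ i → ∃[ cᵢ ] cᵢ ∣ c × Transfers em {k} (adèleRing k) (DiagonalEmbedding.diagonalHom em {k} poles) (E i) (F i) cᵢ

  module _ {m} {E F : Fin m → Extension k} {c} (linked : Linked E F c) where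
    open Linked linked

    normGroup-transfer : ∀ {x} → x ∈ normGroup k E → c Uₖ.· x ∈ normGroup k F
    normGroup-transfer {x} x∈ = generated-map Uₖ.U.group (λ {y} p → gen (product⇒normFrom F {y} p))
      (products-transfer em {k} kR φ E F finite c ordinary {x} (generated-map Uₖ.U.group (λ {y} p → gen (normFrom⇒product E {y} p)) x∈))

    idèlicNormGroup-transfer : ∀ {β} → β ∈ idèlicNormGroup k E → c U𝔸.· β ∈ idèlicNormGroup k F
    idèlicNormGroup-transfer {β} β∈ = generated-map U𝔸.U.group (λ {y} p → gen (product⇒idèlicNormFrom F {y} p))
      (products-transfer em {k} (adèleRing k) (DiagonalEmbedding.diagonalHom em {k} poles) E F finite c idèlic {β} (generated-map U𝔸.U.group (λ {y} p → gen (idèlicNormFrom⇒product E {y} p)) β∈))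

    localNorms-transfer : ∀ {x} → x ∈ localNorms k E → c Uₖ.· x ∈ localNorms k F
    localNorms-transfer {x} (β , β∈ , principal) = c U𝔸.· β , idèlicNormGroup-transfer {β} β∈ , powers c
      where
      powers : ∀ n → IsPrincipal k (proj₁ (n Uₖ.· x)) (proj₁ (n U𝔸.· β))
      powers zero    v = CommutativeRing.refl (Completion v) {constant v k.1#}
      powers (suc n) v = CommutativeRing.*-cong (Completion v) {Adèle.at (proj₁ β) v} {constant v (proj₁ x)}
        {Adèle.at (proj₁ (n U𝔸.· β)) v} {constant v (proj₁ (n Uₖ.· x))} (principal v) (powers n v)

-- Subquotients compared by multiplication with integers

inverse-modulo : ∀ a m → 0 ℕ.< a → Coprime a m → ∃[ u ] ∃[ k ] u ℕ.* a ≡ 1 ℕ.+ k ℕ.* m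
inverse-modulo a@(suc _) m _ cop with coprime-Bézout cop
... | Bézout.+- x y eq = x , y , ≡.sym eq
... | Bézout.-+ zero y eq = 1 , ℕ.pred a ℕ.* y , ≡.trans (ℕ.+-identityʳ a) (≡.cong suc (≡.sym (≡.trans (ℕ.*-assoc (ℕ.pred a) y m)
      (≡.trans (≡.cong (ℕ.pred a ℕ.*_) (≡.sym eq)) (ℕ.*-identityʳ (ℕ.pred a))))))
-- Here x a is -1 modulo `m`, so x (x a) is an inverse of `a`.
... | Bézout.-+ x@(suc _) y eq = x ℕ.* (x ℕ.* a) , ℕ.pred (x ℕ.* a) ℕ.* y , (begin
    x ℕ.* (x ℕ.* a) ℕ.* a                  ≡⟨ NS.solve 2 (λ x a → x NS.:* (x NS.:* a) NS.:* a NS.:= (x NS.:* a) NS.:* (x NS.:* a)) ≡.refl x a ⟩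
    (x ℕ.* a) ℕ.* (x ℕ.* a)                ≡⟨ NS.solve 1 (λ t → (NS.con 1 NS.:+ t) NS.:* (NS.con 1 NS.:+ t) NS.:= NS.con 1 NS.:+ t NS.:* (NS.con 1 NS.:+ (NS.con 1 NS.:+ t))) ≡.refl (ℕ.pred (x ℕ.* a)) ⟩
    suc (ℕ.pred (x ℕ.* a) ℕ.* suc (x ℕ.* a)) ≡⟨ ≡.cong (λ t → suc (ℕ.pred (x ℕ.* a) ℕ.* t)) eq ⟩
    suc (ℕ.pred (x ℕ.* a) ℕ.* (y ℕ.* m))   ≡⟨ ≡.cong suc (ℕ.*-assoc (ℕ.pred (x ℕ.* a)) y m) ⟨
    suc (ℕ.pred (x ℕ.* a) ℕ.* y ℕ.* m)     ∎)
  where open ≡.≡-Reasoning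

coprime⇒positive : ∀ {c p} → Prime p → Coprime c p → 0 ℕ.< c
coprime⇒positive {zero}  {p} pr cop = ⊥-elim (¬prime[1] (≡.subst Prime (cop (p ℕ.∣0 , ℕ.∣-refl)) pr))
coprime⇒positive {suc c} pr cop = ℕ.s≤s ℕ.z≤n

coprime-^ʳ : ∀ {a c} n → Coprime a c → Coprime a (c ℕ.^ n)
coprime-^ʳ n cop = Coprimality.sym (coprime-^ n (Coprimality.sym cop))

module _ {A : AbelianGroup 0ℓ 0ℓ} where
  open AbelianGroup A
  open MonoidMult monoid using (×-homo-+; ×-congˡ; ×-assocˡ) renaming (_×_ to _·_)

  gcd-powers∈ : (N : Subgroup group 0ℓ) → ∀ m n {x} → m · x ∈ N → n · x ∈ N → gcd m n · x ∈ N
  gcd-powers∈ N m n {x} mx∈ nx∈ = go (Bézout.identity (gcd-GCD m n))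
    where
    module N = Subgroup N
    combine : ∀ {a b} u w → gcd m n ℕ.+ w ℕ.* b ≡ u ℕ.* a → a · x ∈ N → b · x ∈ N → gcd m n · x ∈ N
    combine {a} {b} u w eq ax∈ bx∈ = N.resp (trans (assoc _ _ _) (trans (∙-congˡ (inverseʳ _)) (identityʳ _)))
      (N.∙∈ (N.resp (trans (×-assocˡ x u a) (trans (×-congˡ (≡.sym eq)) (×-homo-+ x (gcd m n) (w ℕ.* b)))) (power-closed N u ax∈))
            (N.⁻¹∈ (N.resp (×-assocˡ x w b) (power-closed N w bx∈))))
    go : Bézout.Identity (gcd m n) m n → gcd m n · x ∈ N
    go (Bézout.+- u w eq) = combine u w eq mx∈ nx∈
    go (Bézout.-+ u w eq) = combine w u eq nx∈ mx∈

  gcds-powers∈ : (N : Subgroup group 0ℓ) → ∀ {m} (f : Fin m → ℕ) {x} → (∀ i → f i · x ∈ N) → gcds f · x ∈ N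
  gcds-powers∈ N {zero}  f h = Subgroup.ε∈ N
  gcds-powers∈ N {suc m} f h = gcd-powers∈ N (f zero) (gcds (f ∘ suc)) (h zero) (gcds-powers∈ N (f ∘ suc) (h ∘ suc))

module Subquotients (A : AbelianGroup 0ℓ 0ℓ) where
  open AbelianGroup A
  open MonoidMult monoid using (×-congˡ; ×-congʳ; ×-assocˡ; ×-homo-1) renaming (_×_ to _·_)
  open CommutativeMonoidMult commutativeMonoid using (×-distrib-+)
  open AbelianGroupProperties A using (⁻¹-∙-comm)
  open GroupProperties group using (ε⁻¹≈ε)
  open SetoidReasoning setoid
  private module Sum = MonoidSum commutativeMonoid

  ·-ε : ∀ n → n · ε ≈ ε
  ·-ε zero    = refl
  ·-ε (suc n) = trans (identityˡ _) (·-ε n)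

  ·-⁻¹ : ∀ n x → n · (x ⁻¹) ≈ (n · x) ⁻¹
  ·-⁻¹ zero    x = sym ε⁻¹≈ε
  ·-⁻¹ (suc n) x = trans (∙-congˡ (·-⁻¹ n x)) (⁻¹-∙-comm _ _)

  ·-/ : ∀ n x y → n · (x ∙ y ⁻¹) ≈ n · x ∙ (n · y) ⁻¹
  ·-/ n x y = trans (×-distrib-+ x (y ⁻¹) n) (∙-congˡ (·-⁻¹ n y))

  ·-comm : ∀ m n x → m · (n · x) ≈ n · (m · x)
  ·-comm m n x = trans (×-assocˡ x m n) (trans (×-congˡ (ℕ.*-comm m n)) (sym (×-assocˡ x n m)))

  module _ (N : Subgroup group 0ℓ) where
    private module N = Subgroup N

    /∈-refl : ∀ {x y} → x ≈ y → x ∙ y ⁻¹ ∈ N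
    /∈-refl {x} {y} e = N.resp (sym (trans (∙-congʳ e) (inverseʳ y))) N.ε∈

    /ε : ∀ {x} → x ∈ N → x ∙ ε ⁻¹ ∈ N
    /ε x∈ = N.resp (sym (trans (∙-congˡ ε⁻¹≈ε) (identityʳ _))) x∈

    ε/ : ∀ {x} → x ∙ ε ⁻¹ ∈ N → x ∈ N
    ε/ x∈ = N.resp (trans (∙-congˡ ε⁻¹≈ε) (identityʳ _)) x∈

    multiple∈ : ∀ {m n x} → m ∣ n → m · x ∈ N → n · x ∈ N
    multiple∈ {m} {n} {x} (divides q eq) h = N.resp (trans (×-assocˡ x q m) (×-congˡ (≡.sym eq))) (power-closed N q h)

    near : ∀ n k m {y} → n ≡ 1 ℕ.+ k ℕ.* m → m · y ∈ N → n · y ∙ y ⁻¹ ∈ N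
    near n k m {y} eq my∈ = N.resp (sym (begin
        n · y ∙ y ⁻¹                  ≈⟨ ∙-congʳ (×-congˡ eq) ⟩
        y ∙ (k ℕ.* m) · y ∙ y ⁻¹      ≈⟨ ∙-congʳ (comm _ _) ⟩
        (k ℕ.* m) · y ∙ y ∙ y ⁻¹      ≈⟨ trans (assoc _ _ _) (trans (∙-congˡ (inverseʳ y)) (identityʳ _)) ⟩
        (k ℕ.* m) · y                 ∎))
      (multiple∈ {m} (divides k ≡.refl) my∈)

    -- If `q` divides the exponent `e` reached so far and `n` is prime to `q`, then gcd e n is a
    -- proper divisor of `e` that also carries `x` into `N`. The descent ends at exponent 1.
    local-global : ∀ {x} d → 0 ℕ.< d → d · x ∈ N → (∀ p → Prime p → p ∣ d → ∃[ n ] Coprime n p × n · x ∈ N) → x ∈ N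
    local-global {x} d 0<d dx∈ local = go d ℕ.∣-refl 0<d dx∈ (<-wellFounded d)
      where
      go : ∀ e → e ∣ d → 0 ℕ.< e → e · x ∈ N → Acc ℕ._<_ e → x ∈ N
      go 1                _   _   ex∈ _        = N.resp (×-homo-1 x) ex∈
      go e@(suc (suc _)) e∣d 0<e ex∈ (acc rs) = descend (prime-divisor e (ℕ.s≤s (ℕ.s≤s ℕ.z≤n)))
        where
        descend : ∃[ q ] Prime q × q ∣ e → x ∈ N
        descend (q , qr , q∣e) = next (local q qr (ℕ.∣-trans q∣e e∣d))
          where
          next : ∃[ n ] Coprime n q × n · x ∈ N → x ∈ N
          next (n , cop , nx∈) = go g (ℕ.∣-trans (gcd[m,n]∣m e n) e∣d) 0<g (gcd-powers∈ {A} N e n ex∈ nx∈) (rs g<e)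
            where
            g = gcd e n
            0<g : 0 ℕ.< g
            0<g = ℕ.n≢0⇒n>0 λ g≡0 → ℕ.<⇒≢ 0<e (≡.sym (ℕ.0∣⇒≡0 (≡.subst (_∣ e) g≡0 (gcd[m,n]∣m e n))))
            g<e : g ℕ.< e
            g<e = ℕ.≤∧≢⇒< (ℕ.∣⇒≤ (gcd[m,n]∣m e n)) λ g≡e → ¬prime[1] (≡.subst Prime (cop (ℕ.∣-trans q∣e (≡.subst (_∣ n) g≡e (gcd[m,n]∣n e n)) , ℕ.∣-refl)) qr)

  module _ {p} (L : Subgroup group p) (N : Subgroup group 0ℓ) where
    private
      Q = Subquotient A L N
      module Q = AbelianGroup Q

    subquotient-power : ∀ n (x : Q.Carrier) → proj₁ (MonoidMult._×_ Q.monoid n x) ≈ n · proj₁ x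
    subquotient-power zero    x = refl
    subquotient-power (suc n) x = ∙-congˡ (subquotient-power n x)

  module PrimaryComponent {p} (pr : Prime p) (L L′ : Subgroup group (lsuc 0ℓ)) (N N′ : Subgroup group 0ℓ)
    (c : ℕ) (c⊥p : Coprime c p)
    (L⇒L′ : ∀ {x} → x ∈ L → c · x ∈ L′) (L′⇒L : ∀ {x} → x ∈ L′ → c · x ∈ L)
    (N⇒N′ : ∀ {x} → x ∈ N → c · x ∈ N′) (N′⇒N : ∀ {x} → x ∈ N′ → c · x ∈ N)
    (b : ℕ) (exponent : ∀ x → (p ℕ.^ b) · x ∈ N′) where

    -- The map is multiplication by `c`. Going there and back multiplies by the square of `c`, which
    -- is prime to `p`: this gives injectivity on `p`-primary elements, and a preimage of `y` is u c
    -- y with u c² congruent to 1 modulo the exponent of the target.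
    primary≅ : ∀ {Q Q′ : AbelianGroup (lsuc 0ℓ) 0ℓ} → Q ≡ Subquotient A L N → Q′ ≡ Subquotient A L′ N′ → primaryComponent Q p ≅ Q′
    primary≅ ≡.refl ≡.refl = f , record
      { isGroupMonomorphism = record
        { isGroupHomomorphism = record
          { isMonoidHomomorphism = record
            { isMagmaHomomorphism = record
              { isRelHomomorphism = record { cong = λ {x} {y} → cong {x} {y} }
              ; homo = λ { ((x , _) , _) ((y , _) , _) → /∈-refl N′ (×-distrib-+ x y c) } }
            ; ε-homo = /∈-refl N′ (·-ε c) }
          ; ⁻¹-homo = λ { ((x , _) , _) → /∈-refl N′ (·-⁻¹ c x) } }
        ; injective = λ {x} {y} → injective {x} {y} }
      ; surjective = surjective }
      where
      module P = AbelianGroup (primaryComponent (Subquotient A L N) p)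
      module N′ = Subgroup N′
      f : P.Carrier → AbelianGroup.Carrier (Subquotient A L′ N′)
      f ((x , x∈) , _) = c · x , L⇒L′ x∈
      cong : ∀ {x y : P.Carrier} → proj₁ (proj₁ x) ∙ proj₁ (proj₁ y) ⁻¹ ∈ N → c · proj₁ (proj₁ x) ∙ (c · proj₁ (proj₁ y)) ⁻¹ ∈ N′
      cong {(x , _) , _} {(y , _) , _} h = N′.resp (·-/ c x y) (N⇒N′ h)
      torsion∈ : ∀ (x : P.Carrier) → ∃[ n ] (p ℕ.^ n) · proj₁ (proj₁ x) ∈ N
      torsion∈ ((x , x∈) , (n , e)) = n , Subgroup.resp N (subquotient-power L N (p ℕ.^ n) (x , x∈)) (ε/ N e)
      injective : ∀ {x y : P.Carrier} → c · proj₁ (proj₁ x) ∙ (c · proj₁ (proj₁ y)) ⁻¹ ∈ N′ → proj₁ (proj₁ x) ∙ proj₁ (proj₁ y) ⁻¹ ∈ N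
      injective {x̂@((x , _) , _)} {ŷ@((y , _) , _)} h = local-global N (p ℕ.^ (m ℕ.+ n)) (ℕ.m^n>0 p {{ℕ.nonTrivial⇒nonZero p {{prime⇒nonTrivial pr}}}} (m ℕ.+ n))
          (Subgroup.resp N (sym (·-/ (p ℕ.^ (m ℕ.+ n)) x y)) (Subgroup.∙∈ N
            (multiple∈ N (divides (p ℕ.^ n) (≡.trans (ℕ.^-distribˡ-+-* p m n) (ℕ.*-comm (p ℕ.^ m) (p ℕ.^ n)))) xm∈) (Subgroup.⁻¹∈ N (multiple∈ N (divides (p ℕ.^ m) (ℕ.^-distribˡ-+-* p m n)) yn∈))))
          λ q qr q∣ → c ℕ.* c , ≡.subst (Coprime (c ℕ.* c)) (≡.sym (same qr q∣)) (coprime-* c⊥p c⊥p) ,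
            Subgroup.resp N (×-assocˡ _ c c) (N′⇒N (N′.resp (sym (·-/ c x y)) h))
        where
        m = proj₁ (torsion∈ x̂)
        n = proj₁ (torsion∈ ŷ)
        xm∈ = proj₂ (torsion∈ x̂)
        yn∈ = proj₂ (torsion∈ ŷ)
        same : ∀ {q} → Prime q → q ∣ p ℕ.^ (m ℕ.+ n) → q ≡ p
        same = prime∣^⇒≡ pr (m ℕ.+ n)
      surjective : ∀ y → ∃[ x ] (∀ {z : P.Carrier} → proj₁ (proj₁ z) ∙ proj₁ (proj₁ x) ⁻¹ ∈ N → c · proj₁ (proj₁ z) ∙ proj₁ y ⁻¹ ∈ N′)
      surjective (y , y∈) = build (inverse-modulo (c ℕ.* c) (p ℕ.^ b) (ℕ.*-mono-< (coprime⇒positive pr c⊥p) (coprime⇒positive pr c⊥p)) (coprime-^ʳ b (coprime-* c⊥p c⊥p)))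
        where
        build : ∃[ u ] ∃[ k ] u ℕ.* (c ℕ.* c) ≡ 1 ℕ.+ k ℕ.* p ℕ.^ b →
                ∃[ x ] (∀ {z : P.Carrier} → proj₁ (proj₁ z) ∙ proj₁ (proj₁ x) ⁻¹ ∈ N → c · proj₁ (proj₁ z) ∙ y ⁻¹ ∈ N′)
        build (u , k , eq) = ((x , x∈) , (b , /ε N (Subgroup.resp N (sym (subquotient-power L N (p ℕ.^ b) (x , x∈))) torsion))) ,
          λ {((z , _) , _)} h → N′.resp (telescope (c · z) (c · x) y) (N′.∙∈ (N′.resp (·-/ c z x) (N⇒N′ h)) c·x~y)
          where
          x = u · (c · y)
          x∈ : x ∈ L
          x∈ = power-closed L u (L′⇒L y∈)
          torsion : (p ℕ.^ b) · x ∈ N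
          torsion = Subgroup.resp N (trans (×-congʳ u (·-comm c (p ℕ.^ b) y)) (·-comm u (p ℕ.^ b) (c · y))) (power-closed N u (N′⇒N (exponent y)))
          c·x≈ : c · x ≈ (u ℕ.* (c ℕ.* c)) · y
          c·x≈ = trans (·-comm c u (c · y)) (trans (×-congʳ u (×-assocˡ y c c)) (×-assocˡ y u (c ℕ.* c)))
          c·x~y : c · x ∙ y ⁻¹ ∈ N′
          c·x~y = N′.resp (∙-congʳ (sym c·x≈)) (near N′ (u ℕ.* (c ℕ.* c)) k (p ℕ.^ b) eq (exponent y))
          telescope : ∀ x y z → x ∙ y ⁻¹ ∙ (y ∙ z ⁻¹) ≈ x ∙ z ⁻¹
          telescope x y z = trans (assoc _ _ _) (∙-congˡ (trans (sym (assoc _ _ _)) (trans (∙-congʳ (inverseˡ y)) (identityˡ _))))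

  module PrimaryDecomposition {r} (p : Fin r → ℕ) (prime : ∀ j → Prime (p j)) (distinct : ∀ i j → p i ≡ p j → i ≡ j)
    (L : Subgroup group (lsuc 0ℓ)) (N : Subgroup group 0ℓ) (L′ : Fin r → Subgroup group (lsuc 0ℓ)) (N′ : Fin r → Subgroup group 0ℓ)
    (c : Fin r → ℕ) (c⊥p : ∀ j → Coprime (c j) (p j))
    (L⇒L′ : ∀ j {x} → x ∈ L → c j · x ∈ L′ j) (L′⇒L : ∀ j {x} → x ∈ L′ j → c j · x ∈ L)
    (N⇒N′ : ∀ j {x} → x ∈ N → c j · x ∈ N′ j) (N′⇒N : ∀ j {x} → x ∈ N′ j → c j · x ∈ N)
    (b : Fin r → ℕ) (exponent : ∀ j x → (p j ℕ.^ b j) · x ∈ N′ j)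
    (d : ℕ) (0<d : 0 ℕ.< d) (d-exponent : ∀ x → d · x ∈ N) (all-primes : ∀ q → Prime q → q ∣ d → ∃[ j ] p j ≡ q) where

    private
      cofactor : ∀ {r} (q : Fin r → ℕ) → Fin r → ℕ
      cofactor {suc r} q zero    = ListAction.product (List.tabulate (q ∘ suc))
      cofactor {suc r} q (suc j) = q zero ℕ.* cofactor (q ∘ suc) j

      cofactor-∣ : ∀ {r} (q : Fin r → ℕ) l j → l ≢ j → q j ∣ cofactor q l
      cofactor-∣ {suc r} q zero    zero    ne = ⊥-elim (ne ≡.refl)
      cofactor-∣ {suc r} q zero    (suc j) ne = ∣-product (q ∘ suc) j
      cofactor-∣ {suc r} q (suc l) zero    ne = ℕ.m∣m*n _
      cofactor-∣ {suc r} q (suc l) (suc j) ne = ℕ.∣n⇒∣m*n (q zero) (cofactor-∣ (q ∘ suc) l j λ { ≡.refl → ne ≡.refl })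

      cofactor-coprime : ∀ {r} (q : Fin r → ℕ) {m} j → (∀ l → l ≢ j → Coprime (q l) m) → Coprime (cofactor q j) m
      cofactor-coprime {suc r} q zero    h = coprime-product (q ∘ suc) (λ l → h (suc l) λ ())
      cofactor-coprime {suc r} q (suc j) h = coprime-* (h zero λ ()) (cofactor-coprime (q ∘ suc) j λ l ne → h (suc l) λ { ≡.refl → ne ≡.refl })

      q : Fin r → ℕ
      q j = p j ℕ.^ b j

      prime-powers-coprime : ∀ l j → l ≢ j → Coprime (q l) (p j)
      prime-powers-coprime l j ne = coprime-^ (b l) (prime∤⇒coprime (prime l) (prime-∤-prime (prime l) (prime j) (ne ∘ distinct l j)))

      solution : ∀ j → ∃[ u ] ∃[ k ] u ℕ.* (c j ℕ.* c j ℕ.* cofactor q j) ≡ 1 ℕ.+ k ℕ.* q j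
      solution j = inverse-modulo _ (q j) (coprime⇒positive (prime j) cop) (coprime-^ʳ (b j) cop)
        where
        cop : Coprime (c j ℕ.* c j ℕ.* cofactor q j) (p j)
        cop = coprime-* (coprime-* (c⊥p j) (c⊥p j)) (cofactor-coprime q j (λ l ne → prime-powers-coprime l j ne))

      -- Chinese remainder coefficients: `E j` is divisible by `q l` for every other `l`, and its
      -- product with the square of `c j` is 1 modulo `q j`. The square accounts for passing from
      -- `L′ j` to `L` and back.
      E : Fin r → ℕ
      E j = proj₁ (solution j) ℕ.* cofactor q j

      c²E : ∀ j → c j ℕ.* (E j ℕ.* c j) ≡ 1 ℕ.+ proj₁ (proj₂ (solution j)) ℕ.* q j
      c²E j = ≡.trans (NS.solve 3 (λ c u Q → c NS.:* (u NS.:* Q NS.:* c) NS.:= u NS.:* (c NS.:* c NS.:* Q)) ≡.refl (c j) (proj₁ (solution j)) (cofactor q j))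
        (proj₂ (proj₂ (solution j)))

    -- For surjectivity the components, moved into `L` by the `c l`, are added with weights `E l`;
    -- in component `j` every other term lies in `N′ j`. For injectivity each prime dividing `d` is
    -- some `p j`, and the square of `c j` is a multiplier prime to it, as `local-global` requires.
    ⨁≅ : ∀ {Q : AbelianGroup (lsuc 0ℓ) 0ℓ} {Q′ : Fin r → AbelianGroup (lsuc 0ℓ) 0ℓ} →
      Q ≡ Subquotient A L N → Q′ ≡ (λ j → Subquotient A (L′ j) (N′ j)) → Q ≅ ⨁ Q′
    ⨁≅ ≡.refl ≡.refl = f , record
      { isGroupMonomorphism = record
        { isGroupHomomorphism = record
          { isMonoidHomomorphism = record
            { isMagmaHomomorphism = record
              { isRelHomomorphism = record { cong = λ { {x , _} {y , _} h j → Subgroup.resp (N′ j) (·-/ (c j) x y) (N⇒N′ j h) } }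
              ; homo = λ { (x , _) (y , _) j → /∈-refl (N′ j) (×-distrib-+ x y (c j)) } }
            ; ε-homo = λ j → /∈-refl (N′ j) (·-ε (c j)) }
          ; ⁻¹-homo = λ { (x , _) j → /∈-refl (N′ j) (·-⁻¹ (c j) x) } }
        ; injective = λ { {x , _} {y , _} → injective x y } }
      ; surjective = surjective }
      where
      ⨁Q′ = ⨁ (λ j → Subquotient A (L′ j) (N′ j))
      f : AbelianGroup.Carrier (Subquotient A L N) → AbelianGroup.Carrier ⨁Q′
      f (x , x∈) j = c j · x , L⇒L′ j x∈
      injective : ∀ x y → (∀ j → c j · x ∙ (c j · y) ⁻¹ ∈ N′ j) → x ∙ y ⁻¹ ∈ N
      injective x y h = local-global N d 0<d (d-exponent (x ∙ y ⁻¹)) λ q qr q∣d → local q (all-primes q qr q∣d)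
        where
        local : ∀ q → ∃[ j ] p j ≡ q → ∃[ n ] Coprime n q × n · (x ∙ y ⁻¹) ∈ N
        local _ (j , ≡.refl) = c j ℕ.* c j , coprime-* (c⊥p j) (c⊥p j) ,
          Subgroup.resp N (×-assocˡ _ (c j) (c j)) (N′⇒N j (Subgroup.resp (N′ j) (sym (·-/ (c j) x y)) (h j)))
      surjective : ∀ (y : AbelianGroup.Carrier ⨁Q′) → Σ[ x ∈ AbelianGroup.Carrier (Subquotient A L N) ]
        (∀ {z : AbelianGroup.Carrier (Subquotient A L N)} → proj₁ z ∙ proj₁ x ⁻¹ ∈ N → ∀ j → c j · proj₁ z ∙ proj₁ (y j) ⁻¹ ∈ N′ j)
      surjective y = (x , x∈) , λ {z} h j → Subgroup.resp (N′ j) (telescope (c j · proj₁ z) (c j · x) (proj₁ (y j)))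
          (Subgroup.∙∈ (N′ j) (Subgroup.resp (N′ j) (·-/ (c j) (proj₁ z) x) (N⇒N′ j h)) (approximates j))
        where
        term : Fin r → Carrier
        term l = E l · (c l · proj₁ (y l))
        x = Sum.sum term
        sum∈ : ∀ {s ℓ} (S : Subgroup group ℓ) (t : Fin s → Carrier) → (∀ l → t l ∈ S) → Sum.sum t ∈ S
        sum∈ {zero}  S t h = Subgroup.ε∈ S
        sum∈ {suc s} S t h = Subgroup.∙∈ S (h zero) (sum∈ S (t ∘ suc) (h ∘ suc))
        x∈ : x ∈ L
        x∈ = sum∈ L term λ l → power-closed L (E l) (L′⇒L l (proj₂ (y l)))
        ·-sum : ∀ n {s} (t : Fin s → Carrier) → n · Sum.sum t ≈ Sum.sum (λ l → n · t l)
        ·-sum n {zero}  t = ·-ε n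
        ·-sum n {suc s} t = trans (×-distrib-+ (t zero) (Sum.sum (t ∘ suc)) n) (∙-congˡ (·-sum n (t ∘ suc)))
        collapse : ∀ j l → c j · term l ≈ (c j ℕ.* (E l ℕ.* c l)) · proj₁ (y l)
        collapse j l = trans (×-congʳ (c j) (×-assocˡ _ (E l) (c l))) (×-assocˡ _ (c j) (E l ℕ.* c l))
        telescope : ∀ x y z → x ∙ y ⁻¹ ∙ (y ∙ z ⁻¹) ≈ x ∙ z ⁻¹
        telescope x y z = trans (assoc _ _ _) (∙-congˡ (trans (sym (assoc _ _ _)) (trans (∙-congʳ (inverseˡ y)) (identityˡ _))))
        others : ∀ j l → l ≢ j → c j · term l ∈ N′ j
        others j l ne = Subgroup.resp (N′ j) (sym (collapse j l)) (multiple∈ (N′ j)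
          (ℕ.∣n⇒∣m*n (c j) (ℕ.∣m⇒∣m*n (c l) (ℕ.∣n⇒∣m*n (proj₁ (solution l)) (cofactor-∣ q l j ne)))) (exponent j (proj₁ (y l))))
        approximates : ∀ j → c j · x ∙ proj₁ (y j) ⁻¹ ∈ N′ j
        approximates j = Subgroup.resp (N′ j) (∙-congʳ (sym (·-sum (c j) term))) $ assemble j (λ l → c j · term l) (others j)
            (Subgroup.resp (N′ j) (∙-congʳ (sym (collapse j j))) (near (N′ j) _ (proj₁ (proj₂ (solution j))) (q j) (c²E j) (exponent j (proj₁ (y j)))))
          where
          N′ⱼ = N′ j
          assemble : ∀ {s} (i : Fin s) (t : Fin s → Carrier) → (∀ l → l ≢ i → t l ∈ N′ⱼ) → t i ∙ proj₁ (y j) ⁻¹ ∈ N′ⱼ →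
                     Sum.sum t ∙ proj₁ (y j) ⁻¹ ∈ N′ⱼ
          assemble {suc s} i t h hi = Subgroup.resp N′ⱼ (begin
              Sum.sum (removeAt t i) ∙ (t i ∙ proj₁ (y j) ⁻¹)  ≈⟨ assoc _ _ _ ⟨
              Sum.sum (removeAt t i) ∙ t i ∙ proj₁ (y j) ⁻¹    ≈⟨ ∙-congʳ (comm _ _) ⟩
              t i ∙ Sum.sum (removeAt t i) ∙ proj₁ (y j) ⁻¹    ≈⟨ ∙-congʳ (Sum.sum-remove {i = i} t) ⟨
              Sum.sum t ∙ proj₁ (y j) ⁻¹                       ∎)
            (Subgroup.∙∈ N′ⱼ (sum∈ N′ⱼ (removeAt t i) λ l → h (punchIn i l) (Fin.punchInᵢ≢i i l)) hi)

-- Degrees, p-parts and the two isomorphisms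

lookup-injective : ∀ {a} {A : Set a} {xs : List A} → Unique xs → ∀ i j → lookup xs i ≡ lookup xs j → i ≡ j
lookup-injective (_ AllPairs.∷ _)    zero    zero    _ = ≡.refl
lookup-injective (x∉ AllPairs.∷ _)   zero    (suc j) e = ⊥-elim (All.lookup x∉ (∈-lookup j) e)
lookup-injective (x∉ AllPairs.∷ _)   (suc i) zero    e = ⊥-elim (All.lookup x∉ (∈-lookup i) (≡.sym e))
lookup-injective (_ AllPairs.∷ uniq) (suc i) (suc j) e = ≡.cong suc (lookup-injective uniq i j e)

gcds∣ : ∀ {m} (f : Fin m → ℕ) i → gcds f ∣ f i
gcds∣ f zero    = gcd[m,n]∣m (f zero) (gcds (f ∘ suc))
gcds∣ f (suc i) = ℕ.∣-trans (gcd[m,n]∣n (f zero) (gcds (f ∘ suc))) (gcds∣ (f ∘ suc) i)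

module PrimeDivisors (d : ℕ) where
  private
    P? = λ p → prime? p ×-dec (p ∣? d)

  prime : ∀ j → Prime (lookup (primeDivisors d) j)
  prime j = proj₁ (proj₂ (∈-filter⁻ P? {xs = upTo (suc d)} (∈-lookup j)))

  distinct : ∀ i j → lookup (primeDivisors d) i ≡ lookup (primeDivisors d) j → i ≡ j
  distinct = lookup-injective (Unique.filter⁺ P? (Unique.upTo⁺ (suc d)))

  complete : 0 ℕ.< d → ∀ q → Prime q → q ∣ d → ∃[ j ] lookup (primeDivisors d) j ≡ q
  complete 0<d q qr q∣d = Any.index q∈ , ≡.sym (Any.lookup-index q∈)
    where q∈ = ∈-filter⁺ P? (∈-upTo⁺ (ℕ.s≤s (ℕ.∣⇒≤ {{ℕ.>-nonZero 0<d}} q∣d))) (qr , q∣d)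

-- Here `h` is the order of H and `s` the degree of its fixed field. The product decomposition of
-- the group bounds `s` by p^a; conversely p^a divides h s and is prime to `h`, so it divides `s`.
complement-order : ∀ {p a m h s} → Prime p → Coprime h p → 0 ℕ.< p ℕ.^ a ℕ.* m → p ℕ.^ a ℕ.* m ≡ h ℕ.* s → p ℕ.^ a ℕ.* m ℕ.≤ h ℕ.* p ℕ.^ a → s ≡ p ℕ.^ a
complement-order {p} {a} {m} {h} {s} pr cop 0<n n≡ n≤ = ℕ.≤-antisym
  (ℕ.*-cancelˡ-≤ h {{ℕ.>-nonZero (coprime⇒positive pr cop)}} (≡.subst (ℕ._≤ h ℕ.* p ℕ.^ a) n≡ n≤))
  (ℕ.∣⇒≤ {{s≢0}} (Coprimality.coprime-divisor (Coprimality.sym (coprime-^ʳ a cop)) (≡.subst (p ℕ.^ a ∣_) n≡ (ℕ.m∣m*n m))))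
  where
  s≢0 : ℕ.NonZero s
  s≢0 = ℕ.≢-nonZero λ s≡0 → ℕ.<⇒≢ 0<n (≡.sym (≡.trans n≡ (≡.trans (≡.cong (h ℕ.*_) s≡0) (ℕ.*-zeroʳ h))))

module PPrimaryPart (em : ExcludedMiddle (lsuc 0ℓ)) {k : Field} (K : Extension k) (nilpotent : IsNilpotentExtension K) {p : ℕ} (pr : Prime p) where
  private
    module K = IsNilpotentExtension nilpotent
    open GaloisExtensions em K K.isGalois

  hall : NilpotentGroups.HallSubgroup em (Gal K) K.nilpotent bounded p
  hall = NilpotentGroups.hallSubgroup em (Gal K) K.nilpotent bounded p pr

  open NilpotentGroups.HallSubgroup hall public

  pPart : Subextension K
  pPart = fixedField K H

  pPart-basis : Basis (asExtension K pPart) (p ℕ.^ j)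
  pPart-basis = go (fixedField-degree H order)
    where
    go : ∃[ m ] Basis (asExtension K pPart) m × proj₁ K.finite ≡ h ℕ.* m → Basis (asExtension K pPart) (p ℕ.^ j)
    go (m , b , n≡hm) = ≡.subst (Basis (asExtension K pPart)) (ℕ.*-cancelˡ-≡ m (p ℕ.^ j) h {{ℕ.>-nonZero (coprime⇒positive pr coprime)}}
      (≡.trans (≡.sym n≡hm) (≡.trans (order≡degree total) (ℕ.*-comm (p ℕ.^ j) h)))) b

  pPart-maximal : IsMaximalOfPPowerDegree p pPart
  pPart-maximal = (j , pPart-basis) , ppower-subfield⊆fixedField {p} {M} pr M-coprime H K.nilpotent (λ _ → exponent)

module TateShafarevich (em : ExcludedMiddle (lsuc 0ℓ)) (k : Field) (poles : HasFinitelyManyPoles em k) where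
  open NormGroups em k poles
  private
    kR = Field.commutativeRing k
    φ = identityHom kR
    δ = DiagonalEmbedding.diagonalHom em {k} poles
    open MonoidMult (AbelianGroup.monoid (Units kR)) using () renaming (_×_ to _·_)

  linked⇒primaryComponent≅ : ∀ {m} (E F : Fin m → Extension k) {p} → Prime p → ∀ c → Coprime c p → Linked E F c → Linked F E c →
    ∀ a → (∀ x → (p ℕ.^ a) · x ∈ normGroup k F) → primaryComponent (Ш k E) p ≅ Ш k F
  linked⇒primaryComponent≅ E F {p} pr c cop down up a exponent =
    Subquotients.PrimaryComponent.primary≅ (Units kR) pr (localNorms k E) (localNorms k F) (normGroup k E) (normGroup k F) c cop
      (λ {x} → localNorms-transfer down {x}) (λ {x} → localNorms-transfer up {x})
      (λ {x} → normGroup-transfer down {x}) (λ {x} → normGroup-transfer up {x}) a exponent {Ш k E} {Ш k F} ≡.refl ≡.refl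

  linked⇒decomposition≅ : ∀ {m r} (E : Fin m → Extension k) (F : Fin r → Fin m → Extension k) (p : Fin r → ℕ) → (∀ j → Prime (p j)) →
    (∀ i j → p i ≡ p j → i ≡ j) → (c : Fin r → ℕ) → (∀ j → Coprime (c j) (p j)) → (∀ j → Linked E (F j) (c j)) → (∀ j → Linked (F j) E (c j)) →
    (b : Fin r → ℕ) → (∀ j x → (p j ℕ.^ b j) · x ∈ normGroup k (F j)) →
    ∀ d → 0 ℕ.< d → (∀ x → d · x ∈ normGroup k E) → (∀ q → Prime q → q ∣ d → ∃[ j ] p j ≡ q) →
    Ш k E ≅ ⨁ (λ j → Ш k (F j))
  linked⇒decomposition≅ E F p prime distinct c c⊥p down up b exponent d 0<d d-exponent complete =
    Subquotients.PrimaryDecomposition.⨁≅ (Units kR) p prime distinct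
      (localNorms k E) (normGroup k E) (λ j → localNorms k (F j)) (λ j → normGroup k (F j)) c c⊥p
      (λ j {x} → localNorms-transfer (down j) {x}) (λ j {x} → localNorms-transfer (up j) {x})
      (λ j {x} → normGroup-transfer (down j) {x}) (λ j {x} → normGroup-transfer (up j) {x})
      b exponent d 0<d d-exponent complete {Ш k E} {λ j → Ш k (F j)} ≡.refl ≡.refl

  primaryPart≅ : ∀ p → Prime p → (K : Extension k) → IsGalois K → (H Gₚ : Subgroup (Gal K) 0ℓ) →
    (∃[ h ] (HasOrder (subgroup H) h × Coprime h p)) → IsSylow Gₚ p → IsSemidirect H Gₚ → (K′ : EtaleAlgebra k) →
    primaryComponent (Ш k (K ∷ EtaleAlgebra.factor K′)) p ≅ Ш k (asExtension K (fixedField K H) ∷ EtaleAlgebra.factor K′)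
  primaryPart≅ p pr K galois H Gₚ (h , oH , cop) (a , m , oP , oG , _) (_ , _ , decompose) K′ =
    linked⇒primaryComponent≅ (K ∷ EtaleAlgebra.factor K′) (asExtension K (fixedField K H) ∷ EtaleAlgebra.factor K′) pr h cop down up
      a (degree-power∈ (asExtension K (fixedField K H) ∷ EtaleAlgebra.factor K′) (Linked.finite down) zero basis)
    where
    module K′ = EtaleAlgebra K′
    open GaloisExtensions em K galois
    open FiniteGroups em (Gal K)
    Kᴴ = asExtension K (fixedField K H)
    E F : Fin (suc K′.size) → Extension k
    E = K ∷ K′.factor
    F = Kᴴ ∷ K′.factor
    e = proj₂ (IsGalois.finite galois)

    oW : HasOrder (subgroup whole) (p ℕ.^ a ℕ.* m)
    oW = mkOrder whole (Inverse.to oG) (λ _ → Unit.tt)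
      (λ i j eq → ≡.trans (≡.sym (Inverse.strictlyInverseʳ oG i)) (≡.trans (Inverse.from-cong oG eq) (Inverse.strictlyInverseʳ oG j)))
      (λ x _ → Inverse.from oG x , Inverse.strictlyInverseˡ oG x)

    basis : Basis Kᴴ (p ℕ.^ a)
    basis = go (fixedField-degree H oH)
      where
      go : ∃[ s ] Basis Kᴴ s × proj₁ (IsGalois.finite galois) ≡ h ℕ.* s → Basis Kᴴ (p ℕ.^ a)
      go (s , b , n≡hs) = ≡.subst (Basis Kᴴ) (complement-order {p} {a} {m} pr cop (order-positive {whole} oW)
        (≡.trans (≡.sym (order≡degree oW)) n≡hs) (product-order-≤ {H} {Gₚ} {whole} oH oP oW decompose)) b

    down : Linked E F h
    down = record
      { finite   = λ { zero → p ℕ.^ a , basis ; (suc i) → K′.finite i }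
      ; ordinary = λ { zero → h , ℕ.∣-refl , transfers-down em kR φ K H oH e ; (suc i) → 1 , ℕ.1∣ h , transfers-refl em kR φ (K′.factor i) }
      ; idèlic   = λ { zero → h , ℕ.∣-refl , transfers-down em (adèleRing k) δ K H oH e ; (suc i) → 1 , ℕ.1∣ h , transfers-refl em (adèleRing k) δ (K′.factor i) }
      }

    up : Linked F E h
    up = record
      { finite   = λ { zero → IsGalois.finite galois ; (suc i) → K′.finite i }
      ; ordinary = λ { zero → h , ℕ.∣-refl , transfers-up em kR φ K H oH e ; (suc i) → 1 , ℕ.1∣ h , transfers-refl em kR φ (K′.factor i) }
      ; idèlic   = λ { zero → h , ℕ.∣-refl , transfers-up em (adèleRing k) δ K H oH e ; (suc i) → 1 , ℕ.1∣ h , transfers-refl em (adèleRing k) δ (K′.factor i) }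
      }

  module _ {m : ℕ} (K : Fin (suc m) → Extension k) (nilpotent : ∀ i → IsNilpotentExtension (K i)) where
    private
      module K i = IsNilpotentExtension (nilpotent i)
      degrees : Fin (suc m) → ℕ
      degrees i = degree (K i) (K.finite i)
      d = gcds degrees
      ps = primeDivisors d
      module Part i j = PPrimaryPart em (K i) (nilpotent i) (PrimeDivisors.prime d j)

      0<d : 0 ℕ.< d
      0<d = ℕ.n≢0⇒n>0 λ d≡0 → ℕ.<⇒≢ 0<n (≡.sym (ℕ.0∣⇒≡0 (≡.subst (_∣ degrees zero) d≡0 (gcds∣ degrees zero))))
        where
        open GaloisExtensions em (K zero) (K.isGalois zero)
        open FiniteGroups em (Gal (K zero))
        oW = proj₂ (finite-order bounded whole)
        0<n : 0 ℕ.< degrees zero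
        0<n = ≡.subst (0 ℕ.<_) (≡.sym (order≡degree oW)) (order-positive {whole} oW)

    pParts : ∀ i → Fin (length ps) → Subextension (K i)
    pParts i j = Part.pPart i j

    private
      F : Fin (length ps) → Fin (suc m) → Extension k
      F j i = asExtension (K i) (pParts i j)

      h : Fin (length ps) → Fin (suc m) → ℕ
      h j i = Part.h i j

      -- A common multiple of the orders of the Hall subgroups belonging to the different factors,
      -- still prime to the prime in question.
      c : Fin (length ps) → ℕ
      c j = ListAction.product (List.tabulate (h j))

      down : ∀ j → Linked K (F j) (c j)
      down j = record
        { finite   = λ i → _ , Part.pPart-basis i j
        ; ordinary = λ i → h j i , ∣-product (h j) i , transfers-down em kR φ (K i) (Part.H i j) (Part.order i j) (proj₂ (K.finite i))
        ; idèlic   = λ i → h j i , ∣-product (h j) i , transfers-down em (adèleRing k) δ (K i) (Part.H i j) (Part.order i j) (proj₂ (K.finite i))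
        }

      up : ∀ j → Linked (F j) K (c j)
      up j = record
        { finite   = K.finite
        ; ordinary = λ i → h j i , ∣-product (h j) i , transfers-up em kR φ (K i) (Part.H i j) (Part.order i j) (proj₂ (K.finite i))
        ; idèlic   = λ i → h j i , ∣-product (h j) i , transfers-up em (adèleRing k) δ (K i) (Part.H i j) (Part.order i j) (proj₂ (K.finite i))
        }

    pParts-maximal : ∀ i j → IsMaximalOfPPowerDegree (lookup ps j) (pParts i j)
    pParts-maximal i j = Part.pPart-maximal i j

    primaryDecomposition≅ : Ш k K ≅ ⨁ (λ j → Ш k (λ i → asExtension (K i) (pParts i j)))
    primaryDecomposition≅ = linked⇒decomposition≅ K (λ j i → asExtension (K i) (pParts i j)) (lookup ps) (PrimeDivisors.prime d) (PrimeDivisors.distinct d)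
      c (λ j → coprime-product (h j) (λ i → Part.coprime i j)) down up
      -- One factor is enough to bound the exponent: scalars raised to the degree of the p-part of
      -- `K zero` are norms from it.
      (λ j → Part.j zero j) (λ j → degree-power∈ (F j) (Linked.finite (down j)) zero (Part.pPart-basis zero j))
      -- Every degree kills the units of `k` modulo norms, hence so does the gcd of the degrees.
      d 0<d (λ x → gcds-powers∈ {Units kR} (normGroup k K) degrees {x} (λ i → degree-power∈ K K.finite i (proj₂ (K.finite i)) x))
      (PrimeDivisors.complete d 0<d)

theorem1p4 :
  ExcludedMiddle (lsuc 0ℓ) →
  (k : Field) → IsGlobal k →
    ( (p : ℕ) → Prime p →
      (K : Extension k) → IsGalois K →
      (H Gₚ : Subgroup (Gal K) 0ℓ) →
      (∃[ h ] (HasOrder (subgroup H) h × Coprime h p)) →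
      IsSylow Gₚ p →
      IsSemidirect H Gₚ →
      (K′ : EtaleAlgebra k) →
      let open EtaleAlgebra K′ using (factor) in
      primaryComponent (Ш k (K ∷ factor)) p
        ≅ Ш k (asExtension K (fixedField K H) ∷ factor) )
  × ( (m : ℕ) (K : Fin (suc m) → Extension k) →
      (nilpotent : ∀ i → IsNilpotentExtension (K i)) →
      let d  = gcds (λ i → degree (K i) (IsNilpotentExtension.finite (nilpotent i)))
          ps = primeDivisors d
      in
      Σ[ Kₚ ∈ (∀ i → Fin (length ps) → Subextension (K i)) ]
        (∀ i j → IsMaximalOfPPowerDegree (lookup ps j) (Kₚ i j))
        × Ш k K ≅ ⨁ (λ j → Ш k (λ i → asExtension (K i) (Kₚ i j))) )
theorem1p4 em k global = T.primaryPart≅ , λ m K nilpotent →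
  T.pParts K nilpotent , T.pParts-maximal K nilpotent , T.primaryDecomposition≅ K nilpotent
  where module T = TateShafarevich em k (global-poles em k global)
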